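{- Let $\mathcal{L}_n$ be the set of all Latin squares of order $n$, viewed as a family of subsets of $\Omega=\{1,\dots,n\}^3$. Then the VC-dimension of $\mathcal{L}_n$ is at least $n^2-(e+o(1))n^{5/3}$, where $o(1)$ denotes a quantity tending to $0$ as $n\to\infty$.
   Context: A Latin square of order $n$ is an $n\times n$ array filled with elements of $\{1,\dots,n\}$ such that every element occurs exactly once in each row and each column; it is identified with the set of triples $(i,j,k)\in\{1,\dots,n\}^3$ such that the $(i,j)$-th entry equals $k$. For a family $\mathcal{C}$ of subsets of a finite set $\Omega$, a set $S\subseteq \Omega$ is shattered by $\mathcal{C}$ if for every $T\subseteq S$ there is $c\in\mathcal{C}$ with $c\cap S=T$; the VC-dimension of $\mathcal{C}$ is the maximum size of a set shattered by $\mathcal{C}$. -}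

module Defs where

open import Data.Nat using (ℕ; zero; suc; _*_; _^_; _!)
open import Data.Nat.Properties using (_!≢0; m*n≢0)
open import Data.Fin using (Fin)
open import Data.Bool using (Bool; true)
open import Data.Vec using (Vec; lookup)
open import Data.Product using (_×_; _,_; ∃-syntax)
open import Data.Integer using (+_)
open import Data.Rational using (ℚ; _/_; _+_; _≤_; 0ℚ)
open import Relation.Binary.PropositionalEquality using (_≡_)
open import Function.Definitions using (Bijective)
open import Function.Bundles using (_⇔_)

Triple : ℕ → Set
Triple n = Fin n × Fin n × Fin n

record LatinSquare (n : ℕ) : Set where
  field
    entry  : Fin n → Fin n → Fin n
    rows   : ∀ i → Bijective _≡_ _≡_ (λ j → entry i j)
    cols   : ∀ j → Bijective _≡_ _≡_ (λ i → entry i j)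
open LatinSquare public

_∈L_ : ∀ {n} → Triple n → LatinSquare n → Set
(i , j , k) ∈L L = entry L i j ≡ k

-- a set S ⊆ Ω of size m, given as a vector of pairwise distinct triples
Distinct : ∀ {n m} → Vec (Triple n) m → Set
Distinct {m = m} S = ∀ (a b : Fin m) → lookup S a ≡ lookup S b → a ≡ b

Shattered : ∀ {n m} → Vec (Triple n) m → Set
Shattered {n} {m} S =
  ∀ (t : Fin m → Bool) → ∃[ L ] (∀ (a : Fin m) → (lookup S a ∈L L) ⇔ (t a ≡ true))

VCdimAtLeast : ℕ → ℕ → Set
VCdimAtLeast n m = ∃[ S ] (Distinct {n} {m} S × Shattered S)

-- rational upper approximations of e:  for k ≥ 1,
--   eUpper k = Σ_{i=0}^{k} 1/i!  +  1/(k·k!)   with   e < eUpper k,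
-- and eUpper k decreases to e.  Hence for c : ℚ,  e < c  ⇔  ∃ k, eUpper k ≤ c.
partialE : ℕ → ℚ
partialE zero    = (+ 1) / 1
partialE (suc i) = partialE i + ((+ 1) / (suc i !)) {{suc i !≢0}}

eUpper : ℕ → ℚ   -- eUpper k denotes the bound for index suc k
eUpper k = partialE (suc k) + ((+ 1) / (suc k * suc k !)) {{m*n≢0 (suc k) (suc k !) {{_}} {{suc k !≢0}}}}

ℕtoℚ : ℕ → ℚ
ℕtoℚ n = (+ n) / 1

{-# OPTIONS --safe #-}
module Submission where

-- A set of triples shattered by the Latin squares is a partial Latin square, and by Pajor's inequality a family
-- shatters at least as many sets as it has members. So if no set of n² − X triples is shattered, then for some
-- y > X there are at least |L_n| / n² partial Latin squares with y holes. Up to subexponential factors,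
-- |L_n| ≥ (n/e²)^(n²): each new row is a perfect matching of a regular bipartite graph, and a k-regular graph on
-- n + n vertices has about (k/e)^n of them, as one sees in its N-fold blow-up. For N = 2^t the blow-up is compared
-- with the graph by repeated doubling (a 2-regular multigraph splits into two matchings), and its perfect
-- matchings are counted from a decomposition of the graph into k perfect matchings.
-- A partial Latin square with y holes has three n × n hole matrices (row–column, column–symbol, symbol–row)
-- with y ones each, at most (en²/y)^(3y) choices in all. Given these, it is a triangle decomposition of a
-- tripartite graph, which has about n³ − 3yn triangles unless a hole matrix is one of the few unbalanced ones.
-- Removing a random triangle of the decomposition repeatedly bounds the number of decompositions by
-- (n/e²)^(n²) n^(−y). So the quotient is at most (e³n⁵/y³)^y, which tends to 0 when y ≥ (e + ε) n^(5/3).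
-- All estimates are inequalities between natural numbers: e is replaced by quotients such as
-- ((n² + 1)/n²)^(n² + 1), and logarithms and roots by their integer parts.

-- Why a decomposition count carries n^(-y): with k = n² - y cells filled, n³ - 3yn equals nk(1 -
-- 2y/k), so there are about (n/e²)^k e^(-2y) decompositions, and the factors e cancel against the
-- passage from k to n². The random removal works because a triangle outside the decomposition is
-- destroyed by at least three of the k possible removals. The number of these triangles therefore
-- decays like the cube of the number of members. The step has to be averaged over the removed
-- member, and a bound in product form does not survive this, while an inequality linear in the
-- number of triangles does. The triangle count is an inclusion-exclusion whose error is the sum of
-- the squared degrees of the hole matrices. Matrices for which it is not small against yn are so
-- rare that the trivial bound nk on the number of triangles can be afforded for them. For y³ above
-- a constant times n⁵ this trivial bound suffices for all matrices. The remaining losses have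
-- exponents of order n^(3/2) log n, which is below n^(5/3), or a small fraction of y. They are paid
-- from a slack between e and the given constant.

module Proof where

  open import Defs using (Triple; LatinSquare; Distinct; Shattered; VCdimAtLeast; _∈L_; partialE; eUpper; ℕtoℚ)
  open import Data.Bool using (Bool; true; false; _∧_; _∨_; not)
  open import Data.Nat using (ℕ; zero; suc; _+_; _*_; _∸_; _^_; _≤_; _<_; z≤n; s≤s; _!)
  open import Data.Nat.Properties hiding (_≟_)
  open import Data.Fin using (Fin; zero; suc)
  open import Data.Vec using (Vec; []; _∷_; lookup)
  open import Data.List using (List; []; _∷_; length; map; allFin; filter; cartesianProductWith) renaming (_++_ to _++ˡ_)
  open import Data.List.Membership.Propositional using (_∈_)
  open import Data.List.Relation.Unary.Any using (here; there)
  open import Data.List.Relation.Unary.All using ([]; _∷_)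
  open import Data.List.Relation.Unary.AllPairs using ([]; _∷_)
  open import Data.List.Relation.Unary.Unique.Propositional using (Unique)
  open import Data.Product using (∃; ∃-syntax; _×_; _,_; proj₁; proj₂)
  open import Data.Sum using (_⊎_; inj₁; inj₂)
  open import Data.Empty using (⊥; ⊥-elim)
  open import Relation.Nullary using (¬_; Dec; yes; no; does)
  open import Relation.Binary.Definitions using (DecidableEquality)
  open import Relation.Binary.PropositionalEquality using (_≡_; _≢_; refl; sym; trans; cong; cong₂; subst; subst₂; module ≡-Reasoning)
  open import Function using (_∘_; id; case_of_)
  open import Data.Nat.Tactic.RingSolver using (solve-∀)
  open import Algebra.Properties.CommutativeSemigroup *-commutativeSemigroup using (x∙yz≈y∙xz; x∙yz≈xz∙y; x∙yz≈yx∙z; x∙yz≈y∙zx; xy∙z≈xz∙y; xy∙z≈y∙xz; xy∙z≈x∙zy; xy∙z≈zx∙y) renaming (interchange to *-interchange)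
  open import Algebra.Properties.CommutativeSemigroup +-commutativeSemigroup using () renaming (interchange to +-interchange; x∙yz≈y∙xz to m+[n+o]≡n+[m+o])
  open import Data.Maybe using (Maybe; just; nothing)
  open import Function.Bundles using (mk⇔)
  open import Relation.Nullary.Decidable using (_×-dec_; ¬?; decidable-stable)
  import Data.Bool.Properties as Boolₚ
  import Data.List.Relation.Unary.Unique.Propositional.Properties as Uniqueₚ
  import Data.List.Properties as Listₚ
  import Data.List.Membership.Propositional.Properties as Mem
  import Data.List.Relation.Unary.All as All
  import Data.List.Membership.DecPropositional as DecMem
  import Data.Fin.Properties as Finₚ
  import Data.Maybe.Properties as Maybeₚ
  import Data.List as List
  import Data.Vec as Vec
  import Data.Vec.Properties as Vecₚ
  import Data.Fin as Fin
  import Data.Product.Properties as ×ₚ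
  import Data.Nat as ℕ
  import Data.Nat.DivMod as DivMod
  import Data.Integer as ℤ
  import Data.Integer.Properties as ℤₚ
  import Data.Rational as ℚ
  import Data.Rational.Properties as ℚₚ
  import Data.Rational.Unnormalised as ℚᵘ
  import Data.Rational.Unnormalised.Properties as ℚᵘₚ

  -- Finite sums, booleans and enumerations by lists

  private variable
    ι κ ξ : Set

  ∑ : List ι → (ι → ℕ) → ℕ
  ∑ []       f = 0
  ∑ (x ∷ xs) f = f x + ∑ xs f

  ⟦_⟧ : Bool → ℕ
  ⟦ false ⟧ = 0
  ⟦ true ⟧  = 1

  ⟦⟧≤1 : ∀ b → ⟦ b ⟧ ≤ 1
  ⟦⟧≤1 false = z≤n
  ⟦⟧≤1 true  = ≤-refl

  ⟦⟧-true : ∀ {b} → 0 < ⟦ b ⟧ → b ≡ true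
  ⟦⟧-true {true} _ = refl

  ⟦∧⟧ : ∀ a b → ⟦ a ∧ b ⟧ ≡ ⟦ a ⟧ * ⟦ b ⟧
  ⟦∧⟧ false b = refl
  ⟦∧⟧ true  b = sym (+-identityʳ _)

  ∧-true : ∀ {a b} → a ∧ b ≡ true → (a ≡ true) × (b ≡ true)
  ∧-true {true} {true} _ = refl , refl

  ∧-intro : ∀ {a b} → a ≡ true → b ≡ true → a ∧ b ≡ true
  ∧-intro refl refl = refl

  not-true : ∀ {b} → not b ≡ true → b ≡ false
  not-true {false} _ = refl

  true≢false : true ≢ false
  true≢false ()

  bool-cases : ∀ b → (b ≡ true) ⊎ (b ≡ false)
  bool-cases true  = inj₁ refl
  bool-cases false = inj₂ refl

  does-true : ∀ {P : Set} (d : Dec P) → does d ≡ true → P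
  does-true (yes p) _ = p

  does-false : ∀ {P : Set} (d : Dec P) → does d ≡ false → ¬ P
  does-false (no ¬p) _ = ¬p

  does-yes : ∀ {P : Set} (d : Dec P) → P → does d ≡ true
  does-yes (yes _) _ = refl
  does-yes (no ¬p) p = ⊥-elim (¬p p)

  does-no : ∀ {P : Set} (d : Dec P) → ¬ P → does d ≡ false
  does-no (yes p) ¬p = ⊥-elim (¬p p)
  does-no (no _)  _  = refl

  does-⇔ : ∀ {P Q : Set} (d : Dec P) (e : Dec Q) → (P → Q) → (Q → P) → does d ≡ does e
  does-⇔ (yes p) (yes q) f g = refl
  does-⇔ (yes p) (no ¬q) f g = ⊥-elim (¬q (f p))
  does-⇔ (no ¬p) (yes q) f g = ⊥-elim (¬p (g q))
  does-⇔ (no ¬p) (no ¬q) f g = refl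

  ⟦does⟧-≤ : ∀ {P : Set} (d : Dec P) {x} → (P → 1 ≤ x) → ⟦ does d ⟧ ≤ x
  ⟦does⟧-≤ (yes p) h = h p
  ⟦does⟧-≤ (no _)  h = z≤n

  ∑-cong : ∀ (xs : List ι) {f g} → (∀ x → x ∈ xs → f x ≡ g x) → ∑ xs f ≡ ∑ xs g
  ∑-cong []       e = refl
  ∑-cong (x ∷ xs) e = cong₂ _+_ (e x (here refl)) (∑-cong xs (λ y m → e y (there m)))

  ∑-cong′ : ∀ (xs : List ι) {f g} → (∀ x → f x ≡ g x) → ∑ xs f ≡ ∑ xs g
  ∑-cong′ xs e = ∑-cong xs (λ x _ → e x)

  ∑-mono : ∀ (xs : List ι) {f g} → (∀ x → x ∈ xs → f x ≤ g x) → ∑ xs f ≤ ∑ xs g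
  ∑-mono []       e = z≤n
  ∑-mono (x ∷ xs) e = +-mono-≤ (e x (here refl)) (∑-mono xs (λ y m → e y (there m)))

  ∑-mono′ : ∀ (xs : List ι) {f g} → (∀ x → f x ≤ g x) → ∑ xs f ≤ ∑ xs g
  ∑-mono′ xs e = ∑-mono xs (λ x _ → e x)

  ∑-0 : ∀ (xs : List ι) → ∑ xs (λ _ → 0) ≡ 0
  ∑-0 []       = refl
  ∑-0 (x ∷ xs) = ∑-0 xs

  ∑-+ : ∀ (xs : List ι) f g → ∑ xs (λ x → f x + g x) ≡ ∑ xs f + ∑ xs g
  ∑-+ []       f g = refl
  ∑-+ (x ∷ xs) f g rewrite ∑-+ xs f g = +-interchange (f x) (g x) (∑ xs f) (∑ xs g)

  ∑-*ˡ : ∀ (xs : List ι) c f → ∑ xs (λ x → c * f x) ≡ c * ∑ xs f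
  ∑-*ˡ []       c f = sym (*-zeroʳ c)
  ∑-*ˡ (x ∷ xs) c f rewrite ∑-*ˡ xs c f = sym (*-distribˡ-+ c (f x) (∑ xs f))

  ∑-*ʳ : ∀ (xs : List ι) c f → ∑ xs (λ x → f x * c) ≡ ∑ xs f * c
  ∑-*ʳ xs c f = trans (∑-cong′ xs (λ x → *-comm (f x) c)) (trans (∑-*ˡ xs c f) (*-comm c _))

  ∑-const : ∀ (xs : List ι) c → ∑ xs (λ _ → c) ≡ length xs * c
  ∑-const []       c = refl
  ∑-const (x ∷ xs) c = cong (c +_) (∑-const xs c)

  ∑-swap : ∀ (xs : List ι) (ys : List κ) (f : ι → κ → ℕ) →
           ∑ xs (λ x → ∑ ys (f x)) ≡ ∑ ys (λ y → ∑ xs (λ x → f x y))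
  ∑-swap []       ys f = sym (∑-0 ys)
  ∑-swap (x ∷ xs) ys f rewrite ∑-swap xs ys f = sym (∑-+ ys (f x) _)

  ∑-++ : ∀ (xs ys : List ι) f → ∑ (xs ++ˡ ys) f ≡ ∑ xs f + ∑ ys f
  ∑-++ []       ys f = refl
  ∑-++ (x ∷ xs) ys f rewrite ∑-++ xs ys f = sym (+-assoc (f x) _ _)

  ∑-map : ∀ (g : ι → κ) (xs : List ι) f → ∑ (map g xs) f ≡ ∑ xs (f ∘ g)
  ∑-map g []       f = refl
  ∑-map g (x ∷ xs) f = cong (f (g x) +_) (∑-map g xs f)

  ∑-product : ∀ (g : ι → κ → ξ) (xs : List ι) (ys : List κ) f →
              ∑ (cartesianProductWith g xs ys) f ≡ ∑ xs (λ x → ∑ ys (λ y → f (g x y)))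
  ∑-product g []       ys f = refl
  ∑-product g (x ∷ xs) ys f =
    trans (∑-++ (map (g x) ys) _ f) (cong₂ _+_ (∑-map (g x) ys f) (∑-product g xs ys f))

  ∑-mult : ∀ (xs : List ι) (ys : List κ) f g → ∑ xs f * ∑ ys g ≡ ∑ xs (λ x → ∑ ys (λ y → f x * g y))
  ∑-mult xs ys f g =
    trans (sym (∑-*ʳ xs (∑ ys g) f)) (∑-cong′ xs (λ x → sym (∑-*ˡ ys (f x) g)))

  length-∑ : ∀ (xs : List ι) → length xs ≡ ∑ xs (λ _ → 1)
  length-∑ []       = refl
  length-∑ (x ∷ xs) = cong suc (length-∑ xs)

  ∑-member : ∀ {xs : List ι} {x} → x ∈ xs → ∀ (f : ι → ℕ) → f x ≤ ∑ xs f
  ∑-member (here refl) f = m≤m+n _ _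
  ∑-member {xs = y ∷ _} (there m) f = ≤-trans (∑-member m f) (m≤n+m _ (f y))

  ∑-positive : ∀ (xs : List ι) f → 0 < ∑ xs f → ∃ λ x → x ∈ xs × 0 < f x
  ∑-positive (x ∷ xs) f p with f x in e
  ... | suc k = x , here refl , subst (0 <_) (sym e) (s≤s z≤n)
  ... | zero with y , m , q ← ∑-positive xs f p = y , there m , q

  sift : (ι → Bool) → List ι → List ι
  sift p = filter (λ x → Boolₚ._≟_ (p x) true)

  length-sift : ∀ (p : ι → Bool) xs → length (sift p xs) ≡ ∑ xs (λ x → ⟦ p x ⟧)
  length-sift p []       = refl
  length-sift p (x ∷ xs) with p x
  ... | true  = cong suc (length-sift p xs)
  ... | false = length-sift p xs

  ∑-sift : ∀ (p : ι → Bool) xs f → ∑ (sift p xs) f ≡ ∑ xs (λ x → ⟦ p x ⟧ * f x)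
  ∑-sift p []       f = refl
  ∑-sift p (x ∷ xs) f with p x
  ... | true  = cong₂ _+_ (sym (+-identityʳ _)) (∑-sift p xs f)
  ... | false = ∑-sift p xs f

  ∈-sift⁺ : ∀ (p : ι → Bool) {xs x} → x ∈ xs → p x ≡ true → x ∈ sift p xs
  ∈-sift⁺ p = Mem.∈-filter⁺ _

  ∈-sift⁻ : ∀ (p : ι → Bool) {xs x} → x ∈ sift p xs → x ∈ xs × p x ≡ true
  ∈-sift⁻ p {xs} = Mem.∈-filter⁻ _ {xs = xs}

  ∑-one : ∀ {xs : List ι} (_≟_ : DecidableEquality ι) → Unique xs → ∀ {x} → x ∈ xs →
          ∀ (f : ι → ℕ) → ∑ xs (λ y → ⟦ does (y ≟ x) ⟧ * f y) ≡ f x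
  ∑-one {xs = y ∷ xs} _≟_ (d ∷ u) {x} m f with y ≟ x
  ... | yes refl = trans (cong₂ _+_ (+-identityʳ (f x)) zeros) (+-identityʳ _)
    where
    zeros : ∑ xs (λ y → ⟦ does (y ≟ x) ⟧ * f y) ≡ 0
    zeros = trans (∑-cong xs (λ z z∈ → cong (λ b → ⟦ b ⟧ * f z)
      (does-no (z ≟ x) (λ e → All.lookup d z∈ (sym e))))) (∑-0 xs)
  ... | no y≢x with m
  ...   | here refl = ⊥-elim (y≢x refl)
  ...   | there m′  = ∑-one _≟_ u m′ f

  remove-length : ∀ {ys : List ι} {y} → y ∈ ys →
                  ∃ λ zs → length ys ≡ suc (length zs) × (∀ {z} → z ∈ ys → z ≢ y → z ∈ zs)
  remove-length {ys = _ ∷ zs} (here refl) = zs , refl , λ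
    { (here e) ne → ⊥-elim (ne e) ; (there m) _ → m }
  remove-length {ys = x ∷ _} (there m) with zs , l , h ← remove-length m =
    x ∷ zs , cong suc l , λ { (here e) _ → here e ; (there k) ne → there (h k ne) }

  -- Pigeonhole for a relation instead of a function, so that an object may be sent to data which
  -- determine it only indirectly.
  inject-length : ∀ {xs : List ι} {ys : List κ} (R : ι → κ → Set) → Unique xs →
                  (∀ {x} → x ∈ xs → ∃ λ y → y ∈ ys × R x y) →
                  (∀ {x x′ y} → x ∈ xs → x′ ∈ xs → R x y → R x′ y → x ≡ x′) →
                  length xs ≤ length ys
  inject-length {xs = []} R u tot inj = z≤n
  inject-length {xs = x ∷ xs} R (d ∷ u) tot inj with tot (here refl)
  ... | y , y∈ , r with zs , l , h ← remove-length y∈ rewrite l =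
    s≤s (inject-length R u
      (λ {x′} m → let (y′ , y′∈ , r′) = tot (there m) in
        y′ , h y′∈ (λ e → All.lookup d m (inj (here refl) (there m) r (subst (R x′) e r′))) , r′)
      (λ m m′ → inj (there m) (there m′)))

  vecs : List ι → ∀ n → List (Vec ι n)
  vecs xs zero    = [] ∷ []
  vecs xs (suc n) = cartesianProductWith _∷_ xs (vecs xs n)

  ∑-vecs : ∀ (xs : List ι) n f → ∑ (vecs xs (suc n)) f ≡ ∑ xs (λ x → ∑ (vecs xs n) (λ v → f (x ∷ v)))
  ∑-vecs xs n = ∑-product _∷_ xs (vecs xs n)

  length-vecs : ∀ (xs : List ι) n → length (vecs xs n) ≡ length xs ^ n
  length-vecs xs zero    = refl
  length-vecs xs (suc n) = begin
    length (vecs xs (suc n))                           ≡⟨ length-∑ (vecs xs (suc n)) ⟩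
    ∑ (vecs xs (suc n)) (λ _ → 1)                      ≡⟨ ∑-vecs xs n _ ⟩
    ∑ xs (λ _ → ∑ (vecs xs n) (λ _ → 1))               ≡⟨ ∑-const xs _ ⟩
    length xs * ∑ (vecs xs n) (λ _ → 1)                ≡⟨ cong (length xs *_) (sym (length-∑ (vecs xs n))) ⟩
    length xs * length (vecs xs n)                     ≡⟨ cong (length xs *_) (length-vecs xs n) ⟩
    length xs * length xs ^ n                          ∎
    where open ≡-Reasoning

  ∈-vecs : ∀ {xs : List ι} {n} (v : Vec ι n) → (∀ i → lookup v i ∈ xs) → v ∈ vecs xs n
  ∈-vecs []      h = here refl
  ∈-vecs (x ∷ v) h = Mem.∈-cartesianProductWith⁺ _∷_ (h zero) (∈-vecs v (h ∘ suc))

  vecs-∈ : ∀ {xs : List ι} {n} {v : Vec ι n} → v ∈ vecs xs n → ∀ i → lookup v i ∈ xs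
  vecs-∈ {xs = xs} {suc n} m i with Mem.∈-cartesianProductWith⁻ _∷_ xs (vecs xs n) m
  vecs-∈ {n = suc n} m zero    | x , v , x∈ , v∈ , refl = x∈
  vecs-∈ {n = suc n} m (suc i) | x , v , x∈ , v∈ , refl = vecs-∈ v∈ i

  ∷-inj : ∀ {n} {x y : ι} {v w : Vec ι n} → x Vec.∷ v ≡ y ∷ w → x ≡ y × v ≡ w
  ∷-inj refl = refl , refl

  vecs-unique : ∀ {xs : List ι} → Unique xs → ∀ n → Unique (vecs xs n)
  vecs-unique u zero    = [] ∷ []
  vecs-unique u (suc n) = Uniqueₚ.cartesianProductWith⁺ _∷_ ∷-inj u (vecs-unique u n)

  sift-unique : ∀ (p : ι → Bool) {xs} → Unique xs → Unique (sift p xs)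
  sift-unique p = Uniqueₚ.filter⁺ _

  product-unique : ∀ {xs : List ι} {ys : List κ} → Unique xs → Unique ys → Unique (cartesianProductWith _,_ xs ys)
  product-unique = Uniqueₚ.cartesianProductWith⁺ _,_ (λ { refl → refl , refl })

  ∈-product : ∀ {xs : List ι} {ys : List κ} {x y} → x ∈ xs → y ∈ ys → (x , y) ∈ cartesianProductWith _,_ xs ys
  ∈-product = Mem.∈-cartesianProductWith⁺ _,_

  length-product : ∀ (g : ι → κ → ξ) (xs : List ι) (ys : List κ) →
                   length (cartesianProductWith g xs ys) ≡ length xs * length ys
  length-product g xs ys = begin
    length (cartesianProductWith g xs ys)           ≡⟨ length-∑ (cartesianProductWith g xs ys) ⟩
    ∑ (cartesianProductWith g xs ys) (λ _ → 1)      ≡⟨ ∑-product g xs ys _ ⟩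
    ∑ xs (λ _ → ∑ ys (λ _ → 1))                     ≡⟨ ∑-const xs _ ⟩
    length xs * ∑ ys (λ _ → 1)                      ≡⟨ cong (length xs *_) (sym (length-∑ ys)) ⟩
    length xs * length ys                           ∎
    where open ≡-Reasoning

  all-fin : ∀ {n} (i : Fin n) → i ∈ allFin n
  all-fin = Mem.∈-allFin

  fin-unique : ∀ n → Unique (allFin n)
  fin-unique = Uniqueₚ.allFin⁺

  length-fin : ∀ n → length (allFin n) ≡ n
  length-fin n = Listₚ.length-tabulate id

  ∑-fin : ∀ n f → ∑ (allFin (suc n)) f ≡ f zero + ∑ (allFin n) (f ∘ suc)
  ∑-fin n f = cong (f zero +_) (trans (cong (λ l → ∑ l f) (sym (Listₚ.map-tabulate id suc)))
                                      (∑-map suc (allFin n) f))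

  bools : List Bool
  bools = false ∷ true ∷ []

  bools-unique : Unique bools
  bools-unique = ((λ ()) ∷ []) ∷ [] ∷ []

  ∈-bools : ∀ b → b ∈ bools
  ∈-bools false = here refl
  ∈-bools true  = there (here refl)

  cube : ∀ n → List (Vec Bool n)
  cube = vecs bools

  ∈-cube : ∀ {n} (v : Vec Bool n) → v ∈ cube n
  ∈-cube v = ∈-vecs v (λ i → ∈-bools _)

  ∑-cube : ∀ n f → ∑ (cube (suc n)) f ≡ ∑ (cube n) (f ∘ (false ∷_)) + ∑ (cube n) (f ∘ (true ∷_))
  ∑-cube n f = trans (∑-vecs bools n f) (cong (∑ (cube n) (f ∘ (false ∷_)) +_) (+-identityʳ _))

  -- Pajor's inequality

  -- The family obtained from F by down-compressing all coordinates in turn; its members are shattered by F.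
  compress : ∀ {n} → (Vec Bool n → Bool) → Vec Bool n → Bool
  compress F []          = F []
  compress F (false ∷ Y) = compress (F ∘ (false ∷_)) Y ∨ compress (F ∘ (true ∷_)) Y
  compress F (true ∷ Y)  = compress (F ∘ (false ∷_)) Y ∧ compress (F ∘ (true ∷_)) Y

  ⟦∨⟧+⟦∧⟧ : ∀ a b → ⟦ a ∨ b ⟧ + ⟦ a ∧ b ⟧ ≡ ⟦ a ⟧ + ⟦ b ⟧
  ⟦∨⟧+⟦∧⟧ false b = +-identityʳ _
  ⟦∨⟧+⟦∧⟧ true  b = refl

  -- Compressing one coordinate replaces the two halves of the family by their union and their
  -- intersection, which keeps the total size.
  compress-count : ∀ n (F : Vec Bool n → Bool) →
                   ∑ (cube n) (λ Y → ⟦ compress F Y ⟧) ≡ ∑ (cube n) (λ Y → ⟦ F Y ⟧)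
  compress-count zero    F = refl
  compress-count (suc n) F = begin
    ∑ (cube (suc n)) (λ Y → ⟦ compress F Y ⟧)
      ≡⟨ ∑-cube n _ ⟩
    ∑ (cube n) (λ Y → ⟦ c₀ Y ∨ c₁ Y ⟧) + ∑ (cube n) (λ Y → ⟦ c₀ Y ∧ c₁ Y ⟧)
      ≡⟨ ∑-+ (cube n) _ _ ⟨
    ∑ (cube n) (λ Y → ⟦ c₀ Y ∨ c₁ Y ⟧ + ⟦ c₀ Y ∧ c₁ Y ⟧)
      ≡⟨ ∑-cong′ (cube n) (λ Y → ⟦∨⟧+⟦∧⟧ (c₀ Y) (c₁ Y)) ⟩
    ∑ (cube n) (λ Y → ⟦ c₀ Y ⟧ + ⟦ c₁ Y ⟧)
      ≡⟨ ∑-+ (cube n) _ _ ⟩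
    ∑ (cube n) (λ Y → ⟦ c₀ Y ⟧) + ∑ (cube n) (λ Y → ⟦ c₁ Y ⟧)
      ≡⟨ cong₂ _+_ (compress-count n _) (compress-count n _) ⟩
    ∑ (cube n) (λ Y → ⟦ F (false ∷ Y) ⟧) + ∑ (cube n) (λ Y → ⟦ F (true ∷ Y) ⟧)
      ≡⟨ ∑-cube n _ ⟨
    ∑ (cube (suc n)) (λ Y → ⟦ F Y ⟧) ∎
    where
    open ≡-Reasoning
    c₀ = compress (F ∘ (false ∷_))
    c₁ = compress (F ∘ (true ∷_))

  -- At a coordinate in `Y` both halves of the family are available, so either value of the trace
  -- can be realised. At a coordinate outside `Y` one half is enough.
  compress-shattered : ∀ {n} (F : Vec Bool n → Bool) Y → compress F Y ≡ true → ∀ (T : Vec Bool n) →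
                       ∃ λ W → F W ≡ true × (∀ e → lookup Y e ≡ true → lookup W e ≡ lookup T e)
  compress-shattered F [] p [] = [] , p , λ ()
  compress-shattered F (false ∷ Y) p (t ∷ T)
    with compress (F ∘ (false ∷_)) Y in e₀ | compress (F ∘ (true ∷_)) Y in e₁
  ... | true  | _ with W , q , h ← compress-shattered _ Y e₀ T =
    false ∷ W , q , λ { zero () ; (suc e) → h e }
  ... | false | true with W , q , h ← compress-shattered _ Y e₁ T =
    true ∷ W , q , λ { zero () ; (suc e) → h e }
  compress-shattered F (true ∷ Y) p (false ∷ T)
    with W , q , h ← compress-shattered _ Y (proj₁ (∧-true p)) T =
    false ∷ W , q , λ { zero _ → refl ; (suc e) → h e }
  compress-shattered F (true ∷ Y) p (true ∷ T)
    with W , q , h ← compress-shattered _ Y (proj₂ (∧-true {compress (F ∘ (false ∷_)) Y} p)) T =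
    true ∷ W , q , λ { zero _ → refl ; (suc e) → h e }

  -- Matchings in regular bipartite graphs

  remove-∑ : ∀ {A : Set} {ys : List A} {y} → y ∈ ys → ∀ (f : A → ℕ) →
             ∃ λ zs → ∑ ys f ≡ f y + ∑ zs f × (∀ {z} → z ∈ ys → z ≢ y → z ∈ zs)
  remove-∑ {ys = _ ∷ zs} (here refl) f = zs , refl , λ
    { (here e) ne → ⊥-elim (ne e) ; (there m) _ → m }
  remove-∑ {ys = x ∷ ys} {y} (there m) f with zs , l , h ← remove-∑ m f =
    x ∷ zs , trans (cong (f x +_) l) (m+[n+o]≡n+[m+o] (f x) (f y) (∑ zs f))
    , λ { (here e) _ → here e ; (there k) ne → there (h k ne) }

  ∑-⊆ : ∀ {A : Set} {xs ys : List A} → Unique xs → (∀ {x} → x ∈ xs → x ∈ ys) → ∀ (f : A → ℕ) → ∑ xs f ≤ ∑ ys f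
  ∑-⊆ {xs = []} u h f = z≤n
  ∑-⊆ {xs = x ∷ xs} (d ∷ u) h f with zs , l , k ← remove-∑ (h (here refl)) f rewrite l =
    +-monoʳ-≤ (f x) (∑-⊆ u (λ m → k (h (there m)) (λ e → All.lookup d m (sym e))) f)

  ∑-mono-gap : ∀ {A : Set} {xs : List A} {f g : A → ℕ} {e x} → (∀ y → y ∈ xs → f y ≤ g y) → x ∈ xs →
               f x + e ≤ g x → ∑ xs f + e ≤ ∑ xs g
  ∑-mono-gap {xs = x ∷ xs} {f} {g} {e} h (here refl) p = begin
    f x + ∑ xs f + e     ≡⟨ acb (f x) (∑ xs f) e ⟩
    (f x + e) + ∑ xs f   ≤⟨ +-mono-≤ p (∑-mono xs (λ y m → h y (there m))) ⟩
    g x + ∑ xs g         ∎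
    where
    open ≤-Reasoning
    acb : ∀ a b c → a + b + c ≡ (a + c) + b
    acb = solve-∀
  ∑-mono-gap {xs = y ∷ xs} {f} {g} {e} h (there m) p = begin
    f y + ∑ xs f + e     ≡⟨ +-assoc (f y) _ e ⟩
    f y + (∑ xs f + e)   ≤⟨ +-mono-≤ (h y (here refl)) (∑-mono-gap (λ z k → h z (there k)) m p) ⟩
    g y + ∑ xs g         ∎
    where open ≤-Reasoning

  -- A perfect matching in the support of a weighted bipartite graph, built by alternating trees.
  -- Column sums are only bounded, since for a projected matching an injection of edges yields just
  -- this inequality.
  module König {m : ℕ} (w : Fin m → Fin m → ℕ) (d : ℕ) (0<d : 0 < d)
    (row : ∀ r → ∑ (allFin m) (w r) ≡ d)
    (col : ∀ c → ∑ (allFin m) (λ r → w r c) ≤ d) where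

    open DecMem (Finₚ._≟_ {m}) using (_∈?_)

    Partial : Set
    Partial = Fin m → Maybe (Fin m)

    record Valid (μ : Partial) : Set where
      field
        edge : ∀ {r c} → μ r ≡ just c → 0 < w r c
        inj  : ∀ {r r′ c} → μ r ≡ just c → μ r′ ≡ just c → r ≡ r′
    open Valid

    Free : Partial → Fin m → Set
    Free μ c = ∀ r → μ r ≢ just c

    -- The rows of an alternating tree rooted at the unmatched row i, in the reverse order of their discovery.
    data Tree (μ : Partial) (i : Fin m) : List (Fin m) → Set where
      root : Tree μ i (i ∷ [])
      grow : ∀ {R r₀ r c} → Tree μ i R → r₀ ∈ R → 0 < w r₀ c → μ r ≡ just c → ¬ (r ∈ R) → Tree μ i (r ∷ R)

    update : Partial → Fin m → Fin m → Partial
    update μ r c x with x Finₚ.≟ r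
    ... | yes _ = just c
    ... | no  _ = μ x

    update-≡ : ∀ μ r c → update μ r c r ≡ just c
    update-≡ μ r c with r Finₚ.≟ r
    ... | yes _ = refl
    ... | no ne = ⊥-elim (ne refl)

    update-≢ : ∀ μ {r c x} → x ≢ r → update μ r c x ≡ μ x
    update-≢ μ {r} {c} {x} ne with x Finₚ.≟ r
    ... | yes e = ⊥-elim (ne e)
    ... | no _  = refl

    just-inj : ∀ {a b : Fin m} → just a ≡ just b → a ≡ b
    just-inj refl = refl

    update-valid : ∀ {μ r c} → Valid μ → 0 < w r c → Free μ c → Valid (update μ r c)
    update-valid {μ} {r} {c} v p free = record { edge = e ; inj = i }
      where
      e : ∀ {x y} → update μ r c x ≡ just y → 0 < w x y
      e {x} q with x Finₚ.≟ r
      e refl | yes refl = p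
      e q    | no _     = edge v q
      i : ∀ {x x′ y} → update μ r c x ≡ just y → update μ r c x′ ≡ just y → x ≡ x′
      i {x} {x′} q q′ with x Finₚ.≟ r | x′ Finₚ.≟ r
      i q    q′   | yes refl | yes refl = refl
      i refl q′   | yes refl | no _     = ⊥-elim (free _ q′)
      i q    refl | no _     | yes refl = ⊥-elim (free _ q)
      i q    q′   | no _     | no _     = inj v q q′

    update-dom : ∀ μ {r c} x → μ x ≢ nothing → update μ r c x ≢ nothing
    update-dom μ {r} x h with x Finₚ.≟ r
    ... | yes _ = λ ()
    ... | no _  = h

    Extends : Partial → Fin m → Set
    Extends μ i = ∃ λ μ′ → Valid μ′ × (μ′ i ≢ nothing) × (∀ r → μ r ≢ nothing → μ′ r ≢ nothing)

    tree-root : ∀ {μ i R} → Tree μ i R → i ∈ R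
    tree-root root              = here refl
    tree-root (grow t _ _ _ _)  = there (tree-root t)

    tree-cong : ∀ {μ μ′ i R} → (∀ {r} → r ∈ R → μ′ r ≡ μ r) → Tree μ i R → Tree μ′ i R
    tree-cong h root              = root
    tree-cong h (grow t a b e n)  = grow (tree-cong (h ∘ there) t) a b (trans (h (here refl)) e) n

    -- If the row with the free column is the head `r`, it moves to that column and releases its old
    -- one to its parent `r₀`. As `r` does not occur in the rest of the list, the rest is still a
    -- tree, and the recursion continues there towards the root.
    augment : ∀ {i} R {μ} → Valid μ → μ i ≡ nothing → Tree μ i R → ∀ {r c} → r ∈ R → 0 < w r c → Free μ c → Extends μ i
    augment {i} _ {μ} v i∅ root {c = c} (here refl) p free =
      update μ i c , update-valid v p free , (λ e → case trans (sym (update-≡ μ i c)) e of λ ()) , update-dom μ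
    augment (_ ∷ R) v i∅ (grow t _ _ _ _) (there r∈) p free = augment R v i∅ t r∈ p free
    augment {i} (r ∷ R) {μ} v i∅ (grow {c = c₀} t r₀∈ p₀ e r∉) {c = c} (here refl) p free =
      let μ′ , v′ , a , b = augment R {update μ r c} (update-valid v p free) (trans (update-≢ μ i≢r) i∅)
                              (tree-cong (λ x∈ → update-≢ μ (λ { refl → r∉ x∈ })) t) r₀∈ p₀ free′
      in μ′ , v′ , a , λ x h → b x (update-dom μ x h)
      where
      i≢r : i ≢ r
      i≢r refl = r∉ (tree-root t)
      free′ : Free (update μ r c) c₀
      free′ x q with x Finₚ.≟ r
      free′ x refl | yes refl = free _ e
      free′ x q    | no x≢r   = x≢r (inj v q e)

    -- The weight leaving `R` is |R| d by rows. It is at most d for every column matched to a row of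
    -- `R`, and the unmatched root leaves at most |R| - 1 such columns.
    saturated : ∀ {μ : Partial} {i R} → μ i ≡ nothing → Unique R → i ∈ R →
                ¬ (∀ r c → r ∈ R → 0 < w r c → ∃ λ r′ → r′ ∈ R × μ r′ ≡ just c)
    saturated {μ} {i} {R} i∅ u i∈ h = <-irrefl refl (<-≤-trans (m<m+n (∑ R g) 0<d) (begin
      ∑ R g + d        ≤⟨ ∑-mono-gap (λ r _ → g≤d r) i∈ (≤-reflexive (cong (_+ d) gi≡0)) ⟩
      ∑ R (λ _ → d)    ≡⟨ ∑-cong′ R (sym ∘ row) ⟩
      ∑ R (λ r → ∑ (allFin m) (w r))                              ≤⟨ ∑-mono R (λ r r∈ → ∑-mono′ (allFin m) (λ c → single r c r∈)) ⟩
      ∑ R (λ r → ∑ (allFin m) (λ c → ∑ R (λ r′ → hit r′ c * w r c)))  ≡⟨ ∑-swap R (allFin m) _ ⟩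
      ∑ (allFin m) (λ c → ∑ R (λ r → ∑ R (λ r′ → hit r′ c * w r c)))  ≡⟨ ∑-cong′ (allFin m) (λ c → ∑-swap R R _) ⟩
      ∑ (allFin m) (λ c → ∑ R (λ r′ → ∑ R (λ r → hit r′ c * w r c)))  ≡⟨ ∑-swap (allFin m) R _ ⟩
      ∑ R (λ r′ → ∑ (allFin m) (λ c → ∑ R (λ r → hit r′ c * w r c)))  ≤⟨ ∑-mono′ R (λ r′ → ∑-mono′ (allFin m) (λ c → bound r′ c)) ⟩
      ∑ R g            ∎))
      where
      open ≤-Reasoning
      hit : Fin m → Fin m → ℕ
      hit r c = ⟦ does (Maybeₚ.≡-dec Finₚ._≟_ (μ r) (just c)) ⟧
      g : Fin m → ℕ
      g r = ∑ (allFin m) (λ c → hit r c * d)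
      gi≡0 : g i ≡ 0
      gi≡0 = trans (∑-cong′ (allFin m) (λ c → cong (λ b → ⟦ b ⟧ * d)
               (does-no (Maybeₚ.≡-dec Finₚ._≟_ (μ i) (just c)) (λ e → case trans (sym i∅) e of λ ()))))
               (∑-0 (allFin m))
      g≤d : ∀ r → g r ≤ d
      g≤d r with μ r
      ... | nothing = ≤-trans (≤-reflexive (∑-0 (allFin m))) z≤n
      ... | just c₀ = ≤-reflexive (trans (∑-cong′ (allFin m) (λ c → cong (λ b → ⟦ b ⟧ * d) (flip c)))
                       (∑-one Finₚ._≟_ (fin-unique m) (all-fin c₀) (λ _ → d)))
        where
        flip : ∀ c → does (Maybeₚ.≡-dec Finₚ._≟_ (just c₀) (just c)) ≡ does (c Finₚ.≟ c₀)
        flip c with c Finₚ.≟ c₀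
        ... | yes refl = does-yes (Maybeₚ.≡-dec Finₚ._≟_ (just c₀) (just c₀)) refl
        ... | no ne    = does-no (Maybeₚ.≡-dec Finₚ._≟_ (just c₀) (just c)) (λ e → ne (sym (just-inj e)))
      single : ∀ r c → r ∈ R → w r c ≤ ∑ R (λ r′ → hit r′ c * w r c)
      single r c r∈ with w r c in eq
      ... | zero = z≤n
      ... | suc k with r′ , r′∈ , e ← h r c r∈ (subst (0 <_) (sym eq) (s≤s z≤n)) = begin
        suc k                               ≡⟨ +-identityʳ _ ⟨
        1 * suc k                           ≡⟨ cong (λ b → ⟦ b ⟧ * suc k) (does-yes (Maybeₚ.≡-dec Finₚ._≟_ (μ r′) (just c)) e) ⟨
        hit r′ c * suc k                    ≤⟨ ∑-member r′∈ (λ x → hit x c * suc k) ⟩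
        ∑ R (λ x → hit x c * suc k)         ∎
      bound : ∀ r′ c → ∑ R (λ r → hit r′ c * w r c) ≤ hit r′ c * d
      bound r′ c = begin
        ∑ R (λ r → hit r′ c * w r c)   ≡⟨ ∑-*ˡ R (hit r′ c) _ ⟩
        hit r′ c * ∑ R (λ r → w r c)   ≤⟨ *-monoʳ-≤ (hit r′ c) (≤-trans (∑-⊆ u (λ _ → all-fin _) _) (col c)) ⟩
        hit r′ c * d                   ∎

    -- By `saturated`, some row of the tree has a column that is not matched into the tree. If this
    -- column is free, the path to it is augmented; otherwise its row is new and enlarges the tree.
    -- The fuel bounds the number of rows still to come.
    search : ∀ {i} fuel R {μ} → Valid μ → μ i ≡ nothing → Tree μ i R → Unique R → m < length R + fuel → Extends μ i
    search zero R v i∅ t u lt = ⊥-elim (<⇒≱ lt (≤-trans (≤-reflexive (+-identityʳ _))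
      (subst (length R ≤_) (length-fin m)
        (inject-length _≡_ u (λ {x} _ → x , all-fin x , refl) (λ _ _ p q → trans p (sym q))))))
    search {i} (suc fuel) R {μ} v i∅ t u lt
      with Finₚ.any? (λ r → Finₚ.any? (λ c → (r ∈? R) ×-dec (1 ≤? w r c) ×-dec
             ¬? (Finₚ.any? (λ r′ → (r′ ∈? R) ×-dec Maybeₚ.≡-dec Finₚ._≟_ (μ r′) (just c)))))
    ... | no none = ⊥-elim (saturated {μ} i∅ u (tree-root t) (λ r c r∈ p → found r c r∈ p))
      where
      found : ∀ r c → r ∈ R → 0 < w r c → ∃ λ r′ → r′ ∈ R × μ r′ ≡ just c
      found r c r∈ p with Finₚ.any? (λ r′ → (r′ ∈? R) ×-dec Maybeₚ.≡-dec Finₚ._≟_ (μ r′) (just c))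
      ... | yes q = q
      ... | no ¬q = ⊥-elim (none (r , c , r∈ , p , ¬q))
    ... | yes (r , c , r∈ , p , ¬q) with Finₚ.any? (λ r′ → Maybeₚ.≡-dec Finₚ._≟_ (μ r′) (just c))
    ...   | no free = augment R v i∅ t r∈ p (λ x e → free (x , e))
    ...   | yes (r′ , e) = search fuel (r′ ∷ R) v i∅
              (grow t r∈ p e r′∉) (All.tabulate (λ { x∈ refl → r′∉ x∈ }) ∷ u)
              (subst (m <_) (+-suc (length R) fuel) lt)
      where
      r′∉ : ¬ (r′ ∈ R)
      r′∉ q = ¬q (r′ , q , e)

    match-all : ∀ (L : List (Fin m)) → ∃ λ μ → Valid μ × (∀ r → r ∈ L → μ r ≢ nothing)
    match-all [] = (λ _ → nothing) , record { edge = λ () ; inj = λ () } , λ _ ()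
    match-all (i ∷ L) with μ , v , h ← match-all L | μ i in eq
    ... | just _ = μ , v , λ { r (here refl) e → case trans (sym eq) e of λ () ; r (there m) → h r m }
    ... | nothing with μ′ , v′ , a , b ← search m (i ∷ []) v eq root ([] ∷ []) (s≤s ≤-refl) =
      μ′ , v′ , λ { r (here refl) → a ; r (there k) → b r (h r k) }

    abstract
      matching : ∃ λ (M : Fin m → Fin m) → (∀ r → 0 < w r (M r)) × (∀ {r r′} → M r ≡ M r′ → r ≡ r′)
      matching with μ , v , h ← match-all (allFin m) =
        (λ r → proj₁ (get r)) , (λ r → edge v (proj₂ (get r))) ,
        λ {r} {r′} e → inj v (proj₂ (get r)) (trans (proj₂ (get r′)) (cong just (sym e)))
        where
        get : ∀ r → ∃ λ c → μ r ≡ just c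
        get r with μ r | h r (all-fin r)
        ... | just c  | _ = c , refl
        ... | nothing | q = ⊥-elim (q refl)

  abstract
    -- A missed value would extend `M` to an injection of `Fin (suc m)` into `Fin m`.
    fin-surjective : ∀ {m} (M : Fin m → Fin m) → (∀ {r r′} → M r ≡ M r′ → r ≡ r′) → ∀ c → ∃ λ r → M r ≡ c
    fin-surjective {m} M inj c with Finₚ.any? (λ r → M r Finₚ.≟ c)
    ... | yes q = q
    ... | no ¬q = ⊥-elim (1+n≰n (Finₚ.injective⇒≤ {f = f} f-inj))
      where
      f : Fin (suc m) → Fin m
      f zero    = c
      f (suc r) = M r
      f-inj : ∀ {x y} → f x ≡ f y → x ≡ y
      f-inj {zero}  {zero}  e = refl
      f-inj {zero}  {suc y} e = ⊥-elim (¬q (y , sym e))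
      f-inj {suc x} {zero}  e = ⊥-elim (¬q (x , e))
      f-inj {suc x} {suc y} e = cong suc (inj e)

  vec-ext : ∀ {A : Set} {n} {v w : Vec A n} → (∀ i → lookup v i ≡ lookup w i) → v ≡ w
  vec-ext {v = v} {w} h = trans (sym (Vecₚ.tabulate∘lookup v)) (trans (Vecₚ.tabulate-cong h) (Vecₚ.tabulate∘lookup w))

  lookup-injective : ∀ {A : Set} {xs : List A} → Unique xs → ∀ {i j} → List.lookup xs i ≡ List.lookup xs j → i ≡ j
  lookup-injective (d ∷ u) {zero}  {zero}  e = refl
  lookup-injective (d ∷ u) {zero}  {suc j} e = ⊥-elim (All.lookup d (Mem.∈-lookup j) e)
  lookup-injective (d ∷ u) {suc i} {zero}  e = ⊥-elim (All.lookup d (Mem.∈-lookup i) (sym e))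
  lookup-injective (d ∷ u) {suc i} {suc j} e = cong suc (lookup-injective u e)

  ∑-lookup : ∀ {A : Set} (xs : List A) f → ∑ (allFin (length xs)) (f ∘ List.lookup xs) ≡ ∑ xs f
  ∑-lookup []       f = refl
  ∑-lookup (x ∷ xs) f = trans (∑-fin (length xs) _) (cong (f x +_) (∑-lookup xs f))

  index : ∀ {A : Set} {xs : List A} {x} → x ∈ xs → ∃ λ i → List.lookup xs i ≡ x
  index (here refl) = zero , refl
  index (there m) with i , e ← index m = suc i , e

  -- Counting perfect matchings, and doubled vertices

  module Matchings {C : Set} (_≟_ : DecidableEquality C) where

    fresh : ∀ {m} → C → Vec C m → Bool
    fresh c []      = true
    fresh c (x ∷ v) = not (does (c ≟ x)) ∧ fresh c v

    valid : ∀ {A : Set} → (A → C → Bool) → ∀ {m} → Vec A m → Vec C m → Bool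
    valid adj []       []      = true
    valid adj (a ∷ as) (c ∷ v) = (adj a c ∧ fresh c v) ∧ valid adj as v

    -- The permanent of the 0-1 matrix with rows as, columns B and entries given by adj.
    pm : ∀ {A : Set} → (A → C → Bool) → ∀ {m} → Vec A m → List C → ℕ
    pm adj {m} as B = ∑ (vecs B m) (λ v → ⟦ valid adj as v ⟧)

    fresh-sound : ∀ {m} c (v : Vec C m) → fresh c v ≡ true → ∀ i → c ≢ lookup v i
    fresh-sound c (x ∷ v) p zero    = does-false (c ≟ x) (not-true (proj₁ (∧-true p)))
    fresh-sound c (x ∷ v) p (suc i) = fresh-sound c v (proj₂ (∧-true {not (does (c ≟ x))} p)) i

    fresh-complete : ∀ {m} c (v : Vec C m) → (∀ i → c ≢ lookup v i) → fresh c v ≡ true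
    fresh-complete c []      h = refl
    fresh-complete c (x ∷ v) h = ∧-intro (cong not (does-no (c ≟ x) (h zero))) (fresh-complete c v (h ∘ suc))

    module _ {A : Set} (adj : A → C → Bool) where

      valid-adj : ∀ {m} (as : Vec A m) v → valid adj as v ≡ true → ∀ i → adj (lookup as i) (lookup v i) ≡ true
      valid-adj (a ∷ as) (c ∷ v) p zero    = proj₁ (∧-true (proj₁ (∧-true p)))
      valid-adj (a ∷ as) (c ∷ v) p (suc i) = valid-adj as v (proj₂ (∧-true {adj a c ∧ fresh c v} p)) i

      valid-inj : ∀ {m} (as : Vec A m) v → valid adj as v ≡ true → ∀ {i j} → lookup v i ≡ lookup v j → i ≡ j
      valid-inj (a ∷ as) (c ∷ v) p {zero}  {zero}  e = refl
      valid-inj (a ∷ as) (c ∷ v) p {zero}  {suc j} e =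
        ⊥-elim (fresh-sound c v (proj₂ (∧-true {adj a c} (proj₁ (∧-true p)))) j e)
      valid-inj (a ∷ as) (c ∷ v) p {suc i} {zero}  e =
        ⊥-elim (fresh-sound c v (proj₂ (∧-true {adj a c} (proj₁ (∧-true p)))) i (sym e))
      valid-inj (a ∷ as) (c ∷ v) p {suc i} {suc j} e =
        cong suc (valid-inj as v (proj₂ (∧-true {adj a c ∧ fresh c v} p)) e)

      valid-complete : ∀ {m} (as : Vec A m) v → (∀ i → adj (lookup as i) (lookup v i) ≡ true) →
                       (∀ {i j} → lookup v i ≡ lookup v j → i ≡ j) → valid adj as v ≡ true
      valid-complete []       []      a d = refl
      valid-complete (x ∷ as) (c ∷ v) a d =
        ∧-intro (∧-intro (a zero) (fresh-complete c v (λ i e → case d {zero} {suc i} e of λ ())))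
                (valid-complete as v (a ∘ suc) (λ e → Finₚ.suc-injective (d e)))

  open Matchings

  half : ∀ m → Bool → Fin m → Fin (m + m)
  half m true  i = i Fin.↑ˡ m
  half m false i = m Fin.↑ʳ i

  half-disjoint : ∀ m (i j : Fin m) → half m true i ≢ half m false j
  half-disjoint m i j e with trans (sym (Finₚ.splitAt-↑ˡ m i m)) (trans (cong (Fin.splitAt m) e) (Finₚ.splitAt-↑ʳ m m j))
  ... | ()

  half-injective : ∀ m b b′ (i j : Fin m) → half m b i ≡ half m b′ j → b ≡ b′ × i ≡ j
  half-injective m true  true  i j e = refl , Finₚ.↑ˡ-injective m _ _ e
  half-injective m false false i j e = refl , Finₚ.↑ʳ-injective m _ _ e
  half-injective m true  false i j e = ⊥-elim (half-disjoint m i j e)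
  half-injective m false true  i j e = ⊥-elim (half-disjoint m j i (sym e))

  half-surjective : ∀ m (k : Fin (m + m)) → ∃ λ b → ∃ λ i → half m b i ≡ k
  half-surjective m k with Fin.splitAt m k in eq
  ... | inj₁ i = true , i , Finₚ.splitAt⁻¹-↑ˡ eq
  ... | inj₂ i = false , i , Finₚ.splitAt⁻¹-↑ʳ eq

  lookup-half : ∀ {A : Set} {m} (as : Vec A m) b i → lookup (as Vec.++ as) (half m b i) ≡ lookup as i
  lookup-half as true  i = Vecₚ.lookup-++ˡ as as i
  lookup-half as false i = Vecₚ.lookup-++ʳ as as i

  not-≢ : ∀ b → b ≢ not b
  not-≢ true  ()
  not-≢ false ()

  half-opposite : ∀ m (f : Fin m → Bool) i j → half m (f j) j ≢ half m (not (f i)) i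
  half-opposite m f i j e = not-≢ (f i) (trans (cong f (sym (proj₂ pq))) (proj₁ pq))
    where pq = half-injective m (f j) (not (f i)) j i e

  ≢-not : ∀ {b b′} → b ≢ b′ → b′ ≡ not b
  ≢-not {true}  {true}  h = ⊥-elim (h refl)
  ≢-not {true}  {false} h = refl
  ≢-not {false} {true}  h = refl
  ≢-not {false} {false} h = ⊥-elim (h refl)

  bits-pigeonhole : ∀ {a b c : Bool} → a ≢ b → a ≢ c → b ≢ c → ⊥
  bits-pigeonhole p q r = r (trans (≢-not p) (sym (≢-not q)))

  -- With two copies of every vertex, the number of perfect matchings is at most 4^m times the square of the original one:
  -- a perfect matching of the blow-up projects to a 2-regular multigraph, which splits into two matchings.
  module Doubling {A C : Set} (_≟_ : DecidableEquality C) (adj : A → C → Bool)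
    (B : List C) (uB : Unique B) (as : Vec A (length B)) where

    m : ℕ
    m = length B

    _≟′_ : DecidableEquality (C × Bool)
    _≟′_ = ×ₚ.≡-dec _≟_ Boolₚ._≟_

    adj′ : A → C × Bool → Bool
    adj′ a (c , _) = adj a c

    B′ : List (C × Bool)
    B′ = cartesianProductWith _,_ B bools

    singles : List (Vec C m)
    singles = sift (valid _≟_ adj as) (vecs B m)

    doubles : List (Vec (C × Bool) (m + m))
    doubles = sift (valid _≟′_ adj′ (as Vec.++ as)) (vecs B′ (m + m))

    -- Two matchings of the original graph, then which copy of each left vertex uses the first one,
    -- then which copy of its right end this edge reaches. The copies reached by the second matching
    -- are forced, hence the factor 4^m.
    Data : Set
    Data = (Vec C m × Vec C m) × (Vec Bool m × Vec Bool m)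

    record R (x : Vec (C × Bool) (m + m)) (y : Data) : Set where
      M₁ = proj₁ (proj₁ y)
      M₂ = proj₂ (proj₁ y)
      b  = proj₁ (proj₂ y)
      β  = proj₂ (proj₂ y)
      field
        first  : ∀ i → lookup x (half m (lookup b i) i) ≡ (lookup M₁ i , lookup β i)
        second : ∀ i → proj₁ (lookup x (half m (not (lookup b i)) i)) ≡ lookup M₂ i
        onto   : ∀ i → ∃ λ j → lookup M₁ j ≡ lookup M₂ i

    choose : ∀ (c : C) (u : Bool → C) → 0 < ⟦ does (c ≟ u false) ⟧ + ⟦ does (c ≟ u true) ⟧ → u (does (c ≟ u true)) ≡ c
    choose c u p with c ≟ u true | c ≟ u false
    ... | yes e | _     = sym e
    ... | no _  | yes e = sym e

    module _ {x : Vec (C × Bool) (m + m)} (x∈ : x ∈ doubles) where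

      x-inj : ∀ {k l} → lookup x k ≡ lookup x l → k ≡ l
      x-inj = valid-inj _≟′_ adj′ (as Vec.++ as) x (proj₂ (∈-sift⁻ _ {vecs B′ (m + m)} x∈))

      x-adj : ∀ b i → adj (lookup as i) (proj₁ (lookup x (half m b i))) ≡ true
      x-adj b i = subst (λ a → adj a (proj₁ (lookup x (half m b i))) ≡ true) (lookup-half as b i)
        (valid-adj _≟′_ adj′ (as Vec.++ as) x (proj₂ (∈-sift⁻ _ {vecs B′ (m + m)} x∈)) (half m b i))

      x-B′ : ∀ k → lookup x k ∈ B′
      x-B′ = vecs-∈ (proj₁ (∈-sift⁻ _ x∈))

      x-B : ∀ k → proj₁ (lookup x k) ∈ B
      x-B k with Mem.∈-cartesianProductWith⁻ _,_ B bools (x-B′ k)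
      ... | c , _ , c∈ , _ , e = subst (_∈ B) (cong proj₁ (sym e)) c∈

      u : Bool → Fin m → C
      u b i = proj₁ (lookup x (half m b i))

      Bv : Fin m → C
      Bv = List.lookup B

      hit : Bool → Fin m → Fin m → ℕ
      hit b r c = ⟦ does (Bv c ≟ u b r) ⟧

      -- The multigraph onto which `x` projects.
      w : Fin m → Fin m → ℕ
      w r c = hit false r c + hit true r c

      hit-row : ∀ b r → ∑ (allFin m) (hit b r) ≡ 1
      hit-row b r = trans (∑-lookup B (λ y → ⟦ does (y ≟ u b r) ⟧))
        (trans (∑-cong′ B (λ y → sym (*-identityʳ _))) (∑-one _≟_ uB (x-B (half m b r)) (λ _ → 1)))

      w-row : ∀ r → ∑ (allFin m) (w r) ≡ 2
      w-row r = trans (∑-+ (allFin m) _ _) (cong₂ _+_ (hit-row false r) (hit-row true r))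

      edges : List (C × Bool)
      edges = map (λ (b , r) → lookup x (half m b r)) (cartesianProductWith _,_ bools (allFin m))

      edges-unique : Unique edges
      edges-unique = Uniqueₚ.map⁺ (λ e → let p , q = half-injective m _ _ _ _ (x-inj e) in cong₂ _,_ p q)
                       (product-unique bools-unique (fin-unique m))

      edges-⊆ : ∀ {y} → y ∈ edges → y ∈ B′
      edges-⊆ k with Mem.∈-map⁻ _ {xs = cartesianProductWith _,_ bools (allFin m)} k
      ... | _ , _ , refl = x-B′ _

      w-col : ∀ c → ∑ (allFin m) (λ r → w r c) ≤ 2
      w-col c = begin
        ∑ (allFin m) (λ r → w r c)                                                     ≡⟨ ∑-+ (allFin m) _ _ ⟩
        ∑ (allFin m) (λ r → hit false r c) + ∑ (allFin m) (λ r → hit true r c)         ≡⟨ cong (∑ (allFin m) (λ r → hit false r c) +_) (+-identityʳ _) ⟨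
        ∑ bools (λ b → ∑ (allFin m) (λ r → hit b r c))                                 ≡⟨ ∑-product _,_ bools (allFin m) _ ⟨
        ∑ (cartesianProductWith _,_ bools (allFin m)) (λ (b , r) → hit b r c)          ≡⟨ ∑-map _ (cartesianProductWith _,_ bools (allFin m)) (λ y → ⟦ does (Bv c ≟ proj₁ y) ⟧) ⟨
        ∑ edges (λ y → ⟦ does (Bv c ≟ proj₁ y) ⟧)                                      ≤⟨ ∑-⊆ edges-unique edges-⊆ _ ⟩
        ∑ B′ (λ y → ⟦ does (Bv c ≟ proj₁ y) ⟧)                                         ≡⟨ ∑-product _,_ B bools _ ⟩
        ∑ B (λ y → ∑ bools (λ _ → ⟦ does (Bv c ≟ y) ⟧))                                ≡⟨ ∑-cong′ B (λ y → cong (λ b → ⟦ b ⟧ + (⟦ b ⟧ + 0)) (flip y)) ⟩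
        ∑ B (λ y → ∑ bools (λ _ → ⟦ does (y ≟ Bv c) ⟧))                                ≡⟨ ∑-cong′ B (λ y → two ⟦ does (y ≟ Bv c) ⟧) ⟩
        ∑ B (λ y → ⟦ does (y ≟ Bv c) ⟧ * 2)                                            ≡⟨ ∑-one _≟_ uB (Mem.∈-lookup c) (λ _ → 2) ⟩
        2 ∎
        where
        open ≤-Reasoning
        two : ∀ a → a + (a + 0) ≡ a * 2
        two = solve-∀
        flip : ∀ y → does (Bv c ≟ y) ≡ does (y ≟ Bv c)
        flip y with y ≟ Bv c
        ... | yes e = does-yes (Bv c ≟ y) (sym e)
        ... | no ne = does-no (Bv c ≟ y) (ne ∘ sym)

      open König w 2 (s≤s z≤n) w-row w-col using (matching)

      M = proj₁ matching

      M-inj : ∀ {r r′} → M r ≡ M r′ → r ≡ r′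
      M-inj = proj₂ (proj₂ matching)

      b₀ : Fin m → Bool
      b₀ r = does (Bv (M r) ≟ u true r)

      e₁ e₂ : Fin m → C × Bool
      e₁ r = lookup x (half m (b₀ r) r)
      e₂ r = lookup x (half m (not (b₀ r)) r)

      e₁-M : ∀ r → proj₁ (e₁ r) ≡ Bv (M r)
      e₁-M r = choose (Bv (M r)) (λ b → u b r) (proj₁ (proj₂ matching) r)

      e₁≢e₂ : ∀ j i → e₁ j ≢ e₂ i
      e₁≢e₂ j i e = half-opposite m b₀ i j (x-inj e)

      find : ∀ i → ∃ λ j → proj₁ (e₁ j) ≡ proj₁ (e₂ i)
      find i = proj₁ r , trans (e₁-M (proj₁ r)) (trans (cong Bv (proj₂ r)) (proj₂ c))
        where
        c = index (x-B (half m (not (b₀ i)) i))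
        r = fin-surjective M M-inj (proj₁ c)

      bits-differ : ∀ {p q : C × Bool} → proj₁ p ≡ proj₁ q → p ≢ q → proj₂ p ≢ proj₂ q
      bits-differ e h f = h (cong₂ _,_ e f)

      -- A right vertex hit by two second edges is also hit by a first edge, by `find`. Three
      -- distinct edges cannot end in its two copies.
      e₂-inj : ∀ {i i′} → proj₁ (e₂ i) ≡ proj₁ (e₂ i′) → i ≡ i′
      e₂-inj {i} {i′} e = decidable-stable (i Finₚ.≟ i′) λ ¬p →
        bits-pigeonhole
          (bits-differ (proj₂ (find i)) (e₁≢e₂ (proj₁ (find i)) i))
          (bits-differ (trans (proj₂ (find i)) e) (e₁≢e₂ (proj₁ (find i)) i′))
          (bits-differ e (λ q → ¬p (proj₂ (half-injective m (not (b₀ i)) (not (b₀ i′)) i i′ (x-inj q)))))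

      e₁-inj : ∀ {i i′} → proj₁ (e₁ i) ≡ proj₁ (e₁ i′) → i ≡ i′
      e₁-inj {i} {i′} e = M-inj (lookup-injective uB (trans (sym (e₁-M i)) (trans e (e₁-M i′))))

      single : ∀ (f : Fin m → C × Bool) → (∀ {i i′} → proj₁ (f i) ≡ proj₁ (f i′) → i ≡ i′) →
               (∀ i → ∃ λ b → f i ≡ lookup x (half m b i)) → Vec.tabulate (proj₁ ∘ f) ∈ singles
      single f inj h = ∈-sift⁺ (valid _≟_ adj as)
        (∈-vecs _ (λ i → subst (_∈ B) (sym (trans (Vecₚ.lookup∘tabulate _ i) (cong proj₁ (proj₂ (h i))))) (x-B _)))
        (valid-complete _≟_ adj as _
          (λ i → subst (λ c → adj (lookup as i) c ≡ true)
            (sym (trans (Vecₚ.lookup∘tabulate _ i) (cong proj₁ (proj₂ (h i))))) (x-adj (proj₁ (h i)) i))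
          (λ {i} {j} e → inj (trans (sym (Vecₚ.lookup∘tabulate _ i)) (trans e (Vecₚ.lookup∘tabulate _ j)))))

      split : ∃ λ y → y ∈ cartesianProductWith _,_ (cartesianProductWith _,_ singles singles)
                                                    (cartesianProductWith _,_ (cube m) (cube m)) × R x y
      split = ((Vec.tabulate (proj₁ ∘ e₁) , Vec.tabulate (proj₁ ∘ e₂)) , (Vec.tabulate b₀ , Vec.tabulate (proj₂ ∘ e₁)))
            , ∈-product (∈-product (single e₁ e₁-inj (λ i → b₀ i , refl)) (single e₂ e₂-inj (λ i → not (b₀ i) , refl)))
                        (∈-product (∈-cube _) (∈-cube _))
            , record
            { first  = λ i → trans (cong (λ b → lookup x (half m b i)) (Vecₚ.lookup∘tabulate b₀ i))
                               (cong₂ _,_ (sym (Vecₚ.lookup∘tabulate (proj₁ ∘ e₁) i)) (sym (Vecₚ.lookup∘tabulate (proj₂ ∘ e₁) i)))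
            ; second = λ i → trans (cong (λ b → proj₁ (lookup x (half m (not b) i))) (Vecₚ.lookup∘tabulate b₀ i))
                               (sym (Vecₚ.lookup∘tabulate (proj₁ ∘ e₂) i))
            ; onto   = λ i → let j , f = find i in
                       j , trans (Vecₚ.lookup∘tabulate (proj₁ ∘ e₁) j) (trans f (sym (Vecₚ.lookup∘tabulate (proj₁ ∘ e₂) i))) }

    -- One copy of the right end is taken by the first edge that `onto` provides, so the second edge
    -- takes the other copy.
    second-bit : ∀ {x y} → x ∈ doubles → (r : R x y) → ∀ i →
                 let open R r in proj₂ (lookup x (half m (not (lookup b i)) i)) ≡ not (lookup β (proj₁ (onto i)))
    second-bit {x} {y} x∈ r i = ≢-not (λ e → contra (x-inj x∈ (trans (first j) (cong₂ _,_ (trans q (sym (second i))) e))))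
      where
      open R r
      j = proj₁ (onto i)
      q = proj₂ (onto i)
      contra : half m (lookup b j) j ≢ half m (not (lookup b i)) i
      contra = half-opposite m (lookup b) i j

    R-injective : ∀ {x x′ y} → x ∈ doubles → x′ ∈ doubles → R x y → R x′ y → x ≡ x′
    R-injective {x} {x′} {y} x∈ x′∈ r r′ = vec-ext λ k → at k
      where
      open R r using (b; β)
      open R using (first; second; onto)
      bit : ∀ i → not (lookup β (proj₁ (onto r i))) ≡ not (lookup β (proj₁ (onto r′ i)))
      bit i = trans (sym (second-bit x∈ r i)) (second-bit {x} {y} x∈ (record { first = first r ; second = second r ; onto = onto r′ }) i)
      here₁ : ∀ i → lookup x (half m (lookup b i) i) ≡ lookup x′ (half m (lookup b i) i)
      here₁ i = trans (first r i) (sym (first r′ i))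
      here₂ : ∀ i → lookup x (half m (not (lookup b i)) i) ≡ lookup x′ (half m (not (lookup b i)) i)
      here₂ i = cong₂ _,_ (trans (second r i) (sym (second r′ i)))
                  (trans (second-bit x∈ r i) (trans (bit i) (sym (second-bit x′∈ r′ i))))
      at : ∀ k → lookup x k ≡ lookup x′ k
      at k with half-surjective m k
      ... | true , i , refl with lookup b i | here₁ i | here₂ i
      ...   | true  | p | _ = p
      ...   | false | _ | q = q
      at k | false , i , refl with lookup b i | here₁ i | here₂ i
      ...   | true  | _ | q = q
      ...   | false | p | _ = p

    doubling : pm _≟′_ adj′ (as Vec.++ as) B′ ≤ (pm _≟_ adj as B * pm _≟_ adj as B) * (2 ^ m * 2 ^ m)
    doubling = begin
      pm _≟′_ adj′ (as Vec.++ as) B′     ≡⟨ length-sift _ (vecs B′ (m + m)) ⟨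
      length doubles                     ≤⟨ inject-length R (sift-unique _ (vecs-unique (product-unique uB bools-unique) (m + m))) split R-injective ⟩
      length pairs                       ≡⟨ length-product _,_ (cartesianProductWith _,_ singles singles) _ ⟩
      length (cartesianProductWith _,_ singles singles) * length (cartesianProductWith _,_ (cube m) (cube m))
                                         ≡⟨ cong₂ _*_ (length-product _,_ singles singles) (length-product _,_ (cube m) (cube m)) ⟩
      (length singles * length singles) * (length (cube m) * length (cube m))
                                         ≡⟨ cong₂ _*_ (cong₂ _*_ len len) (cong₂ _*_ (length-vecs bools m) (length-vecs bools m)) ⟩
      (pm _≟_ adj as B * pm _≟_ adj as B) * (2 ^ m * 2 ^ m) ∎
      where
      open ≤-Reasoning
      pairs = cartesianProductWith _,_ (cartesianProductWith _,_ singles singles) (cartesianProductWith _,_ (cube m) (cube m))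
      len = length-sift (valid _≟_ adj as) (vecs B m)

  -- Blow-ups

  ∏ : ∀ n → (Fin n → ℕ) → ℕ
  ∏ zero    f = 1
  ∏ (suc n) f = f zero * ∏ n (f ∘ suc)

  ∏-cong : ∀ n {f g : Fin n → ℕ} → (∀ i → f i ≡ g i) → ∏ n f ≡ ∏ n g
  ∏-cong zero    e = refl
  ∏-cong (suc n) e = cong₂ _*_ (e zero) (∏-cong n (e ∘ suc))

  ∏-const : ∀ n c → ∏ n (λ _ → c) ≡ c ^ n
  ∏-const zero    c = refl
  ∏-const (suc n) c = cong (c *_) (∏-const n c)

  ∏-0 : ∀ n (f : Fin n → ℕ) i → f i ≡ 0 → ∏ n f ≡ 0
  ∏-0 (suc n) f zero    e rewrite e = refl
  ∏-0 (suc n) f (suc i) e rewrite ∏-0 n (f ∘ suc) i e = *-zeroʳ (f zero)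

  ∏-≤1 : ∀ n (f : Fin n → ℕ) → (∀ i → f i ≤ 1) → ∏ n f ≤ 1
  ∏-≤1 zero    f h = ≤-refl
  ∏-≤1 (suc n) f h = *-mono-≤ (h zero) (∏-≤1 n (f ∘ suc) (h ∘ suc))

  ∏-rest : ∀ {n} → Fin n → (Fin n → ℕ) → ℕ
  ∏-rest {suc n} zero    f = ∏ n (f ∘ suc)
  ∏-rest {suc n} (suc i) f = f zero * ∏-rest i (f ∘ suc)

  ∏-split : ∀ {n} (a : Fin n) f → ∏ n f ≡ f a * ∏-rest a f
  ∏-split zero    f = refl
  ∏-split (suc a) f = trans (cong (f zero *_) (∏-split a (f ∘ suc))) (x∙yz≈y∙xz (f zero) (f (suc a)) (∏-rest a (f ∘ suc)))

  ∏-rest-cong : ∀ {n} (a : Fin n) {f g} → (∀ i → i ≢ a → f i ≡ g i) → ∏-rest a f ≡ ∏-rest a g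
  ∏-rest-cong {suc n} zero    h = ∏-cong n (λ i → h (suc i) λ ())
  ∏-rest-cong {suc n} (suc a) h = cong₂ _*_ (h zero λ ()) (∏-rest-cong a (λ i ne → h (suc i) (ne ∘ Finₚ.suc-injective)))

  δ : ∀ {n} → Fin n → Fin n → ℕ
  δ i j = ⟦ does (i Finₚ.≟ j) ⟧

  δ-refl : ∀ {n} (i : Fin n) → δ i i ≡ 1
  δ-refl i = cong ⟦_⟧ (does-yes (i Finₚ.≟ i) refl)

  δ-≢ : ∀ {n} {i j : Fin n} → i ≢ j → δ i j ≡ 0
  δ-≢ {i = i} {j} ne = cong ⟦_⟧ (does-no (i Finₚ.≟ j) ne)

  δ-sym : ∀ {n} (i j : Fin n) → δ i j ≡ δ j i
  δ-sym i j with i Finₚ.≟ j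
  ... | yes refl = sym (δ-refl i)
  ... | no ne    = sym (δ-≢ (ne ∘ sym))

  ∑-δ : ∀ {n} (i : Fin n) (f : Fin n → ℕ) → ∑ (allFin n) (λ j → δ j i * f j) ≡ f i
  ∑-δ {n} i f = ∑-one Finₚ._≟_ (fin-unique n) (all-fin i) f

  occ : ∀ {k m} → Vec (Fin k) m → Fin k → ℕ
  occ []      l = 0
  occ (x ∷ s) l = δ x l + occ s l

  occ-++ : ∀ {k m m′} (s : Vec (Fin k) m) (s′ : Vec (Fin k) m′) l → occ (s Vec.++ s′) l ≡ occ s l + occ s′ l
  occ-++ []      s′ l = refl
  occ-++ (x ∷ s) s′ l rewrite occ-++ s s′ l = sym (+-assoc (δ x l) _ _)

  occ-sum : ∀ {k m} (s : Vec (Fin k) m) → ∑ (allFin k) (occ s) ≡ m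
  occ-sum {k} []      = ∑-0 (allFin k)
  occ-sum {k} (x ∷ s) = trans (∑-+ (allFin k) _ _) (cong₂ _+_ one (occ-sum s))
    where
    one : ∑ (allFin k) (δ x) ≡ 1
    one = trans (∑-cong′ (allFin k) (λ j → trans (δ-sym x j) (sym (*-identityʳ _)))) (∑-δ x (λ _ → 1))

  occ-≤ : ∀ {k m} (s : Vec (Fin k) m) l → occ s l ≤ m
  occ-≤ {k} s l = subst (occ s l ≤_) (occ-sum s) (∑-member (all-fin l) (occ s))

  ∑-largest : ∀ {A : Set} (xs : List A) f → 0 < length xs → ∃ λ x → x ∈ xs × ∑ xs f ≤ length xs * f x
  ∑-largest (x ∷ []) f _ = x , here refl , ≤-refl
  ∑-largest (x ∷ y ∷ ys) f _ with z , m , h ← ∑-largest (y ∷ ys) f (s≤s z≤n) | ≤-total (f x) (f z)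
  ... | inj₁ p = z , there m , +-mono-≤ p h
  ... | inj₂ p = x , here refl , +-monoʳ-≤ (f x) (≤-trans h (*-monoʳ-≤ (length (y ∷ ys)) p))

  positive : ℕ → Bool
  positive zero    = false
  positive (suc _) = true

  positive-true : ∀ {n} → 1 ≤ n → positive n ≡ true
  positive-true (s≤s _) = refl

  positive-≥1 : ∀ {n} → positive n ≡ true → 1 ≤ n
  positive-≥1 {suc n} _ = s≤s z≤n

  module _ {k : ℕ} where

    occ-is : ∀ {N} → (Fin k → ℕ) → Vec (Fin k) N → Bool
    occ-is β s = does (Finₚ.all? (λ l → occ s l ℕ.≟ β l))

    -- The multinomial coefficient of type β.
    mult : ℕ → (Fin k → ℕ) → ℕ
    mult N β = ∑ (vecs (allFin k) N) (λ s → ⟦ occ-is β s ⟧)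

    mult-cong : ∀ N {β γ} → (∀ l → β l ≡ γ l) → mult N β ≡ mult N γ
    mult-cong N {β} {γ} e = ∑-cong′ (vecs (allFin k) N) (λ s → cong ⟦_⟧ (same s))
      where
      same : ∀ s → occ-is β s ≡ occ-is γ s
      same s = does-⇔ (Finₚ.all? _) (Finₚ.all? _) (λ h l → trans (h l) (e l)) (λ h l → trans (h l) (sym (e l)))

    mult-step : ∀ N β → mult (suc N) β ≤ ∑ (allFin k) (λ l → ⟦ positive (β l) ⟧ * mult N (λ x → β x ∸ δ x l))
    mult-step N β = begin
      mult (suc N) β
        ≡⟨ ∑-vecs (allFin k) N _ ⟩
      ∑ (allFin k) (λ l → ∑ (vecs (allFin k) N) (λ s → ⟦ occ-is β (l ∷ s) ⟧))
        ≤⟨ ∑-mono′ (allFin k) (λ l → ∑-mono′ (vecs (allFin k) N) (λ s → step l s)) ⟩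
      ∑ (allFin k) (λ l → ∑ (vecs (allFin k) N) (λ s → ⟦ positive (β l) ⟧ * ⟦ occ-is (λ x → β x ∸ δ x l) s ⟧))
        ≡⟨ ∑-cong′ (allFin k) (λ l → ∑-*ˡ (vecs (allFin k) N) ⟦ positive (β l) ⟧ (λ s → ⟦ occ-is (λ x → β x ∸ δ x l) s ⟧)) ⟩
      ∑ (allFin k) (λ l → ⟦ positive (β l) ⟧ * mult N (λ x → β x ∸ δ x l)) ∎
      where
      open ≤-Reasoning
      step : ∀ l (s : Vec (Fin k) N) → ⟦ occ-is β (l ∷ s) ⟧ ≤ ⟦ positive (β l) ⟧ * ⟦ occ-is (λ x → β x ∸ δ x l) s ⟧
      step l s = ⟦does⟧-≤ (Finₚ.all? (λ x → occ (l ∷ s) x ℕ.≟ β x)) λ h →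
        ≤-reflexive (sym (cong₂ (λ a b → ⟦ a ⟧ * ⟦ b ⟧)
          (positive-true (subst (1 ≤_) (h l) (≤-trans (≤-reflexive (sym (δ-refl l))) (m≤m+n _ _))))
          (does-yes (Finₚ.all? (λ x → occ s x ℕ.≟ β x ∸ δ x l)) (λ x → sym
            (trans (cong₂ _∸_ (sym (h x)) (δ-sym x l)) (m+n∸m≡n (δ l x) (occ s x)))))))

    -- The k^N sequences have at most (N + 1)^k types; the most frequent type is chosen.
    large-type : ∀ N → 0 < k ^ N → ∃ λ (β : Fin k → ℕ) → k ^ N ≤ suc N ^ k * mult N β × ∑ (allFin k) β ≡ N
    large-type N pos with b , b∈ , le ← ∑-largest (vecs (List.upTo (suc N)) k) (λ b → mult N (lookup b))
           (subst (0 <_) (sym (trans (length-vecs (List.upTo (suc N)) k) (cong (_^ k) (Listₚ.length-upTo (suc N)))))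
                  (m^n>0 (suc N) k))
      = lookup b , total , from-seq
      where
      all-types : k ^ N ≤ ∑ (vecs (List.upTo (suc N)) k) (λ b → mult N (lookup b))
      all-types = begin
        k ^ N                                             ≡⟨ cong (_^ N) (length-fin k) ⟨
        length (allFin k) ^ N                             ≡⟨ length-vecs (allFin k) N ⟨
        length (vecs (allFin k) N)                        ≡⟨ length-∑ (vecs (allFin k) N) ⟩
        ∑ (vecs (allFin k) N) (λ _ → 1)                   ≤⟨ ∑-mono′ (vecs (allFin k) N) one ⟩
        ∑ (vecs (allFin k) N) (λ s → ∑ (vecs (List.upTo (suc N)) k) (λ b → ⟦ occ-is (lookup b) s ⟧))
                                                          ≡⟨ ∑-swap (vecs (allFin k) N) (vecs (List.upTo (suc N)) k) _ ⟩
        ∑ (vecs (List.upTo (suc N)) k) (λ b → mult N (lookup b)) ∎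
        where
        open ≤-Reasoning
        one : ∀ s → 1 ≤ ∑ (vecs (List.upTo (suc N)) k) (λ b → ⟦ occ-is (lookup b) s ⟧)
        one s = ≤-trans (≤-reflexive (cong ⟦_⟧ (sym (does-yes (Finₚ.all? _)
                  (λ l → sym (Vecₚ.lookup∘tabulate (occ s) l))))))
                (∑-member (∈-vecs (Vec.tabulate (occ s)) (λ l → subst (_∈ List.upTo (suc N))
                  (sym (Vecₚ.lookup∘tabulate (occ s) l)) (Mem.∈-upTo⁺ (s≤s (occ-≤ s l))))) (λ b → ⟦ occ-is (lookup b) s ⟧))
      total : k ^ N ≤ suc N ^ k * mult N (lookup b)
      total = ≤-trans all-types (≤-trans le (≤-reflexive (cong (_* mult N (lookup b))
                (trans (length-vecs (List.upTo (suc N)) k) (cong (_^ k) (Listₚ.length-upTo (suc N)))))))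
      nonzero : 0 < mult N (lookup b)
      nonzero with mult N (lookup b) | total
      ... | zero  | h = ⊥-elim (<⇒≱ pos (≤-trans h (≤-reflexive (*-zeroʳ (suc N ^ k)))))
      ... | suc _ | _ = s≤s z≤n
      from-seq : ∑ (allFin k) (lookup b) ≡ N
      from-seq with s , _ , p ← ∑-positive (vecs (allFin k) N) (λ s → ⟦ occ-is (lookup b) s ⟧) nonzero =
        trans (∑-cong′ (allFin k) (λ l → sym (matches s p l))) (occ-sum s)
        where
        matches : ∀ s → 0 < ⟦ occ-is (lookup b) s ⟧ → ∀ l → occ s l ≡ lookup b l
        matches s p = does-true (Finₚ.all? (λ l → occ s l ℕ.≟ lookup b l)) (⟦⟧-true p)

  *-^ : ∀ m n o → (m * n) ^ o ≡ m ^ o * n ^ o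
  *-^ m n zero    = refl
  *-^ m n (suc o) rewrite *-^ m n o = *-interchange m n (m ^ o) (n ^ o)

  module _ {C : Set} (_≟_ : DecidableEquality C) where

    del : C → List C → List C
    del c = sift (λ x → not (does (c ≟ x)))

    ∑-fresh : ∀ c (B : List C) m (f : Vec C m → ℕ) →
              ∑ (vecs B m) (λ v → ⟦ fresh _≟_ c v ⟧ * f v) ≡ ∑ (vecs (del c B) m) f
    ∑-fresh c B zero    f = cong (_+ 0) (+-identityʳ _)
    ∑-fresh c B (suc m) f = begin
      ∑ (vecs B (suc m)) (λ v → ⟦ fresh _≟_ c v ⟧ * f v)
        ≡⟨ ∑-vecs B m _ ⟩
      ∑ B (λ x → ∑ (vecs B m) (λ v → ⟦ not (does (c ≟ x)) ∧ fresh _≟_ c v ⟧ * f (x ∷ v)))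
        ≡⟨ ∑-cong′ B (λ x → trans (∑-cong′ (vecs B m) (λ v → trans (cong (_* f (x ∷ v)) (⟦∧⟧ (not (does (c ≟ x))) _)) (*-assoc ⟦ not (does (c ≟ x)) ⟧ _ _)))
                                (trans (∑-*ˡ (vecs B m) ⟦ not (does (c ≟ x)) ⟧ _) (cong (⟦ not (does (c ≟ x)) ⟧ *_) (∑-fresh c B m (f ∘ (x ∷_)))))) ⟩
      ∑ B (λ x → ⟦ not (does (c ≟ x)) ⟧ * ∑ (vecs (del c B) m) (f ∘ (x ∷_)))
        ≡⟨ ∑-sift _ B _ ⟨
      ∑ (del c B) (λ x → ∑ (vecs (del c B) m) (f ∘ (x ∷_)))
        ≡⟨ ∑-vecs (del c B) m f ⟨
      ∑ (vecs (del c B) (suc m)) f ∎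
      where open ≡-Reasoning

    pm-cons : ∀ {A : Set} (adj : A → C → Bool) {m} a (as : Vec A m) B →
              pm _≟_ adj (a ∷ as) B ≡ ∑ B (λ c → ⟦ adj a c ⟧ * pm _≟_ adj as (del c B))
    pm-cons adj {m} a as B = begin
      pm _≟_ adj (a ∷ as) B
        ≡⟨ ∑-vecs B m _ ⟩
      ∑ B (λ c → ∑ (vecs B m) (λ v → ⟦ (adj a c ∧ fresh _≟_ c v) ∧ valid _≟_ adj as v ⟧))
        ≡⟨ ∑-cong′ B (λ c → trans (∑-cong′ (vecs B m) (λ v → trans (⟦∧⟧ (adj a c ∧ fresh _≟_ c v) _)
              (trans (cong (_* ⟦ valid _≟_ adj as v ⟧) (⟦∧⟧ (adj a c) _)) (*-assoc ⟦ adj a c ⟧ _ _))))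
              (trans (∑-*ˡ (vecs B m) ⟦ adj a c ⟧ _) (cong (⟦ adj a c ⟧ *_) (∑-fresh c B m _)))) ⟩
      ∑ B (λ c → ⟦ adj a c ⟧ * pm _≟_ adj as (del c B)) ∎
      where open ≡-Reasoning

  module Blown {n k : ℕ} (adj : Fin n → Fin n → Bool) (M : Fin k → Fin n → Fin n)
    (M-adj : ∀ l v → adj v (M l v) ≡ true)
    (M-disjoint : ∀ {l l′} v → M l v ≡ M l′ v → l ≡ l′)
    (M-inj : ∀ l {v v′} → M l v ≡ M l v′ → v ≡ v′)
    {C : Set} (_≟_ : DecidableEquality C) (proj : C → Fin n) where

    adjᵖ : Fin n → C → Bool
    adjᵖ v c = adj v (proj c)

    cap : List C → Fin n → ℕ
    cap B u = ∑ B (λ c → δ (proj c) u)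

    -- How many copies of the column u are used when, for all v and l, `β v l` copies of v are sent
    -- along the matching `M l`.
    demand : (Fin n → Fin k → ℕ) → Fin n → ℕ
    demand β u = ∑ (allFin n) (λ v → ∑ (allFin k) (λ l → β v l * δ (M l v) u))

    cap-del : ∀ {B c} → Unique B → c ∈ B → ∀ u → cap B u ≡ cap (del _≟_ c B) u + δ (proj c) u
    cap-del {B} {c} uB c∈ u = begin
      ∑ B (λ x → δ (proj x) u)
        ≡⟨ ∑-cong′ B (λ x → sym (split (does (c ≟ x)) _)) ⟩
      ∑ B (λ x → ⟦ not (does (c ≟ x)) ⟧ * δ (proj x) u + ⟦ does (c ≟ x) ⟧ * δ (proj x) u)
        ≡⟨ ∑-+ B _ _ ⟩
      ∑ B (λ x → ⟦ not (does (c ≟ x)) ⟧ * δ (proj x) u) + ∑ B (λ x → ⟦ does (c ≟ x) ⟧ * δ (proj x) u)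
        ≡⟨ cong₂ _+_ (sym (∑-sift _ B _)) (trans (∑-cong′ B (λ x → cong (λ b → ⟦ b ⟧ * δ (proj x) u) (flip x))) (∑-one _≟_ uB c∈ (λ x → δ (proj x) u))) ⟩
      cap (del _≟_ c B) u + δ (proj c) u ∎
      where
      open ≡-Reasoning
      split : ∀ b x → ⟦ not b ⟧ * x + ⟦ b ⟧ * x ≡ x
      split true  x = +-identityʳ x
      split false x = trans (+-identityʳ _) (+-identityʳ x)
      flip : ∀ x → does (c ≟ x) ≡ does (x ≟ c)
      flip x with x ≟ c
      ... | yes e = does-yes (c ≟ x) (sym e)
      ... | no ne = does-no (c ≟ x) (ne ∘ sym)

    weight : ∀ {m} → Vec (Fin n) m → List C → (Fin n → Fin k → ℕ) → ℕ
    weight as B β = ∏ n (λ u → cap B u !) * ∏ n (λ v → mult (occ as v) (β v))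

    -- A label sequence of type β v for the copies of each row v, and for each column u an order on its copies,
    -- determine a perfect matching of the blow-up: a copy of v with label l is sent to the next copy of M l v.
    lower : ∀ {m} (as : Vec (Fin n) m) B β → Unique B → (∀ u → cap B u ≡ demand β u) → weight as B β ≤ pm _≟_ adjᵖ as B
    lower [] B β uB h with Finₚ.all? (λ v → Finₚ.all? (λ l → 0 ℕ.≟ β v l))
    ... | yes z = *-mono-≤
      (≤-reflexive (trans (∏-cong n (λ u → cong _! (trans (h u) (trans (∑-cong′ (allFin n) (λ v →
        trans (∑-cong′ (allFin k) (λ l → cong (_* δ (M l v) u) (sym (z v l)))) (∑-0 (allFin k)))) (∑-0 (allFin n))))))
        (trans (∏-const n 1) (^-zeroˡ n))))
      (∏-≤1 n _ (λ v → ≤-trans (≤-reflexive (+-identityʳ _)) (⟦⟧≤1 _)))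
    ... | no ¬z with v , ¬p ← Finₚ.¬∀⟶∃¬ n _ (λ v → Finₚ.all? (λ l → 0 ℕ.≟ β v l)) ¬z =
      ≤-trans (≤-reflexive (trans (cong (∏ n (λ u → cap B u !) *_) (∏-0 n _ v
        (cong (λ b → ⟦ b ⟧ + 0) (does-no (Finₚ.all? (λ l → 0 ℕ.≟ β v l)) ¬p)))) (*-zeroʳ (∏ n (λ u → cap B u !))))) z≤n
    lower (a ∷ as) B β uB h = begin
      Π * ∏ n (λ v → mult (occ (a ∷ as) v) (β v))
        ≡⟨ cong (Π *_) (∏-split a _) ⟩
      Π * (mult (occ (a ∷ as) a) (β a) * rest)
        ≡⟨ cong (λ x → Π * (mult (x + occ as a) (β a) * rest)) (δ-refl a) ⟩
      Π * (mult (suc j) (β a) * rest)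
        ≤⟨ *-monoʳ-≤ Π (*-monoˡ-≤ rest (mult-step j (β a))) ⟩
      Π * (∑ (allFin k) (λ l → ⟦ positive (β a l) ⟧ * mult j (λ x → β a x ∸ δ x l)) * rest)
        ≡⟨ trans (cong (Π *_) (sym (∑-*ʳ (allFin k) rest _))) (sym (∑-*ˡ (allFin k) Π _)) ⟩
      ∑ (allFin k) (λ l → Π * (⟦ positive (β a l) ⟧ * mult j (λ x → β a x ∸ δ x l) * rest))
        ≤⟨ ∑-mono′ (allFin k) choose-label ⟩
      ∑ (allFin k) (λ l → ∑ B (λ c → δ (proj c) (M l a) * pm _≟_ adjᵖ as (del _≟_ c B)))
        ≡⟨ ∑-swap (allFin k) B _ ⟩
      ∑ B (λ c → ∑ (allFin k) (λ l → δ (proj c) (M l a) * pm _≟_ adjᵖ as (del _≟_ c B)))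
        ≡⟨ ∑-cong′ B (λ c → ∑-*ʳ (allFin k) _ _) ⟩
      ∑ B (λ c → ∑ (allFin k) (λ l → δ (proj c) (M l a)) * pm _≟_ adjᵖ as (del _≟_ c B))
        ≤⟨ ∑-mono′ B (λ c → *-monoˡ-≤ (pm _≟_ adjᵖ as (del _≟_ c B)) (one-label c)) ⟩
      ∑ B (λ c → ⟦ adjᵖ a c ⟧ * pm _≟_ adjᵖ as (del _≟_ c B))
        ≡⟨ pm-cons _≟_ adjᵖ a as B ⟨
      pm _≟_ adjᵖ (a ∷ as) B ∎
      where
      open ≤-Reasoning
      Π = ∏ n (λ u → cap B u !)
      j = occ as a
      rest = ∏-rest a (λ v → mult (occ (a ∷ as) v) (β v))

      -- The matchings `M l` are disjoint, so at most one label leads from `a` to the column of `c`.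
      -- Thus no matching of the blow-up is counted for two labels.
      one-label : ∀ c → ∑ (allFin k) (λ l → δ (proj c) (M l a)) ≤ ⟦ adjᵖ a c ⟧
      one-label c with Finₚ.any? (λ l → M l a Finₚ.≟ proj c)
      ... | no none = ≤-trans (≤-reflexive (trans (∑-cong′ (allFin k) (λ l → δ-≢ (λ e → none (l , sym e)))) (∑-0 (allFin k)))) z≤n
      ... | yes (l₀ , e) = ≤-trans (≤-trans (∑-mono′ (allFin k) unique-label) (≤-reflexive (∑-δ l₀ (λ _ → 1))))
                             (≤-reflexive (cong ⟦_⟧ (sym (subst (λ u → adj a u ≡ true) e (M-adj l₀ a)))))
        where
        unique-label : ∀ l → δ (proj c) (M l a) ≤ δ l l₀ * 1
        unique-label l with proj c Finₚ.≟ M l a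
        ... | no _  = z≤n
        ... | yes p = ≤-reflexive (sym (trans (*-identityʳ _) (trans (cong (δ l) (M-disjoint a (trans e p))) (δ-refl l))))

      choose-label : ∀ l → Π * (⟦ positive (β a l) ⟧ * mult j (λ x → β a x ∸ δ x l) * rest) ≤
                     ∑ B (λ c → δ (proj c) (M l a) * pm _≟_ adjᵖ as (del _≟_ c B))
      choose-label l with bool-cases (positive (β a l))
      ... | inj₂ e = ≤-trans (≤-reflexive (trans (cong (λ b → Π * (⟦ b ⟧ * mult j (λ x → β a x ∸ δ x l) * rest)) e) (*-zeroʳ Π))) z≤n
      -- Multiplied by `cap B u`: each of the `cap B u` copies of u leaves the same remaining
      -- weight, and `Π` is `cap B u` times the product after the deletion of one copy.
      ... | inj₁ β>0 = *-cancelˡ-≤ (cap B u) {{ℕ.>-nonZero cap>0}} (begin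
        cap B u * (Π * (⟦ positive (β a l) ⟧ * mult j (λ x → β a x ∸ δ x l) * rest))
          ≡⟨ cong (λ b → cap B u * (Π * (⟦ b ⟧ * mult j (λ x → β a x ∸ δ x l) * rest))) β>0 ⟩
        cap B u * (Π * (1 * mult j (λ x → β a x ∸ δ x l) * rest))
          ≡⟨ cong (λ z → cap B u * (Π * z)) weights ⟩
        cap B u * (Π * P)
          ≡⟨ ∑-*ʳ B (Π * P) _ ⟨
        ∑ B (λ c → δ (proj c) u * (Π * P))
          ≤⟨ ∑-mono B (λ c c∈ → per-copy c c∈) ⟩
        ∑ B (λ c → cap B u * (δ (proj c) u * pm _≟_ adjᵖ as (del _≟_ c B)))
          ≡⟨ ∑-*ˡ B (cap B u) _ ⟩
        cap B u * ∑ B (λ c → δ (proj c) u * pm _≟_ adjᵖ as (del _≟_ c B)) ∎)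
        where
        u = M l a
        β≥1 = positive-≥1 β>0
        γ : Fin n → Fin k → ℕ
        γ v x = β v x ∸ δ v a * δ x l
        P = ∏ n (λ v → mult (occ as v) (γ v))

        β-γ : ∀ v x → β v x ≡ γ v x + δ v a * δ x l
        β-γ v x with v Finₚ.≟ a | x Finₚ.≟ l
        ... | yes refl | yes refl = sym (m∸n+n≡m β≥1)
        ... | yes _    | no _     = sym (+-identityʳ _)
        ... | no _     | _        = sym (+-identityʳ _)

        weights : 1 * mult j (λ x → β a x ∸ δ x l) * rest ≡ P
        weights = trans (cong₂ _*_ (trans (*-identityˡ _) (mult-cong j (λ x → cong (β a x ∸_)
                           (sym (trans (cong (_* δ x l) (δ-refl a)) (*-identityˡ _))))))
                         (∏-rest-cong a (λ v v≢a → trans (cong (λ z → mult (z + occ as v) (β v)) (δ-≢ (v≢a ∘ sym)))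
                           (mult-cong (occ as v) (λ x → cong (λ z → β v x ∸ z * δ x l) (sym (δ-≢ v≢a)))))))
                  (sym (∏-split a _))

        demand-γ : ∀ w → demand β w ≡ demand γ w + δ u w
        demand-γ w = begin-equality
          demand β w
            ≡⟨ ∑-cong′ (allFin n) (λ v → trans (∑-cong′ (allFin k) (λ x → trans (cong (_* δ (M x v) w) (β-γ v x))
                 (trans (*-distribʳ-+ (δ (M x v) w) (γ v x) _) (cong (γ v x * δ (M x v) w +_) (*-assoc (δ v a) (δ x l) _))))) (∑-+ (allFin k) _ _)) ⟩
          ∑ (allFin n) (λ v → ∑ (allFin k) (λ x → γ v x * δ (M x v) w) + ∑ (allFin k) (λ x → δ v a * (δ x l * δ (M x v) w)))
            ≡⟨ ∑-+ (allFin n) _ _ ⟩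
          demand γ w + ∑ (allFin n) (λ v → ∑ (allFin k) (λ x → δ v a * (δ x l * δ (M x v) w)))
            ≡⟨ cong (demand γ w +_) (trans (∑-cong′ (allFin n) (λ v → trans (∑-*ˡ (allFin k) (δ v a) _)
                 (cong (δ v a *_) (∑-δ l (λ x → δ (M x v) w))))) (∑-δ a (λ v → δ (M l v) w))) ⟩
          demand γ w + δ u w ∎

        cap>0 : 0 < cap B u
        cap>0 = subst (0 <_) (sym (trans (h u) (demand-γ u))) (≤-trans (≤-reflexive (sym (δ-refl u))) (m≤n+m _ (demand γ u)))

        per-copy : ∀ c → c ∈ B → δ (proj c) u * (Π * P) ≤ cap B u * (δ (proj c) u * pm _≟_ adjᵖ as (del _≟_ c B))
        per-copy c c∈ with proj c Finₚ.≟ u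
        ... | no _ = z≤n
        ... | yes e = begin
          1 * (Π * P)                                      ≡⟨ *-identityˡ _ ⟩
          Π * P                                            ≡⟨ cong (_* P) Π-del ⟩
          (cap B u * ∏ n (λ w → cap B′ w !)) * P           ≡⟨ *-assoc (cap B u) _ _ ⟩
          cap B u * (∏ n (λ w → cap B′ w !) * P)           ≤⟨ *-monoʳ-≤ (cap B u) (lower as B′ γ (sift-unique _ uB) h′) ⟩
          cap B u * pm _≟_ adjᵖ as B′                      ≡⟨ cong (cap B u *_) (sym (*-identityˡ _)) ⟩
          cap B u * (1 * pm _≟_ adjᵖ as B′)                ∎
          where
          B′ = del _≟_ c B
          cd : ∀ w → cap B w ≡ cap B′ w + δ u w
          cd w = trans (cap-del uB c∈ w) (cong (λ z → cap B′ w + δ z w) e)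
          h′ : ∀ w → cap B′ w ≡ demand γ w
          h′ w = +-cancelʳ-≡ (δ u w) _ _ (trans (sym (cd w)) (trans (h w) (demand-γ w)))
          cap-u : cap B u ≡ suc (cap B′ u)
          cap-u = trans (cd u) (trans (cong (cap B′ u +_) (δ-refl u)) (+-comm _ 1))
          Π-del : Π ≡ cap B u * ∏ n (λ w → cap B′ w !)
          Π-del = begin-equality
            Π                                                            ≡⟨ ∏-split u _ ⟩
            cap B u ! * ∏-rest u (λ w → cap B w !)                       ≡⟨ cong₂ _*_ (cong _! cap-u) (∏-rest-cong u (λ w w≢u →
                                                                              cong _! (trans (cd w) (trans (cong (cap B′ w +_) (δ-≢ (w≢u ∘ sym))) (+-identityʳ _))))) ⟩
            (suc (cap B′ u) * cap B′ u !) * ∏-rest u (λ w → cap B′ w !)  ≡⟨ *-assoc (suc (cap B′ u)) (cap B′ u !) (∏-rest u (λ w → cap B′ w !)) ⟩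
            suc (cap B′ u) * (cap B′ u ! * ∏-rest u (λ w → cap B′ w !))  ≡⟨ cong₂ _*_ (sym cap-u) (sym (∏-split u _)) ⟩
            cap B u * ∏ n (λ w → cap B′ w !)                             ∎

  permutation-hit : ∀ {n} (M : Fin n → Fin n) → (∀ {r r′} → M r ≡ M r′ → r ≡ r′) → ∀ c →
                    ∑ (allFin n) (λ r → δ (M r) c) ≡ 1
  permutation-hit {n} M inj c = trans (∑-cong′ (allFin n) same) (∑-δ (proj₁ s) (λ _ → 1))
    where
    s = fin-surjective M inj c
    same : ∀ r → δ (M r) c ≡ δ r (proj₁ s) * 1
    same r = trans (cong ⟦_⟧ (does-⇔ (M r Finₚ.≟ c) (r Finₚ.≟ proj₁ s)
               (λ e → inj (trans e (sym (proj₂ s)))) (λ e → trans (cong M e) (proj₂ s)))) (sym (*-identityʳ _))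

  record Factorisation {n} (k : ℕ) (E : Fin n → Fin n → Bool) : Set where
    field
      M        : Fin k → Fin n → Fin n
      M-adj    : ∀ l v → E v (M l v) ≡ true
      disjoint : ∀ {l l′} v → M l v ≡ M l′ v → l ≡ l′
      M-inj    : ∀ l {v v′} → M l v ≡ M l v′ → v ≡ v′

  remove : ∀ {n} → (Fin n → Fin n → Bool) → (Fin n → Fin n) → Fin n → Fin n → Bool
  remove E M r c = E r c ∧ not (does (M r Finₚ.≟ c))

  module _ {n} (E : Fin n → Fin n → Bool) (M : Fin n → Fin n) (edges : ∀ r → E r (M r) ≡ true) where

    remove-split : ∀ r c → ⟦ E r c ⟧ ≡ δ (M r) c + ⟦ remove E M r c ⟧
    remove-split r c with M r Finₚ.≟ c
    ... | yes refl = trans (cong ⟦_⟧ (edges r)) (cong (λ b → 1 + ⟦ b ⟧) (sym (Boolₚ.∧-zeroʳ (E r c))))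
    ... | no _ = cong ⟦_⟧ (sym (Boolₚ.∧-identityʳ (E r c)))

    remove-row : ∀ r → ∑ (allFin n) (λ c → ⟦ E r c ⟧) ≡ suc (∑ (allFin n) (λ c → ⟦ remove E M r c ⟧))
    remove-row r = trans (∑-cong′ (allFin n) (remove-split r)) (trans (∑-+ (allFin n) _ _) (cong (_+ ∑ (allFin n) (λ c → ⟦ remove E M r c ⟧)) one))
      where
      one : ∑ (allFin n) (δ (M r)) ≡ 1
      one = trans (∑-cong′ (allFin n) (λ c → trans (δ-sym (M r) c) (sym (*-identityʳ _)))) (∑-δ (M r) (λ _ → 1))

    remove-col : (∀ {r r′} → M r ≡ M r′ → r ≡ r′) → ∀ c →
                 ∑ (allFin n) (λ r → ⟦ E r c ⟧) ≡ suc (∑ (allFin n) (λ r → ⟦ remove E M r c ⟧))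
    remove-col inj c = trans (∑-cong′ (allFin n) (λ r → remove-split r c)) (trans (∑-+ (allFin n) _ _) (cong (_+ ∑ (allFin n) (λ r → ⟦ remove E M r c ⟧)) (permutation-hit M inj c)))

  -- A perfect matching is split off, and what remains is regular of degree one less.
  factorise : ∀ {n} k (E : Fin n → Fin n → Bool) → (∀ r → ∑ (allFin n) (λ c → ⟦ E r c ⟧) ≡ k) →
              (∀ c → ∑ (allFin n) (λ r → ⟦ E r c ⟧) ≡ k) → Factorisation k E
  factorise zero E row col = record { M = λ () ; M-adj = λ () ; disjoint = λ { {()} } ; M-inj = λ () }
  factorise {n} (suc k) E row col = record { M = M ; M-adj = M-adj ; disjoint = λ {l} {l′} → disj {l} {l′} ; M-inj = M-inj }
    where
    open König (λ r c → ⟦ E r c ⟧) (suc k) (s≤s z≤n) row (≤-reflexive ∘ col) using (matching)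
    M₀ = proj₁ matching
    M₀-inj : ∀ {r r′} → M₀ r ≡ M₀ r′ → r ≡ r′
    M₀-inj = proj₂ (proj₂ matching)
    E′ = remove E M₀
    edges : ∀ r → E r (M₀ r) ≡ true
    edges r = ⟦⟧-true (proj₁ (proj₂ matching) r)
    F : Factorisation k E′
    F = factorise k E′
      (λ r → suc-injective (trans (sym (remove-row E M₀ edges r)) (row r)))
      (λ c → suc-injective (trans (sym (remove-col E M₀ edges M₀-inj c)) (col c)))
    M : Fin (suc k) → Fin n → Fin n
    M zero    = M₀
    M (suc l) = Factorisation.M F l
    M-adj : ∀ l v → E v (M l v) ≡ true
    M-adj zero    v = edges v
    M-adj (suc l) v = proj₁ (∧-true (Factorisation.M-adj F l v))
    avoid : ∀ l v → M₀ v ≢ Factorisation.M F l v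
    avoid l v = does-false (M₀ v Finₚ.≟ _) (not-true (proj₂ (∧-true {E v _} (Factorisation.M-adj F l v))))
    disj : ∀ {l l′} v → M l v ≡ M l′ v → l ≡ l′
    disj {zero}  {zero}   v e = refl
    disj {zero}  {suc l′} v e = ⊥-elim (avoid l′ v e)
    disj {suc l} {zero}   v e = ⊥-elim (avoid l v (sym e))
    disj {suc l} {suc l′} v e = cong suc (Factorisation.disjoint F v e)
    M-inj : ∀ l {v v′} → M l v ≡ M l v′ → v ≡ v′
    M-inj zero    = M₀-inj
    M-inj (suc l) = Factorisation.M-inj F l

  doubling-cast : ∀ {A C : Set} (_≟_ : DecidableEquality C) (adj : A → C → Bool) B (uB : Unique B) {m} (as : Vec A m) →
    length B ≡ m →
    pm (×ₚ.≡-dec _≟_ Boolₚ._≟_) (λ a → adj a ∘ proj₁) (as Vec.++ as) (cartesianProductWith _,_ B bools)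
      ≤ (pm _≟_ adj as B * pm _≟_ adj as B) * (2 ^ m * 2 ^ m)
  doubling-cast _≟_ adj B uB as refl = Doubling.doubling _≟_ adj B uB as

  module Levels (n : ℕ) (adj : Fin n → Fin n → Bool) where

    -- Nested pairs make each level the doubling of the preceding one by definition.
    Copies : ℕ → Set
    Copies zero    = Fin n
    Copies (suc t) = Copies t × Bool

    dec : ∀ t → DecidableEquality (Copies t)
    dec zero    = Finₚ._≟_
    dec (suc t) = ×ₚ.≡-dec (dec t) Boolₚ._≟_

    proj : ∀ t → Copies t → Fin n
    proj zero    = id
    proj (suc t) = proj t ∘ proj₁

    right : ∀ t → List (Copies t)
    right zero    = allFin n
    right (suc t) = cartesianProductWith _,_ (right t) bools

    size : ℕ → ℕ
    size zero    = n
    size (suc t) = size t + size t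

    left : ∀ t → Vec (Fin n) (size t)
    left zero    = Vec.allFin n
    left (suc t) = left t Vec.++ left t

    right-unique : ∀ t → Unique (right t)
    right-unique zero    = fin-unique n
    right-unique (suc t) = product-unique (right-unique t) bools-unique

    double : ∀ x → x * 2 ≡ x + x
    double = solve-∀

    right-length : ∀ t → length (right t) ≡ size t
    right-length zero    = length-fin n
    right-length (suc t) = trans (length-product _,_ (right t) bools) (trans (double (length (right t))) (cong₂ _+_ (right-length t) (right-length t)))

    size-≡ : ∀ t → size t ≡ 2 ^ t * n
    size-≡ zero    = sym (*-identityˡ n)
    size-≡ (suc t) = trans (cong₂ _+_ (size-≡ t) (size-≡ t)) (twice (2 ^ t) n)
      where
      twice : ∀ a b → a * b + a * b ≡ (2 * a) * b
      twice = solve-∀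

    occ-allFin : ∀ {m} v → occ (Vec.allFin m) v ≡ 1
    occ-allFin {m} v = trans (occ-tabulate id) (trans (∑-cong′ (allFin m) (λ i → sym (*-identityʳ _))) (∑-δ v (λ _ → 1)))
      where
      occ-tabulate : ∀ {m′} (f : Fin m′ → Fin m) → occ (Vec.tabulate f) v ≡ ∑ (allFin m′) (λ i → δ (f i) v)
      occ-tabulate {zero}   f = refl
      occ-tabulate {suc m′} f = trans (cong (δ (f zero) v +_) (occ-tabulate (f ∘ suc))) (sym (∑-fin m′ _))

    left-occ : ∀ t v → occ (left t) v ≡ 2 ^ t
    left-occ zero    v = occ-allFin v
    left-occ (suc t) v = trans (occ-++ (left t) (left t) v) (trans (cong₂ _+_ (left-occ t v) (left-occ t v)) (cong (2 ^ t +_) (sym (+-identityʳ _))))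

    right-cap : ∀ t u → ∑ (right t) (λ c → δ (proj t c) u) ≡ 2 ^ t
    right-cap zero    u = trans (∑-cong′ (allFin n) (λ i → sym (*-identityʳ _))) (∑-δ u (λ _ → 1))
    right-cap (suc t) u = trans (∑-product _,_ (right t) bools _) (trans (∑-cong′ (right t) (λ c → trans (two (δ (proj t c) u)) refl))
                            (trans (∑-*ˡ (right t) 2 _) (cong (2 *_) (right-cap t u))))
      where
      two : ∀ a → a + (a + 0) ≡ 2 * a
      two a = refl

    pmₜ : ℕ → ℕ
    pmₜ t = pm (dec t) (λ v c → adj v (proj t c)) (left t) (right t)

    private
      p = pmₜ 0

    -- From N to 2N the bound is squared and multiplied by 4^(nN), and (N^(nN))² 4^(nN) =
    -- (2N)^(2nN).
    chain : ∀ t → pmₜ t ≤ ((2 ^ t) ^ (2 ^ t)) ^ n * p ^ (2 ^ t)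
    chain zero = ≤-reflexive (sym (trans (cong₂ _*_ (^-zeroˡ n) (*-identityʳ p)) (*-identityˡ p)))
    chain (suc t) = begin
      pmₜ (suc t)
        ≤⟨ doubling-cast (dec t) (λ v c → adj v (proj t c)) (right t) (right-unique t) (left t) (right-length t) ⟩
      (pmₜ t * pmₜ t) * (2 ^ size t * 2 ^ size t)
        ≤⟨ *-monoˡ-≤ (2 ^ size t * 2 ^ size t) (*-mono-≤ (chain t) (chain t)) ⟩
      (Q ^ n * p ^ N) * (Q ^ n * p ^ N) * (2 ^ size t * 2 ^ size t)
        ≡⟨ cong (λ z → (Q ^ n * p ^ N) * (Q ^ n * p ^ N) * (z * z)) (trans (cong (2 ^_) (size-≡ t)) (sym (^-*-assoc 2 N n))) ⟩
      (Q ^ n * p ^ N) * (Q ^ n * p ^ N) * ((2 ^ N) ^ n * (2 ^ N) ^ n)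
        ≡⟨ regroup (Q ^ n) (p ^ N) ((2 ^ N) ^ n) ⟩
      (((2 ^ N) ^ n * Q ^ n) * ((2 ^ N) ^ n * Q ^ n)) * (p ^ N * p ^ N)
        ≡⟨ cong₂ _*_ (trans (cong₂ _*_ (sym (*-^ (2 ^ N) Q n)) (sym (*-^ (2 ^ N) Q n))) (sym (*-^ (2 ^ N * Q) (2 ^ N * Q) n))) (sym (^-double p)) ⟩
      ((2 ^ N * Q) * (2 ^ N * Q)) ^ n * p ^ (2 * N)
        ≡⟨ cong (λ z → z ^ n * p ^ (2 * N)) (trans (cong₂ _*_ (sym (*-^ 2 N N)) (sym (*-^ 2 N N))) (sym (^-double (2 * N)))) ⟩
      ((2 * N) ^ (2 * N)) ^ n * p ^ (2 * N) ∎
      where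
      open ≤-Reasoning
      N = 2 ^ t
      Q = N ^ N
      ^-double : ∀ x → x ^ (2 * N) ≡ x ^ N * x ^ N
      ^-double x = trans (^-distribˡ-+-* x N (N + 0)) (cong (λ z → x ^ N * x ^ z) (+-identityʳ N))
      regroup : ∀ a b c → (a * b) * (a * b) * (c * c) ≡ ((c * a) * (c * a)) * (b * b)
      regroup = solve-∀

  -- A k-regular bipartite graph on n + n vertices has at least about (k/e)^n perfect matchings; here N!/N^N plays the part of e^{-N}.
  regular-pm : ∀ {n} k (E : Fin n → Fin n → Bool) → 0 < k → (∀ r → ∑ (allFin n) (λ c → ⟦ E r c ⟧) ≡ k) →
               (∀ c → ∑ (allFin n) (λ r → ⟦ E r c ⟧) ≡ k) → ∀ t → let N = 2 ^ t in
               (k ^ N) ^ n * (N !) ^ n ≤ ((suc N ^ k) ^ n * (N ^ N) ^ n) * pm Finₚ._≟_ E (Vec.allFin n) (allFin n) ^ N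
  regular-pm {n} k E 0<k row col t = begin
    (k ^ N) ^ n * (N !) ^ n
      ≤⟨ *-monoˡ-≤ ((N !) ^ n) (^-monoˡ-≤ n (proj₁ (proj₂ large))) ⟩
    (suc N ^ k * μ) ^ n * (N !) ^ n
      ≡⟨ trans (cong (_* (N !) ^ n) (*-^ (suc N ^ k) μ n)) (*-assoc ((suc N ^ k) ^ n) _ _) ⟩
    (suc N ^ k) ^ n * (μ ^ n * (N !) ^ n)
      ≡⟨ cong ((suc N ^ k) ^ n *_) (*-comm (μ ^ n) _) ⟩
    (suc N ^ k) ^ n * ((N !) ^ n * μ ^ n)
      ≡⟨ cong ((suc N ^ k) ^ n *_) (sym weight-≡) ⟩
    (suc N ^ k) ^ n * weight (left t) (right t) (λ _ → β)
      ≤⟨ *-monoʳ-≤ ((suc N ^ k) ^ n) (≤-trans (lower (left t) (right t) (λ _ → β) (right-unique t) balance) (chain t)) ⟩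
    (suc N ^ k) ^ n * ((N ^ N) ^ n * pm Finₚ._≟_ E (Vec.allFin n) (allFin n) ^ N)
      ≡⟨ *-assoc ((suc N ^ k) ^ n) ((N ^ N) ^ n) _ ⟨
    ((suc N ^ k) ^ n * (N ^ N) ^ n) * pm Finₚ._≟_ E (Vec.allFin n) (allFin n) ^ N ∎
    where
    open ≤-Reasoning
    N = 2 ^ t
    open Factorisation (factorise k E row col)
    open Levels n E
    open Blown E M M-adj disjoint M-inj (dec t) (proj t) using (weight; lower; cap; demand)
    large = large-type {k} N (m^n>0 k {{ℕ.>-nonZero 0<k}} N)
    β = proj₁ large
    μ = mult N β
    weight-≡ : weight (left t) (right t) (λ _ → β) ≡ (N !) ^ n * μ ^ n
    weight-≡ = cong₂ _*_ (trans (∏-cong n (λ u → cong _! (right-cap t u))) (∏-const n (N !)))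
                         (trans (∏-cong n (λ v → cong (λ z → mult z β) (left-occ t v))) (∏-const n μ))
    -- Each `M l` is a permutation and all rows have the same type β, so every column receives the
    -- sum of β, which is N.
    balance : ∀ u → cap (right t) u ≡ demand (λ _ → β) u
    balance u = trans (right-cap t u) (sym (trans (∑-swap (allFin n) (allFin k) _)
      (trans (∑-cong′ (allFin k) (λ l → trans (∑-*ˡ (allFin n) (β l) _) (trans (cong (β l *_) (hits l)) (*-identityʳ _))))
             (proj₂ (proj₂ large)))))
      where
      hits : ∀ l → ∑ (allFin n) (λ v → δ (M l v) u) ≡ 1
      hits l = permutation-hit (M l) (M-inj l) u

  -- The number of Latin squares

  -- A bound on N-th powers does not add up directly. It is transferred through the least value m of
  -- `f` where `g` holds, since the sum is at least m times the number of terms.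
  ∑-power : ∀ {A : Set} (xs : List A) (g : A → Bool) (f : A → ℕ) N X Y → 0 < N →
            (∀ x → g x ≡ true → Y ≤ X * f x ^ N) →
            ∑ xs (λ x → ⟦ g x ⟧) ^ N * Y ≤ X * ∑ xs (λ x → ⟦ g x ⟧ * f x) ^ N
  ∑-power xs g f N X Y 0<N h with least xs
    where
    least : ∀ xs → ∃ λ m → (∀ x → x ∈ xs → ⟦ g x ⟧ * m ≤ ⟦ g x ⟧ * f x) × (Y ≤ X * m ^ N ⊎ ∑ xs (λ x → ⟦ g x ⟧) ≡ 0)
    least [] = 0 , (λ _ ()) , inj₂ refl
    least (x ∷ xs) with least xs | g x in e
    ... | m , b , c | false = m , (λ { _ (here refl) → ≤-reflexive (trans (cong (λ z → ⟦ z ⟧ * m) e) (sym (cong (λ z → ⟦ z ⟧ * f x) e))) ; y (there k) → b y k }) , c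
    ... | m , b , c | true with ≤-total m (f x) | c
    ...   | inj₁ p | inj₁ q = m , (λ { _ (here refl) → *-monoʳ-≤ ⟦ g x ⟧ p ; y (there k) → b y k }) , inj₁ q
    ...   | inj₁ p | inj₂ q = f x , (λ { _ (here refl) → ≤-refl ; y (there k) → ≤-trans (≤-reflexive (cong (_* f x) (none xs q y k))) z≤n }) , inj₁ (h x e)
      where
      none : ∀ xs → ∑ xs (λ x → ⟦ g x ⟧) ≡ 0 → ∀ y → y ∈ xs → ⟦ g y ⟧ ≡ 0
      none xs q y k = n≤0⇒n≡0 (subst (⟦ g y ⟧ ≤_) q (∑-member k (λ x → ⟦ g x ⟧)))
    ...   | inj₂ p | _ = f x , (λ { _ (here refl) → ≤-refl ; y (there k) → ≤-trans (*-monoʳ-≤ ⟦ g y ⟧ p) (b y k) }) , inj₁ (h x e)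
  ∑-power xs g f (suc N) X Y 0<N h | m , b , inj₂ z = ≤-trans (≤-reflexive (cong (λ s → s ^ suc N * Y) z)) z≤n
  ∑-power xs g f N X Y 0<N h | m , b , inj₁ q = begin
    G ^ N * Y               ≤⟨ *-monoʳ-≤ (G ^ N) q ⟩
    G ^ N * (X * m ^ N)     ≡⟨ x∙yz≈y∙xz (G ^ N) X (m ^ N) ⟩
    X * (G ^ N * m ^ N)     ≡⟨ cong (X *_) (*-^ G m N) ⟨
    X * (G * m) ^ N         ≡⟨ cong (λ z → X * z ^ N) (∑-*ʳ xs m _) ⟨
    X * ∑ xs (λ x → ⟦ g x ⟧ * m) ^ N     ≤⟨ *-monoʳ-≤ X (^-monoˡ-≤ N (∑-mono xs b)) ⟩
    X * ∑ xs (λ x → ⟦ g x ⟧ * f x) ^ N   ∎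
    where
    open ≤-Reasoning
    G = ∑ xs (λ x → ⟦ g x ⟧)

  module Latin (n : ℕ) where

    Row : Set
    Row = Vec (Fin n) n

    rows : List Row
    rows = vecs (allFin n) n

    free : ∀ {i} → Vec Row i → Fin n → Fin n → Bool
    free []      j c = true
    free (r ∷ R) j c = free R j c ∧ not (does (lookup r j Finₚ.≟ c))

    latin : ∀ {i} → Vec Row i → Bool
    latin []      = true
    latin (r ∷ R) = valid Finₚ._≟_ (free R) (Vec.allFin n) r ∧ latin R

    count : ℕ → ℕ
    count i = ∑ (vecs rows i) (λ R → ⟦ latin R ⟧)

    row-inj : ∀ {i} r (R : Vec Row i) → latin (r ∷ R) ≡ true → ∀ {j j′} → lookup r j ≡ lookup r j′ → j ≡ j′
    row-inj r R h = valid-inj Finₚ._≟_ (free R) (Vec.allFin n) r (proj₁ (∧-true h))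

    row-free : ∀ {i} r (R : Vec Row i) → latin (r ∷ R) ≡ true → ∀ j → free R j (lookup r j) ≡ true
    row-free r R h j = subst (λ z → free R z (lookup r j) ≡ true) (Vecₚ.lookup∘tabulate id j)
      (valid-adj Finₚ._≟_ (free R) (Vec.allFin n) r (proj₁ (∧-true h)) j)

    tail : ∀ {i} r (R : Vec Row i) → latin (r ∷ R) ≡ true → latin R ≡ true
    tail r R h = proj₂ (∧-true {valid Finₚ._≟_ (free R) (Vec.allFin n) r} h)

    free-≢ : ∀ {i} (R : Vec Row i) j c → free R j c ≡ true → ∀ i′ → lookup (lookup R i′) j ≢ c
    free-≢ (r ∷ R) j c h zero     = does-false (lookup r j Finₚ.≟ c) (not-true (proj₂ (∧-true {free R j c} h)))
    free-≢ (r ∷ R) j c h (suc i′) = free-≢ R j c (proj₁ (∧-true h)) i′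

    rows-inj : ∀ {i} (R : Vec Row i) → latin R ≡ true → ∀ i′ {j j′} → lookup (lookup R i′) j ≡ lookup (lookup R i′) j′ → j ≡ j′
    rows-inj (r ∷ R) h zero     = row-inj r R h
    rows-inj (r ∷ R) h (suc i′) = rows-inj R (tail r R h) i′

    cols-inj : ∀ {i} (R : Vec Row i) → latin R ≡ true → ∀ j {i′ i″} → lookup (lookup R i′) j ≡ lookup (lookup R i″) j → i′ ≡ i″
    cols-inj (r ∷ R) h j {zero}   {zero}   e = refl
    cols-inj (r ∷ R) h j {zero}   {suc i″} e = ⊥-elim (free-≢ R j _ (row-free r R h j) i″ (sym e))
    cols-inj (r ∷ R) h j {suc i′} {zero}   e = ⊥-elim (free-≢ R j _ (row-free r R h j) i′ e)
    cols-inj (r ∷ R) h j {suc i′} {suc i″} e = cong suc (cols-inj R (tail r R h) j e)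

    free-row : ∀ {i} (R : Vec Row i) → latin R ≡ true → ∀ j → i + ∑ (allFin n) (λ c → ⟦ free R j c ⟧) ≡ n
    free-row []      h j = trans (sym (length-∑ (allFin n))) (length-fin n)
    free-row {suc i} (r ∷ R) h j = trans (sym (+-suc i _)) (trans (cong (i +_) (sym (remove-row (free R) (lookup r) (row-free r R h) j))) (free-row R (tail r R h) j))

    free-col : ∀ {i} (R : Vec Row i) → latin R ≡ true → ∀ c → i + ∑ (allFin n) (λ j → ⟦ free R j c ⟧) ≡ n
    free-col []      h c = trans (sym (length-∑ (allFin n))) (length-fin n)
    free-col {suc i} (r ∷ R) h c = trans (sym (+-suc i _)) (trans (cong (i +_) (sym (remove-col (free R) (lookup r) (row-free r R h) (row-inj r R h) c))) (free-col R (tail r R h) c))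

    count-suc : ∀ i → count (suc i) ≡ ∑ (vecs rows i) (λ R → ⟦ latin R ⟧ * pm Finₚ._≟_ (free R) (Vec.allFin n) (allFin n))
    count-suc i = begin
      count (suc i)
        ≡⟨ ∑-vecs rows i _ ⟩
      ∑ rows (λ r → ∑ (vecs rows i) (λ R → ⟦ valid Finₚ._≟_ (free R) (Vec.allFin n) r ∧ latin R ⟧))
        ≡⟨ ∑-swap rows (vecs rows i) _ ⟩
      ∑ (vecs rows i) (λ R → ∑ rows (λ r → ⟦ valid Finₚ._≟_ (free R) (Vec.allFin n) r ∧ latin R ⟧))
        ≡⟨ ∑-cong′ (vecs rows i) (λ R → trans (∑-cong′ rows (λ r → trans (⟦∧⟧ (valid Finₚ._≟_ (free R) (Vec.allFin n) r) _) (*-comm _ ⟦ latin R ⟧))) (∑-*ˡ rows ⟦ latin R ⟧ _)) ⟩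
      ∑ (vecs rows i) (λ R → ⟦ latin R ⟧ * pm Finₚ._≟_ (free R) (Vec.allFin n) (allFin n)) ∎
      where open ≡-Reasoning

    falling : ℕ → ℕ
    falling zero    = 1
    falling (suc i) = (n ∸ i) * falling i

    falling-! : ∀ i → i ≤ n → falling i * (n ∸ i) ! ≡ n !
    falling-! zero    le = *-identityˡ _
    falling-! (suc i) le = trans (trans (xy∙z≈y∙xz (n ∸ i) (falling i) _) (cong (falling i *_) (trans (cong (_* (n ∸ suc i) !) eq) (sym (cong _! eq))))) (falling-! i (<⇒≤ le))
      where
      eq : n ∸ i ≡ suc (n ∸ suc i)
      eq = +-∸-assoc 1 le

    -- A further row is a perfect matching of the (n - i)-regular graph of free symbols. In the
    -- subexponential factor n - i is replaced by n, so that one `D` serves all rows.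
    lower-count : ∀ t i → i ≤ n → let N = 2 ^ t ; D = (suc N ^ n) ^ n * (N ^ N) ^ n in
                  (falling i ^ N) ^ n * ((N !) ^ n) ^ i ≤ D ^ i * count i ^ N
    lower-count t zero le = ≤-reflexive (trans (cong (_* 1) (trans (cong (_^ n) (^-zeroˡ (2 ^ t))) (^-zeroˡ n)))
      (sym (trans (*-identityˡ _) (^-zeroˡ (2 ^ t)))))
    lower-count t (suc i) lt = begin
      (((n ∸ i) * falling i) ^ N) ^ n * (F * F ^ i)
        ≡⟨ cong (_* (F * F ^ i)) (trans (cong (_^ n) (*-^ (n ∸ i) (falling i) N)) (*-^ ((n ∸ i) ^ N) _ n)) ⟩
      (((n ∸ i) ^ N) ^ n * (falling i ^ N) ^ n) * (F * F ^ i)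
        ≡⟨ regroup (((n ∸ i) ^ N) ^ n) ((falling i ^ N) ^ n) F (F ^ i) ⟩
      ((falling i ^ N) ^ n * F ^ i) * (((n ∸ i) ^ N) ^ n * F)
        ≤⟨ *-monoˡ-≤ (((n ∸ i) ^ N) ^ n * F) (lower-count t i (<⇒≤ lt)) ⟩
      (D ^ i * count i ^ N) * (((n ∸ i) ^ N) ^ n * F)
        ≡⟨ *-assoc (D ^ i) (count i ^ N) _ ⟩
      D ^ i * (count i ^ N * (((n ∸ i) ^ N) ^ n * F))
        ≤⟨ *-monoʳ-≤ (D ^ i) (∑-power (vecs rows i) latin (λ R → pm Finₚ._≟_ (free R) (Vec.allFin n) (allFin n)) N D _ (m^n>0 2 t) bound) ⟩
      D ^ i * (D * ∑ (vecs rows i) (λ R → ⟦ latin R ⟧ * pm Finₚ._≟_ (free R) (Vec.allFin n) (allFin n)) ^ N)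
        ≡⟨ trans (cong (λ z → D ^ i * (D * z ^ N)) (sym (count-suc i))) (x∙yz≈yx∙z (D ^ i) D _) ⟩
      (D * D ^ i) * count (suc i) ^ N ∎
      where
      open ≤-Reasoning
      N = 2 ^ t
      F = (N !) ^ n
      D = (suc N ^ n) ^ n * (N ^ N) ^ n
      regroup : ∀ a b c d → (a * b) * (c * d) ≡ (b * d) * (a * c)
      regroup = solve-∀
      bound : ∀ R → latin R ≡ true → ((n ∸ i) ^ N) ^ n * F ≤ D * pm Finₚ._≟_ (free R) (Vec.allFin n) (allFin n) ^ N
      bound R h = ≤-trans (regular-pm (n ∸ i) (free R) (m<n⇒0<n∸m lt)
          (λ j → trans (sym (m+n∸m≡n i _)) (cong (_∸ i) (free-row R h j)))
          (λ c → trans (sym (m+n∸m≡n i _)) (cong (_∸ i) (free-col R h c))) t)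
        (*-monoˡ-≤ (pm Finₚ._≟_ (free R) (Vec.allFin n) (allFin n) ^ N)
          (*-monoˡ-≤ ((N ^ N) ^ n) (^-monoˡ-≤ n (^-monoʳ-≤ (suc N) (m∸n≤m n i)))))

    latin-count : ∀ t → let N = 2 ^ t in
                  ((n !) ^ N) ^ n * ((N !) ^ n) ^ n ≤ ((suc N ^ n) ^ n * (N ^ N) ^ n) ^ n * count n ^ N
    latin-count t = subst (λ z → (z ^ 2 ^ t) ^ n * (((2 ^ t) !) ^ n) ^ n ≤ ((suc (2 ^ t) ^ n) ^ n * ((2 ^ t) ^ 2 ^ t) ^ n) ^ n * count n ^ 2 ^ t)
      (trans (sym (trans (cong (λ z → falling n * z !) (n∸n≡0 n)) (*-identityʳ _))) (falling-! n ≤-refl)) (lower-count t n ≤-refl)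

  -- Triangle decompositions

  -- Inserting e is a bijection from the sets without e onto the sets with e.
  ∑-toggle : ∀ {N} (e : Fin N) (g : Vec Bool N → ℕ) →
             ∑ (cube N) (λ P → ⟦ lookup P e ⟧ * g P) ≡ ∑ (cube N) (λ P → ⟦ not (lookup P e) ⟧ * g (P Vec.[ e ]≔ true))
  ∑-toggle {suc N} zero g = begin
    ∑ (cube (suc N)) (λ P → ⟦ lookup P zero ⟧ * g P)                ≡⟨ ∑-cube N _ ⟩
    ∑ (cube N) (λ _ → 0) + ∑ (cube N) (λ P → 1 * g (true ∷ P))      ≡⟨ +-comm (∑ (cube N) (λ _ → 0)) _ ⟩
    ∑ (cube N) (λ P → 1 * g (true ∷ P)) + ∑ (cube N) (λ _ → 0)      ≡⟨ ∑-cube N _ ⟨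
    ∑ (cube (suc N)) (λ P → ⟦ not (lookup P zero) ⟧ * g (P Vec.[ zero ]≔ true)) ∎
    where open ≡-Reasoning
  ∑-toggle {suc N} (suc e) g =
    trans (∑-cube N _) (trans (cong₂ _+_ (∑-toggle e (g ∘ (false ∷_))) (∑-toggle e (g ∘ (true ∷_)))) (sym (∑-cube N _)))

  card : ∀ {N} → (Fin N → Bool) → ℕ
  card {N} U = ∑ (allFin N) (λ u → ⟦ U u ⟧)

  card-∷ : ∀ {N} b (P : Vec Bool N) → card (lookup (b ∷ P)) ≡ ⟦ b ⟧ + card (lookup P)
  card-∷ {N} b P = ∑-fin N (λ u → ⟦ lookup (b ∷ P) u ⟧)

  card-[]≔ : ∀ {N} (P : Vec Bool N) e → lookup P e ≡ false → card (lookup (P Vec.[ e ]≔ true)) ≡ suc (card (lookup P))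
  card-[]≔ (false ∷ P) zero    refl = trans (card-∷ true P) (cong suc (sym (card-∷ false P)))
  card-[]≔ (p ∷ P)     (suc e) h    = trans (card-∷ p (P Vec.[ e ]≔ true)) (trans (cong (⟦ p ⟧ +_) (card-[]≔ P e h))
    (trans (+-suc ⟦ p ⟧ _) (cong suc (sym (card-∷ p P)))))

  card-0 : ∀ {N} (P : Vec Bool N) → card (lookup P) ≡ 0 → P ≡ Vec.replicate N false
  card-0 []          e = refl
  card-0 (false ∷ P) e = cong (false ∷_) (card-0 P (trans (sym (card-∷ false P)) e))
  card-0 (true ∷ P)  e = ⊥-elim (1+n≢0 (trans (sym (card-∷ true P)) e))

  -- Both sides of a linear inequality in Y = βT − kg, first for Y ≥ 0, then for Y ≤ 0.
  module Step (α β T′ k K z x m d : ℕ) where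

    g = β + α * (k * k)
    T = k + T′

    kg : k * g ≡ k * β + α * (k * k * k)
    kg = identity α β k
      where
      identity : ∀ α β k → k * (β + α * (k * k)) ≡ k * β + α * (k * k * k)
      identity = solve-∀

    step⁺ : ∀ Y → 0 < T → 0 < β → β * T′ ≡ α * (k * k * k) + Y →
            d * (k * z * β + x * m * (α * (k * k * k))) ≤ T * z * β * K + d * (x * m * (β * T′)) →
            d * β * (z * k * g * β + (x * m * g + z * β) * (k * g)) ≤
              z * k * g * β * (K * g) + d * β * ((x * m * g + z * β) * (β * T))
    step⁺ Y 0<T 0<β e h = begin
      d * β * (z * k * g * β + X * (k * g))         ≡⟨ expand₁ d β (z * k * g * β) X (k * g) ⟩
      d * β * (z * k * g * β) + d * β * X * (k * g) ≤⟨ +-monoˡ-≤ (d * β * X * (k * g)) main ⟩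
      RHS + d * β * X * Y + d * β * X * (k * g)     ≡⟨ expand₂ RHS (d * β) X Y (k * g) ⟩
      RHS + d * β * (X * (k * g + Y))               ≡⟨ cong (λ w → RHS + d * β * (X * w)) (sym βT) ⟩
      RHS + d * β * (X * (β * T))                   ∎
      where
      open ≤-Reasoning
      X = x * m * g + z * β
      RHS = z * k * g * β * (K * g)
      expand₁ : ∀ d β a X w → d * β * (a + X * w) ≡ d * β * a + d * β * X * w
      expand₁ = solve-∀
      expand₂ : ∀ R c X Y w → R + c * X * Y + c * X * w ≡ R + c * (X * (w + Y))
      expand₂ = solve-∀
      βT : β * T ≡ k * g + Y
      βT = begin-equality
        β * (k + T′)                        ≡⟨ *-distribˡ-+ β k T′ ⟩
        β * k + β * T′                      ≡⟨ cong₂ _+_ (*-comm β k) e ⟩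
        k * β + (α * (k * k * k) + Y)       ≡⟨ +-assoc (k * β) _ Y ⟨
        k * β + α * (k * k * k) + Y         ≡⟨ cong (_+ Y) kg ⟨
        k * g + Y                           ∎
      h′ : d * (k * z * β) ≤ T * z * β * K + d * (x * m * Y)
      h′ = +-cancelʳ-≤ (d * (x * m * (α * (k * k * k)))) _ _ (begin
        d * (k * z * β) + d * (x * m * (α * (k * k * k)))                    ≡⟨ *-distribˡ-+ d (k * z * β) _ ⟨
        d * (k * z * β + x * m * (α * (k * k * k)))                          ≤⟨ h ⟩
        T * z * β * K + d * (x * m * (β * T′))                               ≡⟨ cong (λ w → T * z * β * K + d * (x * m * w)) e ⟩
        T * z * β * K + d * (x * m * (α * (k * k * k) + Y))                  ≡⟨ split (T * z * β * K) d (x * m) (α * (k * k * k)) Y ⟩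
        T * z * β * K + d * (x * m * Y) + d * (x * m * (α * (k * k * k)))    ∎)
        where
        split : ∀ a d c u v → a + d * (c * (u + v)) ≡ a + d * (c * v) + d * (c * u)
        split = solve-∀
      main : d * β * (z * k * g * β) ≤ RHS + d * β * X * Y
      main = *-cancelʳ-≤ _ _ (β * T) {{ℕ.>-nonZero (*-mono-< 0<β 0<T)}} (begin
        d * β * (z * k * g * β) * (β * T)                                    ≡⟨ cong (d * β * (z * k * g * β) *_) βT ⟩
        d * β * (z * k * g * β) * (k * g + Y)                                ≡⟨ identity₁ d β z k g Y ⟩
        β * k * (g * g) * (d * (k * z * β)) + d * β * (z * β) * Y * (k * g)  ≤⟨ +-monoˡ-≤ _ (*-monoʳ-≤ (β * k * (g * g)) h′) ⟩
        β * k * (g * g) * (T * z * β * K + d * (x * m * Y)) + d * β * (z * β) * Y * (k * g)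
                                                                             ≡⟨ identity₂ β k g T z K d (x * m) Y ⟩
        RHS * (β * T) + d * β * X * Y * (k * g)                              ≤⟨ +-monoʳ-≤ (RHS * (β * T)) (*-monoʳ-≤ (d * β * X * Y) (≤-trans (m≤m+n (k * g) Y) (≤-reflexive (sym βT)))) ⟩
        RHS * (β * T) + d * β * X * Y * (β * T)                              ≡⟨ *-distribʳ-+ (β * T) RHS _ ⟨
        (RHS + d * β * X * Y) * (β * T)                                      ∎)
        where
        identity₁ : ∀ d β z k g Y → d * β * (z * k * g * β) * (k * g + Y) ≡
                    β * k * (g * g) * (d * (k * z * β)) + d * β * (z * β) * Y * (k * g)
        identity₁ = solve-∀
        identity₂ : ∀ β k g T z K d c Y → β * k * (g * g) * (T * z * β * K + d * (c * Y)) + d * β * (z * β) * Y * (k * g) ≡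
                    z * k * g * β * (K * g) * (β * T) + d * β * (c * g + z * β) * Y * (k * g)
        identity₂ = solve-∀

    step⁻ : ∀ Y → 0 < T → 0 < β → α * (k * k * k) ≡ β * T′ + Y →
            d * (k * z * β + x * m * (α * (k * k * k))) ≤ T * z * β * K + d * (x * m * (β * T′)) →
            d * β * (z * k * g * β + (x * m * g + z * β) * (k * g)) ≤
              z * k * g * β * (K * g) + d * β * ((x * m * g + z * β) * (β * T))
    step⁻ Y 0<T 0<β e h = begin
      d * β * (z * k * g * β + X * (k * g))                     ≡⟨ cong (λ w → d * β * (z * k * g * β + X * w)) kg≡ ⟩
      d * β * (z * k * g * β + X * (β * T + Y))                 ≡⟨ expand (d * β) (z * k * g * β) X (β * T) Y ⟩
      d * β * (z * k * g * β + X * Y) + d * β * (X * (β * T))   ≤⟨ +-monoˡ-≤ _ main ⟩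
      RHS + d * β * (X * (β * T))                               ∎
      where
      open ≤-Reasoning
      X = x * m * g + z * β
      RHS = z * k * g * β * (K * g)
      expand : ∀ c a X u v → c * (a + X * (u + v)) ≡ c * (a + X * v) + c * (X * u)
      expand = solve-∀
      kg≡ : k * g ≡ β * T + Y
      kg≡ = begin-equality
        k * g                               ≡⟨ kg ⟩
        k * β + α * (k * k * k)             ≡⟨ cong (k * β +_) e ⟩
        k * β + (β * T′ + Y)                ≡⟨ identity k β T′ Y ⟩
        β * (k + T′) + Y                    ∎
        where
        identity : ∀ k β t Y → k * β + (β * t + Y) ≡ β * (k + t) + Y
        identity = solve-∀
      h′ : d * (k * z * β + x * m * Y) ≤ T * z * β * K
      h′ = +-cancelʳ-≤ (d * (x * m * (β * T′))) _ _ (begin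
        d * (k * z * β + x * m * Y) + d * (x * m * (β * T′))   ≡⟨ split d (k * z * β) (x * m) Y (β * T′) ⟩
        d * (k * z * β + x * m * (β * T′ + Y))                 ≡⟨ cong (λ w → d * (k * z * β + x * m * w)) (sym e) ⟩
        d * (k * z * β + x * m * (α * (k * k * k)))            ≤⟨ h ⟩
        T * z * β * K + d * (x * m * (β * T′))                 ∎)
        where
        split : ∀ d a c u v → d * (a + c * u) + d * (c * v) ≡ d * (a + c * (v + u))
        split = solve-∀
      main : d * β * (z * k * g * β + X * Y) ≤ RHS
      main = *-cancelʳ-≤ _ _ (β * T) {{ℕ.>-nonZero (*-mono-< 0<β 0<T)}} (begin
        d * β * (z * k * g * β + X * Y) * (β * T)                               ≤⟨ m≤m+n _ (d * β * (z * β * (Y * Y) + x * m * g * (Y * Y))) ⟩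
        d * β * (z * k * g * β + X * Y) * (β * T) + d * β * (z * β * (Y * Y) + x * m * g * (Y * Y))
          ≡⟨ cong (λ w → d * β * (w + X * Y) * (β * T) + d * β * (z * β * (Y * Y) + x * m * g * (Y * Y))) (trans (shuffle z k g β) (cong (λ w → z * β * w) kg≡)) ⟩
        d * β * (z * β * (β * T + Y) + X * Y) * (β * T) + d * β * (z * β * (Y * Y) + x * m * g * (Y * Y))
          ≡⟨ identity d β z (β * T) Y (x * m) g ⟩
        d * β * (z * β * ((β * T + Y) * (β * T + Y)) + x * m * g * Y * (β * T + Y))
          ≡⟨ cong (λ w → d * β * (z * β * (w * w) + x * m * g * Y * w)) (sym kg≡) ⟩
        d * β * (z * β * ((k * g) * (k * g)) + x * m * g * Y * (k * g))         ≡⟨ identity₂ d β z k g (x * m) Y ⟩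
        β * k * (g * g) * (d * (k * z * β + x * m * Y))                         ≤⟨ *-monoʳ-≤ (β * k * (g * g)) h′ ⟩
        β * k * (g * g) * (T * z * β * K)                                       ≡⟨ identity₃ β k g T z K ⟩
        RHS * (β * T)                                                           ∎)
        where
        shuffle : ∀ z k g β → z * k * g * β ≡ z * β * (k * g)
        shuffle = solve-∀
        identity : ∀ d β z a Y c g → d * β * (z * β * (a + Y) + (c * g + z * β) * Y) * a + d * β * (z * β * (Y * Y) + c * g * (Y * Y)) ≡
                   d * β * (z * β * ((a + Y) * (a + Y)) + c * g * Y * (a + Y))
        identity = solve-∀
        identity₂ : ∀ d β z k g c Y → d * β * (z * β * ((k * g) * (k * g)) + c * g * Y * (k * g)) ≡ β * k * (g * g) * (d * (k * z * β + c * Y))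
        identity₂ = solve-∀
        identity₃ : ∀ β k g T z K → β * k * (g * g) * (T * z * β * K) ≡ z * k * g * β * (K * g) * (β * T)
        identity₃ = solve-∀

    -- With u = Y/(kg) and v = xmY/(zkβ), the hypothesis reads dβ(1 - v) ≤ Kg(1 + u) and the
    -- conclusion dβ(1 - u - v) ≤ Kg. As u and v have the same sign, (1 + u)(1 - u - v) ≤ 1 - v, and
    -- 1 + u > 0 is cancelled.
    step : 0 < T → 0 < β →
           d * (k * z * β + x * m * (α * (k * k * k))) ≤ T * z * β * K + d * (x * m * (β * T′)) →
           d * β * (z * k * g * β + (x * m * g + z * β) * (k * g)) ≤
             z * k * g * β * (K * g) + d * β * ((x * m * g + z * β) * (β * T))
    step 0<T 0<β h with ≤-total (α * (k * k * k)) (β * T′)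
    ... | inj₁ p = step⁺ (β * T′ ∸ α * (k * k * k)) 0<T 0<β (sym (m+[n∸m]≡n p)) h
    ... | inj₂ p = step⁻ (α * (k * k * k) ∸ β * T′) 0<T 0<β (sym (m+[n∸m]≡n p)) h

  -- With U the triangles of a tripartite graph G and conf the relation of sharing an edge, the triangle
  -- decompositions P of G are of this kind: every other triangle of G shares its three edges with three members of P.
  record Saturating {N} (conf : Fin N → Fin N → Bool) (U : Fin N → Bool) (k : ℕ) (P : Vec Bool N) : Set where
    field
      size  : card (lookup P) ≡ k
      sub   : ∀ {e} → lookup P e ≡ true → U e ≡ true
      indep : ∀ {e f} → lookup P e ≡ true → lookup P f ≡ true → conf e f ≡ false
      sat   : ∀ {u} → U u ≡ true → lookup P u ≡ false → 3 ≤ ∑ (allFin N) (λ e → ⟦ lookup P e ∧ conf u e ⟧)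

  -- This is 1 - 3/i ≤ (1 - 1/i)³ for i = k + 1: the survival rate of the triangles outside the
  -- decomposition is at most the rate at which the cube of its size shrinks.
  cube-step : ∀ k → (suc k ∸ 3) * (suc k * suc k * suc k) ≤ suc k * (k * k * k)
  cube-step 0 = z≤n
  cube-step 1 = z≤n
  cube-step (suc (suc j)) = ≤-trans (m≤m+n _ (3 * j * j + 17 * j + 24)) (≤-reflexive (identity j))
    where
    identity : ∀ j → j * ((3 + j) * (3 + j) * (3 + j)) + (3 * j * j + 17 * j + 24) ≡ (3 + j) * ((2 + j) * (2 + j) * (2 + j))
    identity = solve-∀

  module SaturatingCount {N : ℕ} (conf : Fin N → Fin N → Bool) (α β : ℕ) (0<β : 0 < β) where

    open Saturating

    fs = allFin N

    -- Deleting the edges of the triangle e destroys e and every triangle sharing an edge with it.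
    _⊖_ : (Fin N → Bool) → Fin N → Fin N → Bool
    (U ⊖ e) u = U u ∧ (not (does (u Finₚ.≟ e)) ∧ not (conf u e))

    link : (Vec Bool N → Bool) → Fin N → Vec Bool N → Bool
    link F e P = not (lookup P e) ∧ F (P Vec.[ e ]≔ true)

    -- A surviving triangle is not in conflict with e, so the three members in conflict with it are
    -- all still present.
    link-saturating : ∀ {U k P e} → lookup P e ≡ false → Saturating conf U (suc k) (P Vec.[ e ]≔ true) → Saturating conf (U ⊖ e) k P
    link-saturating {U} {k} {P} {e} e∉ s = record
      { size = suc-injective (trans (sym (card-[]≔ P e e∉)) (size s))
      ; sub = λ {f} f∈ → ∧-intro (sub s (keep f∈)) (∧-intro (cong not (does-no (f Finₚ.≟ e) (≢e f∈))) (cong not (indep s (keep f∈) new)))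
      ; indep = λ e∈ f∈ → indep s (keep e∈) (keep f∈)
      ; sat = saturated }
      where
      new : lookup (P Vec.[ e ]≔ true) e ≡ true
      new = Vecₚ.lookup∘updateAt e P
      ≢e : ∀ {f} → lookup P f ≡ true → f ≢ e
      ≢e f∈ refl = true≢false (trans (sym f∈) e∉)
      same : ∀ {f} → f ≢ e → lookup (P Vec.[ e ]≔ true) f ≡ lookup P f
      same {f} ne = Vecₚ.lookup∘updateAt′ f e ne P
      keep : ∀ {f} → lookup P f ≡ true → lookup (P Vec.[ e ]≔ true) f ≡ true
      keep f∈ = trans (same (≢e f∈)) f∈
      saturated : ∀ {u} → (U ⊖ e) u ≡ true → lookup P u ≡ false → 3 ≤ ∑ fs (λ f → ⟦ lookup P f ∧ conf u f ⟧)
      saturated {u} u∈ u∉ = subst (3 ≤_) (∑-cong′ fs agree) (sat s (proj₁ uu) (trans (same u≢e) u∉))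
        where
        uu = ∧-true {U u} u∈
        vv = ∧-true {not (does (u Finₚ.≟ e))} (proj₂ uu)
        u≢e : u ≢ e
        u≢e = does-false (u Finₚ.≟ e) (not-true (proj₁ vv))
        agree : ∀ f → ⟦ lookup (P Vec.[ e ]≔ true) f ∧ conf u f ⟧ ≡ ⟦ lookup P f ∧ conf u f ⟧
        agree f with f Finₚ.≟ e
        ... | no ne    = cong (λ b → ⟦ b ∧ conf u f ⟧) (same ne)
        ... | yes refl = cong ⟦_⟧ (trans (trans (cong (lookup (P Vec.[ e ]≔ true) e ∧_) c) (Boolₚ.∧-zeroʳ _))
                           (sym (trans (cong (lookup P e ∧_) c) (Boolₚ.∧-zeroʳ _))))
          where c = not-true (proj₂ vv)

    module _ {U k P} (s : Saturating conf U k P) where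

      extra : ℕ
      extra = ∑ fs (λ u → ⟦ U u ∧ not (lookup P u) ⟧)

      card-split : card U ≡ k + extra
      card-split = trans (trans (∑-cong′ fs split) (∑-+ fs (λ u → ⟦ lookup P u ⟧) (λ u → ⟦ U u ∧ not (lookup P u) ⟧))) (cong (_+ extra) (size s))
        where
        split : ∀ u → ⟦ U u ⟧ ≡ ⟦ lookup P u ⟧ + ⟦ U u ∧ not (lookup P u) ⟧
        split u with lookup P u in e
        ... | true  = trans (cong ⟦_⟧ (sub s e)) (cong (λ b → suc ⟦ b ⟧) (sym (Boolₚ.∧-zeroʳ (U u))))
        ... | false = cong ⟦_⟧ (sym (Boolₚ.∧-identityʳ (U u)))

      -- Counted by survivors: a member of `P` is lost only when it is itself removed, and any other
      -- element of `U` is lost for at least three of the k choices of e.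
      survivors : ∑ fs (λ e → ⟦ lookup P e ⟧ * card (U ⊖ e)) ≤ k * (k ∸ 1) + extra * (k ∸ 3)
      survivors = begin
        ∑ fs (λ e → ⟦ lookup P e ⟧ * card (U ⊖ e))
          ≡⟨ ∑-cong′ fs (λ e → sym (∑-*ˡ fs ⟦ lookup P e ⟧ _)) ⟩
        ∑ fs (λ e → ∑ fs (λ u → ⟦ lookup P e ⟧ * ⟦ (U ⊖ e) u ⟧))
          ≡⟨ ∑-swap fs fs _ ⟩
        ∑ fs (λ u → ∑ fs (λ e → ⟦ lookup P e ⟧ * ⟦ (U ⊖ e) u ⟧))
          ≤⟨ ∑-mono′ fs bound ⟩
        ∑ fs (λ u → ⟦ lookup P u ⟧ * (k ∸ 1) + ⟦ U u ∧ not (lookup P u) ⟧ * (k ∸ 3))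
          ≡⟨ trans (∑-+ fs _ _) (cong₂ _+_ (∑-*ʳ fs (k ∸ 1) (λ u → ⟦ lookup P u ⟧)) (∑-*ʳ fs (k ∸ 3) (λ u → ⟦ U u ∧ not (lookup P u) ⟧))) ⟩
        card (lookup P) * (k ∸ 1) + extra * (k ∸ 3)
          ≡⟨ cong (λ z → z * (k ∸ 1) + extra * (k ∸ 3)) (size s) ⟩
        k * (k ∸ 1) + extra * (k ∸ 3) ∎
        where
        open ≤-Reasoning
        few : ∀ u (c : Fin N → Bool) j → j ≤ ∑ fs (λ e → ⟦ lookup P e ∧ c e ⟧) →
              (∀ e → c e ≡ true → (U ⊖ e) u ≡ false) → ∑ fs (λ e → ⟦ lookup P e ⟧ * ⟦ (U ⊖ e) u ⟧) ≤ k ∸ j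
        few u c j j≤ h = ≤-trans (≤-reflexive (sym (m+n∸n≡m S j))) (∸-monoˡ-≤ j (begin
          S + j
            ≤⟨ +-monoʳ-≤ S j≤ ⟩
          S + ∑ fs (λ e → ⟦ lookup P e ∧ c e ⟧)
            ≡⟨ ∑-+ fs _ _ ⟨
          ∑ fs (λ e → ⟦ lookup P e ⟧ * ⟦ (U ⊖ e) u ⟧ + ⟦ lookup P e ∧ c e ⟧)
            ≤⟨ ∑-mono′ fs (λ e → both (lookup P e) (c e) ((U ⊖ e) u) (h e)) ⟩
          card (lookup P)
            ≡⟨ size s ⟩
          k ∎))
          where
          S = ∑ fs (λ e → ⟦ lookup P e ⟧ * ⟦ (U ⊖ e) u ⟧)
          both : ∀ p c x → (c ≡ true → x ≡ false) → ⟦ p ⟧ * ⟦ x ⟧ + ⟦ p ∧ c ⟧ ≤ ⟦ p ⟧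
          both false c     x h = z≤n
          both true  true  x h rewrite h refl = ≤-refl
          both true  false x h = ≤-trans (≤-reflexive (trans (+-identityʳ _) (*-identityˡ _))) (⟦⟧≤1 x)
        bound : ∀ u → ∑ fs (λ e → ⟦ lookup P e ⟧ * ⟦ (U ⊖ e) u ⟧) ≤ ⟦ lookup P u ⟧ * (k ∸ 1) + ⟦ U u ∧ not (lookup P u) ⟧ * (k ∸ 3)
        bound u with bool-cases (lookup P u) | bool-cases (U u)
        ... | inj₁ p | _ = ≤-trans (few u (λ e → does (u Finₚ.≟ e)) 1
                (≤-trans (≤-reflexive (cong ⟦_⟧ (sym (∧-intro p (does-yes (u Finₚ.≟ u) refl))))) (∑-member (all-fin u) (λ e → ⟦ lookup P e ∧ does (u Finₚ.≟ e) ⟧)))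
                (λ e q → trans (cong (λ b → U u ∧ (not b ∧ not (conf u e))) q) (Boolₚ.∧-zeroʳ (U u))))
              (≤-trans (≤-reflexive (trans (sym (*-identityˡ _)) (cong (λ b → ⟦ b ⟧ * (k ∸ 1)) (sym p)))) (m≤m+n _ _))
        ... | inj₂ p | inj₁ q = ≤-trans (few u (conf u) 3 (sat s q p)
                (λ e r → trans (cong (λ b → U u ∧ (not (does (u Finₚ.≟ e)) ∧ not b)) r) (trans (cong (U u ∧_) (Boolₚ.∧-zeroʳ _)) (Boolₚ.∧-zeroʳ (U u)))))
              (≤-trans (≤-reflexive (trans (sym (*-identityˡ _)) (cong (λ b → ⟦ b ⟧ * (k ∸ 3)) (sym (∧-intro q (cong not p)))))) (m≤n+m _ (⟦ lookup P u ⟧ * (k ∸ 1))))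
        ... | inj₂ p | inj₂ q = ≤-trans (≤-reflexive (trans (∑-cong′ fs (λ e → trans (cong (λ b → ⟦ lookup P e ⟧ * ⟦ b ∧ (not (does (u Finₚ.≟ e)) ∧ not (conf u e)) ⟧) q) (*-zeroʳ ⟦ lookup P e ⟧))) (∑-0 fs))) z≤n

    -- With i members left, the number of triangles is compared with i + (α/β) i³, which is i times
    -- g i / β.
    g : ℕ → ℕ
    g k = β + α * (k * k)

    -- `K k` over β^k is the bound aimed at, the product over i ≤ k of the number of candidates
    -- divided by the number i of members. The coefficient of the excess β card U - k g k in
    -- `linear` is x k / (z k β); its recursion has denominators, so numerator and denominator are
    -- kept apart.
    K x z : ℕ → ℕ
    K zero    = 1
    K (suc k) = K k * g (suc k)
    z zero    = 1
    z (suc k) = z k * suc k * g (suc k)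
    x zero    = 0
    x (suc k) = x k * (suc k ∸ 3) * g (suc k) + z k * β

    num : (Vec Bool N → Bool) → ℕ
    num F = ∑ (cube N) (λ P → ⟦ F P ⟧)

    -- The bound num F · β^k ≤ K k is strengthened to one that is linear in card U, so that it can be averaged
    -- over the choice of a member e of P.
    linear : ∀ k U F → (∀ P → F P ≡ true → Saturating conf U k P) →
             num F * β ^ k * (z k * β + x k * (k * g k)) ≤ z k * β * K k + num F * β ^ k * (x k * (β * card U))
    linear zero U F h = begin
      num F * 1 * (1 * β + 0)                              ≤⟨ *-monoˡ-≤ (1 * β + 0) (*-monoˡ-≤ 1 num≤1) ⟩
      1 * 1 * (1 * β + 0)                                  ≡⟨ identity β ⟩
      1 * β * 1                                            ≤⟨ m≤m+n _ _ ⟩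
      1 * β * 1 + num F * 1 * (0 * (β * card U))           ∎
      where
      open ≤-Reasoning
      identity : ∀ β → 1 * 1 * (1 * β + 0) ≡ 1 * β * 1
      identity = solve-∀
      _≟ᵛ_ : DecidableEquality (Vec Bool N)
      _≟ᵛ_ = Vecₚ.≡-dec Boolₚ._≟_
      num≤1 : num F ≤ 1
      num≤1 = ≤-trans (∑-mono′ (cube N) only) (≤-reflexive (∑-one _≟ᵛ_ (vecs-unique bools-unique N) (∈-cube (Vec.replicate N false)) (λ _ → 1)))
        where
        only : ∀ P → ⟦ F P ⟧ ≤ ⟦ does (P ≟ᵛ Vec.replicate N false) ⟧ * 1
        only P with F P in e
        ... | false = z≤n
        ... | true  = ≤-reflexive (sym (cong (λ b → ⟦ b ⟧ * 1) (does-yes (P ≟ᵛ _) (card-0 P (size (h P e))))))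
    linear (suc k) U F h with num F in numF
    ... | zero  = z≤n
    ... | suc _ with P₀ , _ , p₀ ← ∑-positive (cube N) (λ P → ⟦ F P ⟧) (subst (0 <_) (sym numF) (s≤s z≤n)) =
      subst (λ D → D * (β * β ^ k) * (z (suc k) * β + x (suc k) * (suc k * g (suc k))) ≤
                   z (suc k) * β * K (suc k) + D * (β * β ^ k) * (x (suc k) * (β * card U))) numF goal
      where
      open ≤-Reasoning
      s₀ = h P₀ (⟦⟧-true p₀)
      T′ = extra s₀
      D = num F
      B = β ^ k
      m = suc k ∸ 3
      d : Fin N → ℕ
      d e = num (link F e)
      card-U : card U ≡ suc k + T′
      card-U = card-split s₀

      extra-≡ : ∀ {P} (s : Saturating conf U (suc k) P) → extra s ≡ T′
      extra-≡ s = +-cancelˡ-≡ (suc k) _ _ (trans (sym (card-split s)) card-U)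

      d-≡ : ∀ e → d e ≡ ∑ (cube N) (λ P → ⟦ lookup P e ⟧ * ⟦ F P ⟧)
      d-≡ e = trans (∑-cong′ (cube N) (λ P → ⟦∧⟧ (not (lookup P e)) _)) (sym (∑-toggle e (λ P → ⟦ F P ⟧)))

      d-weighted : ∀ (f : Fin N → ℕ) → ∑ fs (λ e → d e * f e) ≡ ∑ (cube N) (λ P → ⟦ F P ⟧ * ∑ fs (λ e → ⟦ lookup P e ⟧ * f e))
      d-weighted f = begin-equality
        ∑ fs (λ e → d e * f e)
          ≡⟨ ∑-cong′ fs (λ e → trans (cong (_* f e) (d-≡ e)) (sym (∑-*ʳ (cube N) (f e) _))) ⟩
        ∑ fs (λ e → ∑ (cube N) (λ P → ⟦ lookup P e ⟧ * ⟦ F P ⟧ * f e))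
          ≡⟨ ∑-swap fs (cube N) _ ⟩
        ∑ (cube N) (λ P → ∑ fs (λ e → ⟦ lookup P e ⟧ * ⟦ F P ⟧ * f e))
          ≡⟨ ∑-cong′ (cube N) (λ P → trans (∑-cong′ fs (λ e → xy∙z≈y∙xz ⟦ lookup P e ⟧ ⟦ F P ⟧ (f e))) (∑-*ˡ fs ⟦ F P ⟧ _)) ⟩
        ∑ (cube N) (λ P → ⟦ F P ⟧ * ∑ fs (λ e → ⟦ lookup P e ⟧ * f e)) ∎

      d-total : ∑ fs d ≡ D * suc k
      d-total = trans (∑-cong′ fs (λ e → sym (*-identityʳ (d e)))) (trans (d-weighted (λ _ → 1)) (trans (∑-cong′ (cube N) each) (∑-*ʳ (cube N) (suc k) _)))
        where
        each : ∀ P → ⟦ F P ⟧ * ∑ fs (λ e → ⟦ lookup P e ⟧ * 1) ≡ ⟦ F P ⟧ * suc k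
        each P with F P in e
        ... | false = refl
        ... | true  = cong (_+ 0) (trans (∑-cong′ fs (λ e → *-identityʳ _)) (size (h P e)))

      d-survivors : ∑ fs (λ e → d e * card (U ⊖ e)) ≤ D * (suc k * k + T′ * m)
      d-survivors = ≤-trans (≤-reflexive (d-weighted (λ e → card (U ⊖ e)))) (≤-trans (∑-mono′ (cube N) each) (≤-reflexive (∑-*ʳ (cube N) (suc k * k + T′ * m) _)))
        where
        each : ∀ P → ⟦ F P ⟧ * ∑ fs (λ e → ⟦ lookup P e ⟧ * card (U ⊖ e)) ≤ ⟦ F P ⟧ * (suc k * k + T′ * m)
        each P with F P in e
        ... | false = z≤n
        ... | true  = *-monoʳ-≤ 1 (subst (λ t → ∑ fs (λ e → ⟦ lookup P e ⟧ * card (U ⊖ e)) ≤ suc k * k + t * m) (extra-≡ (h P e)) (survivors (h P e)))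

      hyp : ∀ e → d e * (B * (z k * β + x k * (k * g k))) ≤ ⟦ U e ⟧ * (z k * β * K k) + d e * card (U ⊖ e) * (B * (x k * β))
      hyp e with bool-cases (U e)
      ... | inj₂ q = ≤-trans (≤-reflexive (cong (_* (B * (z k * β + x k * (k * g k)))) d≡0)) z≤n
        where
        none : ∀ P → ⟦ link F e P ⟧ ≡ 0
        none P with link F e P in l
        ... | false = refl
        ... | true  = ⊥-elim (true≢false (trans (sym (sub (h _ (proj₂ (∧-true {not (lookup P e)} l))) (Vecₚ.lookup∘updateAt e P))) q))
        d≡0 : d e ≡ 0
        d≡0 = trans (∑-cong′ (cube N) none) (∑-0 (cube N))
      ... | inj₁ q = begin
        d e * (B * (z k * β + x k * (k * g k)))                                        ≡⟨ *-assoc (d e) B _ ⟨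
        d e * B * (z k * β + x k * (k * g k))                                          ≤⟨ linear k (U ⊖ e) (link F e) linked ⟩
        z k * β * K k + d e * B * (x k * (β * card (U ⊖ e)))                           ≡⟨ cong₂ _+_ (trans (sym (*-identityˡ _)) (cong (λ b → ⟦ b ⟧ * (z k * β * K k)) (sym q))) (shuffle (d e) B (x k) β (card (U ⊖ e))) ⟩
        ⟦ U e ⟧ * (z k * β * K k) + d e * card (U ⊖ e) * (B * (x k * β))               ∎
        where
        linked : ∀ P → link F e P ≡ true → Saturating conf (U ⊖ e) k P
        linked P l = link-saturating (not-true (proj₁ (∧-true l))) (h _ (proj₂ (∧-true {not (lookup P e)} l)))
        shuffle : ∀ d B x β c → d * B * (x * (β * c)) ≡ d * c * (B * (x * β))
        shuffle = solve-∀

      summed : D * suc k * (B * (z k * β + x k * (k * g k))) ≤ card U * (z k * β * K k) + D * (suc k * k + T′ * m) * (B * (x k * β))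
      summed = begin
        D * suc k * (B * (z k * β + x k * (k * g k)))
          ≡⟨ trans (cong (_* (B * (z k * β + x k * (k * g k)))) (sym d-total)) (sym (∑-*ʳ fs _ d)) ⟩
        ∑ fs (λ e → d e * (B * (z k * β + x k * (k * g k))))
          ≤⟨ ∑-mono′ fs hyp ⟩
        ∑ fs (λ e → ⟦ U e ⟧ * (z k * β * K k) + d e * card (U ⊖ e) * (B * (x k * β)))
          ≡⟨ trans (∑-+ fs _ _) (cong₂ _+_ (∑-*ʳ fs (z k * β * K k) _) (∑-*ʳ fs (B * (x k * β)) _)) ⟩
        card U * (z k * β * K k) + ∑ fs (λ e → d e * card (U ⊖ e)) * (B * (x k * β))
          ≤⟨ +-monoʳ-≤ _ (*-monoˡ-≤ (B * (x k * β)) d-survivors) ⟩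
        card U * (z k * β * K k) + D * (suc k * k + T′ * m) * (B * (x k * β)) ∎

      -- Brings `summed` into the form required by `Step.step`. The term with k³ is replaced through
      -- `cube-step` by one with (k + 1)³, and the contribution of the surviving members cancels.
      reduced : D * B * (suc k * z k * β + x k * m * (α * (suc k * suc k * suc k))) ≤
                (suc k + T′) * z k * β * K k + D * B * (x k * m * (β * T′))
      reduced = +-cancelʳ-≤ (D * B * x k * β * (suc k * k)) _ _ (begin
        D * B * (suc k * z k * β + x k * m * (α * (suc k * suc k * suc k))) + D * B * x k * β * (suc k * k)
          ≡⟨ identity₁ (D * B) (suc k * z k * β) (x k) m α (suc k * suc k * suc k) (β * (suc k * k)) (D * B * x k * β * (suc k * k)) (identity₀ (D * B) (x k) β (suc k * k)) ⟩
        D * B * (suc k * z k * β + x k * (α * (m * (suc k * suc k * suc k)) + β * (suc k * k)))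
          ≤⟨ *-monoʳ-≤ (D * B) (+-monoʳ-≤ (suc k * z k * β) (*-monoʳ-≤ (x k) (+-monoˡ-≤ (β * (suc k * k)) (*-monoʳ-≤ α (cube-step k))))) ⟩
        D * B * (suc k * z k * β + x k * (α * (suc k * (k * k * k)) + β * (suc k * k)))
          ≡⟨ identity₂ D B (suc k) (z k) β (x k) α k ⟩
        D * suc k * (B * (z k * β + x k * (k * g k)))
          ≤⟨ summed ⟩
        card U * (z k * β * K k) + D * (suc k * k + T′ * m) * (B * (x k * β))
          ≡⟨ cong (λ c → c * (z k * β * K k) + D * (suc k * k + T′ * m) * (B * (x k * β))) card-U ⟩
        (suc k + T′) * (z k * β * K k) + D * (suc k * k + T′ * m) * (B * (x k * β))
          ≡⟨ identity₃ (suc k + T′) (z k) β (K k) D (suc k * k) T′ m B (x k) ⟩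
        (suc k + T′) * z k * β * K k + D * B * (x k * m * (β * T′)) + D * B * x k * β * (suc k * k) ∎)
        where
        identity₀ : ∀ d x β w → d * x * β * w ≡ d * (x * (β * w))
        identity₀ = solve-∀
        identity₁ : ∀ d a x m α c w r → r ≡ d * (x * w) → d * (a + x * m * (α * c)) + r ≡ d * (a + x * (α * (m * c) + w))
        identity₁ d a x m α c w _ refl = lemma d a x m α c w
          where
          lemma : ∀ d a x m α c w → d * (a + x * m * (α * c)) + d * (x * w) ≡ d * (a + x * (α * (m * c) + w))
          lemma = solve-∀
        identity₂ : ∀ D B k′ z β x α k → D * B * (k′ * z * β + x * (α * (k′ * (k * k * k)) + β * (k′ * k))) ≡ D * k′ * (B * (z * β + x * (k * (β + α * (k * k)))))
        identity₂ = solve-∀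
        identity₃ : ∀ T z β K D w t m B x → T * (z * β * K) + D * (w + t * m) * (B * (x * β)) ≡ T * z * β * K + D * B * (x * m * (β * t)) + D * B * x * β * w
        identity₃ = solve-∀

      goal : D * (β * B) * (z (suc k) * β + x (suc k) * (suc k * g (suc k))) ≤ z (suc k) * β * K (suc k) + D * (β * B) * (x (suc k) * (β * card U))
      goal = subst₂ (λ c u → c * (z (suc k) * β + x (suc k) * (suc k * g (suc k))) ≤ z (suc k) * β * K (suc k) + c * (x (suc k) * (β * u)))
               (trans (*-assoc D B β) (cong (D *_) (*-comm B β))) (sym card-U)
               (Step.step α β T′ (suc k) (K k) (z k) (x k) m (D * B) (s≤s z≤n) 0<β reduced)

    z>0 : ∀ k → 0 < z k
    z>0 zero    = s≤s z≤n
    z>0 (suc k) = *-mono-< (*-mono-< (z>0 k) (s≤s z≤n)) (≤-trans 0<β (m≤m+n β _))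

    saturating-count : ∀ k U F → (∀ P → F P ≡ true → Saturating conf U k P) → β * card U ≤ k * g k → num F * β ^ k ≤ K k
    saturating-count k U F h le = *-cancelʳ-≤ _ _ (z k * β) {{ℕ.>-nonZero (*-mono-< (z>0 k) 0<β)}}
      (+-cancelʳ-≤ (D * (x k * (k * g k))) _ _ (begin
        D * (z k * β) + D * (x k * (k * g k))        ≡⟨ *-distribˡ-+ D (z k * β) _ ⟨
        D * (z k * β + x k * (k * g k))              ≤⟨ linear k U F h ⟩
        z k * β * K k + D * (x k * (β * card U))     ≤⟨ +-mono-≤ (≤-reflexive (*-comm (z k * β) (K k))) (*-monoʳ-≤ D (*-monoʳ-≤ (x k) le)) ⟩
        K k * (z k * β) + D * (x k * (k * g k))      ∎))
      where
      open ≤-Reasoning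
      D = num F * β ^ k

  -- Hole matrices

  rising : ℕ → ℕ → ℕ
  rising zero    s = 1
  rising (suc k) s = rising k s * (suc k + s)

  rising-suc : ∀ k s → rising k (suc s) * suc s ≡ rising k s * suc (k + s)
  rising-suc zero    s = refl
  rising-suc (suc k) s = begin
    rising k (suc s) * (suc k + suc s) * suc s      ≡⟨ xy∙z≈xz∙y (rising k (suc s)) (suc k + suc s) (suc s) ⟩
    rising k (suc s) * suc s * (suc k + suc s)      ≡⟨ cong₂ _*_ (rising-suc k s) (+-suc (suc k) s) ⟩
    rising k s * suc (k + s) * suc (suc k + s)      ∎
    where
    open ≡-Reasoning

  -- Passing from s to s + 1 multiplies `rising k s` by (k + s + 1)/(s + 1), which is at most k + 1.
  rising-≤ : ∀ k s → rising k s ≤ k ! * suc k ^ s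
  rising-≤ k zero = ≤-trans (≤-reflexive (rising-0 k)) (≤-reflexive (sym (*-identityʳ (k !))))
    where
    rising-0 : ∀ k → rising k 0 ≡ k !
    rising-0 zero    = refl
    rising-0 (suc k) = trans (cong₂ _*_ (rising-0 k) (+-identityʳ (suc k))) (*-comm (k !) (suc k))
  rising-≤ k (suc s) = *-cancelʳ-≤ _ _ (suc s) (begin
    rising k (suc s) * suc s            ≡⟨ rising-suc k s ⟩
    rising k s * suc (k + s)            ≤⟨ *-mono-≤ (rising-≤ k s) (m≤m+n (suc (k + s)) (s * k)) ⟩
    k ! * suc k ^ s * (suc (k + s) + s * k)     ≡⟨ identity (k !) (suc k ^ s) k s ⟩
    k ! * (suc k * suc k ^ s) * suc s   ∎)
    where
    open ≤-Reasoning
    identity : ∀ f p k s → f * p * (suc (k + s) + s * k) ≡ f * ((1 + k) * p) * (1 + s)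
    identity = solve-∀

  wt : ∀ {N} → Vec Bool N → ℕ
  wt []      = 0
  wt (b ∷ v) = ⟦ b ⟧ + wt v

  wt-≤ : ∀ {N} (v : Vec Bool N) → wt v ≤ N
  wt-≤ []      = z≤n
  wt-≤ (b ∷ v) = +-mono-≤ (⟦⟧≤1 b) (wt-≤ v)

  wt-++ : ∀ {M N} (v : Vec Bool M) (w : Vec Bool N) → wt (v Vec.++ w) ≡ wt v + wt w
  wt-++ []      w = refl
  wt-++ (b ∷ v) w = trans (cong (⟦ b ⟧ +_) (wt-++ v w)) (sym (+-assoc ⟦ b ⟧ (wt v) (wt w)))

  wt-∑ : ∀ {N} (v : Vec Bool N) → wt v ≡ ∑ (allFin N) (λ i → ⟦ lookup v i ⟧)
  wt-∑ []      = refl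
  wt-∑ (b ∷ v) = trans (cong (⟦ b ⟧ +_) (wt-∑ v)) (sym (∑-fin _ (λ i → ⟦ lookup (b ∷ v) i ⟧)))

  _==_ : ℕ → ℕ → Bool
  a == b = does (a ℕ.≟ b)

  -- The binomial coefficient of N over y.
  layer : ℕ → ℕ → ℕ
  layer N y = ∑ (cube N) (λ v → ⟦ wt v == y ⟧)

  layer-≤ : ∀ N y → layer N y * y ! ≤ N ^ y
  layer-≤ zero    zero    = ≤-refl
  layer-≤ zero    (suc y) = z≤n
  layer-≤ (suc N) zero    = begin
    layer (suc N) 0 * 1     ≡⟨ *-identityʳ _ ⟩
    layer (suc N) 0         ≡⟨ ∑-cube N _ ⟩
    layer N 0 + ∑ (cube N) (λ _ → 0)   ≡⟨ cong (layer N 0 +_) (∑-0 (cube N)) ⟩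
    layer N 0 + 0           ≡⟨ trans (+-identityʳ _) (sym (*-identityʳ _)) ⟩
    layer N 0 * 1           ≤⟨ layer-≤ N 0 ⟩
    1                       ∎
    where open ≤-Reasoning
  layer-≤ (suc N) (suc y) = begin
    layer (suc N) (suc y) * (suc y * y !)                    ≡⟨ cong (_* (suc y * y !)) (∑-cube N _) ⟩
    (layer N (suc y) + layer N y) * (suc y * y !)            ≡⟨ identity (layer N (suc y)) (layer N y) (suc y) (y !) ⟩
    layer N (suc y) * (suc y * y !) + suc y * (layer N y * y !)   ≤⟨ +-mono-≤ (layer-≤ N (suc y)) (*-monoʳ-≤ (suc y) (layer-≤ N y)) ⟩
    N ^ suc y + suc y * N ^ y                                ≤⟨ power-step N (suc y) ⟩
    suc N ^ suc y                                            ∎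
    where
    open ≤-Reasoning
    identity : ∀ a b c f → (a + b) * (c * f) ≡ a * (c * f) + c * (b * f)
    identity = solve-∀
    power-step : ∀ N k → N ^ k + k * N ^ (k ∸ 1) ≤ suc N ^ k
    power-step N zero    = ≤-refl
    power-step N (suc zero) = ≤-reflexive (lin N)
      where
      lin : ∀ N → N * 1 + (1 + 0) ≡ (1 + N) * 1
      lin = solve-∀
    power-step N (suc (suc k)) = begin
      N * (N * N ^ k) + (2 + k) * (N * N ^ k)                         ≤⟨ m≤m+n _ (suc k * N ^ k) ⟩
      N * (N * N ^ k) + (2 + k) * (N * N ^ k) + suc k * N ^ k         ≡⟨ ident N (N ^ k) k ⟩
      suc N * (N * N ^ k + suc k * N ^ k)                             ≤⟨ *-monoʳ-≤ (suc N) (power-step N (suc k)) ⟩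
      suc N * suc N ^ suc k                                           ∎
      where
      ident : ∀ N p k → N * (N * p) + (2 + k) * (N * p) + (1 + k) * p ≡ (1 + N) * (N * p + (1 + k) * p)
      ident = solve-∀

  Matrix : ℕ → ℕ → Set
  Matrix n m = Vec (Vec Bool n) m

  matrices : ∀ n m → List (Matrix n m)
  matrices n = vecs (cube n)

  ones : ∀ {n m} → Matrix n m → ℕ
  ones []      = 0
  ones (r ∷ M) = wt r + ones M

  squares : ∀ {n m} → Matrix n m → ℕ
  squares []      = 0
  squares (r ∷ M) = wt r * wt r + squares M

  ∑-cube-++ : ∀ M N (f : Vec Bool (M + N) → ℕ) → ∑ (cube (M + N)) f ≡ ∑ (cube M) (λ v → ∑ (cube N) (λ w → f (v Vec.++ w)))
  ∑-cube-++ zero    N f = sym (+-identityʳ _)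
  ∑-cube-++ (suc M) N f = trans (∑-cube (M + N) f)
    (trans (cong₂ _+_ (∑-cube-++ M N (f ∘ (false ∷_))) (∑-cube-++ M N (f ∘ (true ∷_)))) (sym (∑-cube M _)))

  matrices-layer : ∀ n m y → ∑ (matrices n m) (λ M → ⟦ ones M == y ⟧) ≡ layer (m * n) y
  matrices-layer n m y = trans (∑-cong′ (matrices n m) (λ M → cong (λ w → ⟦ w == y ⟧) (flat M))) (flatten m (λ v → ⟦ wt v == y ⟧))
    where
    flat : ∀ {m} (M : Matrix n m) → ones M ≡ wt (Vec.concat M)
    flat []      = refl
    flat (r ∷ M) = trans (cong (wt r +_) (flat M)) (sym (wt-++ r (Vec.concat M)))
    flatten : ∀ m (f : Vec Bool (m * n) → ℕ) → ∑ (matrices n m) (f ∘ Vec.concat) ≡ ∑ (cube (m * n)) f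
    flatten zero    f = refl
    flatten (suc m) f = trans (∑-vecs (cube n) m _) (trans (∑-cong′ (cube n) (λ r → flatten m (λ v → f (r Vec.++ v)))) (sym (∑-cube-++ n (m * n) f)))

  -- The binomial theorem, as a sum over subsets.
  power-sum : ∀ N Z → ∑ (cube N) (λ v → Z ^ (N ∸ wt v)) ≡ suc Z ^ N
  power-sum zero    Z = refl
  power-sum (suc N) Z = begin
    ∑ (cube (suc N)) (λ v → Z ^ (suc N ∸ wt v))
      ≡⟨ ∑-cube N _ ⟩
    ∑ (cube N) (λ v → Z ^ (suc N ∸ wt v)) + ∑ (cube N) (λ v → Z ^ (N ∸ wt v))
      ≡⟨ cong (_+ ∑ (cube N) (λ v → Z ^ (N ∸ wt v))) (trans (∑-cong′ (cube N) (λ v → cong (Z ^_) (+-∸-assoc 1 (wt-≤ v)))) (∑-*ˡ (cube N) Z _)) ⟩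
    Z * ∑ (cube N) (λ v → Z ^ (N ∸ wt v)) + ∑ (cube N) (λ v → Z ^ (N ∸ wt v))
      ≡⟨ cong (λ s → Z * s + s) (power-sum N Z) ⟩
    Z * suc Z ^ N + suc Z ^ N
      ≡⟨ +-comm (Z * suc Z ^ N) _ ⟩
    suc Z * suc Z ^ N ∎
    where open ≡-Reasoning

  -- Matrices with few ones and some much too heavy rows, counted by an exponential moment with weight φ^Q
  -- on every entry of a heavy row.
  module Unbalanced (n Q φ Z : ℕ) (0<n : 0 < n) (0<φ : 0 < φ) (Q≥ : (2 * φ) ^ Q ≤ Z) where

    heavy : Vec Bool n → Bool
    heavy r = does (n <? Q * wt r)

    unbalanced : ∀ {m} → ℕ → Matrix n m → Bool
    unbalanced y M = does (2 * (y * n) <? Q * squares M)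

    factor : Vec Bool n → ℕ
    factor r = φ ^ (⟦ heavy r ⟧ * (Q * wt r))

    weight : Vec Bool n → ℕ
    weight r = Z ^ (n ∸ wt r) * factor r

    -- A heavy row with t ones has n < Qt, so 2^n φ^(Qt) ≤ (2φ)^(Qt) ≤ Z^t. There are 2^n rows in
    -- all, hence the heavy ones together weigh at most Z^n.
    weight-≤ : ∀ r → 2 ^ n * weight r ≤ 2 ^ n * Z ^ (n ∸ wt r) + Z ^ n
    weight-≤ r with bool-cases (heavy r)
    ... | inj₂ e = ≤-trans (≤-reflexive (cong (2 ^ n *_) (trans (cong (λ b → Z ^ (n ∸ wt r) * φ ^ (⟦ b ⟧ * (Q * wt r))) e) (*-identityʳ _)))) (m≤m+n _ (Z ^ n))
    ... | inj₁ e = ≤-trans (begin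
      2 ^ n * (Z ^ (n ∸ t) * factor r)              ≡⟨ cong (λ b → 2 ^ n * (Z ^ (n ∸ t) * φ ^ (⟦ b ⟧ * (Q * t)))) e ⟩
      2 ^ n * (Z ^ (n ∸ t) * φ ^ (Q * t + 0))       ≡⟨ trans (cong (λ e → 2 ^ n * (Z ^ (n ∸ t) * φ ^ e)) (+-identityʳ (Q * t))) (x∙yz≈y∙xz (2 ^ n) (Z ^ (n ∸ t)) _) ⟩
      Z ^ (n ∸ t) * (2 ^ n * φ ^ (Q * t))           ≤⟨ *-monoʳ-≤ (Z ^ (n ∸ t)) (*-monoˡ-≤ (φ ^ (Q * t)) (^-monoʳ-≤ 2 (<⇒≤ p))) ⟩
      Z ^ (n ∸ t) * (2 ^ (Q * t) * φ ^ (Q * t))     ≡⟨ cong (Z ^ (n ∸ t) *_) (trans (sym (*-^ 2 φ (Q * t))) (sym (^-*-assoc (2 * φ) Q t))) ⟩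
      Z ^ (n ∸ t) * ((2 * φ) ^ Q) ^ t               ≤⟨ *-monoʳ-≤ (Z ^ (n ∸ t)) (^-monoˡ-≤ t Q≥) ⟩
      Z ^ (n ∸ t) * Z ^ t                           ≡⟨ trans (sym (^-distribˡ-+-* Z (n ∸ t) t)) (cong (Z ^_) (m∸n+n≡m (wt-≤ r))) ⟩
      Z ^ n                                         ∎) (m≤n+m (Z ^ n) _)
      where
      open ≤-Reasoning
      t = wt r
      p = does-true (n <? Q * t) e

    weight-total : ∑ (cube n) weight ≤ 2 * suc Z ^ n
    weight-total = *-cancelˡ-≤ (2 ^ n) {{ℕ.>-nonZero (m^n>0 2 n)}} (begin
      2 ^ n * ∑ (cube n) weight                                  ≡⟨ ∑-*ˡ (cube n) (2 ^ n) weight ⟨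
      ∑ (cube n) (λ r → 2 ^ n * weight r)                        ≤⟨ ∑-mono′ (cube n) weight-≤ ⟩
      ∑ (cube n) (λ r → 2 ^ n * Z ^ (n ∸ wt r) + Z ^ n)          ≡⟨ trans (∑-+ (cube n) _ _) (cong₂ _+_ (trans (∑-*ˡ (cube n) (2 ^ n) _) (cong (2 ^ n *_) (power-sum n Z)))
                                                                      (trans (∑-const (cube n) (Z ^ n)) (cong (_* Z ^ n) (length-vecs bools n)))) ⟩
      2 ^ n * suc Z ^ n + 2 ^ n * Z ^ n                          ≤⟨ +-monoʳ-≤ _ (*-monoʳ-≤ (2 ^ n) (^-monoˡ-≤ n (n≤1+n Z))) ⟩
      2 ^ n * suc Z ^ n + 2 ^ n * suc Z ^ n                      ≡⟨ twice (2 ^ n) (suc Z ^ n) ⟩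
      2 ^ n * (2 * suc Z ^ n)                                    ∎)
      where
      open ≤-Reasoning
      twice : ∀ a b → a * b + a * b ≡ a * (2 * b)
      twice = solve-∀

    weights : ∀ {m} → Matrix n m → ℕ
    weights []      = 1
    weights (r ∷ M) = weight r * weights M

    weights-total : ∀ m → ∑ (matrices n m) weights ≤ (2 * suc Z ^ n) ^ m
    weights-total zero    = ≤-refl
    weights-total (suc m) = ≤-trans (≤-reflexive (trans (∑-vecs (cube n) m _) (trans (∑-cong′ (cube n) (λ r → ∑-*ˡ (matrices n m) (weight r) _))
      (∑-*ʳ (cube n) (∑ (matrices n m) weights) weight)))) (*-mono-≤ weight-total (weights-total m))

    heavy-ones : ∀ {m} → Matrix n m → ℕ
    heavy-ones []      = 0
    heavy-ones (r ∷ M) = ⟦ heavy r ⟧ * (Q * wt r) + heavy-ones M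

    ones-≤ : ∀ {m} (M : Matrix n m) → ones M ≤ m * n
    ones-≤ []      = z≤n
    ones-≤ (r ∷ M) = +-mono-≤ (wt-≤ r) (ones-≤ M)

    weights-≡ : ∀ {m} (M : Matrix n m) → weights M ≡ Z ^ (m * n ∸ ones M) * φ ^ heavy-ones M
    weights-≡ []      = refl
    weights-≡ {suc m} (r ∷ M) = begin
      Z ^ (n ∸ wt r) * factor r * weights M                                                      ≡⟨ cong (Z ^ (n ∸ wt r) * factor r *_) (weights-≡ M) ⟩
      Z ^ (n ∸ wt r) * factor r * (Z ^ (m * n ∸ ones M) * φ ^ heavy-ones M)                      ≡⟨ *-interchange (Z ^ (n ∸ wt r)) (factor r) _ _ ⟩
      Z ^ (n ∸ wt r) * Z ^ (m * n ∸ ones M) * (factor r * φ ^ heavy-ones M)                      ≡⟨ cong₂ _*_ (sym (^-distribˡ-+-* Z (n ∸ wt r) _)) (sym (^-distribˡ-+-* φ (⟦ heavy r ⟧ * (Q * wt r)) _)) ⟩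
      Z ^ ((n ∸ wt r) + (m * n ∸ ones M)) * φ ^ heavy-ones (r ∷ M)                               ≡⟨ cong (λ e → Z ^ e * φ ^ heavy-ones (r ∷ M)) (∸-+ (wt-≤ r) (ones-≤ M)) ⟩
      Z ^ (n + m * n ∸ (wt r + ones M)) * φ ^ heavy-ones (r ∷ M)                                 ∎
      where
      open ≡-Reasoning
      ∸-+ : ∀ {a b c d} → b ≤ a → d ≤ c → (a ∸ b) + (c ∸ d) ≡ a + c ∸ (b + d)
      ∸-+ {a} {b} {c} {d} p q = trans (sym (+-∸-assoc (a ∸ b) q)) (trans (cong (_∸ d) (sym (+-∸-comm c p))) (∸-+-assoc (a + c) b d))

    -- A light row with t ones has Qt ≤ n, so Qt² ≤ nt. For a heavy row t ≤ n gives Qt² ≤ n(Qt),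
    -- which is what `heavy-ones` records.
    squares-≤ : ∀ {m} (M : Matrix n m) → Q * squares M ≤ n * ones M + n * heavy-ones M
    squares-≤ []      = ≤-trans (≤-reflexive (*-zeroʳ Q)) z≤n
    squares-≤ (r ∷ M) = begin
      Q * (t * t + squares M)                                                 ≡⟨ *-distribˡ-+ Q (t * t) _ ⟩
      Q * (t * t) + Q * squares M                                             ≤⟨ +-mono-≤ row (squares-≤ M) ⟩
      (n * t + n * (⟦ heavy r ⟧ * (Q * t))) + (n * ones M + n * heavy-ones M)  ≡⟨ identity n t (⟦ heavy r ⟧ * (Q * t)) (ones M) (heavy-ones M) ⟩
      n * (t + ones M) + n * (⟦ heavy r ⟧ * (Q * t) + heavy-ones M)           ∎
      where
      open ≤-Reasoning
      t = wt r
      identity : ∀ n t h o k → (n * t + n * h) + (n * o + n * k) ≡ n * (t + o) + n * (h + k)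
      identity = solve-∀
      row : Q * (t * t) ≤ n * t + n * (⟦ heavy r ⟧ * (Q * t))
      row with bool-cases (heavy r)
      ... | inj₂ e = ≤-trans (≤-trans (≤-reflexive (sym (*-assoc Q t t))) (*-monoˡ-≤ t (≮⇒≥ (does-false (n <? Q * t) e)))) (m≤m+n (n * t) _)
      ... | inj₁ e = ≤-trans (≤-trans (≤-trans (≤-reflexive (shuffle Q t)) (*-monoˡ-≤ (1 * (Q * t)) (wt-≤ r)))
                       (≤-reflexive (cong (λ b → n * (⟦ b ⟧ * (Q * t))) (sym e)))) (m≤n+m _ (n * t))
        where
        shuffle : ∀ Q t → Q * (t * t) ≡ t * (1 * (Q * t))
        shuffle = solve-∀

    unbalanced-heavy : ∀ {m} (M : Matrix n m) y → ones M ≡ y → unbalanced y M ≡ true → y ≤ heavy-ones M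
    unbalanced-heavy M y refl u = *-cancelˡ-≤ n {{ℕ.>-nonZero 0<n}} (+-cancelˡ-≤ (n * y) _ _ (begin
      n * y + n * y              ≡⟨ two n y ⟩
      2 * (y * n)                ≤⟨ <⇒≤ (does-true (2 * (y * n) <? Q * squares M) u) ⟩
      Q * squares M              ≤⟨ squares-≤ M ⟩
      n * y + n * heavy-ones M   ∎))
      where
      open ≤-Reasoning
      two : ∀ n y → n * y + n * y ≡ 2 * (y * n)
      two = solve-∀

    -- Markov's inequality for `weights`: in every matrix counted here the heavy rows contribute at
    -- least φ^y.
    unbalanced-count : ∀ m y → ∑ (matrices n m) (λ M → ⟦ (ones M == y) ∧ unbalanced y M ⟧) * (Z ^ (m * n ∸ y) * φ ^ y) ≤ (2 * suc Z ^ n) ^ m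
    unbalanced-count m y = ≤-trans (≤-reflexive (sym (∑-*ʳ (matrices n m) _ _))) (≤-trans (∑-mono′ (matrices n m) each) (weights-total m))
      where
      each : ∀ M → ⟦ (ones M == y) ∧ unbalanced y M ⟧ * (Z ^ (m * n ∸ y) * φ ^ y) ≤ weights M
      each M with bool-cases ((ones M == y) ∧ unbalanced y M)
      ... | inj₂ e = ≤-trans (≤-reflexive (cong (λ b → ⟦ b ⟧ * (Z ^ (m * n ∸ y) * φ ^ y)) e)) z≤n
      ... | inj₁ e = begin
        ⟦ (ones M == y) ∧ unbalanced y M ⟧ * (Z ^ (m * n ∸ y) * φ ^ y)   ≡⟨ trans (cong (λ b → ⟦ b ⟧ * (Z ^ (m * n ∸ y) * φ ^ y)) e) (*-identityˡ _) ⟩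
        Z ^ (m * n ∸ y) * φ ^ y                   ≤⟨ *-monoʳ-≤ (Z ^ (m * n ∸ y)) (^-monoʳ-≤ φ {{ℕ.>-nonZero 0<φ}} (unbalanced-heavy M y o (proj₂ (∧-true {ones M == y} e)))) ⟩
        Z ^ (m * n ∸ y) * φ ^ heavy-ones M        ≡⟨ cong (λ w → Z ^ (m * n ∸ w) * φ ^ heavy-ones M) o ⟨
        Z ^ (m * n ∸ ones M) * φ ^ heavy-ones M   ≡⟨ weights-≡ M ⟨
        weights M                                 ∎
        where
        open ≤-Reasoning
        o : ones M ≡ y
        o = does-true (ones M ℕ.≟ y) (proj₁ (∧-true e))

  ∑-fin-+ : ∀ k r (f : Fin (k + r) → ℕ) → ∑ (allFin (k + r)) f ≡ ∑ (allFin k) (λ i → f (i Fin.↑ˡ r)) + ∑ (allFin r) (λ i → f (k Fin.↑ʳ i))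
  ∑-fin-+ zero    r f = refl
  ∑-fin-+ (suc k) r f = trans (∑-fin (k + r) f) (trans (cong (f zero +_) (∑-fin-+ k r (f ∘ suc)))
    (trans (sym (+-assoc (f zero) _ _)) (cong (_+ ∑ (allFin r) (λ i → f (suc k Fin.↑ʳ i))) (sym (∑-fin k (λ i → f (i Fin.↑ˡ r)))))))

  ∑-combine : ∀ m k (f : Fin (m * k) → ℕ) → ∑ (allFin (m * k)) f ≡ ∑ (allFin m) (λ i → ∑ (allFin k) (λ j → f (Fin.combine i j)))
  ∑-combine zero    k f = refl
  ∑-combine (suc m) k f = trans (∑-fin-+ k (m * k) f) (trans (cong (∑ (allFin k) (λ j → f (j Fin.↑ˡ (m * k))) +_) (∑-combine m k (λ e → f (k Fin.↑ʳ e))))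
    (sym (∑-fin m (λ i → ∑ (allFin k) (λ j → f (Fin.combine i j))))))

  ones-∑ : ∀ {n m} (M : Matrix n m) → ones M ≡ ∑ (allFin m) (λ i → wt (lookup M i))
  ones-∑ []      = refl
  ones-∑ (r ∷ M) = trans (cong (wt r +_) (ones-∑ M)) (sym (∑-fin _ (λ i → wt (lookup (r ∷ M) i))))

  squares-∑ : ∀ {n m} (M : Matrix n m) → squares M ≡ ∑ (allFin m) (λ i → wt (lookup M i) * wt (lookup M i))
  squares-∑ []      = refl
  squares-∑ (r ∷ M) = trans (cong (wt r * wt r +_) (squares-∑ M)) (sym (∑-fin _ (λ i → wt (lookup (r ∷ M) i) * wt (lookup (r ∷ M) i))))

  three : ∀ {N} (f : Fin N → ℕ) {a b c} → a ≢ b → a ≢ c → b ≢ c → f a ≡ 1 → f b ≡ 1 → f c ≡ 1 → 3 ≤ ∑ (allFin N) f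
  three f {a} {b} {c} ab ac bc fa fb fc = ≤-trans (≤-reflexive (sym (cong₂ _+_ fa (cong₂ _+_ fb (cong (_+ 0) fc)))))
    (∑-⊆ {xs = a ∷ b ∷ c ∷ []} ((ab ∷ ac ∷ []) ∷ (bc ∷ []) ∷ [] ∷ []) (λ _ → all-fin _) f)

  -- Holes of a partial Latin square and the triangles that they leave

  module Holes {n : ℕ} where

    fs = allFin n

    Pred₃ : Set
    Pred₃ = Fin n → Fin n → Fin n → Bool

    -- A cyclic shift of rows, columns and symbols, which makes the three hole matrices instances of
    -- one construction.
    rotate : Pred₃ → Pred₃
    rotate p j l i = p i j l

    AtMostOne : Pred₃ → Set
    AtMostOne p = ∀ {i j l l′} → p i j l ≡ true → p i j l′ ≡ true → l ≡ l′

    hole : Pred₃ → Fin n → Fin n → Bool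
    hole p i j = not (does (Finₚ.any? (λ l → p i j l Boolₚ.≟ true)))

    fill : ∀ {p} → AtMostOne p → ∀ i j → ∑ fs (λ l → ⟦ p i j l ⟧) + ⟦ hole p i j ⟧ ≡ 1
    fill {p} one i j with Finₚ.any? (λ l → p i j l Boolₚ.≟ true)
    ... | no none = cong (_+ 1) (trans (∑-cong′ fs (λ l → zero′ l)) (∑-0 fs))
      where
      zero′ : ∀ l → ⟦ p i j l ⟧ ≡ 0
      zero′ l with p i j l in e
      ... | false = refl
      ... | true  = ⊥-elim (none (l , e))
    ... | yes (l₀ , e₀) = trans (+-identityʳ _) (trans (∑-cong′ fs same) (∑-δ l₀ (λ _ → 1)))
      where
      same : ∀ l → ⟦ p i j l ⟧ ≡ δ l l₀ * 1
      same l = trans (cong ⟦_⟧ agree) (sym (*-identityʳ _))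
        where
        agree : p i j l ≡ does (l Finₚ.≟ l₀)
        agree with bool-cases (p i j l)
        ... | inj₁ e = trans e (sym (does-yes (l Finₚ.≟ l₀) (one e e₀)))
        ... | inj₂ e = trans e (sym (does-no (l Finₚ.≟ l₀) (λ { refl → true≢false (trans (sym e₀) e) })))

    hole-false : ∀ p {i j l} → p i j l ≡ true → hole p i j ≡ false
    hole-false p {i} {j} {l} e = cong not (does-yes (Finₚ.any? (λ l → p i j l Boolₚ.≟ true)) (l , e))

    hole-witness : ∀ p i j → not (hole p i j) ≡ true → ∃ λ l → p i j l ≡ true
    hole-witness p i j h = does-true (Finₚ.any? (λ l → p i j l Boolₚ.≟ true)) (trans (sym (Boolₚ.not-involutive _)) h)

    row-holes : ∀ {p} → AtMostOne p → ∀ i → ∑ fs (λ j → ∑ fs (λ l → ⟦ p i j l ⟧)) + ∑ fs (λ j → ⟦ hole p i j ⟧) ≡ n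
    row-holes {p} one i = trans (sym (∑-+ fs _ _)) (trans (∑-cong′ fs (fill {p} one i)) (trans (sym (length-∑ fs)) (length-fin n)))

    col-holes : ∀ {p} → AtMostOne p → ∀ j → ∑ fs (λ i → ∑ fs (λ l → ⟦ p i j l ⟧)) + ∑ fs (λ i → ⟦ hole p i j ⟧) ≡ n
    col-holes {p} one j = trans (sym (∑-+ fs _ _)) (trans (∑-cong′ fs (λ i → fill {p} one i j)) (trans (sym (length-∑ fs)) (length-fin n)))

    total : Pred₃ → ℕ
    total p = ∑ fs (λ i → ∑ fs (λ j → ∑ fs (λ l → ⟦ p i j l ⟧)))

    total-rotate : ∀ p → total (rotate p) ≡ total p
    total-rotate p = trans (∑-cong′ fs (λ j → ∑-swap fs fs _)) (∑-swap fs fs _)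

    holes : Pred₃ → Matrix n n
    holes p = Vec.tabulate (λ i → Vec.tabulate (hole p i))

    entry : Matrix n n → Fin n → Fin n → Bool
    entry M i j = lookup (lookup M i) j

    entry-holes : ∀ p i j → entry (holes p) i j ≡ hole p i j
    entry-holes p i j = trans (cong (λ r → lookup r j) (Vecₚ.lookup∘tabulate (λ i → Vec.tabulate (hole p i)) i)) (Vecₚ.lookup∘tabulate (hole p i) j)

    rowdeg coldeg : Matrix n n → Fin n → ℕ
    rowdeg M i = ∑ fs (λ j → ⟦ entry M i j ⟧)
    coldeg M j = ∑ fs (λ i → ⟦ entry M i j ⟧)

    rowdeg-wt : ∀ M i → wt (lookup M i) ≡ rowdeg M i
    rowdeg-wt M i = wt-∑ (lookup M i)

    ones-rowdeg : ∀ M → ones M ≡ ∑ fs (rowdeg M)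
    ones-rowdeg M = trans (ones-∑ M) (∑-cong′ fs (rowdeg-wt M))

    squares-rowdeg : ∀ M → squares M ≡ ∑ fs (λ i → rowdeg M i * rowdeg M i)
    squares-rowdeg M = trans (squares-∑ M) (∑-cong′ fs (λ i → cong₂ _*_ (rowdeg-wt M i) (rowdeg-wt M i)))

    rowdeg-holes : ∀ p i → rowdeg (holes p) i ≡ ∑ fs (λ j → ⟦ hole p i j ⟧)
    rowdeg-holes p i = ∑-cong′ fs (λ j → cong ⟦_⟧ (entry-holes p i j))

    coldeg-holes : ∀ p j → coldeg (holes p) j ≡ ∑ fs (λ i → ⟦ hole p i j ⟧)
    coldeg-holes p j = ∑-cong′ fs (λ i → cong ⟦_⟧ (entry-holes p i j))

    total-holes : ∀ {p} → AtMostOne p → total p + ones (holes p) ≡ n * n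
    total-holes {p} one = begin
      total p + ones (holes p)                          ≡⟨ cong (total p +_) (trans (ones-rowdeg (holes p)) (∑-cong′ fs (rowdeg-holes p))) ⟩
      total p + ∑ fs (λ i → ∑ fs (λ j → ⟦ hole p i j ⟧))  ≡⟨ ∑-+ fs _ _ ⟨
      ∑ fs (λ i → ∑ fs (λ j → ∑ fs (λ l → ⟦ p i j l ⟧)) + ∑ fs (λ j → ⟦ hole p i j ⟧))
                                                        ≡⟨ ∑-cong′ fs (row-holes {p} one) ⟩
      ∑ fs (λ _ → n)                                    ≡⟨ trans (∑-const fs n) (cong (_* n) (length-fin n)) ⟩
      n * n                                             ∎
      where open ≡-Reasoning

    -- Both degrees are n minus the number of triples through j: in the first matrix j indexes a
    -- column, in the next one a row.
    col≡row : ∀ {p} → AtMostOne p → AtMostOne (rotate p) → ∀ j → coldeg (holes p) j ≡ rowdeg (holes (rotate p)) j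
    col≡row {p} one one′ j = trans (coldeg-holes p j) (trans
      (+-cancelˡ-≡ (∑ fs (λ i → ∑ fs (λ l → ⟦ p i j l ⟧))) _ _
        (trans (col-holes {p} one j) (trans (sym (row-holes {rotate p} one′ j)) (cong (_+ ∑ fs (λ l → ⟦ hole (rotate p) j l ⟧)) (∑-swap fs fs _)))))
      (sym (rowdeg-holes (rotate p) j)))

    open ≤-Reasoning

    -- The triangles of the tripartite graph whose edges are the entries that are not holes.
    covered : Matrix n n → Matrix n n → Matrix n n → Pred₃
    covered A F G i j l = not (entry A i j) ∧ (not (entry F j l) ∧ not (entry G l i))

    total-const : ∀ c → ∑ fs (λ _ → c) ≡ n * c
    total-const c = trans (∑-const fs c) (cong (_* c) (length-fin n))

    -- Only the edge in the first matrix is tested: k pairs (i, j), with n choices of the third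
    -- vertex.
    covered-trivial : ∀ A F G k → k + ones A ≡ n * n → total (covered A F G) ≤ n * k
    covered-trivial A F G k e = begin
      total (covered A F G)
        ≤⟨ ∑-mono′ fs (λ i → ∑-mono′ fs (λ j → ∑-mono′ fs (λ l → first (entry A i j) _))) ⟩
      ∑ fs (λ i → ∑ fs (λ j → ∑ fs (λ l → ⟦ not (entry A i j) ⟧)))
        ≡⟨ ∑-cong′ fs (λ i → trans (∑-cong′ fs (λ j → total-const _)) (∑-*ˡ fs n _)) ⟩
      ∑ fs (λ i → n * ∑ fs (λ j → ⟦ not (entry A i j) ⟧))
        ≡⟨ ∑-*ˡ fs n _ ⟩
      n * ∑ fs (λ i → ∑ fs (λ j → ⟦ not (entry A i j) ⟧))
        ≡⟨ cong (n *_) (+-cancelʳ-≡ (ones A) _ _ (trans complement (sym e))) ⟩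
      n * k ∎
      where
      first : ∀ a b → ⟦ not a ∧ b ⟧ ≤ ⟦ not a ⟧
      first true  b = z≤n
      first false b = ⟦⟧≤1 b
      not-sum : ∀ b → ⟦ not b ⟧ + ⟦ b ⟧ ≡ 1
      not-sum true  = refl
      not-sum false = refl
      complement : ∑ fs (λ i → ∑ fs (λ j → ⟦ not (entry A i j) ⟧)) + ones A ≡ n * n
      complement = trans (cong (∑ fs (λ i → ∑ fs (λ j → ⟦ not (entry A i j) ⟧)) +_) (ones-rowdeg A)) (trans (sym (∑-+ fs _ _))
        (trans (∑-cong′ fs (λ i → trans (sym (∑-+ fs _ _)) (trans (∑-cong′ fs (λ j → not-sum (entry A i j))) (trans (total-const 1) (*-identityʳ n))))) (total-const n)))

    -- Bonferroni's inequality for the three events that an edge is a hole. Two holes meeting in a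
    -- vertex are counted by a column degree times a row degree; these agree, so the pair terms add
    -- up to sums of squares.
    covered-refined : ∀ A F G y → ones A ≡ y → ones F ≡ y → ones G ≡ y →
                      (∀ j → coldeg A j ≡ rowdeg F j) → (∀ l → coldeg F l ≡ rowdeg G l) → (∀ i → coldeg G i ≡ rowdeg A i) →
                      total (covered A F G) + 3 * (y * n) ≤ n * (n * n) + (squares A + (squares F + squares G))
    covered-refined A F G y oA oF oG dF dG dA = begin
      total (covered A F G) + 3 * (y * n)
        ≡⟨ cong (total (covered A F G) +_) (trans (three-times y n) (sym linear-part)) ⟩
      total (covered A F G) + sum₃ (λ i j l → a i j + (f j l + g l i))
        ≡⟨ sum₃-+ (λ i j l → ⟦ covered A F G i j l ⟧) (λ i j l → a i j + (f j l + g l i)) ⟨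
      sum₃ (λ i j l → ⟦ covered A F G i j l ⟧ + (a i j + (f j l + g l i)))
        ≤⟨ ∑-mono′ fs (λ i → ∑-mono′ fs (λ j → ∑-mono′ fs (λ l → bonferroni (entry A i j) (entry F j l) (entry G l i)))) ⟩
      sum₃ (λ i j l → 1 + (g l i * a i j + (a i j * f j l + f j l * g l i)))
        ≡⟨ trans (sum₃-+ (λ _ _ _ → 1) _) (cong (sum₃ (λ _ _ _ → 1) +_) (trans (sum₃-+ _ _) (cong (sum₃ (λ i j l → g l i * a i j) +_) (sum₃-+ _ _)))) ⟩
      sum₃ (λ _ _ _ → 1) + (sum₃ (λ i j l → g l i * a i j) + (sum₃ (λ i j l → a i j * f j l) + sum₃ (λ i j l → f j l * g l i)))
        ≡⟨ cong₂ _+_ volume (cong₂ _+_ sqA (cong₂ _+_ sqF sqG)) ⟩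
      n * (n * n) + (squares A + (squares F + squares G)) ∎
      where
      a = λ i j → ⟦ entry A i j ⟧
      f = λ j l → ⟦ entry F j l ⟧
      g = λ l i → ⟦ entry G l i ⟧
      sum₃ : (Fin n → Fin n → Fin n → ℕ) → ℕ
      sum₃ h = ∑ fs (λ i → ∑ fs (λ j → ∑ fs (λ l → h i j l)))
      sum₃-+ : ∀ h h′ → sum₃ (λ i j l → h i j l + h′ i j l) ≡ sum₃ h + sum₃ h′
      sum₃-+ h h′ = trans (∑-cong′ fs (λ i → trans (∑-cong′ fs (λ j → ∑-+ fs _ _)) (∑-+ fs _ _))) (∑-+ fs _ _)
      three-times : ∀ y n → 3 * (y * n) ≡ n * y + (n * y + n * y)
      three-times = solve-∀
      bonferroni : ∀ a f g → ⟦ not a ∧ (not f ∧ not g) ⟧ + (⟦ a ⟧ + (⟦ f ⟧ + ⟦ g ⟧)) ≤ 1 + (⟦ g ⟧ * ⟦ a ⟧ + (⟦ a ⟧ * ⟦ f ⟧ + ⟦ f ⟧ * ⟦ g ⟧))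
      bonferroni false false false = ≤-refl
      bonferroni false false true  = ≤-refl
      bonferroni false true  false = ≤-refl
      bonferroni false true  true  = ≤-refl
      bonferroni true  false false = ≤-refl
      bonferroni true  false true  = ≤-refl
      bonferroni true  true  false = ≤-refl
      bonferroni true  true  true  = n≤1+n 3
      linear-part : sum₃ (λ i j l → a i j + (f j l + g l i)) ≡ n * y + (n * y + n * y)
      linear-part = trans (sum₃-+ (λ i j l → a i j) _) (cong₂ _+_
        (trans (∑-cong′ fs (λ i → trans (∑-cong′ fs (λ j → total-const _)) (∑-*ˡ fs n _))) (trans (∑-*ˡ fs n _) (cong (n *_) (trans (sym (ones-rowdeg A)) oA))))
        (trans (sum₃-+ (λ i j l → f j l) _) (cong₂ _+_
          (trans (total-const _) (cong (n *_) (trans (sym (ones-rowdeg F)) oF)))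
          (trans (∑-cong′ fs (λ i → total-const _)) (trans (∑-*ˡ fs n _) (cong (n *_) (trans (∑-swap fs fs _) (trans (sym (ones-rowdeg G)) oG))))))))
      volume : sum₃ (λ _ _ _ → 1) ≡ n * (n * n)
      volume = trans (∑-cong′ fs (λ i → trans (∑-cong′ fs (λ j → trans (total-const 1) (*-identityʳ n))) (total-const n))) (total-const (n * n))
      sqA : sum₃ (λ i j l → g l i * a i j) ≡ squares A
      sqA = trans (∑-cong′ fs (λ i → trans (∑-swap fs fs _) (trans (sym (∑-mult fs fs (λ l → g l i) (a i))) (cong (_* rowdeg A i) (dA i))))) (sym (squares-rowdeg A))
      sqF : sum₃ (λ i j l → a i j * f j l) ≡ squares F
      sqF = trans (∑-swap fs fs _) (trans (∑-cong′ fs (λ j → trans (sym (∑-mult fs fs (λ i → a i j) (f j))) (cong (_* rowdeg F j) (dF j)))) (sym (squares-rowdeg F)))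
      sqG : sum₃ (λ i j l → f j l * g l i) ≡ squares G
      sqG = trans (∑-cong′ fs (λ i → ∑-swap fs fs _)) (trans (∑-swap fs fs _) (trans (∑-cong′ fs (λ l → trans (∑-swap fs fs _)
              (trans (sym (∑-mult fs fs (λ j → f j l) (g l))) (cong (_* rowdeg G l) (dG l))))) (sym (squares-rowdeg G))))

  -- Sets of triples and their grouping by hole matrices

  module Triples (n : ℕ) where

    open Holes {n}

    volume : ℕ
    volume = n * (n * n)

    idx : Fin n → Fin n → Fin n → Fin volume
    idx i j l = Fin.combine i (Fin.combine j l)

    coords : Fin volume → Fin n × Fin n × Fin n
    coords e = let i , r = Fin.remQuot {n} (n * n) e in i , Fin.remQuot {n} n r

    coords-idx : ∀ i j l → coords (idx i j l) ≡ (i , j , l)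
    coords-idx i j l = trans (cong (λ (i , r) → i , Fin.remQuot {n} n r) (Finₚ.remQuot-combine {n} {n * n} i (Fin.combine j l)))
      (cong (i ,_) (Finₚ.remQuot-combine {n} {n} j l))

    idx′ : Fin n × Fin n × Fin n → Fin volume
    idx′ (i , j , l) = idx i j l

    idx-coords : ∀ e → idx′ (coords e) ≡ e
    idx-coords e = trans (cong (Fin.combine (proj₁ (Fin.remQuot {n} (n * n) e))) (Finₚ.combine-remQuot {n} n (proj₂ (Fin.remQuot {n} (n * n) e))))
      (Finₚ.combine-remQuot {n} (n * n) e)

    ∑-idx : ∀ (f : Fin volume → ℕ) → ∑ (allFin volume) f ≡ ∑ fs (λ i → ∑ fs (λ j → ∑ fs (λ l → f (idx i j l))))
    ∑-idx f = trans (∑-combine n (n * n) f) (∑-cong′ fs (λ i → ∑-combine n n (λ r → f (Fin.combine i r))))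

    same : Fin n → Fin n → Bool
    same i j = does (i Finₚ.≟ j)

    shares : Fin n × Fin n × Fin n → Fin n × Fin n × Fin n → Bool
    shares (i , j , l) (i′ , j′ , l′) = (same i i′ ∧ same j j′) ∨ ((same j j′ ∧ same l l′) ∨ (same l l′ ∧ same i i′))

    conf : Fin volume → Fin volume → Bool
    conf u e = not (does (u Finₚ.≟ e)) ∧ shares (coords u) (coords e)

    Independent : Vec Bool volume → Set
    Independent Y = ∀ {e f} → lookup Y e ≡ true → lookup Y f ≡ true → conf e f ≡ false

    cells : Vec Bool volume → Pred₃
    cells Y i j l = lookup Y (idx i j l)

    same-refl : ∀ i → same i i ≡ true
    same-refl i = does-yes (i Finₚ.≟ i) refl

    shares-ij : ∀ i j l l′ → shares (i , j , l) (i , j , l′) ≡ true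
    shares-ij i j l l′ rewrite same-refl i | same-refl j = refl

    shares-jl : ∀ i i′ j l → shares (i , j , l) (i′ , j , l) ≡ true
    shares-jl i i′ j l rewrite same-refl j | same-refl l = Boolₚ.∨-zeroʳ _

    shares-li : ∀ i j j′ l → shares (i , j , l) (i , j′ , l) ≡ true
    shares-li i j j′ l rewrite same-refl i | same-refl l = trans (cong ((same j j′) ∨_) (Boolₚ.∨-zeroʳ _)) (Boolₚ.∨-zeroʳ _)

    conf-idx : ∀ {i j l i′ j′ l′} → (i , j , l) ≢ (i′ , j′ , l′) → shares (i , j , l) (i′ , j′ , l′) ≡ true →
               conf (idx i j l) (idx i′ j′ l′) ≡ true
    conf-idx {i} {j} {l} {i′} {j′} {l′} ne s = ∧-intro
      (cong not (does-no (idx i j l Finₚ.≟ idx i′ j′ l′) (λ e → ne (trans (sym (coords-idx i j l)) (trans (cong coords e) (coords-idx i′ j′ l′))))))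
      (trans (cong₂ shares (coords-idx i j l) (coords-idx i′ j′ l′)) s)

    module _ {Y : Vec Bool volume} (ind : Independent Y) where

      agree : ∀ {t t′ : Fin n × Fin n × Fin n} → lookup Y (idx′ t) ≡ true → lookup Y (idx′ t′) ≡ true → shares t t′ ≡ true → t ≡ t′
      agree {i , j , l} {i′ , j′ , l′} p q s with idx i j l Finₚ.≟ idx i′ j′ l′
      ... | yes e = trans (sym (coords-idx i j l)) (trans (cong coords e) (coords-idx i′ j′ l′))
      ... | no ne = ⊥-elim (true≢false (trans (sym (conf-idx (λ e → ne (cong idx′ e)) s)) (ind p q)))

      one₁ : AtMostOne (cells Y)
      one₁ {i} {j} {l} {l′} p q = cong (proj₂ ∘ proj₂) (agree {i , j , l} {i , j , l′} p q (shares-ij i j l l′))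

      one₂ : AtMostOne (rotate (cells Y))
      one₂ {j} {l} {i} {i′} p q = cong proj₁ (agree {i , j , l} {i′ , j , l} p q (shares-jl i i′ j l))

      one₃ : AtMostOne (rotate (rotate (cells Y)))
      one₃ {l} {i} {j} {j′} p q = cong (proj₁ ∘ proj₂) (agree {i , j , l} {i , j′ , l} p q (shares-li i j j′ l))

    holes₁ holes₂ holes₃ : Vec Bool volume → Matrix n n
    holes₁ Y = holes (cells Y)
    holes₂ Y = holes (rotate (cells Y))
    holes₃ Y = holes (rotate (rotate (cells Y)))

    coveredᵉ : Matrix n n → Matrix n n → Matrix n n → Fin volume → Bool
    coveredᵉ A F G e = let i , j , l = coords e in covered A F G i j l

    card-covered : ∀ A F G → card (coveredᵉ A F G) ≡ total (covered A F G)
    card-covered A F G = trans (∑-idx _) (∑-cong′ fs (λ i → ∑-cong′ fs (λ j → ∑-cong′ fs (λ l →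
      cong (λ (i , j , l) → ⟦ covered A F G i j l ⟧) (coords-idx i j l)))))

    at-coords : ∀ (Q : Fin volume → Set) → (∀ i j l → Q (idx i j l)) → ∀ e → Q e
    at-coords Q h e = subst Q (idx-coords e) (h _ _ _)

    -- Each edge of a covered triangle lies in a member of `Y`. For a triangle outside `Y` the three
    -- members are distinct, since a member containing two of its edges would be the triangle
    -- itself.
    holes-saturating : ∀ Y → Independent Y → ∀ k → card (lookup Y) ≡ k → Saturating conf (coveredᵉ (holes₁ Y) (holes₂ Y) (holes₃ Y)) k Y
    holes-saturating Y ind k ck = record
      { size = ck
      ; sub = λ {e} → at-coords (λ e → lookup Y e ≡ true → U e ≡ true) sub′ e
      ; indep = ind
      ; sat = λ {u} → at-coords (λ u → U u ≡ true → lookup Y u ≡ false → 3 ≤ ∑ (allFin volume) (λ e → ⟦ lookup Y e ∧ conf u e ⟧)) sat′ u }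
      where
      p₁ = cells Y
      p₂ = rotate p₁
      p₃ = rotate p₂
      U = coveredᵉ (holes₁ Y) (holes₂ Y) (holes₃ Y)
      U-≡ : ∀ i j l → U (idx i j l) ≡ (not (hole p₁ i j) ∧ (not (hole p₂ j l) ∧ not (hole p₃ l i)))
      U-≡ i j l = trans (cong (λ (i , j , l) → covered (holes₁ Y) (holes₂ Y) (holes₃ Y) i j l) (coords-idx i j l))
        (cong₂ (λ a b → not a ∧ b) (entry-holes p₁ i j) (cong₂ (λ a b → not a ∧ not b) (entry-holes p₂ j l) (entry-holes p₃ l i)))
      sub′ : ∀ i j l → lookup Y (idx i j l) ≡ true → U (idx i j l) ≡ true
      sub′ i j l h = trans (U-≡ i j l) (∧-intro (cong not (hole-false p₁ {i} {j} {l} h))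
        (∧-intro (cong not (hole-false p₂ {j} {l} {i} h)) (cong not (hole-false p₃ {l} {i} {j} h))))
      sat′ : ∀ i j l → U (idx i j l) ≡ true → lookup Y (idx i j l) ≡ false → 3 ≤ ∑ (allFin volume) (λ e → ⟦ lookup Y e ∧ conf (idx i j l) e ⟧)
      sat′ i j l u∈ u∉ = three (λ e → ⟦ lookup Y e ∧ conf (idx i j l) e ⟧) ab ac bc
          (hit i j l₁ p (shares-ij i j l l₁)) (hit i₁ j l q (shares-jl i i₁ j l)) (hit i j₁ l r (shares-li i j j₁ l))
        where
        uu = ∧-true {not (hole p₁ i j)} (trans (sym (U-≡ i j l)) u∈)
        vv = ∧-true {not (hole p₂ j l)} (proj₂ uu)
        w₁ = hole-witness p₁ i j (proj₁ uu)
        w₂ = hole-witness p₂ j l (proj₁ vv)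
        w₃ = hole-witness p₃ l i (proj₂ vv)
        l₁ = proj₁ w₁
        i₁ = proj₁ w₂
        j₁ = proj₁ w₃
        p : lookup Y (idx i j l₁) ≡ true
        p = proj₂ w₁
        q : lookup Y (idx i₁ j l) ≡ true
        q = proj₂ w₂
        r : lookup Y (idx i j₁ l) ≡ true
        r = proj₂ w₃
        away : ∀ i′ j′ l′ → lookup Y (idx i′ j′ l′) ≡ true → (i , j , l) ≢ (i′ , j′ , l′)
        away i′ j′ l′ h refl = true≢false (trans (sym h) u∉)
        hit : ∀ i′ j′ l′ → lookup Y (idx i′ j′ l′) ≡ true → shares (i , j , l) (i′ , j′ , l′) ≡ true →
              ⟦ lookup Y (idx i′ j′ l′) ∧ conf (idx i j l) (idx i′ j′ l′) ⟧ ≡ 1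
        hit i′ j′ l′ h s = cong ⟦_⟧ (∧-intro h (conf-idx (away i′ j′ l′ h) s))
        un : ∀ {i j l i′ j′ l′} → idx i j l ≡ idx i′ j′ l′ → (i , j , l) ≡ (i′ , j′ , l′)
        un {i} {j} {l} {i′} {j′} {l′} e = trans (sym (coords-idx i j l)) (trans (cong coords e) (coords-idx i′ j′ l′))
        ab : idx i j l₁ ≢ idx i₁ j l
        ab e = away i j l₁ p (cong (λ z → i , j , z) (sym (cong (proj₂ ∘ proj₂) (un e))))
        ac : idx i j l₁ ≢ idx i j₁ l
        ac e = away i j l₁ p (cong (λ z → i , j , z) (sym (cong (proj₂ ∘ proj₂) (un e))))
        bc : idx i₁ j l ≢ idx i j₁ l
        bc e = away i₁ j l q (cong (λ z → z , j , l) (sym (cong proj₁ (un e))))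

    _≟ᴹ_ : DecidableEquality (Matrix n n)
    _≟ᴹ_ = Vecₚ.≡-dec (Vecₚ.≡-dec Boolₚ._≟_)

    mats : List (Matrix n n)
    mats = matrices n n

    ∈-mats : ∀ (M : Matrix n n) → M ∈ mats
    ∈-mats M = ∈-vecs M (λ i → ∈-cube (lookup M i))

    -- Partial Latin squares with y holes, grouped by their three hole matrices.
    module Grouping (S : Vec Bool volume → Bool) (ind : ∀ Y → S Y ≡ true → Independent Y)
      (k y : ℕ) (k+y : k + y ≡ n * n) (bad : Matrix n n → Bool) (Db Dt : ℕ)
      (balanced-bound : ∀ A F G (Fam : Vec Bool volume → Bool) → bad A ≡ false → bad F ≡ false → bad G ≡ false →
        (∀ P → Fam P ≡ true → Saturating conf (coveredᵉ A F G) k P) →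
        card (coveredᵉ A F G) + 3 * (y * n) ≤ n * (n * n) + (squares A + (squares F + squares G)) →
        ∑ (cube volume) (λ P → ⟦ Fam P ⟧) ≤ Db)
      (trivial-bound : ∀ U (Fam : Vec Bool volume → Bool) → (∀ P → Fam P ≡ true → Saturating conf U k P) → card U ≤ n * k →
        ∑ (cube volume) (λ P → ⟦ Fam P ⟧) ≤ Dt) where

      member : Vec Bool volume → Bool
      member Y = S Y ∧ (card (lookup Y) == k)

      family : Matrix n n → Matrix n n → Matrix n n → Vec Bool volume → Bool
      family A F G Y = member Y ∧ (does (holes₁ Y ≟ᴹ A) ∧ (does (holes₂ Y ≟ᴹ F) ∧ does (holes₃ Y ≟ᴹ G)))

      size : Matrix n n → Matrix n n → Matrix n n → ℕ
      size A F G = ∑ (cube volume) (λ Y → ⟦ family A F G Y ⟧)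

      record Facts (A F G : Matrix n n) : Set where
        field
          oA : ones A ≡ y
          oF : ones F ≡ y
          oG : ones G ≡ y
          dA : ∀ i → coldeg G i ≡ rowdeg A i
          dF : ∀ j → coldeg A j ≡ rowdeg F j
          dG : ∀ l → coldeg F l ≡ rowdeg G l

      family-true : ∀ {A F G Y} → family A F G Y ≡ true →
                    Independent Y × card (lookup Y) ≡ k × holes₁ Y ≡ A × holes₂ Y ≡ F × holes₃ Y ≡ G
      family-true {A} {F} {G} {Y} h =
        let m , r = ∧-true {member Y} h
            s , c = ∧-true {S Y} m
            a , r′ = ∧-true {does (holes₁ Y ≟ᴹ A)} r
            f , g = ∧-true {does (holes₂ Y ≟ᴹ F)} r′
        in (λ {e} {f} → ind Y s {e} {f}) , does-true (card (lookup Y) ℕ.≟ k) c , does-true (holes₁ Y ≟ᴹ A) a , does-true (holes₂ Y ≟ᴹ F) f , does-true (holes₃ Y ≟ᴹ G) g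

      facts : ∀ {A F G Y} → family A F G Y ≡ true → Facts A F G
      facts {A} {F} {G} {Y} h with i , c , refl , refl , refl ← family-true {A} {F} {G} {Y} h = record
        { oA = count {cells Y} (one₁ {Y} i) refl
        ; oF = count {rotate (cells Y)} (one₂ {Y} i) (total-rotate (cells Y))
        ; oG = count {rotate (rotate (cells Y))} (one₃ {Y} i) (trans (total-rotate (rotate (cells Y))) (total-rotate (cells Y)))
        ; dA = col≡row {rotate (rotate (cells Y))} (one₃ {Y} i) (one₁ {Y} i)
        ; dF = col≡row {cells Y} (one₁ {Y} i) (one₂ {Y} i)
        ; dG = col≡row {rotate (cells Y)} (one₂ {Y} i) (one₃ {Y} i) }
        where
        count : ∀ {p} → AtMostOne p → total p ≡ total (cells Y) → ones (holes p) ≡ y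
        count {p} one e = +-cancelˡ-≡ k _ _ (trans (cong (_+ ones (holes p)) (sym (trans e (trans (sym (∑-idx (λ e → ⟦ lookup Y e ⟧))) c)))) (trans (total-holes {p} one) (sym k+y)))

      saturating : ∀ {A F G} P → family A F G P ≡ true → Saturating conf (coveredᵉ A F G) k P
      saturating {A} {F} {G} P h with i , c , refl , refl , refl ← family-true {A} {F} {G} {P} h = holes-saturating P i k c

      L : Matrix n n → Bool
      L M = ones M == y

      -- An empty group needs no bound, and one member of a nonempty group supplies all facts about
      -- its matrices. If one of them is bad, the trivial bound is charged to it.
      bound : ∀ A F G → size A F G ≤ ⟦ L A ⟧ * (⟦ L F ⟧ * (⟦ L G ⟧ * (Db + (⟦ bad A ⟧ + (⟦ bad F ⟧ + ⟦ bad G ⟧)) * Dt)))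
      bound A F G with size A F G in e
      ... | zero  = z≤n
      ... | suc _ with Y , _ , p ← ∑-positive (cube volume) (λ Y → ⟦ family A F G Y ⟧) (subst (0 <_) (sym e) (s≤s z≤n)) =
        subst (_≤ ⟦ L A ⟧ * (⟦ L F ⟧ * (⟦ L G ⟧ * (Db + (⟦ bad A ⟧ + (⟦ bad F ⟧ + ⟦ bad G ⟧)) * Dt)))) e (begin
          size A F G                                              ≤⟨ split (bad A) (bad F) (bad G) refl refl refl ⟩
          X                                                       ≡⟨ trans (sym (*-identityˡ X)) (trans (sym (*-identityˡ (1 * X))) (sym (*-identityˡ (1 * (1 * X))))) ⟩
          1 * (1 * (1 * X))                                       ≡⟨ cong₂ _*_ (layer-true {A} (Facts.oA f)) (cong₂ _*_ (layer-true {F} (Facts.oF f)) (cong (_* X) (layer-true {G} (Facts.oG f)))) ⟩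
          ⟦ L A ⟧ * (⟦ L F ⟧ * (⟦ L G ⟧ * X))                     ∎)
        where
        open ≤-Reasoning
        X = Db + (⟦ bad A ⟧ + (⟦ bad F ⟧ + ⟦ bad G ⟧)) * Dt
        f : Facts A F G
        f = facts {A} {F} {G} {Y} (⟦⟧-true p)
        layer-true : ∀ {M} → ones M ≡ y → 1 ≡ ⟦ L M ⟧
        layer-true {M} o = cong ⟦_⟧ (sym (does-yes (ones M ℕ.≟ y) o))
        trivially : size A F G ≤ Dt
        trivially = trivial-bound (coveredᵉ A F G) (family A F G) (saturating {A} {F} {G})
          (≤-trans (≤-reflexive (card-covered A F G)) (covered-trivial A F G k (trans (cong (k +_) (Facts.oA f)) k+y)))
        by-trivial : ∀ c → size A F G ≤ Db + suc c * Dt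
        by-trivial c = ≤-trans trivially (≤-trans (m≤m+n Dt (c * Dt)) (m≤n+m _ Db))
        split : ∀ a b c → bad A ≡ a → bad F ≡ b → bad G ≡ c → size A F G ≤ Db + (⟦ a ⟧ + (⟦ b ⟧ + ⟦ c ⟧)) * Dt
        split true  b     c     _ _ _ = by-trivial (⟦ b ⟧ + ⟦ c ⟧)
        split false true  c     _ _ _ = by-trivial ⟦ c ⟧
        split false false true  _ _ _ = by-trivial 0
        split false false false a b c = ≤-trans (balanced-bound A F G (family A F G) a b c (saturating {A} {F} {G})
          (subst (λ z → z + 3 * (y * n) ≤ n * (n * n) + (squares A + (squares F + squares G))) (sym (card-covered A F G))
            (covered-refined A F G y (Facts.oA f) (Facts.oF f) (Facts.oG f) (Facts.dF f) (Facts.dG f) (Facts.dA f)))) (m≤m+n Db _)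

      ℓ : ℕ
      ℓ = ∑ mats (λ M → ⟦ L M ⟧)

      b : ℕ
      b = ∑ mats (λ M → ⟦ L M ∧ bad M ⟧)

      one-group : ∀ Y → ⟦ member Y ⟧ ≤ ∑ mats (λ A → ∑ mats (λ F → ∑ mats (λ G → ⟦ family A F G Y ⟧)))
      one-group Y = begin
        ⟦ member Y ⟧
          ≡⟨ cong ⟦_⟧ (trans (sym (Boolₚ.∧-identityʳ (member Y))) (cong (member Y ∧_) (sym (∧-intro (does-yes (holes₁ Y ≟ᴹ holes₁ Y) refl)
               (∧-intro (does-yes (holes₂ Y ≟ᴹ holes₂ Y) refl) (does-yes (holes₃ Y ≟ᴹ holes₃ Y) refl)))))) ⟩
        ⟦ family (holes₁ Y) (holes₂ Y) (holes₃ Y) Y ⟧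
          ≤⟨ ∑-member (∈-mats (holes₃ Y)) (λ G → ⟦ family (holes₁ Y) (holes₂ Y) G Y ⟧) ⟩
        ∑ mats (λ G → ⟦ family (holes₁ Y) (holes₂ Y) G Y ⟧)
          ≤⟨ ∑-member (∈-mats (holes₂ Y)) (λ F → ∑ mats (λ G → ⟦ family (holes₁ Y) F G Y ⟧)) ⟩
        ∑ mats (λ F → ∑ mats (λ G → ⟦ family (holes₁ Y) F G Y ⟧))
          ≤⟨ ∑-member (∈-mats (holes₁ Y)) (λ A → ∑ mats (λ F → ∑ mats (λ G → ⟦ family A F G Y ⟧))) ⟩
        ∑ mats (λ A → ∑ mats (λ F → ∑ mats (λ G → ⟦ family A F G Y ⟧))) ∎
        where open ≤-Reasoning

      grouped : ∑ (cube volume) (λ Y → ⟦ member Y ⟧) ≤ ℓ * (ℓ * ℓ) * Db + 3 * (b * (ℓ * ℓ)) * Dt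
      grouped = begin
        ∑ (cube volume) (λ Y → ⟦ member Y ⟧)
          ≤⟨ ∑-mono′ (cube volume) one-group ⟩
        ∑ (cube volume) (λ Y → ∑ mats (λ A → ∑ mats (λ F → ∑ mats (λ G → ⟦ family A F G Y ⟧))))
          ≡⟨ trans (∑-swap (cube volume) mats _) (∑-cong′ mats (λ A → trans (∑-swap (cube volume) mats _) (∑-cong′ mats (λ F → ∑-swap (cube volume) mats _)))) ⟩
        ∑ mats (λ A → ∑ mats (λ F → ∑ mats (λ G → size A F G)))
          ≤⟨ ∑-mono′ mats (λ A → ∑-mono′ mats (λ F → ∑-mono′ mats (λ G → bound A F G))) ⟩
        ∑ mats (λ A → ∑ mats (λ F → ∑ mats (λ G → ⟦ L A ⟧ * (⟦ L F ⟧ * (⟦ L G ⟧ * (Db + (⟦ bad A ⟧ + (⟦ bad F ⟧ + ⟦ bad G ⟧)) * Dt))))))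
          ≡⟨ ∑-cong′ mats (λ A → trans (∑-cong′ mats (λ F → inner A F)) (middle A)) ⟩
        ∑ mats (λ A → ⟦ L A ⟧ * (ℓ * ℓ * Db + 2 * (b * ℓ) * Dt) + ⟦ L A ∧ bad A ⟧ * (ℓ * ℓ * Dt))
          ≡⟨ trans (∑-+ mats _ _) (cong₂ _+_ (∑-*ʳ mats _ (λ A → ⟦ L A ⟧)) (∑-*ʳ mats _ (λ A → ⟦ L A ∧ bad A ⟧))) ⟩
        ℓ * (ℓ * ℓ * Db + 2 * (b * ℓ) * Dt) + b * (ℓ * ℓ * Dt)
          ≡⟨ final ℓ b Db Dt ⟩
        ℓ * (ℓ * ℓ) * Db + 3 * (b * (ℓ * ℓ)) * Dt ∎
        where
        open ≤-Reasoning
        final : ∀ l b D E → l * (l * l * D + 2 * (b * l) * E) + b * (l * l * E) ≡ l * (l * l) * D + 3 * (b * (l * l)) * E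
        final = solve-∀
        β : Matrix n n → ℕ
        β M = ⟦ bad M ⟧
        expand : ∀ lA lF lG a f g D E → lA * (lF * (lG * (D + (a + (f + g)) * E))) ≡ lG * (lA * (lF * (D + (a + f) * E))) + lG * g * (lA * (lF * E))
        expand = solve-∀
        inner : ∀ A F → ∑ mats (λ G → ⟦ L A ⟧ * (⟦ L F ⟧ * (⟦ L G ⟧ * (Db + (β A + (β F + β G)) * Dt)))) ≡
                ℓ * (⟦ L A ⟧ * (⟦ L F ⟧ * (Db + (β A + β F) * Dt))) + b * (⟦ L A ⟧ * (⟦ L F ⟧ * Dt))
        inner A F = trans (∑-cong′ mats (λ G → trans (expand ⟦ L A ⟧ ⟦ L F ⟧ ⟦ L G ⟧ (β A) (β F) (β G) Db Dt)
                      (cong (λ w → ⟦ L G ⟧ * (⟦ L A ⟧ * (⟦ L F ⟧ * (Db + (β A + β F) * Dt))) + w * (⟦ L A ⟧ * (⟦ L F ⟧ * Dt))) (sym (⟦∧⟧ (L G) (bad G))))))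
                    (trans (∑-+ mats _ _) (cong₂ _+_ (∑-*ʳ mats _ (λ G → ⟦ L G ⟧)) (∑-*ʳ mats _ (λ G → ⟦ L G ∧ bad G ⟧))))
        expand₂ : ∀ l b lA lF a f D E → l * (lA * (lF * (D + (a + f) * E))) + b * (lA * (lF * E)) ≡ lF * (lA * (l * (D + a * E) + b * E)) + lF * f * (l * (lA * E))
        expand₂ = solve-∀
        collect : ∀ l b lA a D E → l * (lA * (l * (D + a * E) + b * E)) + b * (l * (lA * E)) ≡ lA * (l * l * D + 2 * (b * l) * E) + lA * a * (l * l * E)
        collect = solve-∀
        middle : ∀ A → ∑ mats (λ F → ℓ * (⟦ L A ⟧ * (⟦ L F ⟧ * (Db + (β A + β F) * Dt))) + b * (⟦ L A ⟧ * (⟦ L F ⟧ * Dt))) ≡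
                 ⟦ L A ⟧ * (ℓ * ℓ * Db + 2 * (b * ℓ) * Dt) + ⟦ L A ∧ bad A ⟧ * (ℓ * ℓ * Dt)
        middle A = trans (∑-cong′ mats (λ F → trans (expand₂ ℓ b ⟦ L A ⟧ ⟦ L F ⟧ (β A) (β F) Db Dt)
                     (cong (λ w → ⟦ L F ⟧ * (⟦ L A ⟧ * (ℓ * (Db + β A * Dt) + b * Dt)) + w * (ℓ * (⟦ L A ⟧ * Dt))) (sym (⟦∧⟧ (L F) (bad F))))))
                   (trans (∑-+ mats _ _) (trans (cong₂ _+_ (∑-*ʳ mats _ (λ F → ⟦ L F ⟧)) (∑-*ʳ mats _ (λ F → ⟦ L F ∧ bad F ⟧)))
                   (trans (collect ℓ b ⟦ L A ⟧ (β A) Db Dt) (cong (λ w → ⟦ L A ⟧ * (ℓ * ℓ * Db + 2 * (b * ℓ) * Dt) + w * (ℓ * ℓ * Dt)) (sym (⟦∧⟧ (L A) (bad A)))))))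

  -- Shattered sets of Latin squares

  ∨-cases : ∀ {a b} → a ∨ b ≡ true → (a ≡ true) ⊎ (b ≡ true)
  ∨-cases {true}  _ = inj₁ refl
  ∨-cases {false} e = inj₂ e

  module Shatter (n : ℕ) where

    open Latin n
    open Triples n

    Square : Set
    Square = Vec Row n

    at : Square → Fin n → Fin n → Fin n
    at R i j = lookup (lookup R i) j

    all-squares : List Square
    all-squares = sift latin (vecs rows n)

    squares-unique : Unique all-squares
    squares-unique = sift-unique latin (vecs-unique (vecs-unique (fin-unique n) n) n)

    inside : Square → Fin n × Fin n × Fin n → Bool
    inside R (i , j , l) = does (at R i j Finₚ.≟ l)

    char : Square → Vec Bool volume
    char R = Vec.tabulate (λ e → inside R (coords e))

    char-at : ∀ R e → lookup (char R) e ≡ inside R (coords e)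
    char-at R e = Vecₚ.lookup∘tabulate (λ e → inside R (coords e)) e

    char-injective : ∀ {R R′} → char R ≡ char R′ → R ≡ R′
    char-injective {R} {R′} e = vec-ext (λ i → vec-ext (λ j → sym (does-true (at R′ i j Finₚ.≟ at R i j)
      (trans (sym (at-idx R′ i j (at R i j))) (trans (cong (λ v → lookup v (idx i j (at R i j))) (sym e))
        (trans (at-idx R i j (at R i j)) (does-yes (at R i j Finₚ.≟ at R i j) refl)))))))
      where
      at-idx : ∀ R i j l → lookup (char R) (idx i j l) ≡ does (at R i j Finₚ.≟ l)
      at-idx R i j l = trans (char-at R (idx i j l)) (cong (inside R) (coords-idx i j l))

    open DecMem (Vecₚ.≡-dec {n = volume} Boolₚ._≟_) using (_∈?_)

    family : Vec Bool volume → Bool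
    family W = does (W ∈? map char all-squares)

    family-square : ∀ {W} → family W ≡ true → ∃ λ R → latin R ≡ true × W ≡ char R
    family-square {W} h with R , R∈ , e ← Mem.∈-map⁻ char (does-true (W ∈? map char all-squares) h) =
      R , proj₂ (∈-sift⁻ latin {vecs rows n} R∈) , e

    family-count : count n ≤ ∑ (cube volume) (λ W → ⟦ family W ⟧)
    family-count = subst₂ _≤_ (length-sift latin (vecs rows n)) (length-sift family (cube volume))
      (inject-length (λ R W → char R ≡ W) squares-unique
        (λ {R} R∈ → char R , ∈-sift⁺ family (∈-cube (char R)) (does-yes (char R ∈? _) (Mem.∈-map⁺ char R∈)) , refl)
        (λ _ _ p q → char-injective (trans p (sym q))))

    shattered : Vec Bool volume → Bool
    shattered = compress family

    to-latin : ∀ R → latin R ≡ true → LatinSquare n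
    to-latin R h = record
      { entry = at R
      ; rows = λ i → rows-inj R h i , λ c → let j , e = fin-surjective (at R i) (rows-inj R h i) c in j , λ { refl → e }
      ; cols = λ j → cols-inj R h j , λ c → let i , e = fin-surjective (λ i → at R i j) (cols-inj R h j) c in i , λ { refl → e } }

    -- The full trace is realised, so `Y` lies in one Latin square, where two triples agreeing in
    -- two coordinates are equal.
    shattered-independent : ∀ Y → shattered Y ≡ true → Independent Y
    shattered-independent Y h {e} {f} e∈ f∈ with compress-shattered family Y h (Vec.replicate volume true)
    ... | W , w , agrees with family-square w
    ... | R , lat , refl with bool-cases (conf e f)
    ...   | inj₂ c = c
    ...   | inj₁ c = ⊥-elim (does-false (e Finₚ.≟ f) (not-true (proj₁ (∧-true c))) (trans (sym (idx-coords e)) (trans (cong idx′ equal) (idx-coords f))))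
      where
      place : ∀ {e} → lookup Y e ≡ true → at R (proj₁ (coords e)) (proj₁ (proj₂ (coords e))) ≡ proj₂ (proj₂ (coords e))
      place {e} y = does-true (at R _ _ Finₚ.≟ _) (trans (sym (char-at R e)) (trans (agrees e y) (Vecₚ.lookup-replicate e true)))
      i = proj₁ (coords e)
      j = proj₁ (proj₂ (coords e))
      l = proj₂ (proj₂ (coords e))
      i′ = proj₁ (coords f)
      j′ = proj₁ (proj₂ (coords f))
      l′ = proj₂ (proj₂ (coords f))
      eq : ∀ {a b : Fin n} → does (a Finₚ.≟ b) ≡ true → a ≡ b
      eq {a} {b} = does-true (a Finₚ.≟ b)
      by-ij : i ≡ i′ → j ≡ j′ → coords e ≡ coords f
      by-ij p q = cong₂ _,_ p (cong₂ _,_ q (trans (sym (place e∈)) (trans (cong₂ (at R) p q) (place f∈))))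
      by-jl : j ≡ j′ → l ≡ l′ → coords e ≡ coords f
      by-jl p q = by-ij (cols-inj R lat j (trans (place e∈) (trans q (trans (sym (place f∈)) (cong (at R i′) (sym p)))))) p
      by-li : l ≡ l′ → i ≡ i′ → coords e ≡ coords f
      by-li p q = by-ij q (rows-inj R lat i (trans (place e∈) (trans p (trans (sym (place f∈)) (cong (λ z → at R z j′) (sym q))))))
      equal : coords e ≡ coords f
      equal with ∨-cases {same i i′ ∧ same j j′} (proj₂ (∧-true {not (does (e Finₚ.≟ f))} c))
      ... | inj₁ s = by-ij (eq (proj₁ (∧-true s))) (eq (proj₂ (∧-true {same i i′} s)))
      ... | inj₂ s with ∨-cases {same j j′ ∧ same l l′} s
      ...   | inj₁ t = by-jl (eq (proj₁ (∧-true t))) (eq (proj₂ (∧-true {same j j′} t)))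
      ...   | inj₂ t = by-li (eq (proj₁ (∧-true t))) (eq (proj₂ (∧-true {same l l′} t)))

    -- The first m positions of `Y` are listed. A trace prescribed on them is extended by false to
    -- the remaining triples.
    vc-dim : ∀ Y → shattered Y ≡ true → ∀ m → m ≤ card (lookup Y) → VCdimAtLeast n m
    vc-dim Y h m le = S , distinct , shatters
      where
      positions : List (Fin volume)
      positions = sift (lookup Y) (allFin volume)
      pos-unique : Unique positions
      pos-unique = sift-unique (lookup Y) (fin-unique volume)
      le′ : m ≤ length positions
      le′ = ≤-trans le (≤-reflexive (sym (length-sift (lookup Y) (allFin volume))))
      g : Fin m → Fin volume
      g a = List.lookup positions (Fin.inject≤ a le′)
      g-inj : ∀ {a b} → g a ≡ g b → a ≡ b
      g-inj e = Finₚ.inject≤-injective le′ le′ _ _ (lookup-injective pos-unique e)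
      g-Y : ∀ a → lookup Y (g a) ≡ true
      g-Y a = proj₂ (∈-sift⁻ (lookup Y) {allFin volume} (Mem.∈-lookup (Fin.inject≤ a le′)))
      S : Vec (Triple n) m
      S = Vec.tabulate (λ a → coords (g a))
      S-at : ∀ a → lookup S a ≡ coords (g a)
      S-at = Vecₚ.lookup∘tabulate (λ a → coords (g a))
      distinct : Distinct S
      distinct a b e = g-inj (trans (sym (idx-coords (g a))) (trans (cong idx′ (trans (sym (S-at a)) (trans e (S-at b)))) (idx-coords (g b))))
      shatters : Shattered S
      shatters t = to-latin R lat , λ a → mk⇔ (to a) (from a)
        where
        chosen : ∀ e → Dec (∃ λ a → g a ≡ e × t a ≡ true)
        chosen e = Finₚ.any? (λ a → (g a Finₚ.≟ e) ×-dec (t a Boolₚ.≟ true))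
        T : Vec Bool volume
        T = Vec.tabulate (λ e → does (chosen e))
        W = compress-shattered family Y h T
        sq = family-square (proj₁ (proj₂ W))
        R = proj₁ sq
        lat = proj₁ (proj₂ sq)
        value : ∀ a → inside R (coords (g a)) ≡ does (chosen (g a))
        value a = trans (sym (char-at R (g a))) (trans (cong (λ V → lookup V (g a)) (sym (proj₂ (proj₂ sq))))
          (trans (proj₂ (proj₂ W) (g a) (g-Y a)) (Vecₚ.lookup∘tabulate (λ e → does (chosen e)) (g a))))
        to : ∀ a → lookup S a ∈L to-latin R lat → t a ≡ true
        to a p with b , e , q ← does-true (chosen (g a)) (trans (sym (value a)) (does-yes (at R _ _ Finₚ.≟ _) (subst (_∈L to-latin R lat) (S-at a) p)))
          = trans (cong t (sym (g-inj e))) q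
        from : ∀ a → t a ≡ true → lookup S a ∈L to-latin R lat
        from a q = subst (_∈L to-latin R lat) (sym (S-at a)) (does-true (at R _ _ Finₚ.≟ _) (trans (value a) (does-yes (chosen (g a)) (a , refl , q))))

    vc-or-few : ∀ m → VCdimAtLeast n m ⊎
                (count n ≤ ∑ (List.upTo m) (λ k → ∑ (cube volume) (λ Y → ⟦ shattered Y ∧ (card (lookup Y) == k) ⟧)))
    vc-or-few m with ∑ (cube volume) (λ Y → ⟦ shattered Y ∧ does (m ≤? card (lookup Y)) ⟧) in eq
    ... | suc _ with Y , _ , p ← ∑-positive (cube volume) (λ Y → ⟦ shattered Y ∧ does (m ≤? card (lookup Y)) ⟧) (subst (0 <_) (sym eq) (s≤s z≤n)) =
      let s , c = ∧-true (⟦⟧-true p) in inj₁ (vc-dim Y s m (does-true (m ≤? card (lookup Y)) c))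
    ... | zero = inj₂ (begin
      count n                                           ≤⟨ family-count ⟩
      ∑ (cube volume) (λ Y → ⟦ family Y ⟧)              ≡⟨ compress-count volume family ⟨
      ∑ (cube volume) (λ Y → ⟦ shattered Y ⟧)           ≤⟨ ∑-mono′ (cube volume) small ⟩
      ∑ (cube volume) (λ Y → ∑ (List.upTo m) (λ k → ⟦ shattered Y ∧ (card (lookup Y) == k) ⟧))
                                                        ≡⟨ ∑-swap (cube volume) (List.upTo m) _ ⟩
      ∑ (List.upTo m) (λ k → ∑ (cube volume) (λ Y → ⟦ shattered Y ∧ (card (lookup Y) == k) ⟧)) ∎)
      where
      open ≤-Reasoning
      small : ∀ Y → ⟦ shattered Y ⟧ ≤ ∑ (List.upTo m) (λ k → ⟦ shattered Y ∧ (card (lookup Y) == k) ⟧)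
      small Y with bool-cases (shattered Y)
      ... | inj₂ e = ≤-trans (≤-reflexive (cong ⟦_⟧ e)) z≤n
      ... | inj₁ e = ≤-trans (≤-reflexive (trans (cong ⟦_⟧ e) (cong ⟦_⟧ (sym (∧-intro e (does-yes (card (lookup Y) ℕ.≟ card (lookup Y)) refl))))))
                       (∑-member (Mem.∈-upTo⁺ (≰⇒> not-large)) (λ k → ⟦ shattered Y ∧ (card (lookup Y) == k) ⟧))
        where
        not-large : ¬ (m ≤ card (lookup Y))
        not-large le = <⇒≱ (s≤s z≤n) (≤-trans (≤-trans (≤-reflexive (cong ⟦_⟧ (sym (∧-intro e (does-yes (m ≤? card (lookup Y)) le)))))
          (∑-member (∈-cube Y) (λ Y → ⟦ shattered Y ∧ does (m ≤? card (lookup Y)) ⟧))) (≤-reflexive eq))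

  -- Powers and factorials

  -- Bernoulli's inequality (1 + 1/x)^m ≥ 1 + m/x, with denominators cleared.
  bernoulli : ∀ x m → x ^ m * (x + m) ≤ suc x ^ m * x
  bernoulli x zero    = ≤-reflexive (cong (_+ 0) (+-identityʳ x))
  bernoulli x (suc m) = begin
    x * x ^ m * (x + suc m)                       ≤⟨ m≤m+n _ (x ^ m * m) ⟩
    x * x ^ m * (x + suc m) + x ^ m * m           ≡⟨ identity x (x ^ m) m ⟩
    suc x * (x ^ m * (x + m))                     ≤⟨ *-monoʳ-≤ (suc x) (bernoulli x m) ⟩
    suc x * (suc x ^ m * x)                       ≡⟨ *-assoc (suc x) (suc x ^ m) x ⟨
    suc x * suc x ^ m * x                         ∎
    where
    open ≤-Reasoning
    identity : ∀ x p m → x * p * (x + (1 + m)) + p * m ≡ (1 + x) * (p * (x + m))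
    identity = solve-∀

  -- The form (1 - 1/(x + 1))^m ≥ 1 - m/(x + 1), with the subtracted term moved to the other side.
  bernoulli⁻ : ∀ x m → suc x ^ m * suc x ≤ x ^ m * suc x + m * suc x ^ m
  bernoulli⁻ x zero    = m≤m+n _ 0
  bernoulli⁻ x (suc m) = begin
    suc x * suc x ^ m * suc x                                     ≡⟨ *-assoc (suc x) (suc x ^ m) (suc x) ⟩
    suc x * (suc x ^ m * suc x)                                   ≤⟨ *-monoʳ-≤ (suc x) (bernoulli⁻ x m) ⟩
    suc x * (x ^ m * suc x + m * suc x ^ m)                       ≡⟨ identity x (x ^ m) m (suc x ^ m) ⟩
    x * x ^ m * suc x + (x ^ m * suc x + m * (suc x * suc x ^ m)) ≤⟨ +-monoʳ-≤ (x * x ^ m * suc x) (+-monoˡ-≤ _ (≤-trans (*-monoˡ-≤ (suc x) (^-monoˡ-≤ m (n≤1+n x))) (≤-reflexive (*-comm (suc x ^ m) (suc x))))) ⟩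
    x * x ^ m * suc x + (suc x * suc x ^ m + m * (suc x * suc x ^ m)) ∎
    where
    open ≤-Reasoning
    identity : ∀ x p m s → (1 + x) * (p * (1 + x) + m * s) ≡ x * p * (1 + x) + (p * (1 + x) + m * ((1 + x) * s))
    identity = solve-∀

  square-pow : ∀ x m → (x * x) ^ m ≡ x ^ m * x ^ m
  square-pow x m = *-^ x x m

  -- (1 + 1/j)^(j+1) decreases in j.
  upper-step : ∀ j → suc (suc j) ^ suc (suc j) * j ^ suc j ≤ suc j ^ suc (suc j) * suc j ^ suc j
  upper-step zero    = ≤-trans (≤-reflexive (*-zeroʳ (2 ^ 2))) z≤n
  upper-step j@(suc _) = *-cancelʳ-≤ _ _ (suc j * j) (begin
    suc (suc j) ^ m * j ^ suc j * (suc j * j)              ≡⟨ identity₁ (suc (suc j) ^ m) (j ^ suc j) j ⟩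
    suc j * (j ^ m * suc (suc j) ^ m)                      ≡⟨ cong (suc j *_) (*-^ j (suc (suc j)) m) ⟨
    suc j * (j * suc (suc j)) ^ m                          ≤⟨ *-cancelʳ-≤ _ _ (suc (suc j)) step ⟩
    j * (suc j * suc j) ^ m                                ≡⟨ cong (j *_) (square-pow (suc j) m) ⟩
    j * (suc j ^ m * (suc j * suc j ^ suc j))              ≡⟨ identity₂ j (suc j ^ m) (suc j ^ suc j) ⟩
    suc j ^ m * suc j ^ suc j * (suc j * j)                ∎)
    where
    open ≤-Reasoning
    m = suc (suc j)
    identity₁ : ∀ p r j → p * r * ((1 + j) * j) ≡ (1 + j) * (j * r * p)
    identity₁ = solve-∀
    identity₂ : ∀ j p r → j * (p * ((1 + j) * r)) ≡ p * r * ((1 + j) * j)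
    identity₂ = solve-∀
    step : suc j * (j * suc (suc j)) ^ m * suc (suc j) ≤ j * (suc j * suc j) ^ m * suc (suc j)
    step = begin
      suc j * (j * suc (suc j)) ^ m * suc (suc j)          ≡⟨ identity₃ j ((j * suc (suc j)) ^ m) ⟩
      (j * suc (suc j)) ^ m * (j * suc (suc j) + m)        ≤⟨ bernoulli (j * suc (suc j)) m ⟩
      suc (j * suc (suc j)) ^ m * (j * suc (suc j))        ≡⟨ cong (λ w → w ^ m * (j * suc (suc j))) (identity₄ j) ⟩
      (suc j * suc j) ^ m * (j * suc (suc j))              ≡⟨ identity₅ ((suc j * suc j) ^ m) j ⟩
      j * (suc j * suc j) ^ m * suc (suc j)                ∎
      where
      identity₃ : ∀ j p → (1 + j) * p * (2 + j) ≡ p * (j * (2 + j) + (2 + j))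
      identity₃ = solve-∀
      identity₄ : ∀ j → 1 + j * (2 + j) ≡ (1 + j) * (1 + j)
      identity₄ = solve-∀
      identity₅ : ∀ p j → p * (j * (2 + j)) ≡ j * p * (2 + j)
      identity₅ = solve-∀

  -- (1 + 1/j)^j increases in j.
  lower-step : ∀ j → suc j ^ j * suc j ^ suc j ≤ suc (suc j) ^ suc j * j ^ j
  lower-step zero    = ≤-trans (≤-reflexive refl) (n≤1+n 1)
  lower-step j@(suc _) = *-cancelʳ-≤ _ _ (suc j * j) (begin
    suc j ^ j * suc j ^ m * (suc j * j)                   ≡⟨ identity₁ (suc j ^ j) (suc j ^ m) j ⟩
    j * (suc j ^ m * suc j ^ m)                           ≡⟨ cong (j *_) (square-pow (suc j) m) ⟨
    j * (suc j * suc j) ^ m                               ≤⟨ *-cancelʳ-≤ _ _ (suc j) step ⟩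
    suc j * (j * suc (suc j)) ^ m                         ≡⟨ cong (suc j *_) (*-^ j (suc (suc j)) m) ⟩
    suc j * (j * j ^ j * suc (suc j) ^ m)                 ≡⟨ identity₂ j (j ^ j) (suc (suc j) ^ m) ⟩
    suc (suc j) ^ m * j ^ j * (suc j * j)                 ∎)
    where
    open ≤-Reasoning
    m = suc j
    x = j * suc (suc j)
    x≡ : suc x ≡ suc j * suc j
    x≡ = lemma j
      where
      lemma : ∀ j → 1 + j * (2 + j) ≡ (1 + j) * (1 + j)
      lemma = solve-∀
    identity₁ : ∀ p r j → p * r * ((1 + j) * j) ≡ j * ((1 + j) * p * r)
    identity₁ = solve-∀
    identity₂ : ∀ j p r → (1 + j) * (j * p * r) ≡ r * p * ((1 + j) * j)
    identity₂ = solve-∀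
    step : j * (suc j * suc j) ^ m * suc j ≤ suc j * x ^ m * suc j
    step = +-cancelʳ-≤ (m * (suc j * suc j) ^ m) _ _ (begin
      j * (suc j * suc j) ^ m * suc j + m * (suc j * suc j) ^ m   ≡⟨ identity₃ j ((suc j * suc j) ^ m) ⟩
      (suc j * suc j) ^ m * (suc j * suc j)                       ≡⟨ cong (λ w → w ^ m * w) x≡ ⟨
      suc x ^ m * suc x                                           ≤⟨ bernoulli⁻ x m ⟩
      x ^ m * suc x + m * suc x ^ m                               ≡⟨ cong (λ w → x ^ m * w + m * w ^ m) x≡ ⟩
      x ^ m * (suc j * suc j) + m * (suc j * suc j) ^ m           ≡⟨ cong (_+ m * (suc j * suc j) ^ m) (identity₄ (x ^ m) j) ⟩
      suc j * x ^ m * suc j + m * (suc j * suc j) ^ m             ∎)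
      where
      identity₃ : ∀ j p → j * p * (1 + j) + (1 + j) * p ≡ p * ((1 + j) * (1 + j))
      identity₃ = solve-∀
      identity₄ : ∀ p j → p * ((1 + j) * (1 + j)) ≡ (1 + j) * p * (1 + j)
      identity₄ = solve-∀

  pos^ : ∀ x k → 0 < suc x ^ k
  pos^ x k = m^n>0 (suc x) k

  pos-self : ∀ x → 0 < x ^ x
  pos-self zero    = s≤s z≤n
  pos-self (suc x) = pos^ x (suc x)

  -- Reads a/b ≤ c/d and c/d ≤ e/f with denominators cleared.
  frac-trans : ∀ {a b c d e f} → 0 < d → a * d ≤ c * b → c * f ≤ e * d → a * f ≤ e * b
  frac-trans {a} {b} {c} {d} {e} {f} 0<d p q = *-cancelʳ-≤ _ _ d {{ℕ.>-nonZero 0<d}} (begin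
    a * f * d      ≡⟨ xy∙z≈xz∙y a f d ⟩
    a * d * f      ≤⟨ *-monoˡ-≤ f p ⟩
    c * b * f      ≡⟨ xy∙z≈xz∙y c b f ⟩
    c * f * b      ≤⟨ *-monoˡ-≤ b q ⟩
    e * d * b      ≡⟨ xy∙z≈xz∙y e d b ⟩
    e * b * d      ∎)
    where
    open ≤-Reasoning

  upper-mono : ∀ j d → 0 < j → suc (d + j) ^ suc (d + j) * j ^ suc j ≤ suc j ^ suc j * (d + j) ^ suc (d + j)
  upper-mono j zero    0<j = ≤-refl
  upper-mono j (suc d) 0<j = frac-trans {suc (suc (d + j)) ^ suc (suc (d + j))} {suc (d + j) ^ suc (suc (d + j))} {suc (d + j) ^ suc (d + j)} {(d + j) ^ suc (d + j)} {suc j ^ suc j} {j ^ suc j}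
    (m^n>0 (d + j) {{ℕ.>-nonZero (≤-trans 0<j (m≤n+m j d))}} (suc (d + j)))
    (≤-trans (upper-step (d + j)) (≤-reflexive (*-comm (suc (d + j) ^ suc (suc (d + j))) _))) (upper-mono j d 0<j)

  lower-mono : ∀ j d → suc j ^ j * (d + j) ^ (d + j) ≤ suc (d + j) ^ (d + j) * j ^ j
  lower-mono j zero    = ≤-refl
  lower-mono j (suc d) = frac-trans {suc j ^ j} {j ^ j} {suc (d + j) ^ (d + j)} {(d + j) ^ (d + j)} {suc (suc (d + j)) ^ suc (d + j)} {suc (d + j) ^ suc (d + j)}
    (pos-self (d + j)) (lower-mono j d) (lower-step (d + j))

  -- E = a/b approximates e from above.
  module Euler (V : ℕ) (0<V : 0 < V) where

    a b : ℕ
    a = suc V ^ suc V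
    b = V ^ suc V

    0<b : 0 < b
    0<b = m^n>0 V {{ℕ.>-nonZero 0<V}} (suc V)

    0<a : 0 < a
    0<a = pos^ V (suc V)

    b≤a : b ≤ a
    b≤a = ^-monoˡ-≤ (suc V) (n≤1+n V)

    E≤upper : ∀ j → 0 < j → j ≤ V → a * j ^ suc j ≤ suc j ^ suc j * b
    E≤upper j 0<j j≤V = subst (λ v → suc v ^ suc v * j ^ suc j ≤ suc j ^ suc j * v ^ suc v) (m∸n+n≡m j≤V) (upper-mono j (V ∸ j) 0<j)

    E≤4 : a ≤ 4 * b
    E≤4 = ≤-trans (≤-reflexive (sym (*-identityʳ a))) (E≤upper 1 (s≤s z≤n) 0<V)

    lower≤E : ∀ j → suc j ^ j * b ≤ a * j ^ j
    lower≤E j with ≤-total j V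
    ... | inj₁ j≤V = begin
      suc j ^ j * (V * V ^ V)        ≡⟨ x∙yz≈y∙xz (suc j ^ j) V _ ⟩
      V * (suc j ^ j * V ^ V)        ≤⟨ *-monoʳ-≤ V (subst (λ v → suc j ^ j * v ^ v ≤ suc v ^ v * j ^ j) (m∸n+n≡m j≤V) (lower-mono j (V ∸ j))) ⟩
      V * (suc V ^ V * j ^ j)        ≤⟨ *-monoˡ-≤ _ (n≤1+n V) ⟩
      suc V * (suc V ^ V * j ^ j)    ≡⟨ *-assoc (suc V) (suc V ^ V) (j ^ j) ⟨
      a * j ^ j                      ∎
      where
      open ≤-Reasoning
    ... | inj₂ V≤j = *-cancelʳ-≤ _ _ j {{ℕ.>-nonZero (≤-trans 0<V V≤j)}} (begin
      suc j ^ j * b * j              ≤⟨ *-monoʳ-≤ (suc j ^ j * b) (n≤1+n j) ⟩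
      suc j ^ j * b * suc j          ≡⟨ xy∙z≈zx∙y (suc j ^ j) b (suc j) ⟩
      suc j ^ suc j * b              ≤⟨ subst (λ v → suc v ^ suc v * V ^ suc V ≤ suc V ^ suc V * v ^ suc v) (m∸n+n≡m V≤j) (upper-mono V (j ∸ V) 0<V) ⟩
      a * (j * j ^ j)                ≡⟨ x∙yz≈xz∙y a j (j ^ j) ⟩
      a * j ^ j * j                  ∎)
      where
      open ≤-Reasoning

    -- N^N / N! is the product of (1 + 1/j)^j over 0 < j < N, and every factor is at most E.
    power≤factorial : ∀ N → N ^ N * b ^ N ≤ a ^ N * N !
    power≤factorial zero    = ≤-refl
    power≤factorial (suc N) = *-cancelʳ-≤ _ _ (N ^ N) {{ℕ.>-nonZero (pos-self N)}} (begin
      suc N * suc N ^ N * (b * b ^ N) * N ^ N           ≡⟨ identity₁ (suc N) (suc N ^ N) b (b ^ N) (N ^ N) ⟩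
      suc N * (suc N ^ N * b) * (N ^ N * b ^ N)         ≤⟨ *-mono-≤ (*-monoʳ-≤ (suc N) (lower≤E N)) (power≤factorial N) ⟩
      suc N * (a * N ^ N) * (a ^ N * N !)               ≡⟨ identity₂ (suc N) a (N ^ N) (a ^ N) (N !) ⟩
      a * a ^ N * (suc N * N !) * N ^ N                 ∎)
      where
      open ≤-Reasoning
      identity₁ : ∀ s p b q r → s * p * (b * q) * r ≡ s * (p * b) * (r * q)
      identity₁ = solve-∀
      identity₂ : ∀ s a r p f → s * (a * r) * (p * f) ≡ a * p * (s * f) * r
      identity₂ = solve-∀

    -- With k = i + 1, the product of (1 + 1/j)^(j+1) over 0 < j < k is k^k / (k - 1)!. Each factor
    -- is at least E, as j ≤ V.
    factorial≤power⁺ : ∀ i → suc i ≤ V → suc i ! * a ^ suc i * b ≤ suc i ^ suc i * b ^ suc i * (suc i * a)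
    factorial≤power⁺ zero    le = ≤-reflexive (identity a b)
      where
      identity : ∀ a b → 1 * (a * 1) * b ≡ 1 * (b * 1) * (1 * a)
      identity = solve-∀
    factorial≤power⁺ (suc i) le = *-cancelʳ-≤ _ _ (j ^ suc j) {{ℕ.>-nonZero (pos^ i (suc j))}} (begin
      suc j * j ! * (a * a ^ j) * b * j ^ suc j                    ≡⟨ identity₁ (suc j) (j !) a (a ^ j) b (j ^ suc j) ⟩
      suc j * (j ! * a ^ j * b) * (a * j ^ suc j)                  ≤⟨ *-mono-≤ (*-monoʳ-≤ (suc j) (factorial≤power⁺ i (<⇒≤ le))) (E≤upper j (s≤s z≤n) (<⇒≤ le)) ⟩
      suc j * (j ^ j * b ^ j * (j * a)) * (suc j ^ suc j * b)      ≡⟨ identity₂ (suc j) (j ^ j) (b ^ j) j a (suc j ^ suc j) b ⟩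
      suc j ^ suc j * (b * b ^ j) * (suc j * a) * j ^ suc j        ∎)
      where
      open ≤-Reasoning
      j = suc i
      identity₁ : ∀ s f a p b r → s * f * (a * p) * b * r ≡ s * (f * p * b) * (a * r)
      identity₁ = solve-∀
      identity₂ : ∀ s r q j a t b → s * (r * q * (j * a)) * (t * b) ≡ t * (b * q) * (s * a) * (j * r)
      identity₂ = solve-∀

    factorial≤power : ∀ k → k ≤ V → k ! * a ^ k * b ≤ k ^ k * b ^ k * (suc k * a)
    factorial≤power zero    le = ≤-trans (≤-reflexive (+-identityʳ b)) (≤-trans b≤a (≤-reflexive (sym (trans (+-identityʳ _) (+-identityʳ a)))))
    factorial≤power (suc i) le = ≤-trans (factorial≤power⁺ i le) (*-monoʳ-≤ (suc i ^ suc i * b ^ suc i) (*-monoˡ-≤ a (n≤1+n (suc i))))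

  -- Extraction of roots, and Latin squares bounded from below

  ^-cancel-≤ : ∀ x y N → 0 < N → x ^ N ≤ y ^ N → x ≤ y
  ^-cancel-≤ x y (suc N) 0<N h = ≮⇒≥ (λ y<x → <⇒≱ (^-monoˡ-< (suc N) y<x) h)

  n<2^n : ∀ n → suc n ≤ 2 ^ n
  n<2^n zero    = ≤-refl
  n<2^n (suc n) = ≤-trans (+-mono-≤ {1} {2 ^ n} (m^n>0 2 n) (n<2^n n)) (≤-reflexive (cong (2 ^ n +_) (sym (+-identityʳ _))))

  tower : ∀ W → ∃ λ t → suc (2 ^ t) ^ W ≤ 2 ^ (2 ^ t)
  -- As 2^t + 1 ≤ 2^(t+1), it suffices that (t + 1)W ≤ 2^t, which follows from (W + 1)³ ≤ 2^(3W).
  tower W = 3 * W , (begin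
    suc (2 ^ t) ^ W              ≤⟨ ^-monoˡ-≤ W (≤-trans (+-monoˡ-≤ (2 ^ t) (m^n>0 2 t)) (≤-reflexive (cong (2 ^ t +_) (sym (+-identityʳ _))))) ⟩
    (2 ^ suc t) ^ W              ≡⟨ ^-*-assoc 2 (suc t) W ⟩
    2 ^ (suc t * W)              ≤⟨ ^-monoʳ-≤ 2 exponent ⟩
    2 ^ (2 ^ t)                  ∎)
    where
    open ≤-Reasoning
    t = 3 * W
    exponent : suc t * W ≤ 2 ^ t
    exponent = begin
      suc t * W                                 ≤⟨ m≤m+n _ (W * (W * W) + 2 * W + 1) ⟩
      suc t * W + (W * (W * W) + 2 * W + 1)     ≡⟨ identity W ⟩
      suc W * (suc W * (suc W * 1))             ≤⟨ ^-monoˡ-≤ 3 (n<2^n W) ⟩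
      (2 ^ W) ^ 3                               ≡⟨ ^-*-assoc 2 W 3 ⟩
      2 ^ (W * 3)                               ≡⟨ cong (2 ^_) (*-comm W 3) ⟩
      2 ^ t                                     ∎
      where
      identity : ∀ W → (1 + 3 * W) * W + (W * (W * W) + 2 * W + 1) ≡ (1 + W) * ((1 + W) * ((1 + W) * 1))
      identity = solve-∀

  -- N is so large that the subexponential factor (N + 1)^(n³) is at most 2^N, so the N-th root of
  -- `Latin.latin-count` loses only a factor 2. One factor E comes from n!, the other from N!.
  latin-lower : ∀ n (0<V : 0 < n * n) → let open Euler (n * n) 0<V in
                (n * (b * b)) ^ (n * n) ≤ 2 * Latin.count n n * (a * a) ^ (n * n)
  latin-lower n 0<V = ^-cancel-≤ _ _ N (m^n>0 2 t) (*-cancelʳ-≤ _ _ (((N ^ N) ^ n) ^ n) {{ℕ.>-nonZero (pos (m^n>0 N {{ℕ.>-nonZero (m^n>0 2 t)}} N))}} (begin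
    ((n * (b * b)) ^ V) ^ N * ((N ^ N) ^ n) ^ n
      ≡⟨ cong₂ _*_ split-left (^-*-assoc (N ^ N) n n) ⟩
    ((n ^ n * b ^ n) ^ (n * N) * (b ^ N) ^ V) * (N ^ N) ^ V
      ≡⟨ trans (*-assoc ((n ^ n * b ^ n) ^ (n * N)) _ _) (cong ((n ^ n * b ^ n) ^ (n * N) *_) (trans (*-comm ((b ^ N) ^ V) _) (sym (*-^ (N ^ N) (b ^ N) V)))) ⟩
    (n ^ n * b ^ n) ^ (n * N) * (N ^ N * b ^ N) ^ V
      ≤⟨ *-mono-≤ (^-monoˡ-≤ (n * N) (power≤factorial n)) (^-monoˡ-≤ V (power≤factorial N)) ⟩
    (a ^ n * n !) ^ (n * N) * (a ^ N * N !) ^ V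
      ≡⟨ split-right ⟩
    ((a * a) ^ V) ^ N * (((n !) ^ N) ^ n * ((N !) ^ n) ^ n)
      ≤⟨ *-monoʳ-≤ (((a * a) ^ V) ^ N) (Latin.latin-count n t) ⟩
    ((a * a) ^ V) ^ N * (((suc N ^ n) ^ n * (N ^ N) ^ n) ^ n * C ^ N)
      ≡⟨ cong (λ z → ((a * a) ^ V) ^ N * (z * C ^ N)) (*-^ ((suc N ^ n) ^ n) ((N ^ N) ^ n) n) ⟩
    ((a * a) ^ V) ^ N * (((suc N ^ n) ^ n) ^ n * ((N ^ N) ^ n) ^ n * C ^ N)
      ≤⟨ *-monoʳ-≤ (((a * a) ^ V) ^ N) (*-monoˡ-≤ (C ^ N) (*-monoˡ-≤ (((N ^ N) ^ n) ^ n) small)) ⟩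
    ((a * a) ^ V) ^ N * (2 ^ N * ((N ^ N) ^ n) ^ n * C ^ N)
      ≡⟨ shuffle (((a * a) ^ V) ^ N) (2 ^ N) (((N ^ N) ^ n) ^ n) (C ^ N) ⟩
    2 ^ N * C ^ N * ((a * a) ^ V) ^ N * ((N ^ N) ^ n) ^ n
      ≡⟨ cong (_* ((N ^ N) ^ n) ^ n) (sym (trans (*-^ (2 * C) ((a * a) ^ V) N) (cong (_* ((a * a) ^ V) ^ N) (*-^ 2 C N)))) ⟩
    (2 * C * (a * a) ^ V) ^ N * ((N ^ N) ^ n) ^ n ∎))
    where
    open ≤-Reasoning
    open Euler (n * n) 0<V
    V = n * n
    C = Latin.count n n
    t = proj₁ (tower (n * n * n))
    N = 2 ^ t
    pos : ∀ {x} → 0 < x → 0 < (x ^ n) ^ n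
    pos {suc x} _ = m^n>0 (suc x ^ n) {{ℕ.>-nonZero (pos^ x n)}} n
    small : ((suc N ^ n) ^ n) ^ n ≤ 2 ^ N
    small = ≤-trans (≤-reflexive (trans (cong (_^ n) (^-*-assoc (suc N) n n)) (^-*-assoc (suc N) (n * n) n))) (proj₂ (tower (n * n * n)))
    shuffle : ∀ p q r s → p * (q * r * s) ≡ q * s * p * r
    shuffle = solve-∀
    e₁ : ∀ n N → n * (n * N) ≡ n * n * N
    e₁ = solve-∀
    e₂ : ∀ n N → N * (n * n) ≡ n * n * N
    e₂ = solve-∀
    split-left : ((n * (b * b)) ^ V) ^ N ≡ (n ^ n * b ^ n) ^ (n * N) * (b ^ N) ^ V
    split-left = trans (^-*-assoc (n * (b * b)) V N) (trans (cong (_^ (V * N)) (sym (*-assoc n b b))) (trans (*-^ (n * b) b (V * N))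
      (cong₂ _*_ (trans (cong ((n * b) ^_) (sym (e₁ n N))) (trans (sym (^-*-assoc (n * b) n (n * N))) (cong (_^ (n * N)) (*-^ n b n))))
                 (trans (cong (b ^_) (sym (e₂ n N))) (sym (^-*-assoc b N V))))))
    split-right : (a ^ n * n !) ^ (n * N) * (a ^ N * N !) ^ V ≡ ((a * a) ^ V) ^ N * (((n !) ^ N) ^ n * ((N !) ^ n) ^ n)
    split-right = trans (cong₂ _*_ (*-^ (a ^ n) (n !) (n * N)) (*-^ (a ^ N) (N !) V))
      (trans (*-interchange ((a ^ n) ^ (n * N)) _ ((a ^ N) ^ V) _)
        (cong₂ _*_ (trans (cong₂ _*_ (trans (^-*-assoc a n (n * N)) (cong (a ^_) (e₁ n N))) (trans (^-*-assoc a N V) (cong (a ^_) (e₂ n N))))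
                          (trans (sym (*-^ a a (V * N))) (sym (^-*-assoc (a * a) V N))))
                   (cong₂ _*_ (trans (cong ((n !) ^_) (*-comm n N)) (sym (^-*-assoc (n !) N n))) (sym (^-*-assoc (N !) n n)))))

  -- The explicit bound for triangle decompositions

  module SaturatingBound {M : ℕ} (conf : Fin M → Fin M → Bool) where

    open SaturatingCount conf using () renaming (saturating-count to sat-count)

    -- From β + α i² ≤ α (s + i)²: the product becomes a square of rising factorials at the price of
    -- the shift s.
    rising-bound : ∀ α β (0<β : 0 < β) s → β ≤ α * (s * s) → ∀ k → SaturatingCount.K conf α β 0<β k ≤ α ^ k * (rising k s * rising k s)
    rising-bound α β 0<β s h zero    = ≤-refl
    rising-bound α β 0<β s h (suc k) = begin
      K * (β + α * (suc k * suc k))                                    ≤⟨ *-mono-≤ (rising-bound α β 0<β s h k) (+-monoˡ-≤ _ h) ⟩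
      α ^ k * (r * r) * (α * (s * s) + α * (suc k * suc k))            ≤⟨ *-monoʳ-≤ (α ^ k * (r * r)) (m≤m+n _ (α * (2 * (s * suc k)))) ⟩
      α ^ k * (r * r) * (α * (s * s) + α * (suc k * suc k) + α * (2 * (s * suc k)))  ≡⟨ identity (α ^ k) r α s (suc k) ⟩
      α * α ^ k * (r * (suc k + s) * (r * (suc k + s)))                ∎
      where
      open ≤-Reasoning
      r = rising k s
      K = SaturatingCount.K conf α β 0<β k
      identity : ∀ p r α s k → p * (r * r) * (α * (s * s) + α * (k * k) + α * (2 * (s * k))) ≡ α * p * (r * (k + s) * (r * (k + s)))
      identity = solve-∀

    module _ (V n : ℕ) (0<V : 0 < V) where

      open Euler V 0<V

      private
        F : ℕ → ℕ → ℕ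
        F k s = (suc k * suc k ^ s) * (suc k * suc k ^ s)

      -- Taken with α = n j₁ and β = j₂ k². Then α k³ / β is the assumed bound (j₁/j₂) n k for
      -- `card U`, and (α/β)^k k!² is about (n j₁ / (j₂ e²))^k, because k!/k^k is about e^(-k).
      saturating-bound : ∀ k s j₁ j₂ → k ≤ V → 0 < j₂ → ∀ U (Fam : Vec Bool M → Bool) → (∀ P → Fam P ≡ true → Saturating conf U k P) →
        j₂ * card U ≤ n * j₁ * k → j₂ * (k * k) ≤ n * j₁ * (s * s) →
        ∑ (cube M) (λ P → ⟦ Fam P ⟧) * (j₂ ^ k * (a * a) ^ k * (b * b)) ≤ (n * j₁) ^ k * (b * b) ^ k * (F k s * (a * a))
      -- For k = 0 the choice β = j₂ k² would vanish; here `U` is empty and α = β = 1 serves.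
      saturating-bound zero s j₁ j₂ k≤V 0<j₂ U Fam sat h₁ h₂ = begin
        D * (1 * 1 * (b * b))                           ≡⟨ identity D (b * b) ⟩
        D * 1 * (b * b)                                 ≤⟨ *-mono-≤ (sat-count 1 1 (s≤s z≤n) 0 U Fam sat (≤-reflexive (trans (+-identityʳ _) empty))) (*-mono-≤ b≤a b≤a) ⟩
        1 * (a * a)                                     ≡⟨ units (a * a) ⟩
        1 * 1 * ((1 * 1) * (1 * 1) * (a * a))           ≡⟨ cong (λ z → 1 * 1 * ((1 * z) * (1 * z) * (a * a))) (^-zeroˡ s) ⟨
        1 * 1 * (F 0 s * (a * a))                       ∎
        where
        open ≤-Reasoning
        D = ∑ (cube M) (λ P → ⟦ Fam P ⟧)
        identity : ∀ d b → d * (1 * 1 * b) ≡ d * 1 * b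
        identity = solve-∀
        units : ∀ x → 1 * x ≡ 1 * 1 * ((1 * 1) * (1 * 1) * x)
        units = solve-∀
        empty : card U ≡ 0
        empty = n≤0⇒n≡0 (*-cancelˡ-≤ j₂ {{ℕ.>-nonZero 0<j₂}} (≤-trans h₁ (≤-reflexive (trans (*-zeroʳ (n * j₁)) (sym (*-zeroʳ j₂))))))
      saturating-bound k@(suc k′) s j₁ j₂ k≤V 0<j₂ U Fam sat h₁ h₂ = *-cancelʳ-≤ _ _ ((k * k) ^ k) {{ℕ.>-nonZero (m^n>0 (k * k) k)}} (begin
        D * (j₂ ^ k * (a * a) ^ k * (b * b)) * (k * k) ^ k
          ≡⟨ identity₁ D (j₂ ^ k) ((a * a) ^ k) (b * b) ((k * k) ^ k) ⟩
        D * (j₂ ^ k * (k * k) ^ k) * ((a * a) ^ k * (b * b))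
          ≡⟨ cong (λ z → D * z * ((a * a) ^ k * (b * b))) (*-^ j₂ (k * k) k) ⟨
        D * (j₂ * (k * k)) ^ k * ((a * a) ^ k * (b * b))
          ≤⟨ *-monoˡ-≤ ((a * a) ^ k * (b * b)) (≤-trans (sat-count (n * j₁) (j₂ * (k * k)) 0<β k U Fam sat room) (≤-trans (rising-bound (n * j₁) (j₂ * (k * k)) 0<β s h₂ k) (*-monoʳ-≤ ((n * j₁) ^ k) (*-mono-≤ (rising-≤ k s) (rising-≤ k s))))) ⟩
        (n * j₁) ^ k * (k ! * suc k ^ s * (k ! * suc k ^ s)) * ((a * a) ^ k * (b * b))
          ≡⟨ cong (λ z → (n * j₁) ^ k * (k ! * suc k ^ s * (k ! * suc k ^ s)) * (z * (b * b))) (*-^ a a k) ⟩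
        (n * j₁) ^ k * (k ! * suc k ^ s * (k ! * suc k ^ s)) * (a ^ k * a ^ k * (b * b))
          ≡⟨ identity₂ ((n * j₁) ^ k) (k !) (suc k ^ s) (a ^ k) b ⟩
        (n * j₁) ^ k * (suc k ^ s * suc k ^ s) * ((k ! * a ^ k * b) * (k ! * a ^ k * b))
          ≤⟨ *-monoʳ-≤ ((n * j₁) ^ k * (suc k ^ s * suc k ^ s)) (*-mono-≤ (factorial≤power k k≤V) (factorial≤power k k≤V)) ⟩
        (n * j₁) ^ k * (suc k ^ s * suc k ^ s) * ((k ^ k * b ^ k * (suc k * a)) * (k ^ k * b ^ k * (suc k * a)))
          ≡⟨ identity₃ ((n * j₁) ^ k) (suc k ^ s) (k ^ k) (b ^ k) (suc k) a ⟩
        (n * j₁) ^ k * (b ^ k * b ^ k) * (F k s * (a * a)) * (k ^ k * k ^ k)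
          ≡⟨ cong₂ (λ y z → (n * j₁) ^ k * y * (F k s * (a * a)) * z) (*-^ b b k) (*-^ k k k) ⟨
        (n * j₁) ^ k * (b * b) ^ k * (F k s * (a * a)) * (k * k) ^ k ∎)
        where
        open ≤-Reasoning
        D = ∑ (cube M) (λ P → ⟦ Fam P ⟧)
        0<β : 0 < j₂ * (k * k)
        0<β = *-mono-< 0<j₂ (s≤s z≤n)
        room : j₂ * (k * k) * card U ≤ k * (j₂ * (k * k) + n * j₁ * (k * k))
        room = begin
          j₂ * (k * k) * card U                         ≡⟨ xy∙z≈xz∙y j₂ (k * k) (card U) ⟩
          j₂ * card U * (k * k)                         ≤⟨ *-monoˡ-≤ (k * k) h₁ ⟩
          n * j₁ * k * (k * k)                          ≡⟨ swap (n * j₁) k ⟩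
          k * (n * j₁ * (k * k))                        ≤⟨ *-monoʳ-≤ k (m≤n+m _ (j₂ * (k * k))) ⟩
          k * (j₂ * (k * k) + n * j₁ * (k * k))         ∎
          where
          swap : ∀ x k → x * k * (k * k) ≡ k * (x * (k * k))
          swap = solve-∀
        identity₁ : ∀ D j a b k → D * (j * a * b) * k ≡ D * (j * k) * (a * b)
        identity₁ = solve-∀
        identity₂ : ∀ p f r q b → p * (f * r * (f * r)) * (q * q * (b * b)) ≡ p * (r * r) * ((f * q * b) * (f * q * b))
        identity₂ = solve-∀
        identity₃ : ∀ p r t q s a → p * (r * r) * ((t * q * (s * a)) * (t * q * (s * a))) ≡ p * (q * q) * ((s * r) * (s * r) * (a * a)) * (t * t)
        identity₃ = solve-∀

  -- Comparison of the two counts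

  -- `X` stands for the choices of hole matrices and `D` for the decompositions given one choice.
  -- Plain letters carry the exponent k and primed ones y, and p/q is the gain from the smaller
  -- number of triangles.
  combine : ∀ {W X D α α′ c ν ν′ β β′ F p q L R} → 0 < L → 0 < c → 0 < p →
            X * L ≤ R → D * (α * c) * p ≤ ν * β * F * q → W * F * R * α′ * q ≤ ν′ * β′ * L * c * p →
            W * (X * D) * (α * α′) ≤ (ν * β) * (ν′ * β′)
  combine {W} {X} {D} {α} {α′} {c} {ν} {ν′} {β} {β′} {F} {p} {q} {L} {R} 0<L 0<c 0<p h₁ h₂ h₃ =
    *-cancelʳ-≤ _ _ (L * c * p) {{ℕ.>-nonZero (*-mono-< (*-mono-< 0<L 0<c) 0<p)}} (begin
      W * (X * D) * (α * α′) * (L * c * p)         ≡⟨ identity₁ W X D α α′ L c p ⟩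
      (X * L) * (D * (α * c) * p) * (W * α′)       ≤⟨ *-monoˡ-≤ (W * α′) (*-mono-≤ h₁ h₂) ⟩
      R * (ν * β * F * q) * (W * α′)               ≡⟨ identity₂ R ν β F q W α′ ⟩
      ν * β * (W * F * R * α′ * q)                 ≤⟨ *-monoʳ-≤ (ν * β) h₃ ⟩
      ν * β * (ν′ * β′ * L * c * p)                ≡⟨ identity₃ (ν * β) (ν′ * β′) L c p ⟩
      (ν * β) * (ν′ * β′) * (L * c * p)            ∎)
    where
    open ≤-Reasoning
    identity₁ : ∀ W X D α α′ L c p → W * (X * D) * (α * α′) * (L * c * p) ≡ (X * L) * (D * (α * c) * p) * (W * α′)
    identity₁ = solve-∀
    identity₂ : ∀ R ν β F q W α′ → R * (ν * β * F * q) * (W * α′) ≡ ν * β * (W * F * R * α′ * q)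
    identity₂ = solve-∀
    identity₃ : ∀ x y L c p → x * (y * L * c * p) ≡ x * y * (L * c * p)
    identity₃ = solve-∀

  -- Abstract, since unfolding these literals would make the unary arithmetic below explode.
  abstract
    c₆ : ℕ
    c₆ = 4096

    c₆-≡ : c₆ ≡ 4 * (4 * (4 * (4 * (4 * 4))))
    c₆-≡ = refl

    φ : ℕ
    φ = 16384

    φ-≡ : φ ≡ 4 * (4 * (4 * (4 * (4 * (4 * 4)))))
    φ-≡ = refl

    0<φ : 0 < φ
    0<φ = s≤s z≤n

  cube-^ : ∀ x y → x ^ y * (x ^ y * x ^ y) ≡ (x * (x * x)) ^ y
  cube-^ x y = trans (cong (x ^ y *_) (sym (*-^ x x y))) (sym (*-^ x (x * x) y))

  absorb : ∀ {c x y} G m → G ≤ c ^ m → c * x ≤ y → G * x ^ m ≤ y ^ m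
  absorb {c} {x} {y} G m h h′ = ≤-trans (*-monoˡ-≤ (x ^ m) h) (≤-trans (≤-reflexive (sym (*-^ c x m))) (^-monoˡ-≤ m h′))

  -- By Bernoulli's inequality (1 + 1/x)^x ≥ 2 for x = 2B, and m contains at least g blocks of
  -- length x.
  growth : ∀ B g m → 0 < B → 2 * B * g ≤ m → 2 ^ g * (2 * B) ^ m ≤ suc (2 * B) ^ m
  growth B g m 0<B le = begin
    2 ^ g * x ^ m                             ≡⟨ cong (λ w → 2 ^ g * x ^ w) (sym (m∸n+n≡m le)) ⟩
    2 ^ g * x ^ (r + x * g)                   ≡⟨ trans (cong (2 ^ g *_) (trans (^-distribˡ-+-* x r (x * g)) (cong (x ^ r *_) (sym (^-*-assoc x x g))))) (x∙yz≈y∙xz (2 ^ g) (x ^ r) _) ⟩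
    x ^ r * (2 ^ g * (x ^ x) ^ g)             ≡⟨ cong (x ^ r *_) (*-^ 2 (x ^ x) g) ⟨
    x ^ r * (2 * x ^ x) ^ g                   ≤⟨ *-mono-≤ (^-monoˡ-≤ r (n≤1+n x)) (^-monoˡ-≤ g doubled) ⟩
    suc x ^ r * (suc x ^ x) ^ g               ≡⟨ trans (cong (suc x ^ r *_) (^-*-assoc (suc x) x g)) (sym (^-distribˡ-+-* (suc x) r (x * g))) ⟩
    suc x ^ (r + x * g)                       ≡⟨ cong (suc x ^_) (m∸n+n≡m le) ⟩
    suc x ^ m                                 ∎
    where
    open ≤-Reasoning
    x = 2 * B
    r = m ∸ x * g
    0<x : 0 < x
    0<x = *-mono-< {0} {2} (s≤s z≤n) 0<B
    doubled : 2 * x ^ x ≤ suc x ^ x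
    doubled = *-cancelʳ-≤ _ _ x {{ℕ.>-nonZero 0<x}} (≤-trans (≤-reflexive (two (x ^ x) x)) (bernoulli x x))
      where
      two : ∀ p x → 2 * p * x ≡ p * (x + x)
      two = solve-∀

  -- The given inequality is raised to the power g, and the m - gc remaining factors are compared by
  -- x ≤ y.
  power-weaken : ∀ {x y} c g m → x ≤ y → g * c ≤ m → ∀ {u v} → u * x ^ c ≤ v * y ^ c → u ^ g * x ^ m ≤ v ^ g * y ^ m
  power-weaken {x} {y} c g m x≤y le {u} {v} h = begin
    u ^ g * x ^ m                      ≡⟨ split u x ⟩
    x ^ r * (u * x ^ c) ^ g            ≤⟨ *-mono-≤ (^-monoˡ-≤ r x≤y) (^-monoˡ-≤ g h) ⟩
    y ^ r * (v * y ^ c) ^ g            ≡⟨ split v y ⟨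
    v ^ g * y ^ m                      ∎
    where
    open ≤-Reasoning
    r = m ∸ g * c
    split : ∀ u x → u ^ g * x ^ m ≡ x ^ r * (u * x ^ c) ^ g
    split u x = trans (cong (λ w → u ^ g * x ^ w) (sym (m∸n+n≡m le)))
      (trans (cong (u ^ g *_) (trans (^-distribˡ-+-* x r (g * c)) (cong (x ^ r *_) (trans (cong (x ^_) (*-comm g c)) (sym (^-*-assoc x c g))))))
      (trans (x∙yz≈y∙xz (u ^ g) (x ^ r) _) (cong (x ^ r *_) (sym (*-^ u (x ^ c) g)))))

  -- The largest `D` with D c ≤ r. Summing over groups needs natural bounds, while the estimates
  -- carry denominators.
  module Quotient (c r : ℕ) (0<c : 0 < c) where

    instance
      c≢0 : ℕ.NonZero c
      c≢0 = ℕ.>-nonZero 0<c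

    D : ℕ
    D = r ℕ./ c

    D-lower : ∀ {x} → x * c ≤ r → x ≤ D
    D-lower {x} h = ≤-trans (≤-reflexive (sym (DivMod.m*n/n≡m x c))) (DivMod./-monoˡ-≤ c h)

    D-upper : D * c ≤ r
    D-upper = DivMod.m/n*n≤m r c

  -- p/q stands for the constant above e. The hypothesis `slack` is E (1 + 1/(2B)) ≤ p/q, and the
  -- room 1 + 1/(2B) pays for the errors: they are at most 2^e, and e is at most y/(2B).
  module Estimate (n B p q y k s e : ℕ) (0<n : 0 < n) (0<B : 0 < B) (0<q : 0 < q) (q≤p : q ≤ p) (0<y : 0 < y) (k+y : k + y ≡ n * n)
    (s-large : 2 * (n * (n * n)) ≤ s * s)
    (err : 24 * (n * n) * (16 * ((suc (n * n) * suc (n * n) ^ s) * (suc (n * n) * suc (n * n) ^ s))) * 2 ^ n ≤ 2 ^ e)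
    (e-small : 2 * B * e ≤ y) (y-large : p * (p * p) * (n * (n * (n * (n * n)))) ≤ q * (q * q) * (y * (y * y)))
    (slack : suc (n * n) ^ suc (n * n) * q * suc (2 * B) ≤ p * (n * n) ^ suc (n * n) * (2 * B)) where

    V : ℕ
    V = n * n

    0<V : 0 < V
    0<V = *-mono-< 0<n 0<n

    open Euler V 0<V
    open Shatter n
    open Triples n
    open Holes {n}
    open SaturatingBound conf

    k≤V : k ≤ V
    k≤V = ≤-trans (m≤m+n k y) (≤-reflexive k+y)

    -- 24 V is 6 · 4V: 4V serves the sum over all sizes k, and 6 exceeds the 1 + 3 terms of
    -- `grouped`. `F` collects the subexponential factors from rising factorials and from Stirling's
    -- bound.
    W F : ℕ
    W = 24 * V
    F = (suc k * suc k ^ s) * (suc k * suc k ^ s)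

    layer-count : ℕ
    layer-count = ∑ mats (λ M → ⟦ ones M == y ⟧)

    r l : ℕ
    r = (V * a) ^ y
    l = (y * b) ^ y

    0<l : 0 < l
    0<l = m^n>0 (y * b) {{ℕ.>-nonZero (*-mono-< 0<y 0<b)}} y

    0<bb : 0 < b * b
    0<bb = *-mono-< 0<b 0<b

    -- The usual bound (EV/y)^y for a binomial coefficient, from V^y/y! and `power≤factorial`.
    layer-bound : layer-count * l ≤ r
    layer-bound = begin
      layer-count * (y * b) ^ y                      ≡⟨ cong₂ _*_ (matrices-layer n n y) (*-^ y b y) ⟩
      layer V y * (y ^ y * b ^ y)                    ≤⟨ *-monoʳ-≤ (layer V y) (power≤factorial y) ⟩
      layer V y * (a ^ y * y !)                      ≡⟨ x∙yz≈xz∙y (layer V y) (a ^ y) (y !) ⟩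
      layer V y * y ! * a ^ y                        ≤⟨ *-monoˡ-≤ (a ^ y) (layer-≤ V y) ⟩
      V ^ y * a ^ y                                  ≡⟨ *-^ V a y ⟨
      (V * a) ^ y                                    ∎
      where
      open ≤-Reasoning

    cubes : layer-count * (layer-count * layer-count) * (l * (l * l)) ≤ r * (r * r)
    cubes = ≤-trans (≤-reflexive (identity layer-count l)) (*-mono-≤ layer-bound (*-mono-≤ layer-bound layer-bound))
      where
      identity : ∀ x l → x * (x * x) * (l * (l * l)) ≡ x * l * (x * l * (x * l))
      identity = solve-∀

    err-k : W * (16 * F) * 2 ^ n ≤ 2 ^ e
    err-k = ≤-trans (*-monoˡ-≤ (2 ^ n) (*-monoʳ-≤ W (*-monoʳ-≤ 16 (*-mono-≤ F₁ F₁)))) err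
      where
      F₁ : suc k * suc k ^ s ≤ suc V * suc V ^ s
      F₁ = *-mono-≤ (s≤s k≤V) (^-monoˡ-≤ s (s≤s k≤V))

    e≤y : e ≤ y
    e≤y = ≤-trans (m≤n*m e (2 * B) {{ℕ.>-nonZero (*-mono-< {0} {2} (s≤s z≤n) 0<B)}}) e-small

    err-4 : W * (16 * F) * 2 ^ n ≤ 4 ^ y
    err-4 = ≤-trans err-k (≤-trans (^-monoʳ-≤ 2 e≤y) (^-monoˡ-≤ y (s≤s (s≤s z≤n))))

    aa≤16bb : a * a ≤ 16 * (b * b)
    aa≤16bb = ≤-trans (*-mono-≤ E≤4 E≤4) (≤-reflexive (identity b))
      where
      identity : ∀ b → 4 * b * (4 * b) ≡ 16 * (b * b)
      identity = solve-∀

    WF-bound : ∀ x → W * (F * (a * a)) * x ≤ W * (16 * F) * x * (b * b)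
    WF-bound x = ≤-trans (*-monoˡ-≤ x (*-monoʳ-≤ W (*-monoʳ-≤ F aa≤16bb))) (≤-reflexive (identity W F (b * b) x))
      where
      identity : ∀ W F c x → W * (F * (16 * c)) * x ≡ W * (16 * F) * x * c
      identity = solve-∀

    -- The number of triangles is at most nk in general (j₁ = j₂ = 1), and at most nk · j/(j + 1) with j + 1 about k/2y
    -- for balanced hole matrices.
    module Families (j₁ j₂ : ℕ) (0<j₂ : 0 < j₂) (s-ok : j₂ * (k * k) ≤ n * j₁ * (s * s)) where

      open Quotient (j₂ ^ k * (a * a) ^ k * (b * b)) ((n * j₁) ^ k * (b * b) ^ k * (F * (a * a)))
        (*-mono-< (*-mono-< (m^n>0 j₂ {{ℕ.>-nonZero 0<j₂}} k) (m^n>0 (a * a) {{ℕ.>-nonZero (*-mono-< 0<a 0<a)}} k)) 0<bb) public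

      family-bound : ∀ U (Fam : Vec Bool volume → Bool) → (∀ P → Fam P ≡ true → Saturating conf U k P) → j₂ * card U ≤ n * j₁ * k →
                     ∑ (cube volume) (λ P → ⟦ Fam P ⟧) ≤ D
      family-bound U Fam sat h = D-lower (saturating-bound V n 0<V k s j₁ j₂ k≤V 0<j₂ U Fam sat h s-ok)

      D-bound : ∀ z w → j₁ ^ k * z ≤ j₂ ^ k * w → D * ((a * a) ^ k * (b * b)) * z ≤ n ^ k * (b * b) ^ k * (F * (a * a)) * w
      D-bound z w h = *-cancelʳ-≤ _ _ (j₂ ^ k) {{ℕ.>-nonZero (m^n>0 j₂ {{ℕ.>-nonZero 0<j₂}} k)}} (begin
        D * ((a * a) ^ k * (b * b)) * z * j₂ ^ k                  ≡⟨ identity₁ D ((a * a) ^ k) (b * b) z (j₂ ^ k) ⟩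
        D * (j₂ ^ k * (a * a) ^ k * (b * b)) * z                  ≤⟨ *-monoˡ-≤ z D-upper ⟩
        (n * j₁) ^ k * (b * b) ^ k * (F * (a * a)) * z            ≡⟨ cong (λ v → v * (b * b) ^ k * (F * (a * a)) * z) (*-^ n j₁ k) ⟩
        n ^ k * j₁ ^ k * (b * b) ^ k * (F * (a * a)) * z          ≡⟨ identity₂ (n ^ k) (j₁ ^ k) ((b * b) ^ k) (F * (a * a)) z ⟩
        n ^ k * (b * b) ^ k * (F * (a * a)) * (j₁ ^ k * z)        ≤⟨ *-monoʳ-≤ (n ^ k * (b * b) ^ k * (F * (a * a))) h ⟩
        n ^ k * (b * b) ^ k * (F * (a * a)) * (j₂ ^ k * w)        ≡⟨ x∙yz≈xz∙y (n ^ k * (b * b) ^ k * (F * (a * a))) (j₂ ^ k) w ⟩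
        n ^ k * (b * b) ^ k * (F * (a * a)) * w * j₂ ^ k          ∎)
        where
        open ≤-Reasoning
        identity₁ : ∀ D α c z j → D * (α * c) * z * j ≡ D * (j * α * c) * z
        identity₁ = solve-∀
        identity₂ : ∀ ν j β F z → ν * j * β * F * z ≡ ν * β * F * (j * z)
        identity₂ = solve-∀

    split-V : ∀ x → x ^ V ≡ x ^ k * x ^ y
    split-V x = trans (cong (x ^_) (sym k+y)) (^-distribˡ-+-* x k y)

    finish : ∀ {X} → X ≤ (n ^ k * (b * b) ^ k) * (n ^ y * (b * b) ^ y) → X ≤ (n * (b * b)) ^ V
    finish h = ≤-trans h (≤-reflexive (sym (trans (split-V (n * (b * b))) (cong₂ _*_ (*-^ n (b * b) k) (*-^ n (b * b) y)))))

    n⁵ : ℕ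
    n⁵ = n * (n * (n * (n * n)))

    k²≤ : k * k ≤ n * (n * (n * n))
    k²≤ = ≤-trans (*-mono-≤ k≤V k≤V) (≤-reflexive (identity n))
      where
      identity : ∀ n → n * n * (n * n) ≡ n * (n * (n * n))
      identity = solve-∀

    trivial-ok : 1 * (k * k) ≤ n * 1 * (s * s)
    trivial-ok = begin
      1 * (k * k)                          ≡⟨ *-identityˡ (k * k) ⟩
      k * k                                ≤⟨ k²≤ ⟩
      n * (n * (n * n))                    ≤⟨ m≤m+n _ (n * (n * (n * n))) ⟩
      n * (n * (n * n)) + n * (n * (n * n))   ≡⟨ identity n (n * (n * n)) ⟩
      n * 1 * (2 * (n * (n * n)))          ≤⟨ *-monoʳ-≤ (n * 1) s-large ⟩
      n * 1 * (s * s)                      ∎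
      where
      open ≤-Reasoning
      identity : ∀ n x → n * x + n * x ≡ n * 1 * (2 * x)
      identity = solve-∀

    module Trivial = Families 1 1 (s≤s z≤n) trivial-ok

    trivial-bound : ∀ U (Fam : Vec Bool volume → Bool) → (∀ P → Fam P ≡ true → Saturating conf U k P) → card U ≤ n * k →
                    ∑ (cube volume) (λ P → ⟦ Fam P ⟧) ≤ Trivial.D
    trivial-bound U Fam sat le = Trivial.family-bound U Fam sat
      (≤-trans (≤-reflexive (*-identityˡ (card U))) (≤-trans le (≤-reflexive (cong (_* k) (sym (*-identityʳ n))))))

    -- With the trivial number of triangles the quotient is (E⁵n⁵/y³)^y up to error factors, which
    -- is harmless for such large y.
    big : c₆ * n⁵ ≤ y * (y * y) → W * (layer-count * (layer-count * layer-count) * Trivial.D) * (a * a) ^ V ≤ (n * (b * b)) ^ V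
    big h = finish (≤-trans (≤-reflexive (cong (W * (layer-count * (layer-count * layer-count) * Trivial.D) *_) (split-V (a * a))))
      (combine {W} {layer-count * (layer-count * layer-count)} {Trivial.D} {(a * a) ^ k} {(a * a) ^ y} {b * b} {n ^ k} {n ^ y} {(b * b) ^ k} {(b * b) ^ y} {F * (a * a)} {1} {1} {l * (l * l)} {r * (r * r)}
        (*-mono-< 0<l (*-mono-< 0<l 0<l)) 0<bb (s≤s z≤n) cubes (Trivial.D-bound 1 1 ≤-refl) (begin
          W * (F * (a * a)) * (r * (r * r)) * (a * a) ^ y * 1            ≡⟨ identity₁ (W * (F * (a * a))) (r * (r * r)) ((a * a) ^ y) ⟩
          W * (F * (a * a)) * (r * (r * r) * (a * a) ^ y)                ≤⟨ WF-bound _ ⟩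
          W * (16 * F) * (r * (r * r) * (a * a) ^ y) * (b * b)           ≡⟨ cong (λ z → W * (16 * F) * z * (b * b)) (trans (cong (_* (a * a) ^ y) (cube-^ (V * a) y)) (sym (*-^ (V * a * (V * a * (V * a))) (a * a) y))) ⟩
          W * (16 * F) * (V * a * (V * a * (V * a)) * (a * a)) ^ y * (b * b)
            ≤⟨ *-monoˡ-≤ (b * b) (absorb (W * (16 * F)) y (≤-trans (m≤m*n (W * (16 * F)) (2 ^ n) {{ℕ.>-nonZero (m^n>0 2 n)}}) err-4) base) ⟩
          (n * (b * b) * (y * b * (y * b * (y * b)))) ^ y * (b * b)      ≡⟨ cong (_* (b * b)) (trans (*-^ (n * (b * b)) _ y) (cong₂ _*_ (*-^ n (b * b) y) (sym (cube-^ (y * b) y)))) ⟩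
          n ^ y * (b * b) ^ y * (l * (l * l)) * (b * b)                  ≡⟨ *-identityʳ _ ⟨
          n ^ y * (b * b) ^ y * (l * (l * l)) * (b * b) * 1              ∎)))
      where
      open ≤-Reasoning
      identity₁ : ∀ w x y → w * x * y * 1 ≡ w * (x * y)
      identity₁ = solve-∀
      -- Five factors E ≤ 4, and one more factor 4 whose y-th power absorbs the errors, make `c₆` =
      -- 4⁶.
      base : 4 * (V * a * (V * a * (V * a)) * (a * a)) ≤ n * (b * b) * (y * b * (y * b * (y * b)))
      base = begin
        4 * (V * a * (V * a * (V * a)) * (a * a))                         ≡⟨ identity₂ n a ⟩
        4 * n * n⁵ * (a * (a * (a * (a * a))))                            ≤⟨ *-monoʳ-≤ (4 * n * n⁵) (*-mono-≤ E≤4 (*-mono-≤ E≤4 (*-mono-≤ E≤4 (*-mono-≤ E≤4 E≤4)))) ⟩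
        4 * n * n⁵ * (4 * b * (4 * b * (4 * b * (4 * b * (4 * b)))))      ≡⟨ identity₃ 4 n n⁵ b ⟩
        n * (4 * (4 * (4 * (4 * (4 * 4)))) * n⁵) * (b * (b * (b * (b * b))))   ≡⟨ cong (λ z → n * (z * n⁵) * (b * (b * (b * (b * b))))) {c₆} {4 * (4 * (4 * (4 * (4 * 4))))} c₆-≡ ⟨
        n * (c₆ * n⁵) * (b * (b * (b * (b * b))))                       ≤⟨ *-monoˡ-≤ (b * (b * (b * (b * b)))) (*-monoʳ-≤ n h) ⟩
        n * (y * (y * y)) * (b * (b * (b * (b * b))))                     ≡⟨ identity₄ n y b ⟩
        n * (b * b) * (y * b * (y * b * (y * b)))                         ∎
        where
        identity₂ : ∀ n a → 4 * (n * n * a * (n * n * a * (n * n * a)) * (a * a)) ≡ 4 * n * (n * (n * (n * (n * n)))) * (a * (a * (a * (a * a))))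
        identity₂ = solve-∀
        identity₃ : ∀ f n m b → f * n * m * (f * b * (f * b * (f * b * (f * b * (f * b))))) ≡ n * (f * (f * (f * (f * (f * f)))) * m) * (b * (b * (b * (b * b))))
        identity₃ = solve-∀
        identity₄ : ∀ n y b → n * (y * (y * y)) * (b * (b * (b * (b * b)))) ≡ n * (b * b) * (y * b * (y * b * (y * b)))
        identity₄ = solve-∀

    total-of : ℕ
    total-of = ∑ (cube volume) (λ Y → ⟦ shattered Y ∧ (card (lookup Y) == k) ⟧)

    claim-big : c₆ * n⁵ ≤ y * (y * y) → 4 * V * total-of * (a * a) ^ V ≤ (n * (b * b)) ^ V
    claim-big h = begin
      4 * V * total-of * (a * a) ^ V                           ≤⟨ *-monoˡ-≤ ((a * a) ^ V) (*-monoʳ-≤ (4 * V) grouped) ⟩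
      4 * V * (ℓ * (ℓ * ℓ) * 0 + 3 * (bad-count * (ℓ * ℓ)) * Trivial.D) * (a * a) ^ V
        ≡⟨ cong (λ x → 4 * V * (ℓ * (ℓ * ℓ) * 0 + 3 * (x * (ℓ * ℓ)) * Trivial.D) * (a * a) ^ V) (∑-cong′ mats (λ M → cong ⟦_⟧ (Boolₚ.∧-identityʳ _))) ⟩
      4 * V * (ℓ * (ℓ * ℓ) * 0 + 3 * (ℓ * (ℓ * ℓ)) * Trivial.D) * (a * a) ^ V
        ≤⟨ m≤m+n _ _ ⟩
      4 * V * (ℓ * (ℓ * ℓ) * 0 + 3 * (ℓ * (ℓ * ℓ)) * Trivial.D) * (a * a) ^ V + 12 * V * (ℓ * (ℓ * ℓ) * Trivial.D) * (a * a) ^ V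
        ≡⟨ identity V (ℓ * (ℓ * ℓ)) Trivial.D ((a * a) ^ V) ⟩
      W * (ℓ * (ℓ * ℓ) * Trivial.D) * (a * a) ^ V              ≤⟨ big h ⟩
      (n * (b * b)) ^ V                                        ∎
      where
      open ≤-Reasoning
      -- All hole matrices count as bad here, so the balanced case is vacuous and contributes 0.
      open Grouping shattered shattered-independent k y k+y (λ _ → true) 0 Trivial.D
        (λ A F G Fam ())
        trivial-bound
        using (grouped; ℓ) renaming (b to bad-count)
      identity : ∀ V x D A → 4 * V * (x * 0 + 3 * x * D) * A + 12 * V * (x * D) * A ≡ 24 * V * (x * D) * A
      identity = solve-∀

    n⁵≤y³ : n⁵ ≤ y * (y * y)
    n⁵≤y³ = *-cancelˡ-≤ (p * (p * p)) {{ℕ.>-nonZero (*-mono-< 0<p (*-mono-< 0<p 0<p))}}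
      (≤-trans y-large (*-monoˡ-≤ (y * (y * y)) (*-mono-≤ q≤p (*-mono-≤ q≤p q≤p))))
      where
      0<p : 0 < p
      0<p = ≤-trans 0<q q≤p

    -- The range where y is at most a small constant times n². There V/y exceeds (2φ)^Q, as needed
    -- for the moment bound, and k/(2y) is at least 16B.
    module Middle (Z-large : (2 * φ) ^ (48 * B) * y ≤ V) (V-large : 32 * B * y ≤ k) where

      Q Z : ℕ
      -- For balanced matrices the three sums of squares then total at most 6yn/Q = yn/(8B).
      Q = 48 * B

      instance
        y≢0 : ℕ.NonZero y
        y≢0 = ℕ.>-nonZero 0<y

      -- With this weight (1 + 1/Z)^V is only exponential in y, so the moment bound is (V/y)^y up to
      -- a factor c^y and 2^n.
      Z = V ℕ./ y

      Z≥ : (2 * φ) ^ Q ≤ Z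
      Z≥ = ≤-trans (≤-reflexive (sym (DivMod.m*n/n≡m ((2 * φ) ^ Q) y))) (DivMod./-monoˡ-≤ y Z-large)

      0<Z : 0 < Z
      0<Z = ≤-trans (m^n>0 (2 * φ) {{ℕ.>-nonZero (*-mono-< {0} {2} (s≤s z≤n) 0<φ)}} Q) Z≥

      open Unbalanced n Q φ Z 0<n 0<φ Z≥

      u : ℕ
      u = ∑ mats (λ M → ⟦ (ones M == y) ∧ unbalanced y M ⟧)

      Zy≤V : Z * y ≤ V
      Zy≤V = DivMod.m/n*n≤m V y

      V≤2Zy : V ≤ Z * (2 * y)
      V≤2Zy = begin
        V                        ≡⟨ DivMod.m≡m%n+[m/n]*n V y ⟩
        V ℕ.% y + Z * y          ≤⟨ +-monoˡ-≤ (Z * y) (≤-trans (<⇒≤ (DivMod.m%n<n V y)) (m≤n*m y Z {{ℕ.>-nonZero 0<Z}})) ⟩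
        Z * y + Z * y            ≡⟨ identity Z y ⟩
        Z * (2 * y)              ∎
        where
        open ≤-Reasoning
        identity : ∀ Z y → Z * y + Z * y ≡ Z * (2 * y)
        identity = solve-∀

      -- (1 + 1/Z)^Z ≤ E ≤ 4, used 2y times because V ≤ 2yZ.
      suc-Z-power : suc Z ^ V ≤ 16 ^ y * Z ^ V
      suc-Z-power = *-cancelʳ-≤ _ _ (Z ^ d) {{ℕ.>-nonZero (m^n>0 Z {{ℕ.>-nonZero 0<Z}} d)}} (begin
        suc Z ^ V * Z ^ d                 ≤⟨ *-monoʳ-≤ (suc Z ^ V) (^-monoˡ-≤ d (n≤1+n Z)) ⟩
        suc Z ^ V * suc Z ^ d             ≡⟨ ^-distribˡ-+-* (suc Z) V d ⟨
        suc Z ^ (V + d)                   ≡⟨ cong (suc Z ^_) (m+[n∸m]≡n V≤2Zy) ⟩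
        suc Z ^ (Z * (2 * y))             ≡⟨ ^-*-assoc (suc Z) Z (2 * y) ⟨
        (suc Z ^ Z) ^ (2 * y)             ≤⟨ ^-monoˡ-≤ (2 * y) four ⟩
        (4 * Z ^ Z) ^ (2 * y)             ≡⟨ *-^ 4 (Z ^ Z) (2 * y) ⟩
        4 ^ (2 * y) * (Z ^ Z) ^ (2 * y)   ≡⟨ cong₂ _*_ (sym (^-*-assoc 4 2 y)) (^-*-assoc Z Z (2 * y)) ⟩
        16 ^ y * Z ^ (Z * (2 * y))        ≡⟨ cong (λ x → 16 ^ y * Z ^ x) (sym (m+[n∸m]≡n V≤2Zy)) ⟩
        16 ^ y * Z ^ (V + d)              ≡⟨ cong (16 ^ y *_) (^-distribˡ-+-* Z V d) ⟩
        16 ^ y * (Z ^ V * Z ^ d)          ≡⟨ *-assoc (16 ^ y) (Z ^ V) (Z ^ d) ⟨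
        16 ^ y * Z ^ V * Z ^ d            ∎)
        where
        open ≤-Reasoning
        d = Z * (2 * y) ∸ V
        four : suc Z ^ Z ≤ 4 * Z ^ Z
        four = *-cancelʳ-≤ _ _ b {{ℕ.>-nonZero 0<b}} (≤-trans (lower≤E Z) (≤-trans (*-monoˡ-≤ (Z ^ Z) E≤4) (≤-reflexive (xy∙z≈xz∙y 4 b (Z ^ Z)))))

      Y₀ : ℕ
      Y₀ = (2 * suc Z ^ n) ^ n

      Y₀-bound : Y₀ ≤ 2 ^ n * (16 ^ y * (Z ^ k * Z ^ y))
      Y₀-bound = begin
        (2 * suc Z ^ n) ^ n                       ≡⟨ *-^ 2 (suc Z ^ n) n ⟩
        2 ^ n * (suc Z ^ n) ^ n                   ≡⟨ cong (2 ^ n *_) (^-*-assoc (suc Z) n n) ⟩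
        2 ^ n * suc Z ^ V                         ≤⟨ *-monoʳ-≤ (2 ^ n) suc-Z-power ⟩
        2 ^ n * (16 ^ y * Z ^ V)                  ≡⟨ cong (λ x → 2 ^ n * (16 ^ y * x)) (split-V Z) ⟩
        2 ^ n * (16 ^ y * (Z ^ k * Z ^ y))        ∎
        where open ≤-Reasoning

      -- One of the three matrices is unbalanced and saves φ^y, which outweighs the use of the
      -- trivial number of triangles.
      few-unbalanced : W * (u * (layer-count * layer-count) * Trivial.D) * (a * a) ^ V ≤ (n * (b * b)) ^ V
      few-unbalanced = finish (≤-trans (≤-reflexive (cong (W * (u * (layer-count * layer-count) * Trivial.D) *_) (split-V (a * a))))
        (combine {W} {u * (layer-count * layer-count)} {Trivial.D} {(a * a) ^ k} {(a * a) ^ y} {b * b} {n ^ k} {n ^ y} {(b * b) ^ k} {(b * b) ^ y} {F * (a * a)} {1} {1} {Z ^ k * φ ^ y * (l * l)} {Y₀ * (r * r)}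
          (*-mono-< (*-mono-< (m^n>0 Z {{ℕ.>-nonZero 0<Z}} k) (m^n>0 φ {{ℕ.>-nonZero 0<φ}} y)) (*-mono-< 0<l 0<l)) 0<bb (s≤s z≤n) product (Trivial.D-bound 1 1 ≤-refl) (begin
            W * (F * (a * a)) * (Y₀ * (r * r)) * (a * a) ^ y * 1             ≡⟨ identity₁ (W * (F * (a * a))) Y₀ (r * r) ((a * a) ^ y) ⟩
            W * (F * (a * a)) * (Y₀ * (r * r * (a * a) ^ y))                 ≤⟨ WF-bound _ ⟩
            W * (16 * F) * (Y₀ * (r * r * (a * a) ^ y)) * (b * b)            ≤⟨ *-monoˡ-≤ (b * b) (*-monoʳ-≤ (W * (16 * F)) (*-monoˡ-≤ (r * r * (a * a) ^ y) Y₀-bound)) ⟩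
            W * (16 * F) * (2 ^ n * (16 ^ y * (Z ^ k * Z ^ y)) * (r * r * (a * a) ^ y)) * (b * b)
              ≡⟨ identity₂ (W * (16 * F)) (2 ^ n) (16 ^ y) (Z ^ k) (Z ^ y) (r * r) ((a * a) ^ y) (b * b) ⟩
            W * (16 * F) * 2 ^ n * (16 ^ y * Z ^ y * (r * r) * (a * a) ^ y) * (Z ^ k * (b * b))
              ≡⟨ cong (λ x → W * (16 * F) * 2 ^ n * x * (Z ^ k * (b * b))) merge ⟩
            W * (16 * F) * 2 ^ n * (16 * Z * (V * a * (V * a)) * (a * a)) ^ y * (Z ^ k * (b * b))
              ≤⟨ *-monoˡ-≤ (Z ^ k * (b * b)) (absorb (W * (16 * F) * 2 ^ n) y err-4 base) ⟩
            (n * (b * b) * φ * (y * b * (y * b))) ^ y * (Z ^ k * (b * b))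
              ≡⟨ cong (_* (Z ^ k * (b * b))) (trans (*-^ (n * (b * b) * φ) _ y) (cong₂ _*_ (trans (*-^ (n * (b * b)) φ y) (cong (_* φ ^ y) (*-^ n (b * b) y))) (*-^ (y * b) (y * b) y))) ⟩
            n ^ y * (b * b) ^ y * φ ^ y * (l * l) * (Z ^ k * (b * b))        ≡⟨ identity₃ (n ^ y * (b * b) ^ y) (φ ^ y) (l * l) (Z ^ k) (b * b) ⟩
            n ^ y * (b * b) ^ y * (Z ^ k * φ ^ y * (l * l)) * (b * b) * 1    ∎)))
        where
        open ≤-Reasoning
        identity₁ : ∀ w x y z → w * (x * y) * z * 1 ≡ w * (x * (y * z))
        identity₁ = solve-∀
        identity₂ : ∀ w t s zk zy r α c → w * (t * (s * (zk * zy)) * (r * α)) * c ≡ w * t * (s * zy * r * α) * (zk * c)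
        identity₂ = solve-∀
        identity₃ : ∀ x f l z c → x * f * l * (z * c) ≡ x * (z * f * l) * c * 1
        identity₃ = solve-∀
        merge : 16 ^ y * Z ^ y * (r * r) * (a * a) ^ y ≡ (16 * Z * (V * a * (V * a)) * (a * a)) ^ y
        merge = sym (trans (*-^ (16 * Z * (V * a * (V * a))) (a * a) y) (cong (_* (a * a) ^ y) (trans (*-^ (16 * Z) (V * a * (V * a)) y) (cong₂ _*_ (*-^ 16 Z y) (*-^ (V * a) (V * a) y)))))
        product : u * (layer-count * layer-count) * (Z ^ k * φ ^ y * (l * l)) ≤ Y₀ * (r * r)
        product = ≤-trans (≤-reflexive (identity u layer-count (Z ^ k * φ ^ y) l))
          (*-mono-≤ (subst (λ x → u * (Z ^ x * φ ^ y) ≤ Y₀) (trans (cong (_∸ y) (sym k+y)) (m+n∸n≡m k y)) (unbalanced-count n y)) (*-mono-≤ layer-bound layer-bound))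
          where
          identity : ∀ u x z l → u * (x * x) * (z * (l * l)) ≡ u * z * (x * l * (x * l))
          identity = solve-∀
        -- 4 for the errors, 16 from `suc-Z-power` and four factors E ≤ 4 make 4⁷, which is `φ`.
        base : 4 * (16 * Z * (V * a * (V * a)) * (a * a)) ≤ n * (b * b) * φ * (y * b * (y * b))
        base = *-cancelʳ-≤ _ _ y (begin
          4 * (16 * Z * (V * a * (V * a)) * (a * a)) * y              ≡⟨ identity₄ 16 Z V a y ⟩
          4 * 16 * (Z * y) * (V * V) * (a * (a * (a * a)))            ≤⟨ *-mono-≤ (*-monoˡ-≤ (V * V) (*-monoʳ-≤ (4 * 16) Zy≤V)) (*-mono-≤ E≤4 (*-mono-≤ E≤4 (*-mono-≤ E≤4 E≤4))) ⟩
          4 * 16 * V * (V * V) * (4 * b * (4 * b * (4 * b * (4 * b))))  ≡⟨ identity₅ 4 n b ⟩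
          n * n⁵ * (4 * (4 * (4 * (4 * (4 * (4 * 4)))))) * (b * (b * (b * b)))   ≡⟨ cong (λ x → n * n⁵ * x * (b * (b * (b * b)))) (sym φ-≡) ⟩
          n * n⁵ * φ * (b * (b * (b * b)))                            ≤⟨ *-monoˡ-≤ (b * (b * (b * b))) (*-monoˡ-≤ φ (*-monoʳ-≤ n n⁵≤y³)) ⟩
          n * (y * (y * y)) * φ * (b * (b * (b * b)))                 ≡⟨ identity₆ n y φ b ⟩
          n * (b * b) * φ * (y * b * (y * b)) * y                     ∎)
          where
          identity₄ : ∀ c Z V a y → 4 * (c * Z * (V * a * (V * a)) * (a * a)) * y ≡ 4 * c * (Z * y) * (V * V) * (a * (a * (a * a)))
          identity₄ = solve-∀
          identity₅ : ∀ f n b → f * (f * f) * (n * n) * (n * n * (n * n)) * (f * b * (f * b * (f * b * (f * b)))) ≡ n * (n * (n * (n * (n * n)))) * (f * (f * (f * (f * (f * (f * f)))))) * (b * (b * (b * b)))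
          identity₅ = solve-∀
          identity₆ : ∀ n y f b → n * (y * (y * y)) * f * (b * (b * (b * b))) ≡ n * (b * b) * f * (y * b * (y * b)) * y
          identity₆ = solve-∀

      -- J is to be about k/(2y). The denominator is lowered to z = 2y - w, which leaves room for
      -- the sums of squares and for rounding; w is about y/(2B), so the loss is only E^w.
      w z J : ℕ
      instance
        2B≢0 : ℕ.NonZero (2 * B)
        2B≢0 = ℕ.>-nonZero (*-mono-< {0} {2} (s≤s z≤n) 0<B)

      w = y ℕ./ (2 * B)
      z = 2 * y ∸ w

      w≤y : w ≤ y
      w≤y = DivMod.m/n≤m y (2 * B)

      wB≤y : w * (2 * B) ≤ y
      wB≤y = DivMod.m/n*n≤m y (2 * B)

      z+w : z + w ≡ 2 * y
      z+w = m∸n+n≡m (≤-trans w≤y (m≤m+n y (y + 0)))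

      0<e : 0 < e
      0<e = ≮⇒≥ (λ e<1 → <⇒≱ (s≤s (s≤s z≤n)) (≤-trans (≤-trans two err-k) (≤-reflexive (cong (2 ^_) (n<1⇒n≡0 e<1)))))
        where
        two : 2 ≤ W * (16 * F) * 2 ^ n
        two = ≤-trans (*-mono-≤ {1} {W * (16 * F)} {2} {2 ^ n} (*-mono-≤ {1} {W} {1} {16 * F} (*-mono-≤ {1} {24} (s≤s z≤n) 0<V)
            (*-mono-≤ {1} {16} {1} {F} (s≤s z≤n) (*-mono-≤ pos pos))) (^-monoʳ-≤ 2 0<n)) ≤-refl
          where
          pos : 1 ≤ suc k * suc k ^ s
          pos = *-mono-≤ {1} {suc k} {1} (s≤s z≤n) (pos^ k s)

      y≤4Bw : y ≤ 4 * B * w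
      y≤4Bw = begin
        y                                          ≡⟨ DivMod.m≡m%n+[m/n]*n y (2 * B) ⟩
        y ℕ.% (2 * B) + w * (2 * B)                ≤⟨ +-monoˡ-≤ _ (≤-trans (<⇒≤ (DivMod.m%n<n y (2 * B))) (m≤n*m (2 * B) w {{ℕ.>-nonZero 0<w}})) ⟩
        w * (2 * B) + w * (2 * B)                  ≡⟨ identity w B ⟩
        4 * B * w                                  ∎
        where
        open ≤-Reasoning
        identity : ∀ w B → w * (2 * B) + w * (2 * B) ≡ 4 * B * w
        identity = solve-∀
        0<w : 0 < w
        0<w = ≤-trans (≤-reflexive (sym (DivMod.n/n≡1 (2 * B)))) (DivMod./-monoˡ-≤ (2 * B) (≤-trans (≤-trans (≤-reflexive (sym (*-identityʳ (2 * B)))) (*-monoʳ-≤ (2 * B) 0<e)) e-small))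

      y≤z : y ≤ z
      y≤z = +-cancelʳ-≤ w y z (≤-trans (+-monoʳ-≤ y w≤y) (≤-reflexive (trans (cong (y +_) (sym (+-identityʳ y))) (sym z+w))))

      0<z : 0 < z
      0<z = ≤-trans 0<y y≤z

      instance
        z≢0 : ℕ.NonZero z
        z≢0 = ℕ.>-nonZero 0<z

      J = k ℕ./ z

      zJ≤k : z * J ≤ k
      zJ≤k = ≤-trans (≤-reflexive (*-comm z J)) (DivMod.m/n*n≤m k z)

      16B≤J : 16 * B ≤ J
      16B≤J = ≤-trans (≤-reflexive (sym (DivMod.m*n/n≡m (16 * B) z))) (DivMod./-monoˡ-≤ z (begin
        16 * B * z           ≤⟨ *-monoʳ-≤ (16 * B) (m∸n≤m (2 * y) w) ⟩
        16 * B * (2 * y)     ≡⟨ identity B y ⟩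
        32 * B * y           ≤⟨ V-large ⟩
        k                    ∎))
        where
        open ≤-Reasoning
        identity : ∀ B y → 16 * B * (2 * y) ≡ 32 * B * y
        identity = solve-∀

      k≤zJ+z : k ≤ z * suc J
      k≤zJ+z = begin
        k                        ≡⟨ DivMod.m≡m%n+[m/n]*n k z ⟩
        k ℕ.% z + J * z          ≤⟨ +-monoˡ-≤ (J * z) (<⇒≤ (DivMod.m%n<n k z)) ⟩
        suc J * z                ≡⟨ *-comm (suc J) z ⟩
        z * suc J                ∎
        where open ≤-Reasoning

      -- The number of triangles is at most n(k - 2y) + 6yn/Q, and nk(1 - 1/J) is wanted; multiplied
      -- by QJ/n this is the inequality. It follows from k ≤ z(J + 1): the gain w ≥ y/(4B) pays for
      -- the squares, and J ≥ 16B for the rounding.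
      dagger : 48 * B * k + 6 * (y * J) ≤ 96 * B * (y * J)
      dagger = +-cancelʳ-≤ (6 * J * y + 12 * y) _ _ (begin
        48 * B * k + 6 * (y * J) + (6 * J * y + 12 * y)              ≤⟨ +-monoˡ-≤ _ (+-monoˡ-≤ (6 * (y * J)) (*-monoʳ-≤ (48 * B) k≤zJ+z)) ⟩
        48 * B * (z * suc J) + 6 * (y * J) + (6 * J * y + 12 * y)    ≡⟨ identity₁ B z J y ⟩
        48 * B * (z * suc J) + 12 * y * suc J                        ≤⟨ +-monoʳ-≤ (48 * B * (z * suc J)) (*-monoˡ-≤ (suc J) (*-monoʳ-≤ 12 y≤4Bw)) ⟩
        48 * B * (z * suc J) + 12 * (4 * B * w) * suc J              ≡⟨ identity₂ B z w J ⟩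
        48 * B * (z + w) * suc J                                     ≡⟨ cong (λ x → 48 * B * x * suc J) z+w ⟩
        48 * B * (2 * y) * suc J                                     ≡⟨ identity₃ B y J ⟩
        96 * B * (y * J) + 6 * (16 * B) * y                          ≤⟨ +-monoʳ-≤ (96 * B * (y * J)) (≤-trans (*-monoˡ-≤ y (*-monoʳ-≤ 6 16B≤J)) (m≤m+n _ (12 * y))) ⟩
        96 * B * (y * J) + (6 * J * y + 12 * y)                      ∎)
        where
        open ≤-Reasoning
        identity₁ : ∀ B z J y → 48 * B * (z * (1 + J)) + 6 * (y * J) + (6 * J * y + 12 * y) ≡ 48 * B * (z * (1 + J)) + 12 * y * (1 + J)
        identity₁ = solve-∀
        identity₂ : ∀ B z w J → 48 * B * (z * (1 + J)) + 12 * (4 * B * w) * (1 + J) ≡ 48 * B * (z + w) * (1 + J)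
        identity₂ = solve-∀
        identity₃ : ∀ B y J → 48 * B * (2 * y) * (1 + J) ≡ 96 * B * (y * J) + 6 * (16 * B) * y
        identity₃ = solve-∀

      j : ℕ
      j = J ∸ 1

      16≤J : 16 ≤ J
      16≤J = ≤-trans (*-monoʳ-≤ 16 0<B) 16B≤J

      suc-j : suc j ≡ J
      suc-j = trans (+-comm 1 j) (m∸n+n≡m (≤-trans (s≤s z≤n) 16≤J))

      0<j : 0 < j
      0<j = ∸-monoˡ-≤ 1 (≤-trans (s≤s (s≤s z≤n)) 16≤J)

      j≤V : j ≤ V
      j≤V = ≤-trans (m∸n≤m J 1) (≤-trans (DivMod.m/n≤m k z) k≤V)

      j-ok : suc j * (k * k) ≤ n * j * (s * s)
      j-ok = begin
        suc j * (k * k)                    ≤⟨ *-mono-≤ (+-monoˡ-≤ j 0<j) k²≤ ⟩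
        (j + j) * (n * (n * (n * n)))      ≡⟨ identity j n (n * (n * n)) ⟩
        n * j * (2 * (n * (n * n)))        ≤⟨ *-monoʳ-≤ (n * j) s-large ⟩
        n * j * (s * s)                    ∎
        where
        open ≤-Reasoning
        identity : ∀ j n x → (j + j) * (n * x) ≡ n * j * (2 * x)
        identity = solve-∀

      module Refined = Families j (suc j) (s≤s z≤n) j-ok

      balanced-family : ∀ A F G (Fam : Vec Bool volume → Bool) → unbalanced y A ≡ false → unbalanced y F ≡ false → unbalanced y G ≡ false →
        (∀ P → Fam P ≡ true → Saturating conf (coveredᵉ A F G) k P) →
        card (coveredᵉ A F G) + 3 * (y * n) ≤ n * (n * n) + (squares A + (squares F + squares G)) →
        ∑ (cube volume) (λ P → ⟦ Fam P ⟧) ≤ Refined.D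
      balanced-family A F G Fam bA bF bG sat h = Refined.family-bound (coveredᵉ A F G) Fam sat
        (subst (λ x → x * U ≤ n * j * k) (sym suc-j) (+-cancelʳ-≤ (n * k) _ _ (*-cancelˡ-≤ Q {{ℕ.>-nonZero (*-mono-< {0} {48} (s≤s z≤n) 0<B)}} (+-cancelʳ-≤ (3 * (Q * (y * n)) * J) _ _ (begin
          Q * (J * U + n * k) + 3 * (Q * (y * n)) * J
            ≡⟨ identity₁ Q J U (n * k) (y * n) ⟩
          (Q * (U + 3 * (y * n))) * J + Q * (n * k)
            ≤⟨ +-monoˡ-≤ (Q * (n * k)) (*-monoˡ-≤ J (begin
                Q * (U + 3 * (y * n))                                                  ≤⟨ *-monoʳ-≤ Q h ⟩
                Q * (n * (n * n) + (squares A + (squares F + squares G)))              ≡⟨ identity₂ Q (n * (n * n)) (squares A) (squares F) (squares G) ⟩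
                Q * (n * (n * n)) + (Q * squares A + (Q * squares F + Q * squares G))  ≤⟨ +-monoʳ-≤ (Q * (n * (n * n))) (+-mono-≤ (light A bA) (+-mono-≤ (light F bF) (light G bG))) ⟩
                Q * (n * (n * n)) + (2 * (y * n) + (2 * (y * n) + 2 * (y * n)))        ≡⟨ cong (λ x → Q * (n * x) + (2 * (y * n) + (2 * (y * n) + 2 * (y * n)))) (sym k+y) ⟩
                Q * (n * (k + y)) + (2 * (y * n) + (2 * (y * n) + 2 * (y * n)))        ∎)) ⟩
          (Q * (n * (k + y)) + (2 * (y * n) + (2 * (y * n) + 2 * (y * n)))) * J + Q * (n * k)
            ≡⟨ identity₃ B n k y J ⟩
          n * (48 * B * k + 6 * (y * J)) + (48 * B * (n * k) * J + 48 * B * (y * n) * J)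
            ≤⟨ +-monoˡ-≤ _ (*-monoʳ-≤ n dagger) ⟩
          n * (96 * B * (y * J)) + (48 * B * (n * k) * J + 48 * B * (y * n) * J)
            ≡⟨ identity₄ B n k y J ⟩
          Q * (n * J * k) + 3 * (Q * (y * n)) * J
            ≡⟨ cong (λ x → Q * (n * x * k) + 3 * (Q * (y * n)) * J) (sym suc-j) ⟩
          Q * (n * suc j * k) + 3 * (Q * (y * n)) * J
            ≡⟨ cong (λ x → Q * x + 3 * (Q * (y * n)) * J) (identity₅ n j k) ⟩
          Q * (n * j * k + n * k) + 3 * (Q * (y * n)) * J ∎)))))
        where
        open ≤-Reasoning
        U = card (coveredᵉ A F G)
        light : ∀ M → unbalanced y M ≡ false → Q * squares M ≤ 2 * (y * n)
        light M e = ≮⇒≥ (does-false (2 * (y * n) <? Q * squares M) e)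
        identity₁ : ∀ Q J U x t → Q * (J * U + x) + 3 * (Q * t) * J ≡ (Q * (U + 3 * t)) * J + Q * x
        identity₁ = solve-∀
        identity₂ : ∀ Q x a b c → Q * (x + (a + (b + c))) ≡ Q * x + (Q * a + (Q * b + Q * c))
        identity₂ = solve-∀
        identity₃ : ∀ B n k y J → (48 * B * (n * (k + y)) + (2 * (y * n) + (2 * (y * n) + 2 * (y * n)))) * J + 48 * B * (n * k) ≡
                    n * (48 * B * k + 6 * (y * J)) + (48 * B * (n * k) * J + 48 * B * (y * n) * J)
        identity₃ = solve-∀
        identity₄ : ∀ B n k y J → n * (96 * B * (y * J)) + (48 * B * (n * k) * J + 48 * B * (y * n) * J) ≡ 48 * B * (n * J * k) + 3 * (48 * B * (y * n)) * J
        identity₄ = solve-∀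
        identity₅ : ∀ n j k → n * (1 + j) * k ≡ n * j * k + n * k
        identity₅ = solve-∀

      -- The y holes cost E^(2y) = E^z E^w. The smaller number of triangles gains E^(-z), and E^w ≤
      -- 4^w joins the errors, so that (E³n⁵/y³)^y remains.
      few-balanced : W * (layer-count * (layer-count * layer-count) * Refined.D) * (a * a) ^ V ≤ (n * (b * b)) ^ V
      few-balanced = finish (≤-trans (≤-reflexive (cong (W * (layer-count * (layer-count * layer-count) * Refined.D) *_) (split-V (a * a))))
        (combine {W} {layer-count * (layer-count * layer-count)} {Refined.D} {(a * a) ^ k} {(a * a) ^ y} {b * b} {n ^ k} {n ^ y} {(b * b) ^ k} {(b * b) ^ y} {F * (a * a)} {a ^ z} {b ^ z} {l * (l * l)} {r * (r * r)}
          (*-mono-< 0<l (*-mono-< 0<l 0<l)) 0<bb (m^n>0 a {{ℕ.>-nonZero 0<a}} z) cubes (Refined.D-bound (a ^ z) (b ^ z) decay) (begin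
            W * (F * (a * a)) * (r * (r * r)) * (a * a) ^ y * b ^ z           ≡⟨ cong (λ x → W * (F * (a * a)) * (r * (r * r)) * x * b ^ z) (squared a) ⟩
            W * (F * (a * a)) * (r * (r * r)) * (a ^ z * a ^ w) * b ^ z       ≡⟨ identity₁ (W * (F * (a * a))) (r * (r * r)) (a ^ z) (a ^ w) (b ^ z) ⟩
            W * (F * (a * a)) * (r * (r * r) * a ^ z * a ^ w * b ^ z)         ≤⟨ WF-bound _ ⟩
            W * (16 * F) * (r * (r * r) * a ^ z * a ^ w * b ^ z) * (b * b)    ≤⟨ *-monoˡ-≤ (b * b) (*-monoʳ-≤ (W * (16 * F)) (*-monoˡ-≤ (b ^ z) (*-monoʳ-≤ (r * (r * r) * a ^ z) (≤-trans (^-monoˡ-≤ w E≤4) (≤-reflexive (*-^ 4 b w)))))) ⟩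
            W * (16 * F) * (r * (r * r) * a ^ z * (4 ^ w * b ^ w) * b ^ z) * (b * b)   ≡⟨ identity₂ (W * (16 * F)) (r * (r * r)) (a ^ z) (4 ^ w) (b ^ w) (b ^ z) (b * b) ⟩
            W * (16 * F) * 4 ^ w * (r * (r * r)) * ((b ^ z * b ^ w) * (b * b) * a ^ z)  ≡⟨ cong (λ x → W * (16 * F) * 4 ^ w * (r * (r * r)) * (x * (b * b) * a ^ z)) (squared b) ⟨
            W * (16 * F) * 4 ^ w * (r * (r * r)) * ((b * b) ^ y * (b * b) * a ^ z)      ≤⟨ *-monoˡ-≤ _ key ⟩
            n ^ y * (l * (l * l)) * ((b * b) ^ y * (b * b) * a ^ z)           ≡⟨ identity₃ (n ^ y) (l * (l * l)) ((b * b) ^ y) (b * b) (a ^ z) ⟩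
            n ^ y * (b * b) ^ y * (l * (l * l)) * (b * b) * a ^ z             ∎)))
        where
        open ≤-Reasoning
        identity₁ : ∀ x r p q t → x * r * (p * q) * t ≡ x * (r * p * q * t)
        identity₁ = solve-∀
        identity₂ : ∀ x r p f q t c → x * (r * p * (f * q) * t) * c ≡ x * f * r * ((t * q) * c * p)
        identity₂ = solve-∀
        identity₃ : ∀ ν l β c p → ν * l * (β * c * p) ≡ ν * β * l * c * p
        identity₃ = solve-∀
        squared : ∀ x → (x * x) ^ y ≡ x ^ z * x ^ w
        squared x = trans (*-^ x x y) (trans (sym (^-distribˡ-+-* x y y)) (trans (cong (x ^_) (trans (cong (y +_) (sym (+-identityʳ y))) (sym z+w))) (^-distribˡ-+-* x z w)))
        -- E ≤ (1 + 1/j)^(j+1) is applied z times, which is possible because z(j + 1) = zJ ≤ k.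
        decay : j ^ k * a ^ z ≤ suc j ^ k * b ^ z
        decay = ≤-trans (≤-reflexive (*-comm (j ^ k) (a ^ z))) (≤-trans (power-weaken (suc j) z k (n≤1+n j) (≤-trans (≤-reflexive (cong (z *_) suc-j)) zJ≤k) {a} {b}
          (≤-trans (E≤upper j 0<j j≤V) (≤-reflexive (*-comm (suc j ^ suc j) b)))) (≤-reflexive (*-comm (b ^ z) (suc j ^ k))))
        g : ℕ
        g = e + 2 * w
        G : ℕ
        G = W * (16 * F) * 4 ^ w
        G≤ : G ≤ 2 ^ g
        G≤ = ≤-trans (*-mono-≤ {W * (16 * F)} {2 ^ e} {4 ^ w} {2 ^ (2 * w)} (≤-trans (m≤m*n (W * (16 * F)) (2 ^ n) {{ℕ.>-nonZero (m^n>0 2 n)}}) err-k) (≤-reflexive (^-*-assoc 2 2 w))) (≤-reflexive (sym (^-distribˡ-+-* 2 e (2 * w))))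
        -- The bound 3y is available since each of the three layer counts brings a factor E^y, hence
        -- its own slack (1 + 1/(2B))^y.
        g-small : 2 * B * g ≤ 3 * y
        g-small = begin
          2 * B * (e + 2 * w)                   ≡⟨ identity B e w ⟩
          2 * B * e + 2 * (w * (2 * B))         ≤⟨ +-mono-≤ e-small (*-monoʳ-≤ 2 wB≤y) ⟩
          y + 2 * y                             ∎
          where
          identity : ∀ B e w → 2 * B * (e + 2 * w) ≡ 2 * B * e + 2 * (w * (2 * B))
          identity = solve-∀
        β₁ β₂ q³ : ℕ
        β₁ = 2 * B
        β₂ = suc (2 * B)
        q³ = q * (q * q)
        c³ : ℕ → ℕ
        c³ x = x * (x * x)
        c³-^ : ∀ x → x ^ (3 * y) ≡ c³ x ^ y
        c³-^ x = trans (sym (^-*-assoc x 3 y)) (cong (_^ y) (lemma x))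
          where
          lemma : ∀ x → x * (x * (x * 1)) ≡ x * (x * x)
          lemma = solve-∀
        grow : G * c³ β₁ ^ y ≤ c³ β₂ ^ y
        grow = ≤-trans (*-monoˡ-≤ (c³ β₁ ^ y) G≤) (subst₂ (λ u v → 2 ^ g * u ≤ v) (c³-^ β₁) (c³-^ β₂) (growth B g (3 * y) 0<B g-small))
        ratio : c³ (V * a) * q³ * c³ β₂ ≤ n * c³ (y * b) * q³ * c³ β₁
        ratio = begin
          c³ (V * a) * q³ * c³ β₂                            ≡⟨ identity₄ V a q β₂ ⟩
          c³ V * c³ (a * q * β₂)                             ≤⟨ *-monoʳ-≤ (c³ V) (*-mono-≤ slack (*-mono-≤ slack slack)) ⟩
          c³ V * c³ (p * b * β₁)                             ≡⟨ identity₅ n p b β₁ ⟩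
          n * (p * (p * p) * n⁵) * c³ b * c³ β₁              ≤⟨ *-monoˡ-≤ (c³ β₁) (*-monoˡ-≤ (c³ b) (*-monoʳ-≤ n y-large)) ⟩
          n * (q³ * (y * (y * y))) * c³ b * c³ β₁            ≡⟨ identity₆ n q³ y b (c³ β₁) ⟩
          n * c³ (y * b) * q³ * c³ β₁                        ∎
          where
          identity₄ : ∀ V a q t → (V * a) * ((V * a) * (V * a)) * (q * (q * q)) * (t * (t * t)) ≡ V * (V * V) * ((a * q * t) * ((a * q * t) * (a * q * t)))
          identity₄ = solve-∀
          identity₅ : ∀ n p b t → (n * n) * ((n * n) * (n * n)) * ((p * b * t) * ((p * b * t) * (p * b * t))) ≡ n * (p * (p * p) * (n * (n * (n * (n * n))))) * (b * (b * b)) * (t * (t * t))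
          identity₅ = solve-∀
          identity₆ : ∀ n q y b t → n * (q * (y * (y * y))) * (b * (b * b)) * t ≡ n * (y * b * (y * b * (y * b))) * q * t
          identity₆ = solve-∀
        0<q³ : 0 < q³
        0<q³ = *-mono-< 0<q (*-mono-< 0<q 0<q)
        key : G * (r * (r * r)) ≤ n ^ y * (l * (l * l))
        key = *-cancelʳ-≤ _ _ (q³ ^ y * c³ β₂ ^ y) {{ℕ.>-nonZero (*-mono-< (m^n>0 q³ {{ℕ.>-nonZero 0<q³}} y) (m^n>0 (c³ β₂) y))}} (begin
          G * (r * (r * r)) * (q³ ^ y * c³ β₂ ^ y)           ≡⟨ cong (λ x → G * x * (q³ ^ y * c³ β₂ ^ y)) (cube-^ (V * a) y) ⟩
          G * c³ (V * a) ^ y * (q³ ^ y * c³ β₂ ^ y)          ≡⟨ trans (identity₇ G (c³ (V * a) ^ y) (q³ ^ y) (c³ β₂ ^ y)) (cong (G *_) (sym (merge₃ (c³ (V * a)) q³ (c³ β₂)))) ⟩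
          G * (c³ (V * a) * q³ * c³ β₂) ^ y                  ≤⟨ *-monoʳ-≤ G (^-monoˡ-≤ y ratio) ⟩
          G * (n * c³ (y * b) * q³ * c³ β₁) ^ y              ≡⟨ cong (G *_) (merge₃ (n * c³ (y * b)) q³ (c³ β₁)) ⟩
          G * ((n * c³ (y * b)) ^ y * q³ ^ y * c³ β₁ ^ y)    ≡⟨ identity₈ G ((n * c³ (y * b)) ^ y) (q³ ^ y) (c³ β₁ ^ y) ⟩
          (n * c³ (y * b)) ^ y * q³ ^ y * (G * c³ β₁ ^ y)    ≤⟨ *-monoʳ-≤ ((n * c³ (y * b)) ^ y * q³ ^ y) grow ⟩
          (n * c³ (y * b)) ^ y * q³ ^ y * c³ β₂ ^ y          ≡⟨ trans (*-assoc ((n * c³ (y * b)) ^ y) _ _) (cong (_* (q³ ^ y * c³ β₂ ^ y)) (trans (*-^ n (c³ (y * b)) y) (cong (n ^ y *_) (sym (cube-^ (y * b) y))))) ⟩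
          n ^ y * (l * (l * l)) * (q³ ^ y * c³ β₂ ^ y)       ∎)
          where
          merge₃ : ∀ x t v → (x * t * v) ^ y ≡ x ^ y * t ^ y * v ^ y
          merge₃ x t v = trans (*-^ (x * t) v y) (cong (_* v ^ y) (*-^ x t y))
          identity₇ : ∀ G x t v → G * x * (t * v) ≡ G * (x * t * v)
          identity₇ = solve-∀
          identity₈ : ∀ G x t v → G * (x * t * v) ≡ x * t * (G * v)
          identity₈ = solve-∀

      claim-middle : 4 * V * total-of * (a * a) ^ V ≤ (n * (b * b)) ^ V
      claim-middle = *-cancelˡ-≤ 6 (begin
        6 * (4 * V * total-of * (a * a) ^ V)                      ≤⟨ *-monoʳ-≤ 6 (*-monoˡ-≤ ((a * a) ^ V) (*-monoʳ-≤ (4 * V) grouped)) ⟩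
        6 * (4 * V * (ℓ * (ℓ * ℓ) * Refined.D + 3 * (bad-count * (ℓ * ℓ)) * Trivial.D) * (a * a) ^ V)
          ≡⟨ identity V (ℓ * (ℓ * ℓ)) Refined.D (bad-count * (ℓ * ℓ)) Trivial.D ((a * a) ^ V) ⟩
        W * (ℓ * (ℓ * ℓ) * Refined.D) * (a * a) ^ V + 3 * (W * (bad-count * (ℓ * ℓ) * Trivial.D) * (a * a) ^ V)
          ≤⟨ +-mono-≤ few-balanced (*-monoʳ-≤ 3 few-unbalanced) ⟩
        (n * (b * b)) ^ V + 3 * (n * (b * b)) ^ V                 ≤⟨ m≤m+n _ (2 * (n * (b * b)) ^ V) ⟩
        (n * (b * b)) ^ V + 3 * (n * (b * b)) ^ V + 2 * (n * (b * b)) ^ V   ≡⟨ six ((n * (b * b)) ^ V) ⟩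
        6 * (n * (b * b)) ^ V                                     ∎)
        where
        open ≤-Reasoning
        open Grouping shattered shattered-independent k y k+y (unbalanced y) Refined.D Trivial.D balanced-family
          trivial-bound
          using (grouped; ℓ) renaming (b to bad-count)
        identity : ∀ V x D t E A → 6 * (4 * V * (x * D + 3 * t * E) * A) ≡ 24 * V * (x * D) * A + 3 * (24 * V * (t * E) * A)
        identity = solve-∀
        six : ∀ x → x + 3 * x + 2 * x ≡ 6 * x
        six = solve-∀

  -- Choice of the parameters for a given order

  isqrt : ∀ n → ∃ λ v → v * v ≤ n × n < suc v * suc v
  isqrt zero = 0 , z≤n , s≤s z≤n
  isqrt (suc n) with v , lo , hi ← isqrt n with suc v * suc v ≤? suc n
  ... | yes p = suc v , p , ≤-<-trans hi (*-mono-< (n<1+n (suc v)) (n<1+n (suc v)))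
  ... | no ¬p = v , ≤-trans lo (n≤1+n n) , ≰⇒> ¬p

  ilog : ∀ v → 0 < v → ∃ λ L → 2 ^ L ≤ v × v < 2 ^ suc L
  ilog (suc zero) _ = 0 , ≤-refl , ≤-refl
  ilog (suc v@(suc _)) _ with L , lo , hi ← ilog v (s≤s z≤n) with 2 ^ suc L ≤? suc v
  ... | yes p = suc L , p , ≤-trans (s≤s hi) (≤-trans (+-monoˡ-≤ (2 ^ suc L) (m^n>0 2 (suc L))) (≤-reflexive (cong (2 ^ suc L +_) (sym (+-identityʳ _)))))
  ... | no ¬p = L , ≤-trans lo (n≤1+n v) , ≰⇒> ¬p

  quartic : ∀ d → let x = d + 16 in x * (x * (x * x)) ≤ 2 ^ x
  quartic zero    = ≤-refl {65536}
  quartic (suc d) = begin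
    suc x * (suc x * (suc x * suc x))                ≡⟨ expand x ⟩
    x * (x * (x * x)) + (4 * (x * (x * x)) + (6 * (x * x) + (4 * x + 1)))
      ≤⟨ +-monoʳ-≤ (x * (x * (x * x))) (+-monoʳ-≤ (4 * (x * (x * x))) (+-mono-≤ (*-monoʳ-≤ 6 x²≤) (+-mono-≤ (*-monoʳ-≤ 4 x≤) 1≤))) ⟩
    x * (x * (x * x)) + (4 * (x * (x * x)) + (6 * (x * (x * x)) + (4 * (x * (x * x)) + x * (x * x))))
      ≡⟨ collect (x * (x * (x * x))) (x * (x * x)) ⟩
    x * (x * (x * x)) + 15 * (x * (x * x))           ≤⟨ +-monoʳ-≤ (x * (x * (x * x))) (*-monoˡ-≤ (x * (x * x)) (≤-trans (n≤1+n 15) 16≤x)) ⟩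
    x * (x * (x * x)) + x * (x * (x * x))            ≤⟨ +-mono-≤ (quartic d) (quartic d) ⟩
    2 ^ x + 2 ^ x                                    ≡⟨ cong (2 ^ x +_) (sym (+-identityʳ (2 ^ x))) ⟩
    2 ^ suc x                                        ∎
    where
    open ≤-Reasoning
    x = d + 16
    16≤x : 16 ≤ x
    16≤x = m≤n+m 16 d
    1≤x : 1 ≤ x
    1≤x = ≤-trans (s≤s z≤n) 16≤x
    x²≤ : x * x ≤ x * (x * x)
    x²≤ = m≤n*m (x * x) x {{ℕ.>-nonZero 1≤x}}
    x≤ : x ≤ x * (x * x)
    x≤ = ≤-trans (m≤n*m x x {{ℕ.>-nonZero 1≤x}}) x²≤
    1≤ : 1 ≤ x * (x * x)
    1≤ = ≤-trans 1≤x x≤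
    expand : ∀ x → (1 + x) * ((1 + x) * ((1 + x) * (1 + x))) ≡ x * (x * (x * x)) + (4 * (x * (x * x)) + (6 * (x * x) + (4 * x + 1)))
    expand = solve-∀
    collect : ∀ a b → a + (4 * b + (6 * b + (4 * b + b))) ≡ a + 15 * b
    collect = solve-∀

  -- Of x⁴ ≤ 2^x with x = L + 1, one factor x absorbs the constant 2K³.
  cubic : ∀ K L → 16 + 2 * (K * (K * K)) ≤ suc L → (K * suc L) * ((K * suc L) * (K * suc L)) ≤ 2 ^ L
  cubic K L h = *-cancelˡ-≤ 2 (begin
    2 * ((K * x) * ((K * x) * (K * x)))       ≡⟨ identity K x ⟩
    2 * (K * (K * K)) * (x * (x * x))         ≤⟨ *-monoˡ-≤ (x * (x * x)) (≤-trans (m≤n+m _ 16) h) ⟩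
    x * (x * (x * x))                         ≤⟨ subst (λ x → x * (x * (x * x)) ≤ 2 ^ x) (m∸n+n≡m (≤-trans (m≤m+n 16 _) h)) (quartic (x ∸ 16)) ⟩
    2 ^ x                                     ∎)
    where
    open ≤-Reasoning
    x = suc L
    identity : ∀ K x → 2 * ((K * x) * ((K * x) * (K * x))) ≡ 2 * (K * (K * K)) * (x * (x * x))
    identity = solve-∀

  cube-cancel-≤ : ∀ {x y} → x * (x * x) ≤ y * (y * y) → x ≤ y
  cube-cancel-≤ h = ≮⇒≥ (λ y<x → <⇒≱ (*-mono-< y<x (*-mono-< y<x y<x)) h)

  cube-mono-≤ : ∀ {x y} → x ≤ y → x * (x * x) ≤ y * (y * y)
  cube-mono-≤ h = *-mono-≤ h (*-mono-≤ h h)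

  sqrt-cancel : ∀ {x y} → x * x < y * y → x < y
  sqrt-cancel h = ≰⇒> (λ y≤x → <⇒≱ h (*-mono-≤ y≤x y≤x))

  -- The number s used in the rising factorials, and an exponent e with 2^e above all subexponential factors.
  module Sizes (n v L : ℕ) (lo : v * v ≤ n) (hi : n < suc v * suc v) (0<v : 0 < v) (loL : 2 ^ L ≤ v) (hiL : v < 2 ^ suc L) where

    ℓ t s e : ℕ
    ℓ = suc L
    t = suc v
    -- Of order n^(3/2), the order that s² ≥ 2n³ demands.
    s = 2 * (t * (t * t))
    -- In this order: 24 · 16 ≤ 2⁹, the factor n², the 2 + 2s factors n² + 1 of at most 4ℓ + 1 bits
    -- each, and 2^n.
    e = 9 + (4 * ℓ + ((2 + 2 * s) * (4 * ℓ + 1) + t * t))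

    open ≤-Reasoning

    n≤t² : n ≤ t * t
    n≤t² = <⇒≤ hi

    s-large : 2 * (n * (n * n)) ≤ s * s
    s-large = begin
      2 * (n * (n * n))                             ≤⟨ *-monoʳ-≤ 2 (cube-mono-≤ n≤t²) ⟩
      2 * ((t * t) * ((t * t) * (t * t)))           ≤⟨ *-monoˡ-≤ ((t * t) * ((t * t) * (t * t))) {2} {4} (s≤s (s≤s z≤n)) ⟩
      4 * ((t * t) * ((t * t) * (t * t)))           ≡⟨ identity t ⟩
      s * s                                         ∎
      where
      identity : ∀ t → 4 * ((t * t) * ((t * t) * (t * t))) ≡ 2 * (t * (t * t)) * (2 * (t * (t * t)))
      identity = solve-∀

    n≤4^ : n * n ≤ 2 ^ (4 * ℓ)
    n≤4^ = begin
      n * n                         ≤⟨ *-mono-≤ n≤t² n≤t² ⟩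
      t * t * (t * t)               ≤⟨ *-mono-≤ (*-mono-≤ hiL hiL) (*-mono-≤ hiL hiL) ⟩
      2 ^ ℓ * 2 ^ ℓ * (2 ^ ℓ * 2 ^ ℓ)   ≡⟨ identity (2 ^ ℓ) ⟩
      (2 ^ ℓ) ^ 4                   ≡⟨ ^-*-assoc 2 ℓ 4 ⟩
      2 ^ (ℓ * 4)                   ≡⟨ cong (2 ^_) (*-comm ℓ 4) ⟩
      2 ^ (4 * ℓ)                   ∎
      where
      identity : ∀ x → x * x * (x * x) ≡ x * (x * (x * (x * 1)))
      identity = solve-∀

    V+1≤ : suc (n * n) ≤ 2 ^ (4 * ℓ + 1)
    V+1≤ = begin
      1 + n * n                         ≤⟨ +-mono-≤ (m^n>0 2 (4 * ℓ)) n≤4^ ⟩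
      2 ^ (4 * ℓ) + 2 ^ (4 * ℓ)         ≡⟨ identity (2 ^ (4 * ℓ)) ⟩
      2 ^ (4 * ℓ) * 2 ^ 1               ≡⟨ ^-distribˡ-+-* 2 (4 * ℓ) 1 ⟨
      2 ^ (4 * ℓ + 1)                   ∎
      where
      identity : ∀ x → x + x ≡ x * (2 * 1)
      identity = solve-∀

    err : 24 * (n * n) * (16 * ((suc (n * n) * suc (n * n) ^ s) * (suc (n * n) * suc (n * n) ^ s))) * 2 ^ n ≤ 2 ^ e
    err = begin
      24 * V * (16 * ((suc V * suc V ^ s) * (suc V * suc V ^ s))) * 2 ^ n
        ≡⟨ identity V (suc V) (suc V ^ s) (2 ^ n) ⟩
      24 * 16 * (V * ((suc V * suc V) * (suc V ^ s * suc V ^ s) * 2 ^ n))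
        ≡⟨ cong (λ x → 24 * 16 * (V * (x * 2 ^ n))) powers ⟩
      24 * 16 * (V * (suc V ^ (2 + 2 * s) * 2 ^ n))
        ≤⟨ *-mono-≤ {24 * 16} {2 ^ 9} (m≤m+n 384 128) (*-mono-≤ n≤4^ (*-mono-≤ (≤-trans (^-monoˡ-≤ (2 + 2 * s) V+1≤) (≤-reflexive (trans (^-*-assoc 2 (4 * ℓ + 1) (2 + 2 * s)) (cong (2 ^_) (*-comm (4 * ℓ + 1) (2 + 2 * s)))))) (^-monoʳ-≤ 2 n≤t²))) ⟩
      2 ^ 9 * (2 ^ (4 * ℓ) * (2 ^ ((2 + 2 * s) * (4 * ℓ + 1)) * 2 ^ (t * t)))
        ≡⟨ sym (trans (^-distribˡ-+-* 2 9 (4 * ℓ + ((2 + 2 * s) * (4 * ℓ + 1) + t * t))) (cong (2 ^ 9 *_) (trans (^-distribˡ-+-* 2 (4 * ℓ) ((2 + 2 * s) * (4 * ℓ + 1) + t * t)) (cong (2 ^ (4 * ℓ) *_) (^-distribˡ-+-* 2 ((2 + 2 * s) * (4 * ℓ + 1)) (t * t)))))) ⟩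
      2 ^ e ∎
      where
      V = n * n
      powers : suc V * suc V * (suc V ^ s * suc V ^ s) ≡ suc V ^ (2 + 2 * s)
      powers = trans (cong (suc V * suc V *_) (trans (sym (^-distribˡ-+-* (suc V) s s)) (cong (λ x → suc V ^ (s + x)) (sym (+-identityʳ s)))))
                     (*-assoc (suc V) (suc V) (suc V ^ (2 * s)))
      identity : ∀ V x p q → 24 * V * (16 * ((x * p) * (x * p))) * q ≡ 24 * 16 * (V * ((x * x) * (p * p) * q))
      identity = solve-∀

    e≤ : e ≤ 400 * (ℓ * (v * (v * v)))
    e≤ = begin
      9 + (4 * ℓ + ((2 + 2 * s) * (4 * ℓ + 1) + t * t))
        ≤⟨ +-mono-≤ (*-monoʳ-≤ 9 1≤ℓT) (+-mono-≤ (*-monoʳ-≤ 4 ℓ≤ℓT) (+-mono-≤ (*-mono-≤ (+-monoˡ-≤ (2 * s) (*-monoʳ-≤ 2 1≤T)) (+-monoʳ-≤ (4 * ℓ) 1≤ℓ)) t²≤ℓT)) ⟩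
      9 * (ℓ * T) + (4 * (ℓ * T) + ((2 * T + 2 * s) * (4 * ℓ + ℓ) + ℓ * T))
        ≡⟨ identity₁ ℓ T ⟩
      44 * (ℓ * T)
        ≤⟨ *-monoʳ-≤ 44 (*-monoʳ-≤ ℓ (cube-mono-≤ t≤2v)) ⟩
      44 * (ℓ * (2 * v * (2 * v * (2 * v))))
        ≤⟨ m≤m+n _ (48 * (ℓ * (v * (v * v)))) ⟩
      44 * (ℓ * (2 * v * (2 * v * (2 * v)))) + 48 * (ℓ * (v * (v * v)))
        ≡⟨ identity₂ ℓ v ⟩
      400 * (ℓ * (v * (v * v))) ∎
      where
      T = t * (t * t)
      1≤T : 1 ≤ T
      1≤T = *-mono-≤ {1} {t} {1} (s≤s z≤n) (*-mono-≤ {1} {t} {1} (s≤s z≤n) (s≤s z≤n))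
      1≤ℓ : 1 ≤ ℓ
      1≤ℓ = s≤s z≤n
      1≤ℓT : 1 ≤ ℓ * T
      1≤ℓT = *-mono-≤ 1≤ℓ 1≤T
      ℓ≤ℓT : ℓ ≤ ℓ * T
      ℓ≤ℓT = ≤-trans (≤-reflexive (sym (*-identityʳ ℓ))) (*-monoʳ-≤ ℓ 1≤T)
      t²≤ℓT : t * t ≤ ℓ * T
      t²≤ℓT = ≤-trans (m≤n*m (t * t) t) (m≤n*m T ℓ)
      t≤2v : t ≤ 2 * v
      t≤2v = ≤-trans (+-monoˡ-≤ v 0<v) (≤-reflexive (cong (v +_) (sym (+-identityʳ v))))
      identity₁ : ∀ ℓ T → 9 * (ℓ * T) + (4 * (ℓ * T) + ((2 * T + 2 * (2 * T)) * (4 * ℓ + ℓ) + ℓ * T)) ≡ 44 * (ℓ * T)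
      identity₁ = solve-∀
      identity₂ : ∀ ℓ v → 44 * (ℓ * (2 * v * (2 * v * (2 * v)))) + 48 * (ℓ * (v * (v * v))) ≡ 400 * (ℓ * (v * (v * v)))
      identity₂ = solve-∀

    -- e is of order n^(3/2) log n, hence below n^(5/3): in the cube, (800Bℓ)³ ≤ 2^L ≤ v, and v · v⁹
    -- ≤ n⁵.
    e-cube : ∀ B → 16 + 2 * ((800 * B) * ((800 * B) * (800 * B))) ≤ ℓ → (2 * B * e) * ((2 * B * e) * (2 * B * e)) ≤ n * (n * (n * (n * n)))
    e-cube B h = begin
      (2 * B * e) * ((2 * B * e) * (2 * B * e))                       ≤⟨ cube-mono-≤ (*-monoʳ-≤ (2 * B) e≤) ⟩
      c³ (2 * B * (400 * (ℓ * (v * (v * v)))))                        ≡⟨ identity₁ 400 B ℓ v ⟩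
      c³ (2 * 400 * B * ℓ) * (v * (v * v) * (v * (v * v) * (v * (v * v))))   ≤⟨ *-monoˡ-≤ _ (≤-trans (cubic (800 * B) L h) loL) ⟩
      v * (v * (v * v) * (v * (v * v) * (v * (v * v))))               ≡⟨ identity₂ v ⟩
      (v * v) * ((v * v) * ((v * v) * ((v * v) * (v * v))))           ≤⟨ *-mono-≤ lo (*-mono-≤ lo (*-mono-≤ lo (*-mono-≤ lo lo))) ⟩
      n * (n * (n * (n * n)))                                         ∎
      where
      c³ : ℕ → ℕ
      c³ x = x * (x * x)
      identity₁ : ∀ f B ℓ v → (2 * B * (f * (ℓ * (v * (v * v))))) * ((2 * B * (f * (ℓ * (v * (v * v))))) * (2 * B * (f * (ℓ * (v * (v * v)))))) ≡
                  (2 * f * B * ℓ) * ((2 * f * B * ℓ) * (2 * f * B * ℓ)) * (v * (v * v) * (v * (v * v) * (v * (v * v))))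
      identity₁ = solve-∀
      identity₂ : ∀ v → v * (v * (v * v) * (v * (v * v) * (v * (v * v)))) ≡ (v * v) * ((v * v) * ((v * v) * ((v * v) * (v * v))))
      identity₂ = solve-∀

  module PerOrder (n p q B s e K : ℕ) (0<n : 0 < n) (0<B : 0 < B) (0<q : 0 < q) (q≤p : q ≤ p)
    (s-large : 2 * (n * (n * n)) ≤ s * s)
    (err : 24 * (n * n) * (16 * ((suc (n * n) * suc (n * n) ^ s) * (suc (n * n) * suc (n * n) ^ s))) * 2 ^ n ≤ 2 ^ e)
    (e-cube : (2 * B * e) * ((2 * B * e) * (2 * B * e)) ≤ n * (n * (n * (n * n))))
    (K-def : K ≡ (2 * φ) ^ (48 * B) + (32 * B + 1)) (K-small : c₆ * (K * (K * K)) ≤ n)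
    (slack : suc (n * n) ^ suc (n * n) * q * suc (2 * B) ≤ p * (n * n) ^ suc (n * n) * (2 * B)) where

    V n⁵ : ℕ
    V = n * n
    n⁵ = n * (n * (n * (n * n)))

    0<V : 0 < V
    0<V = *-mono-< 0<n 0<n

    open Euler V 0<V
    open Shatter n
    open Triples n

    Large : ℕ → Set
    Large y = p * (p * p) * n⁵ ≤ q * (q * q) * (y * (y * y))

    module _ {y} (large : Large y) where

      n⁵≤y³ : n⁵ ≤ y * (y * y)
      n⁵≤y³ = *-cancelˡ-≤ (p * (p * p)) {{ℕ.>-nonZero (cube-mono-≤ {1} (≤-trans 0<q q≤p))}} (≤-trans large (*-monoˡ-≤ (y * (y * y)) (cube-mono-≤ q≤p)))

      e-small : 2 * B * e ≤ y
      e-small = cube-cancel-≤ (≤-trans e-cube n⁵≤y³)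

      0<y : 0 < y
      0<y = cube-cancel-≤ (≤-trans (*-mono-< 0<n (*-mono-< 0<n (*-mono-< 0<n (*-mono-< 0<n 0<n)))) n⁵≤y³)

    few : ∀ k y → k + y ≡ V → Large y → 4 * V * ∑ (cube volume) (λ Y → ⟦ shattered Y ∧ (card (lookup Y) == k) ⟧) * (a * a) ^ V ≤ (n * (b * b)) ^ V
    few k y k+y large with ≤-total (c₆ * n⁵) (y * (y * y))
    ... | inj₁ h = Estimate.claim-big n B p q y k s e 0<n 0<B 0<q q≤p (0<y large) k+y s-large err (e-small large) large slack h
    ... | inj₂ h = Estimate.Middle.claim-middle n B p q y k s e 0<n 0<B 0<q q≤p (0<y large) k+y s-large err (e-small large) large slack Z-large V-large
      where
      -- `K` is the sum of the constants needed by `Middle`, so that one bound on Ky yields both of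
      -- its conditions. Cubed, the claim follows from y³ ≤ c₆n⁵ and c₆K³ ≤ n.
      Ky≤V : K * y ≤ V
      Ky≤V = cube-cancel-≤ (begin
        K * y * (K * y * (K * y))              ≡⟨ identity₁ K y ⟩
        K * (K * K) * (y * (y * y))            ≤⟨ *-monoʳ-≤ (K * (K * K)) h ⟩
        K * (K * K) * (c₆ * n⁵)                ≡⟨ x∙yz≈yx∙z (K * (K * K)) c₆ n⁵ ⟩
        c₆ * (K * (K * K)) * n⁵                ≤⟨ *-monoˡ-≤ n⁵ K-small ⟩
        n * n⁵                                 ≡⟨ identity₃ n ⟩
        V * (V * V)                            ∎)
        where
        open ≤-Reasoning
        identity₁ : ∀ K y → K * y * (K * y * (K * y)) ≡ K * (K * K) * (y * (y * y))
        identity₁ = solve-∀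
        identity₃ : ∀ n → n * (n * (n * (n * (n * n)))) ≡ n * n * (n * n * (n * n))
        identity₃ = solve-∀
      parts : (2 * φ) ^ (48 * B) * y + (32 * B * y + y) ≤ V
      parts = ≤-trans (≤-reflexive (trans (identity ((2 * φ) ^ (48 * B)) (32 * B) y) (cong (_* y) (sym K-def)))) Ky≤V
        where
        identity : ∀ x z y → x * y + (z * y + y) ≡ (x + (z + 1)) * y
        identity = solve-∀
      Z-large : (2 * φ) ^ (48 * B) * y ≤ V
      Z-large = ≤-trans (m≤m+n _ _) parts
      V-large : 32 * B * y ≤ k
      V-large = +-cancelʳ-≤ y (32 * B * y) k (≤-trans (≤-trans (m≤n+m (32 * B * y + y) ((2 * φ) ^ (48 * B) * y)) parts) (≤-reflexive (sym k+y)))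

    -- By `few` and `latin-lower`, 2V · total k ≤ C for every size k below V - X. There are at most
    -- V sizes, so the totals add up to at most C/2, whereas the second case of `vc-or-few` requires
    -- at least C > 0.
    vc-large : ∀ X → (∀ y → X < y → Large y) → VCdimAtLeast n (V ∸ X)
    vc-large X large with vc-or-few (V ∸ X)
    ... | inj₁ vc = vc
    ... | inj₂ h = ⊥-elim (<⇒≱ C>0 (≮⇒≥ λ C>0′ → <⇒≱ (*-monoʳ-< V {{ℕ.>-nonZero 0<V}} (m<m+n C {C + 0} (≤-trans C>0′ (m≤m+n C 0)))) (begin
        V * (2 * C)                          ≤⟨ *-monoʳ-≤ V (*-monoʳ-≤ 2 h) ⟩
        V * (2 * ∑ (List.upTo m) total)      ≡⟨ trans (identity₁ V (∑ (List.upTo m) total)) (sym (∑-*ˡ (List.upTo m) (2 * V) total)) ⟩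
        ∑ (List.upTo m) (λ k → 2 * V * total k)   ≤⟨ ∑-mono (List.upTo m) (λ k k∈ → each k (Mem.∈-upTo⁻ k∈)) ⟩
        ∑ (List.upTo m) (λ _ → C)            ≡⟨ trans (∑-const (List.upTo m) C) (cong (_* C) (Listₚ.length-upTo m)) ⟩
        m * C                                ≤⟨ *-monoˡ-≤ C (m∸n≤m V X) ⟩
        V * C                                ∎)))
      where
      open ≤-Reasoning
      m = V ∸ X
      C = Latin.count n n
      total : ℕ → ℕ
      total k = ∑ (cube volume) (λ Y → ⟦ shattered Y ∧ (card (lookup Y) == k) ⟧)
      identity₁ : ∀ V x → V * (2 * x) ≡ 2 * V * x
      identity₁ = solve-∀
      0<A : 0 < (a * a) ^ V
      0<A = m^n>0 (a * a) {{ℕ.>-nonZero (*-mono-< 0<a 0<a)}} V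
      C>0 : 0 < C
      C>0 = ≰⇒> λ C≤0 → <⇒≱ (m^n>0 (n * (b * b)) {{ℕ.>-nonZero (*-mono-< 0<n (*-mono-< 0<b 0<b))}} V)
        (≤-trans (latin-lower n 0<V) (≤-reflexive (cong (λ c → 2 * c * (a * a) ^ V) (n≤0⇒n≡0 C≤0))))
      each : ∀ k → k < m → 2 * V * total k ≤ C
      each k k<m = *-cancelˡ-≤ 2 (*-cancelʳ-≤ _ _ ((a * a) ^ V) {{ℕ.>-nonZero 0<A}} (begin
        2 * (2 * V * total k) * (a * a) ^ V      ≡⟨ cong (_* (a * a) ^ V) (identity₂ V (total k)) ⟩
        4 * V * total k * (a * a) ^ V            ≤⟨ few k (V ∸ k) (m+[n∸m]≡n k≤V) (large (V ∸ k) X<y) ⟩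
        (n * (b * b)) ^ V                        ≤⟨ latin-lower n 0<V ⟩
        2 * C * (a * a) ^ V                      ∎))
        where
        identity₂ : ∀ V x → 2 * (2 * V * x) ≡ 4 * V * x
        identity₂ = solve-∀
        k≤V : k ≤ V
        k≤V = ≤-trans (<⇒≤ k<m) (m∸n≤m V X)
        X<y : X < V ∸ k
        X<y = +-cancelʳ-< k X (V ∸ k) (subst (X + k <_) (sym (m∸n+n≡m k≤V)) (subst₂ _<_ (+-comm k X) (m∸n+n≡m X≤V) (+-monoˡ-< X k<m)))
          where
          X≤V : X ≤ V
          X≤V = ≮⇒≥ (λ V<X → <⇒≱ (≤-trans (s≤s z≤n) k<m) (≤-reflexive (m≤n⇒m∸n≡0 (<⇒≤ V<X))))

  -- X is the integer part of the cube root of P/Q, found by descent from N.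
  threshold : ∀ (P Q : ℕ) N → 0 < Q → P ≤ N →
              ∃ λ X → Q * (X * (X * X)) ≤ P × (∀ y → X < y → P ≤ Q * (y * (y * y)))
  threshold P Q N 0<Q P≤N = down N (λ y N<y → ≤-trans (≤-trans P≤N (<⇒≤ N<y)) (≤-trans (cube-≥ y) (m≤n*m _ Q {{ℕ.>-nonZero 0<Q}})))
    where
    cube-≥ : ∀ y → y ≤ y * (y * y)
    cube-≥ zero    = z≤n
    cube-≥ (suc y) = m≤m*n (suc y) (suc y * suc y)
    down : ∀ N → (∀ y → N < y → P ≤ Q * (y * (y * y))) → ∃ λ X → Q * (X * (X * X)) ≤ P × (∀ y → X < y → P ≤ Q * (y * (y * y)))
    down zero    h = 0 , ≤-trans (≤-reflexive (*-zeroʳ Q)) z≤n , h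
    down (suc N) h with Q * (suc N * (suc N * suc N)) ≤? P
    ... | yes p = suc N , p , h
    ... | no ¬p = down N λ y N<y → case m≤n⇒m<n∨m≡n N<y of λ
      { (inj₁ q) → h y q ; (inj₂ refl) → <⇒≤ (≰⇒> ¬p) }

  module Orders (p q B N₁ K M : ℕ) (0<q : 0 < q) (q≤p : q ≤ p) (0<B : 0 < B)
    (slack : ∀ V → N₁ ≤ V → suc V ^ suc V * q * suc (2 * B) ≤ p * V ^ suc V * (2 * B))
    (K-def : K ≡ (2 * φ) ^ (48 * B) + (32 * B + 1)) (M-large : 16 + 2 * ((800 * B) * ((800 * B) * (800 * B))) ≤ M) where

    -- The summands guarantee, in turn, the slack for n², the condition on `K`, and an isqrt of n
    -- beyond 2^M.
    N : ℕ
    N = N₁ + (c₆ * (K * (K * K)) + (2 ^ M * 2 ^ M + 1))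

    module Order (n : ℕ) (N≤n : N ≤ n) where
      v = proj₁ (isqrt n)
      lo = proj₁ (proj₂ (isqrt n))
      hi = proj₂ (proj₂ (isqrt n))
      rest≤n : c₆ * (K * (K * K)) + (2 ^ M * 2 ^ M + 1) ≤ n
      rest≤n = ≤-trans (m≤n+m _ N₁) N≤n
      K≤n : c₆ * (K * (K * K)) ≤ n
      K≤n = ≤-trans (m≤m+n _ _) rest≤n
      M≤n : 2 ^ M * 2 ^ M + 1 ≤ n
      M≤n = ≤-trans (m≤n+m _ (c₆ * (K * (K * K)))) rest≤n
      0<n : 0 < n
      0<n = ≤-trans (m≤n+m 1 (2 ^ M * 2 ^ M)) M≤n
      2^M<t : 2 ^ M < suc v
      2^M<t = sqrt-cancel (≤-<-trans (≤-trans (m≤m+n _ 1) M≤n) hi)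
      0<v : 0 < v
      0<v = ≤-trans (m^n>0 2 M) (≤-pred 2^M<t)
      log = ilog v 0<v
      N₁≤V : N₁ ≤ n * n
      N₁≤V = ≤-trans (m≤m+n N₁ _) (≤-trans N≤n (m≤m*n n n {{ℕ.>-nonZero 0<n}}))
      open Sizes n v (proj₁ log) lo hi 0<v (proj₁ (proj₂ log)) (proj₂ (proj₂ log))
      M≤ℓ : M ≤ ℓ
      M≤ℓ = ≮⇒≥ (λ ℓ<M → <⇒≱ 2^M<t (≤-trans (proj₂ (proj₂ log)) (^-monoʳ-≤ 2 (<⇒≤ ℓ<M))))
      open PerOrder n p q B s e K 0<n 0<B 0<q q≤p s-large err (e-cube B (≤-trans M-large M≤ℓ)) K-def K≤n (slack (n * n) N₁≤V) public using (vc-large)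

    order-bound : ∀ n → N ≤ n → ∃ λ X → q * (q * q) * (X * (X * X)) ≤ p * (p * p) * (n * (n * (n * (n * n)))) × VCdimAtLeast n (n * n ∸ X)
    order-bound n N≤n =
      let X , below , above = threshold (p * (p * p) * (n * (n * (n * (n * n))))) (q * (q * q)) (p * (p * p) * (n * (n * (n * (n * n)))))
                                (*-mono-< 0<q (*-mono-< 0<q 0<q)) ≤-refl
      in X , below , Order.vc-large n N≤n X above

  vc-bound : ∀ p q B → 0 < q → q ≤ p → 0 < B → ∀ N₁ →
             (∀ V → N₁ ≤ V → suc V ^ suc V * q * suc (2 * B) ≤ p * V ^ suc V * (2 * B)) →
             ∃ λ N → ∀ n → N ≤ n → ∃ λ X → q * (q * q) * (X * (X * X)) ≤ p * (p * p) * (n * (n * (n * (n * n)))) × VCdimAtLeast n (n * n ∸ X)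
  vc-bound p q B 0<q q≤p 0<B N₁ slack = _ , Orders.order-bound p q B N₁ _ _ 0<q q≤p 0<B slack refl ≤-refl

  -- Rational approximations of e

  -- eSum i = Σ_{j ≤ i} i!/j!
  eSum : ℕ → ℕ
  eSum zero    = 1
  eSum (suc i) = suc i * eSum i + 1

  -- Their quotient is the K-th partial sum of the series for e plus 1/(K · K!), with common
  -- denominator K · K!.
  eNum eDen : ℕ → ℕ
  eNum K = K * eSum K + 1
  eDen K = K * K !

  !≥1 : ∀ i → 1 ≤ i !
  !≥1 zero    = ≤-refl
  !≥1 (suc i) = *-mono-≤ {1} {suc i} (s≤s z≤n) (!≥1 i)

  eSum≥! : ∀ i → i ! ≤ eSum i
  eSum≥! zero    = ≤-refl
  eSum≥! (suc i) = ≤-trans (*-monoʳ-≤ (suc i) (eSum≥! i)) (m≤m+n _ 1)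

  -- The exact difference of consecutive upper bounds. Being positive, it supplies the slack below
  -- the given constant.
  eNum-step : ∀ K → eNum K * eDen (suc K) ≡ eNum (suc K) * eDen K + K !
  eNum-step K = identity K (eSum K) (K !)
    where
    identity : ∀ K eSum f → (K * eSum + 1) * ((1 + K) * ((1 + K) * f)) ≡ ((1 + K) * ((1 + K) * eSum + 1) + 1) * (K * f) + f
    identity = solve-∀

  eDen>0 : ∀ K → 0 < K → 0 < eDen K
  eDen>0 K 0<K = *-mono-< 0<K (!≥1 K)

  eNum-mono : ∀ K d → 0 < K → eNum (d + K) * eDen K ≤ eNum K * eDen (d + K)
  eNum-mono K zero    0<K = ≤-refl
  eNum-mono K (suc d) 0<K = frac-trans {eNum (suc (d + K))} {eDen (suc (d + K))} {eNum (d + K)} {eDen (d + K)} {eNum K} {eDen K}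
    (eDen>0 (d + K) (≤-trans 0<K (m≤n+m K d))) (≤-trans (m≤m+n _ _) (≤-reflexive (sym (eNum-step (d + K))))) (eNum-mono K d 0<K)

  eSum-mono : ∀ V d → eSum V * (d + V) ! ≤ eSum (d + V) * V !
  eSum-mono V zero    = ≤-refl
  eSum-mono V (suc d) = begin
    eSum V * (suc (d + V) * (d + V) !)               ≡⟨ x∙yz≈y∙xz (eSum V) (suc (d + V)) ((d + V) !) ⟩
    suc (d + V) * (eSum V * (d + V) !)               ≤⟨ *-monoʳ-≤ (suc (d + V)) (eSum-mono V d) ⟩
    suc (d + V) * (eSum (d + V) * V !)               ≡⟨ *-assoc (suc (d + V)) (eSum (d + V)) (V !) ⟨
    suc (d + V) * eSum (d + V) * V !                 ≤⟨ *-monoˡ-≤ (V !) (m≤m+n (suc (d + V) * eSum (d + V)) 1) ⟩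
    (suc (d + V) * eSum (d + V) + 1) * V !           ∎
    where
    open ≤-Reasoning

  -- Partial sums increase and upper bounds decrease, so the two are compared at the larger of the
  -- two indices.
  eSum≤eNum : ∀ V K → 0 < V → 0 < K → eSum V * eDen K ≤ V ! * eNum K
  eSum≤eNum V K 0<V 0<K with ≤-total V K
  ... | inj₁ V≤K = begin
    eSum V * (K * K !)            ≡⟨ x∙yz≈y∙xz (eSum V) K (K !) ⟩
    K * (eSum V * K !)            ≤⟨ *-monoʳ-≤ K (subst (λ k → eSum V * k ! ≤ eSum k * V !) (m∸n+n≡m V≤K) (eSum-mono V (K ∸ V))) ⟩
    K * (eSum K * V !)            ≤⟨ m≤m+n _ (V !) ⟩
    K * (eSum K * V !) + V !      ≡⟨ identity K (eSum K) (V !) ⟩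
    V ! * (K * eSum K + 1)        ∎
    where
    open ≤-Reasoning
    identity : ∀ K eSum f → K * (eSum * f) + f ≡ f * (K * eSum + 1)
    identity = solve-∀
  ... | inj₂ K≤V = *-cancelˡ-≤ V {{ℕ.>-nonZero 0<V}} (begin
    V * (eSum V * eDen K)          ≡⟨ *-assoc V (eSum V) (eDen K) ⟨
    V * eSum V * eDen K            ≤⟨ *-monoˡ-≤ (eDen K) (m≤m+n (V * eSum V) 1) ⟩
    eNum V * eDen K              ≤⟨ subst (λ v → eNum v * eDen K ≤ eNum K * eDen v) (m∸n+n≡m K≤V) (eNum-mono K (V ∸ K) 0<K) ⟩
    eNum K * (V * V !)          ≡⟨ x∙yz≈y∙zx (eNum K) V (V !) ⟩
    V * (V ! * eNum K)          ∎)
    where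
    open ≤-Reasoning

  -- The binomial terms of degree at most j in 1/V of V^V (1 + 1/V)^V.
  truncated : ℕ → ℕ → ℕ
  truncated V j = ∑ (cube V) (λ v → ⟦ does (wt v ≤? j) ⟧ * V ^ (V ∸ wt v))

  truncated-≤ : ∀ V j → j ≤ V → j ! * truncated V j ≤ eSum j * V ^ V
  truncated-step : ∀ V j → truncated V (suc j) ≤ truncated V j + layer V (suc j) * V ^ (V ∸ suc j)
  truncated-step V j = begin
    truncated V (suc j)
      ≤⟨ ∑-mono′ (cube V) each ⟩
    ∑ (cube V) (λ v → ⟦ does (wt v ≤? j) ⟧ * V ^ (V ∸ wt v) + ⟦ wt v == suc j ⟧ * V ^ (V ∸ suc j))
      ≡⟨ trans (∑-+ (cube V) _ _) (cong (truncated V j +_) (∑-*ʳ (cube V) (V ^ (V ∸ suc j)) _)) ⟩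
    truncated V j + layer V (suc j) * V ^ (V ∸ suc j) ∎
    where
    open ≤-Reasoning
    each : ∀ v → ⟦ does (wt v ≤? suc j) ⟧ * V ^ (V ∸ wt v) ≤ ⟦ does (wt v ≤? j) ⟧ * V ^ (V ∸ wt v) + ⟦ wt v == suc j ⟧ * V ^ (V ∸ suc j)
    each v with bool-cases (does (wt v ≤? suc j))
    ... | inj₂ e = ≤-trans (≤-reflexive (cong (λ b → ⟦ b ⟧ * V ^ (V ∸ wt v)) e)) z≤n
    ... | inj₁ e with m≤n⇒m<n∨m≡n (does-true (wt v ≤? suc j) e)
    ...   | inj₁ (s≤s lt) = ≤-trans (≤-reflexive (cong (λ b → ⟦ b ⟧ * V ^ (V ∸ wt v)) (trans e (sym (does-yes (wt v ≤? j) lt))))) (m≤m+n _ _)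
    ...   | inj₂ eq = ≤-trans (≤-reflexive (cong₂ (λ b i → ⟦ b ⟧ * V ^ (V ∸ i)) (trans e (sym (does-yes (wt v ℕ.≟ suc j) eq))) eq)) (m≤n+m _ _)

  truncated-≤ V zero le = begin
    1 * truncated V 0                ≡⟨ *-identityˡ _ ⟩
    truncated V 0                    ≤⟨ ∑-mono′ (cube V) each ⟩
    ∑ (cube V) (λ v → ⟦ wt v == 0 ⟧ * V ^ V)   ≡⟨ ∑-*ʳ (cube V) (V ^ V) _ ⟩
    layer V 0 * V ^ V                ≤⟨ *-monoˡ-≤ (V ^ V) (≤-trans (≤-reflexive (sym (*-identityʳ (layer V 0)))) (layer-≤ V 0)) ⟩
    1 * V ^ V                        ∎
    where
    open ≤-Reasoning
    each : ∀ v → ⟦ does (wt v ≤? 0) ⟧ * V ^ (V ∸ wt v) ≤ ⟦ wt v == 0 ⟧ * V ^ V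
    each v with bool-cases (does (wt v ≤? 0))
    ... | inj₂ e = ≤-trans (≤-reflexive (cong (λ b → ⟦ b ⟧ * V ^ (V ∸ wt v)) e)) z≤n
    ... | inj₁ e with eq ← n≤0⇒n≡0 (does-true (wt v ≤? 0) e) =
      ≤-reflexive (cong₂ (λ b i → ⟦ b ⟧ * V ^ (V ∸ i)) (trans e (sym (does-yes (wt v ℕ.≟ 0) eq))) eq)
  truncated-≤ V (suc j) le = begin
    suc j ! * truncated V (suc j)                                                    ≤⟨ *-monoʳ-≤ (suc j !) (truncated-step V j) ⟩
    suc j ! * (truncated V j + layer V (suc j) * V ^ (V ∸ suc j))                    ≡⟨ identity₁ (suc j) (j !) (truncated V j) (layer V (suc j)) (V ^ (V ∸ suc j)) ⟩
    suc j * (j ! * truncated V j) + layer V (suc j) * (suc j ! ) * V ^ (V ∸ suc j)   ≤⟨ +-mono-≤ (*-monoʳ-≤ (suc j) (truncated-≤ V j (<⇒≤ le))) (*-monoˡ-≤ (V ^ (V ∸ suc j)) (layer-≤ V (suc j))) ⟩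
    suc j * (eSum j * V ^ V) + V ^ suc j * V ^ (V ∸ suc j)                              ≡⟨ cong (suc j * (eSum j * V ^ V) +_) (trans (sym (^-distribˡ-+-* V (suc j) (V ∸ suc j))) (cong (V ^_) (m+[n∸m]≡n le))) ⟩
    suc j * (eSum j * V ^ V) + V ^ V                                                    ≡⟨ identity₂ (suc j) (eSum j) (V ^ V) ⟩
    (suc j * eSum j + 1) * V ^ V                                                        ∎
    where
    open ≤-Reasoning
    identity₁ : ∀ s f t l p → s * f * (t + l * p) ≡ s * (f * t) + l * (s * f) * p
    identity₁ = solve-∀
    identity₂ : ∀ s a v → s * (a * v) + v ≡ (s * a + 1) * v
    identity₂ = solve-∀

  -- Term by term, the binomial coefficient of V over j divided by V^j is at most 1/j!.
  binomial-≤ : ∀ V → V ! * suc V ^ V ≤ eSum V * V ^ V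
  binomial-≤ V = subst (λ x → V ! * x ≤ eSum V * V ^ V)
    (trans (∑-cong′ (cube V) (λ v → trans (cong (λ b → ⟦ b ⟧ * V ^ (V ∸ wt v)) (does-yes (wt v ≤? V) (wt-≤ v))) (*-identityˡ _))) (power-sum V V))
    (truncated-≤ V V ≤-refl)

  lower≤eNum : ∀ V K → 0 < V → 0 < K → suc V ^ V * eDen K ≤ V ^ V * eNum K
  lower≤eNum V K 0<V 0<K = *-cancelˡ-≤ (V !) {{ℕ.>-nonZero (!≥1 V)}} (begin
    V ! * (suc V ^ V * eDen K)      ≡⟨ *-assoc (V !) (suc V ^ V) (eDen K) ⟨
    V ! * suc V ^ V * eDen K        ≤⟨ *-monoˡ-≤ (eDen K) (binomial-≤ V) ⟩
    eSum V * V ^ V * eDen K            ≡⟨ xy∙z≈xz∙y (eSum V) (V ^ V) (eDen K) ⟩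
    eSum V * eDen K * V ^ V            ≤⟨ *-monoˡ-≤ (V ^ V) (eSum≤eNum V K 0<V 0<K) ⟩
    V ! * eNum K * V ^ V            ≡⟨ xy∙z≈x∙zy (V !) (eNum K) (V ^ V) ⟩
    V ! * (V ^ V * eNum K)          ∎)
    where
    open ≤-Reasoning

  -- Since eNum (K+1) / eDen (K+1) is strictly below eNum K / eDen K, there is room for the factors 1 + 1/V and 1 + 1/(4D).
  slack-bound : ∀ p q K → 0 < K → eNum K * q ≤ p * eDen K → let D = eNum (suc K) * eDen K in
                ∀ V → 4 * D ≤ V → suc V ^ suc V * q * suc (2 * (2 * D)) ≤ p * V ^ suc V * (2 * (2 * D))
  slack-bound p q K 0<K h V 4D≤V = *-cancelʳ-≤ _ _ (y″ * V * y′) {{ℕ.>-nonZero (*-mono-< (*-mono-< 0<y″ 0<V) 0<y′)}} (begin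
    suc V * a₀ * q * suc (2 * (2 * D)) * (y″ * V * y′)          ≡⟨ identity₁ (suc V) a₀ q (suc (2 * (2 * D))) y″ V y′ ⟩
    a₀ * y″ * (suc V * q * suc (2 * (2 * D)) * V * y′)          ≤⟨ *-monoˡ-≤ _ (lower≤eNum V (suc K) 0<V (s≤s z≤n)) ⟩
    b₀ * x′ * (suc V * q * suc (2 * (2 * D)) * V * y′)          ≡⟨ identity₂ b₀ x′ V q D y′ ⟩
    b₀ * q * V * ((1 + V) * (4 * D + 1) * D)                    ≤⟨ *-monoʳ-≤ (b₀ * q * V) room ⟩
    b₀ * q * V * (4 * D * V * (D + 1))                          ≤⟨ *-monoʳ-≤ (b₀ * q * V) (*-monoʳ-≤ (4 * D * V) gap) ⟩
    b₀ * q * V * (4 * D * V * (x * y″))                         ≡⟨ identity₃ b₀ q V D x y″ ⟩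
    x * q * (b₀ * V * (4 * D) * (y″ * V))                       ≤⟨ *-monoˡ-≤ _ h ⟩
    p * y′ * (b₀ * V * (4 * D) * (y″ * V))                      ≡⟨ identity₄ p y′ b₀ V D y″ ⟩
    p * (V * b₀) * (2 * (2 * D)) * (y″ * V * y′)                ∎)
    where
    open ≤-Reasoning
    x = eNum K
    x′ = eNum (suc K)
    y′ = eDen K
    y″ = eDen (suc K)
    D = x′ * y′
    a₀ = suc V ^ V
    b₀ = V ^ V
    0<y′ = eDen>0 K 0<K
    0<y″ = eDen>0 (suc K) (s≤s z≤n)
    0<D : 0 < D
    0<D = *-mono-< (m≤n+m 1 (suc K * eSum (suc K))) 0<y′
    0<V : 0 < V
    0<V = ≤-trans (*-mono-< {0} {4} (s≤s z≤n) 0<D) 4D≤V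
    gap : D + 1 ≤ x * y″
    gap = ≤-trans (+-monoʳ-≤ D (!≥1 K)) (≤-reflexive (sym (eNum-step K)))
    -- This is (1 + 1/V)(1 + 1/(4D)) ≤ 1 + 1/D, where 1 + 1/D is at most the ratio of two
    -- consecutive upper bounds, by `gap`.
    room : (1 + V) * (4 * D + 1) * D ≤ 4 * D * V * (D + 1)
    room = begin
      (1 + V) * (4 * D + 1) * D                       ≡⟨ identity₅ V D ⟩
      (4 * D * V + V + (4 * D + 1)) * D               ≤⟨ *-monoˡ-≤ D (+-monoʳ-≤ (4 * D * V + V) (+-mono-≤ 4D≤V 0<V)) ⟩
      (4 * D * V + V + (V + V)) * D                   ≤⟨ m≤m+n _ (V * D) ⟩
      (4 * D * V + V + (V + V)) * D + V * D           ≡⟨ identity₆ V D ⟩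
      4 * D * V * (D + 1)                             ∎
      where
      identity₅ : ∀ V D → (1 + V) * (4 * D + 1) * D ≡ (4 * D * V + V + (4 * D + 1)) * D
      identity₅ = solve-∀
      identity₆ : ∀ V D → (4 * D * V + V + (V + V)) * D + V * D ≡ 4 * D * V * (D + 1)
      identity₆ = solve-∀
    identity₁ : ∀ s a q t y v z → s * a * q * t * (y * v * z) ≡ a * y * (s * q * t * v * z)
    identity₁ = solve-∀
    identity₂ : ∀ b x V q D y → b * x * ((1 + V) * q * (1 + 2 * (2 * D)) * V * y) ≡ b * q * V * ((1 + V) * (4 * D + 1) * (x * y))
    identity₂ = solve-∀
    identity₃ : ∀ b q V D x y → b * q * V * (4 * D * V * (x * y)) ≡ x * q * (b * V * (4 * D) * (y * V))
    identity₃ = solve-∀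
    identity₄ : ∀ p y b V D z → p * y * (b * V * (4 * D) * (z * V)) ≡ p * (V * b) * (2 * (2 * D)) * (z * V * y)
    identity₄ = solve-∀

  -- Transfer to rational numbers

  Represents : ℚ.ℚ → ℕ → (d : ℕ) .{{_ : ℕ.NonZero d}} → Set
  Represents P a d = ℚ.toℚᵘ P ℚᵘ.≃ (ℤ.+ a) ℚᵘ./ d

  frac-≃ : ∀ a d b f .{{_ : ℕ.NonZero d}} .{{_ : ℕ.NonZero f}} → a * f ≡ b * d → (ℤ.+ a) ℚᵘ./ d ℚᵘ.≃ (ℤ.+ b) ℚᵘ./ f
  frac-≃ a (suc d) b (suc f) e = ℚᵘ.*≡* (trans (sym (ℤₚ.pos-* a (suc f))) (trans (cong ℤ.+_ e) (ℤₚ.pos-* b (suc d))))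

  frac-≤ : ∀ a d b f .{{_ : ℕ.NonZero d}} .{{_ : ℕ.NonZero f}} → a * f ≤ b * d → (ℤ.+ a) ℚᵘ./ d ℚᵘ.≤ (ℤ.+ b) ℚᵘ./ f
  frac-≤ a (suc d) b (suc f) e = ℚᵘ.*≤* (subst₂ ℤ._≤_ (ℤₚ.pos-* a (suc f)) (ℤₚ.pos-* b (suc d)) (ℤ.+≤+ e))

  represents-/ : ∀ a d .{{_ : ℕ.NonZero d}} → Represents ((ℤ.+ a) ℚ./ d) a d
  represents-/ a (suc d) = ℚₚ.toℚᵘ-fromℚᵘ (ℚᵘ.mkℚᵘ (ℤ.+ a) d)

  represents-+ : ∀ {P R} a d b f .{{_ : ℕ.NonZero d}} .{{_ : ℕ.NonZero f}} .{{_ : ℕ.NonZero (d * f)}} → Represents P a d → Represents R b f → Represents (P ℚ.+ R) (a * f + b * d) (d * f)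
  represents-+ {P} {R} a (suc d) b (suc f) r s = ℚᵘₚ.≃-trans (ℚₚ.toℚᵘ-homo-+ P R) (ℚᵘₚ.≃-trans (ℚᵘₚ.+-cong r s)
    (ℚᵘ.*≡* (cong (ℤ._* (ℤ.+ (suc d * suc f))) (trans (cong₂ ℤ._+_ (sym (ℤₚ.pos-* a (suc f))) (sym (ℤₚ.pos-* b (suc d)))) (sym (ℤₚ.pos-+ (a * suc f) (b * suc d)))))))

  represents-* : ∀ {P R} a d b f .{{_ : ℕ.NonZero d}} .{{_ : ℕ.NonZero f}} .{{_ : ℕ.NonZero (d * f)}} → Represents P a d → Represents R b f → Represents (P ℚ.* R) (a * b) (d * f)
  represents-* {P} {R} a (suc d) b (suc f) r s = ℚᵘₚ.≃-trans (ℚₚ.toℚᵘ-homo-* P R) (ℚᵘₚ.≃-trans (ℚᵘₚ.*-cong r s)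
    (ℚᵘ.*≡* (cong (ℤ._* (ℤ.+ (suc d * suc f))) (sym (ℤₚ.pos-* a b)))))

  represents-≃ : ∀ {P} a d b f .{{_ : ℕ.NonZero d}} .{{_ : ℕ.NonZero f}} → a * f ≡ b * d → Represents P a d → Represents P b f
  represents-≃ a d b f e r = ℚᵘₚ.≃-trans r (frac-≃ a d b f e)

  partialE-represents : ∀ i → Represents (partialE i) (eSum i) (i !) {{i !≢0}}
  partialE-represents zero    = represents-/ 1 1
  partialE-represents (suc i) = represents-≃ (eSum i * suc i ! + 1 * i !) (i ! * suc i !) (eSum (suc i)) (suc i !) {{m*n≢0 (i !) (suc i !) {{i !≢0}} {{suc i !≢0}}}} {{suc i !≢0}}
    (identity (eSum i) (suc i) (i !))
    (represents-+ (eSum i) (i !) 1 (suc i !) {{i !≢0}} {{suc i !≢0}} {{m*n≢0 (i !) (suc i !) {{i !≢0}} {{suc i !≢0}}}} (partialE-represents i) (represents-/ 1 (suc i !) {{suc i !≢0}}))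
    where
    identity : ∀ eSum s f → (eSum * (s * f) + 1 * f) * (s * f) ≡ (s * eSum + 1) * (f * (s * f))
    identity = solve-∀

  eDen-nonZero : ∀ k → ℕ.NonZero (eDen (suc k))
  eDen-nonZero k = m*n≢0 (suc k) (suc k !) {{_}} {{suc k !≢0}}

  eUpper-represents : ∀ k → Represents (eUpper k) (eNum (suc k)) (eDen (suc k)) {{eDen-nonZero k}}
  eUpper-represents k = represents-≃ (eSum (suc k) * eDen (suc k) + 1 * suc k !) (suc k ! * eDen (suc k)) (eNum (suc k)) (eDen (suc k)) {{m*n≢0 (suc k !) (eDen (suc k)) {{suc k !≢0}} {{eDen-nonZero k}}}} {{eDen-nonZero k}}
    (identity (eSum (suc k)) (suc k) (suc k !))
    (represents-+ (eSum (suc k)) (suc k !) 1 (eDen (suc k)) {{suc k !≢0}} {{eDen-nonZero k}} {{m*n≢0 (suc k !) (eDen (suc k)) {{suc k !≢0}} {{eDen-nonZero k}}}} (partialE-represents (suc k)) (represents-/ 1 (eDen (suc k)) {{eDen-nonZero k}}))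
    where
    identity : ∀ eSum s f → (eSum * (s * f) + 1 * f) * (s * f) ≡ (s * eSum + 1) * (f * (s * f))
    identity = solve-∀

  ≤-represents : ∀ {P R} a d b f .{{_ : ℕ.NonZero d}} .{{_ : ℕ.NonZero f}} → Represents P a d → Represents R b f → a * f ≤ b * d → P ℚ.≤ R
  ≤-represents a d b f r s h = ℚₚ.toℚᵘ-cancel-≤ (ℚᵘₚ.≤-respˡ-≃ (ℚᵘₚ.≃-sym r) (ℚᵘₚ.≤-respʳ-≃ (ℚᵘₚ.≃-sym s) (frac-≤ a d b f h)))

  -- The positive lower bound a/d rules out a negative numerator, so c is a quotient of natural
  -- numbers.
  numerator-bound : ∀ c a d .{{_ : ℕ.NonZero d}} {P} → 0 < a → Represents P a d → P ℚ.≤ c →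
                    ∃ λ p → ∃ λ q → 0 < q × (∀ .{{_ : ℕ.NonZero q}} → Represents c p q) × a * q ≤ p * d
  numerator-bound c@(ℚ.mkℚ z q-1 _) a (suc d) 0<a r h with ℚᵘₚ.≤-respˡ-≃ r (ℚₚ.toℚᵘ-mono-≤ h)
  numerator-bound (ℚ.mkℚ (ℤ.+ p) q-1 _) a (suc d) 0<a r h | ℚᵘ.*≤* le =
    p , suc q-1 , s≤s z≤n , ℚᵘₚ.≃-refl , ℤₚ.drop‿+≤+ (subst₂ ℤ._≤_ (sym (ℤₚ.pos-* a (suc q-1))) (sym (ℤₚ.pos-* p (suc d))) le)
  numerator-bound (ℚ.mkℚ ℤ.-[1+ z ] q-1 _) (suc a) (suc d) 0<a r h | ℚᵘ.*≤* ()

  vc-fraction : ∀ K → 0 < K → ∀ p q → 0 < q → eNum K * q ≤ p * eDen K →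
                ∃ λ N → ∀ n → N ≤ n → ∃ λ X → q * (q * q) * (X * (X * X)) ≤ p * (p * p) * (n * (n * (n * (n * n)))) × VCdimAtLeast n (n * n ∸ X)
  vc-fraction K 0<K p q 0<q le = vc-bound p q (2 * D) 0<q q≤p (*-mono-< {0} {2} (s≤s z≤n) 0<D) (4 * D) (slack-bound p q K 0<K le)
    where
    D = eNum (suc K) * eDen K
    0<D : 0 < D
    0<D = *-mono-< (m≤n+m 1 (suc K * eSum (suc K))) (eDen>0 K 0<K)
    q≤p : q ≤ p
    q≤p = *-cancelʳ-≤ q p (eDen K) {{ℕ.>-nonZero (eDen>0 K 0<K)}}
      (≤-trans (≤-trans (≤-reflexive (*-comm q (eDen K))) (*-monoˡ-≤ q (≤-trans (*-monoʳ-≤ K (eSum≥! K)) (m≤m+n _ 1)))) le)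

  vc-rational : ∀ c p q .{{_ : ℕ.NonZero q}} → Represents c p q → ∀ n X →
    q * (q * q) * (X * (X * X)) ≤ p * (p * p) * (n * (n * (n * (n * n)))) →
    let d = n ^ 2 ∸ (n * n ∸ X) in ℕtoℚ d ℚ.* ℕtoℚ d ℚ.* ℕtoℚ d ℚ.≤ c ℚ.* c ℚ.* c ℚ.* ℕtoℚ (n ^ 5)
  vc-rational c p q@(suc _) rep n X below =
    ≤-represents (d * d * d) 1 (p * p * p * n ^ 5) (q * q * q * 1)
      (represents-* (d * d) 1 d 1 (represents-* d 1 d 1 (represents-/ d 1) (represents-/ d 1)) (represents-/ d 1))
      (represents-* (p * p * p) (q * q * q) (n ^ 5) 1 (represents-* (p * p) (q * q) p q (represents-* p q p q rep rep) rep) (represents-/ (n ^ 5) 1))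
      (begin
        d * d * d * (q * q * q * 1)                          ≤⟨ *-monoˡ-≤ (q * q * q * 1) (*-mono-≤ (*-mono-≤ d≤X d≤X) d≤X) ⟩
        X * X * X * (q * q * q * 1)                          ≡⟨ identity₁ X q ⟩
        q * (q * q) * (X * (X * X))                          ≤⟨ below ⟩
        p * (p * p) * (n * (n * (n * (n * n))))              ≡⟨ identity₂ p n ⟩
        p * p * p * (n * (n * (n * (n * (n * 1))))) * 1      ∎)
    where
    open ≤-Reasoning
    d = n ^ 2 ∸ (n * n ∸ X)
    d≤X : d ≤ X
    d≤X = ≤-trans (≤-reflexive (cong (_∸ (n * n ∸ X)) (cong (n *_) (*-identityʳ n)))) (m≤n+o⇒m∸n≤o (n * n) (n * n ∸ X) (≤-trans (m≤n+m∸n (n * n) X) (≤-reflexive (+-comm X _))))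
    identity₁ : ∀ X q → X * X * X * (q * q * q * 1) ≡ q * (q * q) * (X * (X * X))
    identity₁ = solve-∀
    identity₂ : ∀ p n → p * (p * p) * (n * (n * (n * (n * n)))) ≡ p * p * p * (n * (n * (n * (n * (n * 1))))) * 1
    identity₂ = solve-∀

  vc-asymptotic : ∀ c → ∃[ k ] (eUpper k ℚ.≤ c) →
    ∃[ N ] (∀ n → N ≤ n → ∃[ m ] (VCdimAtLeast n m ×
      ℕtoℚ (n ^ 2 ∸ m) ℚ.* ℕtoℚ (n ^ 2 ∸ m) ℚ.* ℕtoℚ (n ^ 2 ∸ m) ℚ.≤ c ℚ.* c ℚ.* c ℚ.* ℕtoℚ (n ^ 5)))
  vc-asymptotic c (k , e≤c) =
    let p , q , 0<q , rep , le = numerator-bound c (eNum (suc k)) (eDen (suc k)) {{eDen-nonZero k}} (m≤n+m 1 _) (eUpper-represents k) e≤c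
        N , bound = vc-fraction (suc k) (s≤s z≤n) p q 0<q le
    in N , λ n N≤n → let X , below , vc = bound n N≤n in
       n * n ∸ X , vc , vc-rational c p q {{ℕ.>-nonZero 0<q}} (rep {{ℕ.>-nonZero 0<q}}) n X below

open import Defs
open import Data.Nat using (ℕ; _∸_; _^_; _≥_)
open import Data.Product using (_×_; ∃-syntax)
open import Data.Rational using (ℚ; _≤_; _*_)

theorem2 : ∀ (c : ℚ) → ∃[ k ] (eUpper k ≤ c) →
    ∃[ N ] (∀ (n : ℕ) → n ≥ N →
    ∃[ m ] (VCdimAtLeast n m ×
    ℕtoℚ (n ^ 2 ∸ m) * ℕtoℚ (n ^ 2 ∸ m) * ℕtoℚ (n ^ 2 ∸ m)
    ≤ c * c * c * ℕtoℚ (n ^ 5)))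
theorem2 = Proof.vc-asymptotic
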